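{- There is an $\alpha>0$ such that the following holds for every positive integer $n$ and every $\varepsilon$ with $1>\varepsilon\geq n^{ -\alpha}/\alpha$. Let the complete bipartite graph $K_{n,n}$ be properly edge-coloured so that at most $(1-\varepsilon)n$ colours have more than $(1-\varepsilon)n$ edges. Then $K_{n,n}$ has $(1-\varepsilon)n$ edge-disjoint perfect rainbow matchings.
   Context: An edge-colouring is proper if no two edges sharing a vertex have the same colour. A subgraph is rainbow if all its edges have distinct colours. A perfect matching of $K_{n,n}$ is a set of $n$ pairwise vertex-disjoint edges. -}

module Defs where

open import Data.Nat using (ℕ; suc; _+_; _*_; _∸_; _^_; _≤_; _<_; _≟_)
open import Data.Fin using (Fin)
open import Data.Product using (_×_; _,_; proj₁; proj₂; Σ; ∃)
open import Data.List using (List; length; filter; allFin; cartesianProduct)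
open import Data.List.Relation.Unary.All using (All)
open import Data.List.Relation.Unary.Unique.Propositional using (Unique)
open import Relation.Binary.PropositionalEquality using (_≡_; _≢_)
open import Function.Definitions using (Injective)

-- An edge-colouring of K_{n,n}: left vertex i, right vertex j, edge (i,j) has colour c i j.
-- Colours are natural numbers (any countable colour set).
Colouring : ℕ → Set
Colouring n = Fin n → Fin n → ℕ

Proper : ∀ {n} → Colouring n → Set
Proper {n} c =
  (∀ (i : Fin n) (j j' : Fin n) → c i j ≡ c i j' → j ≡ j') ×
  (∀ (i i' : Fin n) (j : Fin n) → c i j ≡ c i' j → i ≡ i')

edgeCount : ∀ {n} → Colouring n → ℕ → ℕ
edgeCount {n} c k =
  length (filter (λ e → c (proj₁ e) (proj₂ e) ≟ k) (cartesianProduct (allFin n) (allFin n)))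

-- With x = N / b (a rational, b > 0): "at most x colours have more than x edges",
-- i.e. every list of distinct colours k with edgeCount k > N/b has length ≤ N/b.
AtMostColoursAbove : ∀ {n} → Colouring n → (N b : ℕ) → Set
AtMostColoursAbove c N b =
  (ks : List ℕ) → Unique ks → All (λ k → N < edgeCount c k * b) ks → length ks * b ≤ N

-- A perfect matching of K_{n,n}: an injective (hence bijective) map σ from left to right,
-- the matching being {(i, σ i)}.
PerfectMatching : ℕ → Set
PerfectMatching n = Σ (Fin n → Fin n) (λ σ → Injective _≡_ _≡_ σ)

Rainbow : ∀ {n} → Colouring n → PerfectMatching n → Set
Rainbow c (σ , _) = Injective _≡_ _≡_ (λ i → c i (σ i))

EdgeDisjointRainbowMatchings : ∀ {n} → Colouring n → ℕ → Set
EdgeDisjointRainbowMatchings {n} c t =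
  Σ (Fin t → PerfectMatching n) λ M →
    (∀ s → Rainbow c (M s)) ×
    (∀ (s s' : Fin t) → s ≢ s' → ∀ (i : Fin n) → proj₁ (M s) i ≢ proj₁ (M s') i)

{-# OPTIONS --safe #-}
module Submission where

-- Move a little weight away from the colours with more than (1 − ε)n edges: this gives weights on the
-- cells of the n × n array with all row and column sums 1, while every colour sum, and (1 − ε)n times
-- every cell weight, falls short of 1 by a fixed amount. That slack pays for putting aside a random set
-- of colours whose cells form a quasirandom graph.  The triples (i , j , s) of a cell outside this
-- reserve and a matching s are the edges of a linear 4-uniform hypergraph on the cells, the pairs
-- (row , s), (column , s) and (colour , s), and the weights are a nearly perfect fractional matching.
-- A random process adds one edge at a time, or kills a single vertex, in such a way that every living
-- vertex dies with the same probability β per step; the weighted degrees then follow a deterministic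
-- curve and the process yields an almost perfect integral matching.  A row a and a column b missed by
-- the matching s are finally joined by replacing two of its edges i₁j₁, i₂j₂ by the reserved edges
-- aj₁, i₁j₂, i₂b, of which quasirandomness provides plenty.  All random choices are derandomised: the
-- potentials (1 + X²)^N of the tracked quantities X have a sum that grows by a bounded factor on
-- average, so some choice keeps it small, and then |X| is small throughout.

open import Data.Nat as ℕ using (ℕ; zero; suc)
import Data.Nat.Properties as ℕP
open import Data.Integer as ℤ using (ℤ; -[1+_]) renaming (+_ to pos)
import Data.Integer.Properties as ℤP
open import Data.Rational as ℚ using (ℚ; 0ℚ; 1ℚ)
import Data.Rational.Properties as ℚP
open import Data.Bool using (Bool; true; false) renaming (T to IsTrue)
open import Data.Product using (Σ; ∃; _×_; _,_; proj₁; proj₂)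
open import Data.Sum using (_⊎_; inj₁; inj₂)
open import Data.Empty using (⊥; ⊥-elim)
open import Data.Unit using (⊤; tt)
open import Data.List using (List; []; _∷_; _++_; map; length; filter; allFin; concatMap; cartesianProduct)
open import Data.List.Relation.Unary.All using (All; []; _∷_)
open import Relation.Nullary using (¬_; Dec; yes; no)
open import Relation.Binary.PropositionalEquality using (_≡_; _≢_; refl; sym; trans; cong; cong₂; subst; subst₂; module ≡-Reasoning)
open import Function using (_∘_)

open import Data.Fin using (Fin; toℕ)
import Data.Fin
import Data.Fin.Properties as FP
open import Data.List.Membership.Propositional using (_∈_)
open import Data.List.Relation.Unary.Any using (Any; here; there; any?)
open import Relation.Nullary.Decidable using (¬?; _×-dec_)
open import Relation.Binary.Definitions using (DecidableEquality)
import Data.List.Properties as LP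
import Data.Sum.Properties as SumP
import Data.Product.Properties as ProdP
open import Data.List.Relation.Binary.Permutation.Propositional using (_↭_; prep; swap; ↭-sym) renaming (refl to ↭-refl′; trans to ↭-trans′)
open import Data.List.Relation.Unary.Unique.Propositional using (Unique)
open import Data.List.Relation.Unary.AllPairs using ([]; _∷_)
import Data.List.Relation.Unary.All as All
import Data.List.Relation.Unary.All.Properties as AllP
import Data.List.Membership.Propositional.Properties as MemP
import Data.List.Relation.Binary.Permutation.Propositional.Properties as PermP
import Data.List.Relation.Unary.Unique.Propositional.Properties as UniqueP
open import Defs
import Data.Nat.DivMod as DM

-- Two obstacles shape the proof. With uniform weights 1/n a colour with n cells is already
-- saturated, so nothing could be set aside; weight must be moved without disturbing rows and
-- columns. And closing one gap of a matching uses up cells and colours that other gaps may need.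
-- The remedy is an invariant: a switch removes one gap and adds at most three reserved edges, so
-- three times the gaps plus the reserved edges never grows, and the gaps left by the random process
-- bound the damage of all switches. Everything is computed in the rationals, without exponentials,
-- logarithms or roots. Hence the polynomial potentials, and hence one scale: m is the integer part
-- of n^(1/200), and the parameters are built from powers of m. As n is below a fixed power of m, a
-- potential of fixed degree outgrows the number of tracked quantities; as m is at least 200, powers
-- of m absorb numerical constants. The exponent 200 leaves room for the costliest error term, of
-- order m^158 / n. The hypothesis on ε makes m at least 200 and the number of matchings at most (1
-- - 4/m)n.

module Development where
  infixl 6 _+_ _-_
  infixl 7 _*_
  infix 8 -_
  infix 4 _≤_

  -- The rationals, sealed so that type checking never unfolds their arithmetic.
  opaque
    𝔽 : Set
    𝔽 = ℚ

    𝟘 𝟙 : 𝔽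
    𝟘 = 0ℚ
    𝟙 = 1ℚ

    _+_ _*_ : 𝔽 → 𝔽 → 𝔽
    _+_ = ℚ._+_
    _*_ = ℚ._*_

    -_ inv : 𝔽 → 𝔽
    -_ = ℚ.-_
    inv x with x ℚP.≟ 0ℚ
    ... | yes _ = 0ℚ
    ... | no x≢0 = ℚ.1/_ x {{ℚ.≢-nonZero x≢0}}

    _≤_ : 𝔽 → 𝔽 → Set
    _≤_ = ℚ._≤_

    +-assoc : ∀ x y z → (x + y) + z ≡ x + (y + z)
    +-assoc = ℚP.+-assoc

    +-comm : ∀ x y → x + y ≡ y + x
    +-comm = ℚP.+-comm

    +-identityˡ : ∀ x → 𝟘 + x ≡ x
    +-identityˡ = ℚP.+-identityˡ

    +-inverseʳ : ∀ x → x + (- x) ≡ 𝟘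
    +-inverseʳ = ℚP.+-inverseʳ

    *-assoc : ∀ x y z → (x * y) * z ≡ x * (y * z)
    *-assoc = ℚP.*-assoc

    *-comm : ∀ x y → x * y ≡ y * x
    *-comm = ℚP.*-comm

    *-identityˡ : ∀ x → 𝟙 * x ≡ x
    *-identityˡ = ℚP.*-identityˡ

    *-distribʳ-+ : ∀ x y z → (y + z) * x ≡ y * x + z * x
    *-distribʳ-+ = ℚP.*-distribʳ-+

    ≤-refl : ∀ {x} → x ≤ x
    ≤-refl = ℚP.≤-refl

    ≤-trans : ∀ {x y z} → x ≤ y → y ≤ z → x ≤ z
    ≤-trans = ℚP.≤-trans

    ≤-antisym : ∀ {x y} → x ≤ y → y ≤ x → x ≡ y
    ≤-antisym = ℚP.≤-antisym

    ≤-total : ∀ x y → x ≤ y ⊎ y ≤ x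
    ≤-total = ℚP.≤-total

    _≤?_ : ∀ x y → Dec (x ≤ y)
    _≤?_ = ℚP._≤?_

    +-mono-≤ : ∀ {x y z w} → x ≤ y → z ≤ w → x + z ≤ y + w
    +-mono-≤ = ℚP.+-mono-≤

    0≤1 : 𝟘 ≤ 𝟙
    0≤1 = ℚP.nonNegative⁻¹ 1ℚ

    1≰0 : ¬ 𝟙 ≤ 𝟘
    1≰0 p = ℚP.<-irrefl refl (ℚP.<-≤-trans (ℚP.positive⁻¹ 1ℚ) p)

    *-nonNeg : ∀ {x y} → 𝟘 ≤ x → 𝟘 ≤ y → 𝟘 ≤ x * y
    *-nonNeg {x} {y} p q = ℚP.nonNegative⁻¹ (x ℚ.* y)
      {{ℚP.nonNeg*nonNeg⇒nonNeg x {{ℚ.nonNegative p}} y {{ℚ.nonNegative q}}}}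

    inv-inverse : ∀ {x} → ¬ x ≤ 𝟘 → x * inv x ≡ 𝟙
    inv-inverse {x} x≰0 with x ℚP.≟ 0ℚ
    ... | yes x≡0 = ⊥-elim (x≰0 (ℚP.≤-reflexive x≡0))
    ... | no x≢0 = ℚP.*-inverseʳ x {{ℚ.≢-nonZero x≢0}}

  _-_ : 𝔽 → 𝔽 → 𝔽
  x - y = x + (- y)

  ≤-reflexive : ∀ {x y} → x ≡ y → x ≤ y
  ≤-reflexive refl = ≤-refl

  ≥-reflexive : ∀ {x y} → x ≡ y → y ≤ x
  ≥-reflexive refl = ≤-refl

  -- The clause for 1 makes `ι 1` reduce to `𝟙` and not to `𝟙 + 𝟘`. Literals of the certificate
  -- language then evaluate to the constants that occur in the statements, without rewriting.
  ι : ℕ → 𝔽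
  ι 0 = 𝟘
  ι 1 = 𝟙
  ι (suc (suc n)) = 𝟙 + ι (suc n)

  ι-suc : ∀ n → ι (suc n) ≡ 𝟙 + ι n
  ι-suc zero = sym (trans (+-comm 𝟙 𝟘) (+-identityˡ 𝟙))
  ι-suc (suc n) = refl

  infixr 8 _^_
  _^_ : 𝔽 → ℕ → 𝔽
  x ^ zero = 𝟙
  x ^ suc k = x * x ^ k

  private
    +-identityʳ : ∀ x → x + 𝟘 ≡ x
    +-identityʳ x = trans (+-comm x 𝟘) (+-identityˡ x)

    *-distribˡ-+ : ∀ x y z → x * (y + z) ≡ x * y + x * z
    *-distribˡ-+ x y z = trans (*-comm x _) (trans (*-distribʳ-+ x y z) (cong₂ _+_ (*-comm y x) (*-comm z x)))

    +-interchange : ∀ a b c d → (a + b) + (c + d) ≡ (a + c) + (b + d)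
    +-interchange a b c d = begin
      (a + b) + (c + d) ≡⟨ +-assoc a b _ ⟩
      a + (b + (c + d)) ≡⟨ cong (a +_) (sym (+-assoc b c d)) ⟩
      a + ((b + c) + d) ≡⟨ cong (λ x → a + (x + d)) (+-comm b c) ⟩
      a + ((c + b) + d) ≡⟨ cong (a +_) (+-assoc c b d) ⟩
      a + (c + (b + d)) ≡⟨ sym (+-assoc a c _) ⟩
      (a + c) + (b + d) ∎
      where open ≡-Reasoning

    *-interchange : ∀ a b c d → (a * b) * (c * d) ≡ (a * c) * (b * d)
    *-interchange a b c d = begin
      (a * b) * (c * d) ≡⟨ *-assoc a b _ ⟩
      a * (b * (c * d)) ≡⟨ cong (a *_) (sym (*-assoc b c d)) ⟩
      a * ((b * c) * d) ≡⟨ cong (λ x → a * (x * d)) (*-comm b c) ⟩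
      a * ((c * b) * d) ≡⟨ cong (a *_) (*-assoc c b d) ⟩
      a * (c * (b * d)) ≡⟨ sym (*-assoc a c _) ⟩
      (a * c) * (b * d) ∎
      where open ≡-Reasoning

    cancelˡ : ∀ x y z → x + y ≡ x + z → y ≡ z
    cancelˡ x y z e = begin
      y ≡⟨ sym (+-identityˡ y) ⟩
      𝟘 + y ≡⟨ cong (_+ y) (sym (trans (+-comm (- x) x) (+-inverseʳ x))) ⟩
      ((- x) + x) + y ≡⟨ +-assoc _ x y ⟩
      (- x) + (x + y) ≡⟨ cong ((- x) +_) e ⟩
      (- x) + (x + z) ≡⟨ sym (+-assoc _ x z) ⟩
      ((- x) + x) + z ≡⟨ cong (_+ z) (trans (+-comm (- x) x) (+-inverseʳ x)) ⟩
      𝟘 + z ≡⟨ +-identityˡ z ⟩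
      z ∎
      where open ≡-Reasoning

  *-zeroˡ : ∀ x → 𝟘 * x ≡ 𝟘
  *-zeroˡ x = cancelˡ (𝟘 * x) _ _ (trans (sym (*-distribʳ-+ x 𝟘 𝟘)) (trans (cong (_* x) (+-identityˡ 𝟘)) (sym (+-identityʳ _))))

  private
    neg-unique : ∀ x y → x + y ≡ 𝟘 → y ≡ - x
    neg-unique x y e = cancelˡ x y (- x) (trans e (sym (+-inverseʳ x)))

    neg-+ : ∀ x y → - (x + y) ≡ (- x) + (- y)
    neg-+ x y = sym (neg-unique (x + y) _ (trans (+-interchange x y _ _) (trans (cong₂ _+_ (+-inverseʳ x) (+-inverseʳ y)) (+-identityˡ 𝟘))))

    neg-* : ∀ x y → (- x) * y ≡ - (x * y)
    neg-* x y = neg-unique (x * y) _ (trans (sym (*-distribʳ-+ y x (- x))) (trans (cong (_* y) (+-inverseʳ x)) (*-zeroˡ y)))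

    neg-neg : ∀ x → - (- x) ≡ x
    neg-neg x = sym (neg-unique (- x) x (trans (+-comm (- x) x) (+-inverseʳ x)))

    neg-0 : - 𝟘 ≡ 𝟘
    neg-0 = sym (neg-unique 𝟘 𝟘 (+-identityˡ 𝟘))

  ι-+ : ∀ m n → ι (m ℕ.+ n) ≡ ι m + ι n
  ι-+ zero n = sym (+-identityˡ (ι n))
  ι-+ (suc m) n = trans (ι-suc (m ℕ.+ n)) (trans (cong (𝟙 +_) (ι-+ m n)) (trans (sym (+-assoc 𝟙 _ _)) (cong (_+ ι n) (sym (ι-suc m)))))

  ι-* : ∀ m n → ι (m ℕ.* n) ≡ ι m * ι n
  ι-* zero n = sym (*-zeroˡ (ι n))
  ι-* (suc m) n = trans (ι-+ n (m ℕ.* n)) (trans (cong (ι n +_) (ι-* m n)) (trans (cong (_+ ι m * ι n) (sym (*-identityˡ _))) (trans (sym (*-distribʳ-+ (ι n) 𝟙 (ι m))) (cong (_* ι n) (sym (ι-suc m))))))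

  -- A certificate checker: polynomials with integer coefficients are brought to normal form,
  -- and a linear or polynomial inequality is deduced from hypotheses l ≤ r by exhibiting
  -- d (rhs − lhs) as a combination of products of the differences r − l, with weights in ℕ.
  infixl 6 _⊕_ _⊖_
  infixl 7 _⊗_
  infixr 8 _↑_
  data Expr : Set where
    # 𝐱 : ℕ → Expr
    _⊕_ _⊖_ _⊗_ : Expr → Expr → Expr
    _↑_ : Expr → ℕ → Expr

  infix 5.5 _≼_
  infixl 7 _·_
  infix 8 _∙_
  infix 8 _∙1
  X0 X1 X2 X3 X4 X5 X6 X7 X8 X9 X10 X11 X12 X13 X14 X15 X16 X17 X18 X19 X20 X21 X22 X23 : Expr
  X0 = 𝐱 0
  X1 = 𝐱 1
  X2 = 𝐱 2
  X3 = 𝐱 3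
  X4 = 𝐱 4
  X5 = 𝐱 5
  X6 = 𝐱 6
  X7 = 𝐱 7
  X8 = 𝐱 8
  X9 = 𝐱 9
  X10 = 𝐱 10
  X11 = 𝐱 11
  X12 = 𝐱 12
  X13 = 𝐱 13
  X14 = 𝐱 14
  X15 = 𝐱 15
  X16 = 𝐱 16
  X17 = 𝐱 17
  X18 = 𝐱 18
  X19 = 𝐱 19
  X20 = 𝐱 20
  X21 = 𝐱 21
  X22 = 𝐱 22
  X23 = 𝐱 23

  _≼_ : Expr → Expr → Expr × Expr
  _≼_ = _,_

  -- Notation for the terms of a certificate: `k ∙ i · j` is k times the product of the differences
  -- of hypotheses i and j, which are counted from 0 and may coincide; `k ∙1` is the bare constant
  -- k.
  _∙_ : ℕ → ℕ → ℕ × List ℕ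
  k ∙ i = k , i ∷ []

  _∙1 : ℕ → ℕ × List ℕ
  k ∙1 = k , []

  _·_ : ℕ × List ℕ → ℕ → ℕ × List ℕ
  (k , is) · i = k , is ++ i ∷ []

  module Normalisation where
    ιℤ : ℤ → 𝔽
    ιℤ (pos n) = ι n
    ιℤ (-[1+ n ]) = - ι (suc n)

    Mono Poly : Set
    Mono = List ℕ
    Poly = List (ℤ × Mono)

    data Order {A : Set} (x y : A) : Set where
      lt gt : Order x y
      eq : x ≡ y → Order x y

    cmpℕ : (a b : ℕ) → Order a b
    cmpℕ a b with a ℕ.≡ᵇ b in e
    ... | true = eq (ℕP.≡ᵇ⇒≡ a b (subst IsTrue (sym e) tt))
    ... | false with a ℕ.<ᵇ b
    ...   | true = lt
    ...   | false = gt

    -- a proper extension precedes its prefix, as in the lexicographic order of exponents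
    cmp : (p q : Mono) → Order p q
    cmp [] [] = eq refl
    cmp [] (_ ∷ _) = gt
    cmp (_ ∷ _) [] = lt
    cmp (a ∷ p) (b ∷ q) with cmpℕ a b
    ... | lt = lt
    ... | gt = gt
    ... | eq refl with cmp p q
    ...   | lt = lt
    ...   | gt = gt
    ...   | eq refl = eq refl

    mulM : Mono → Mono → Mono
    mulM [] q = q
    mulM (a ∷ p) q = insert a (mulM p q)
      where
      insert : ℕ → Mono → Mono
      insert a [] = a ∷ []
      insert a (b ∷ q) with a ℕ.≤ᵇ b
      ... | true = a ∷ b ∷ q
      ... | false = b ∷ insert a q

    -- Merging of sorted lists. The second function keeps the head of the first list apart, so that
    -- each recursive call is on a structurally smaller list.
    addP : Poly → Poly → Poly
    addP′ : ℤ → Mono → Poly → Poly → Poly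
    addP [] q = q
    addP ((k , p) ∷ ps) q = addP′ k p ps q
    addP′ k p ps [] = (k , p) ∷ ps
    addP′ k p ps ((l , q) ∷ qs) with cmp p q
    ... | lt = (k , p) ∷ addP ps ((l , q) ∷ qs)
    ... | gt = (l , q) ∷ addP′ k p ps qs
    ... | eq _ = (k ℤ.+ l , p) ∷ addP ps qs

    scale : ℤ → Mono → Poly → Poly
    scale k p [] = []
    scale k p ((l , q) ∷ qs) = (k ℤ.* l , mulM p q) ∷ scale k p qs

    mulP : Poly → Poly → Poly
    mulP [] q = []
    mulP ((k , p) ∷ ps) q = addP (scale k p q) (mulP ps q)

    powP : Poly → ℕ → Poly
    powP p zero = (pos 1 , []) ∷ []
    powP p (suc k) = mulP p (powP p k)

    norm : Expr → Poly
    norm (𝐱 x) = (pos 1 , x ∷ []) ∷ []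
    norm (# n) = (pos n , []) ∷ []
    norm (a ⊕ b) = addP (norm a) (norm b)
    norm (a ⊖ b) = addP (norm a) (scale -[1+ 0 ] [] (norm b))
    norm (a ⊗ b) = mulP (norm a) (norm b)
    norm (a ↑ k) = powP (norm a) k

    -- Cancelled monomials stay in the list with coefficient 0, so the test looks for zero
    -- coefficients and not for the empty list.
    isZero : Poly → Bool
    isZero [] = true
    isZero ((pos 0 , _) ∷ ps) = isZero ps
    isZero (_ ∷ ps) = false

    ιℤ-neg : ∀ z → ιℤ (ℤ.- z) ≡ - ιℤ z
    ιℤ-neg (pos 0) = sym neg-0
    ιℤ-neg (pos (suc n)) = refl
    ιℤ-neg (-[1+ n ]) = sym (neg-neg _)

    ιℤ-⊖ : ∀ m n → ιℤ (m ℤ.⊖ n) ≡ ι m + (- ι n)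
    ιℤ-⊖ m zero = trans (cong ιℤ (ℤP.⊖-≥ {m} {0} ℕ.z≤n)) (sym (trans (cong (ι m +_) neg-0) (+-identityʳ _)))
    ιℤ-⊖ zero (suc n) = sym (+-identityˡ _)
    ιℤ-⊖ (suc m) (suc n) = trans (cong ιℤ (ℤP.[1+m]⊖[1+n]≡m⊖n m n)) (trans (ιℤ-⊖ m n) (sym (begin
      ι (suc m) + (- ι (suc n)) ≡⟨ cong₂ (λ x y → x + (- y)) (ι-suc m) (ι-suc n) ⟩
      (𝟙 + ι m) + (- (𝟙 + ι n)) ≡⟨ cong ((𝟙 + ι m) +_) (neg-+ 𝟙 (ι n)) ⟩
      (𝟙 + ι m) + ((- 𝟙) + (- ι n)) ≡⟨ +-interchange 𝟙 _ _ _ ⟩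
      (𝟙 + (- 𝟙)) + (ι m + (- ι n)) ≡⟨ cong (_+ (ι m + (- ι n))) (+-inverseʳ 𝟙) ⟩
      𝟘 + (ι m + (- ι n)) ≡⟨ +-identityˡ _ ⟩
      ι m + (- ι n) ∎)))
      where open ≡-Reasoning

    ιℤ-+ : ∀ x y → ιℤ (x ℤ.+ y) ≡ ιℤ x + ιℤ y
    ιℤ-+ (pos m) (pos n) = ι-+ m n
    ιℤ-+ (pos m) (-[1+ n ]) = ιℤ-⊖ m (suc n)
    ιℤ-+ (-[1+ m ]) (pos n) = trans (ιℤ-⊖ n (suc m)) (+-comm _ _)
    ιℤ-+ (-[1+ m ]) (-[1+ n ]) = trans (cong (-_ ∘ ι ∘ suc) (sym (ℕP.+-suc m n))) (trans (cong -_ (ι-+ (suc m) (suc n))) (neg-+ _ _))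

    ιℤ-* : ∀ x y → ιℤ (x ℤ.* y) ≡ ιℤ x * ιℤ y
    ιℤ-* (pos m) (pos n) = trans (cong ιℤ (sym (ℤP.pos-* m n))) (ι-* m n)
    ιℤ-* (pos m) (-[1+ n ]) = trans (cong ιℤ (sym (ℤP.neg-distribʳ-* (pos m) (pos (suc n))))) (trans (ιℤ-neg (pos m ℤ.* pos (suc n))) (trans (cong -_ (ιℤ-* (pos m) (pos (suc n)))) (trans (cong -_ (*-comm (ι m) _)) (trans (sym (neg-* _ _)) (*-comm _ _)))))
    ιℤ-* (-[1+ m ]) (pos n) = trans (cong ιℤ (sym (ℤP.neg-distribˡ-* (pos (suc m)) (pos n)))) (trans (ιℤ-neg (pos (suc m) ℤ.* pos n)) (trans (cong -_ (ιℤ-* (pos (suc m)) (pos n))) (sym (neg-* _ _))))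
    ιℤ-* (-[1+ m ]) (-[1+ n ]) = trans (ι-* (suc m) (suc n)) (sym (trans (neg-* _ _) (trans (cong -_ (trans (*-comm _ _) (neg-* _ _))) (trans (neg-neg _) (*-comm _ _)))))

    module _ (ρ : List 𝔽) where
      look : List 𝔽 → ℕ → 𝔽
      look [] _ = 𝟘
      look (x ∷ xs) zero = x
      look (x ∷ xs) (suc k) = look xs k

      ⟦_⟧ : Expr → 𝔽
      ⟦ 𝐱 x ⟧ = look ρ x
      ⟦ # n ⟧ = ι n
      ⟦ a ⊕ b ⟧ = ⟦ a ⟧ + ⟦ b ⟧
      ⟦ a ⊖ b ⟧ = ⟦ a ⟧ - ⟦ b ⟧
      ⟦ a ⊗ b ⟧ = ⟦ a ⟧ * ⟦ b ⟧
      ⟦ a ↑ k ⟧ = ⟦ a ⟧ ^ k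

      mono : Mono → 𝔽
      mono [] = 𝟙
      mono (x ∷ p) = look ρ x * mono p

      poly : Poly → 𝔽
      poly [] = 𝟘
      poly ((k , p) ∷ ps) = ιℤ k * mono p + poly ps

      mono-mul : ∀ p q → mono (mulM p q) ≡ mono p * mono q
      mono-mul [] q = sym (*-identityˡ _)
      mono-mul (a ∷ p) q = trans (mono-insert a (mulM p q)) (trans (cong (look ρ a *_) (mono-mul p q)) (sym (*-assoc _ _ _)))
        where
        mono-insert : ∀ a r → mono (mulM (a ∷ []) r) ≡ look ρ a * mono r
        mono-insert a [] = refl
        mono-insert a (b ∷ r) with a ℕ.≤ᵇ b
        ... | true = refl
        ... | false = trans (cong (look ρ b *_) (mono-insert a r)) (trans (sym (*-assoc _ _ _)) (trans (cong (_* mono r) (*-comm _ _)) (*-assoc _ _ _)))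

      poly-add : ∀ p q → poly (addP p q) ≡ poly p + poly q
      poly-add′ : ∀ k p ps q → poly (addP′ k p ps q) ≡ (ιℤ k * mono p + poly ps) + poly q
      poly-add [] q = sym (+-identityˡ _)
      poly-add ((k , p) ∷ ps) q = poly-add′ k p ps q
      poly-add′ k p ps [] = sym (+-identityʳ _)
      poly-add′ k p ps ((l , q) ∷ qs) with cmp p q
      ... | lt = trans (cong (ιℤ k * mono p +_) (poly-add ps ((l , q) ∷ qs))) (sym (+-assoc _ _ _))
      ... | gt = trans (cong (ιℤ l * mono q +_) (poly-add′ k p ps qs)) (trans (sym (+-assoc _ _ _)) (trans (cong (_+ poly qs) (+-comm _ _)) (+-assoc _ _ _)))
      ... | eq refl = trans (cong₂ _+_ (trans (cong (_* mono p) (ιℤ-+ k l)) (*-distribʳ-+ _ _ _)) (poly-add ps qs)) (+-interchange _ _ _ _)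

      poly-scale : ∀ k p qs → poly (scale k p qs) ≡ (ιℤ k * mono p) * poly qs
      poly-scale k p [] = sym (trans (*-comm _ 𝟘) (*-zeroˡ _))
      poly-scale k p ((l , q) ∷ qs) = trans (cong₂ _+_ (trans (cong₂ _*_ (ιℤ-* k l) (mono-mul p q)) (*-interchange _ _ _ _)) (poly-scale k p qs)) (sym (*-distribˡ-+ _ _ _))

      poly-mul : ∀ p q → poly (mulP p q) ≡ poly p * poly q
      poly-mul [] q = sym (*-zeroˡ _)
      poly-mul ((k , p) ∷ ps) q = trans (poly-add (scale k p q) (mulP ps q)) (trans (cong₂ _+_ (poly-scale k p q) (poly-mul ps q)) (sym (*-distribʳ-+ _ _ _)))

      const : ∀ x → x * 𝟙 + 𝟘 ≡ x
      const x = trans (+-identityʳ _) (trans (*-comm _ _) (*-identityˡ _))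

      poly-pow : ∀ p k → poly (powP p k) ≡ poly p ^ k
      poly-pow p zero = const 𝟙
      poly-pow p (suc k) = trans (poly-mul p (powP p k)) (cong (poly p *_) (poly-pow p k))

      norm-sound : ∀ a → poly (norm a) ≡ ⟦ a ⟧
      norm-sound (𝐱 x) = trans (+-identityʳ _) (trans (*-identityˡ _) (trans (*-comm _ _) (*-identityˡ _)))
      norm-sound (# n) = const _
      norm-sound (a ⊕ b) = trans (poly-add (norm a) (norm b)) (cong₂ _+_ (norm-sound a) (norm-sound b))
      norm-sound (a ⊖ b) = trans (poly-add (norm a) _) (cong₂ _+_ (norm-sound a) (trans (poly-scale -[1+ 0 ] [] (norm b))
        (trans (cong₂ _*_ (trans (*-comm _ _) (*-identityˡ _)) (norm-sound b)) (trans (neg-* _ _) (cong -_ (*-identityˡ _))))))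
      norm-sound (a ⊗ b) = trans (poly-mul (norm a) (norm b)) (cong₂ _*_ (norm-sound a) (norm-sound b))
      norm-sound (a ↑ k) = trans (poly-pow (norm a) k) (cong (_^ k) (norm-sound a))

      isZero-sound : ∀ p → isZero p ≡ true → poly p ≡ 𝟘
      isZero-sound [] _ = refl
      isZero-sound ((pos 0 , p) ∷ ps) e = trans (cong₂ _+_ (*-zeroˡ _) (isZero-sound ps e)) (+-identityˡ 𝟘)

      difference-zero : ∀ {x y} → x - y ≡ 𝟘 → x ≡ y
      difference-zero {x} {y} e = trans (sym (+-identityʳ x)) (trans (cong (x +_) (sym (trans (+-comm _ _) (+-inverseʳ y)))) (trans (sym (+-assoc _ _ _)) (trans (cong (_+ y) e) (+-identityˡ y))))

      expr-≡ : ∀ a b → isZero (norm (a ⊖ b)) ≡ true → ⟦ a ⟧ ≡ ⟦ b ⟧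
      expr-≡ a b e = difference-zero (trans (sym (norm-sound (a ⊖ b))) (isZero-sound (norm (a ⊖ b)) e))

    open import Data.List using (foldr)

    nth : List (Expr × Expr) → ℕ → Expr × Expr
    nth [] _ = # 0 , # 0
    nth (h ∷ hs) zero = h
    nth (h ∷ hs) (suc k) = nth hs k

    product-of : List (Expr × Expr) → List ℕ → Expr
    product-of hs [] = # 1
    product-of hs (k ∷ ks) = (proj₂ (nth hs k) ⊖ proj₁ (nth hs k)) ⊗ product-of hs ks

    combination : List (Expr × Expr) → List (ℕ × List ℕ) → Expr
    combination hs [] = # 0
    combination hs ((d , ks) ∷ cs) = # d ⊗ product-of hs ks ⊕ combination hs cs

  open Normalisation using (⟦_⟧; norm; isZero; expr-≡; nth; product-of; combination)

  ring : (ρ : List 𝔽) (a b : Expr) → isZero (norm (a ⊖ b)) ≡ true → ⟦_⟧ ρ a ≡ ⟦_⟧ ρ b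
  ring = expr-≡

  0≤ι : ∀ n → 𝟘 ≤ ι n
  0≤ι zero = ≤-refl
  0≤ι (suc n) = subst₂ _≤_ (+-identityˡ 𝟘) (sym (ι-suc n)) (+-mono-≤ 0≤1 (0≤ι n))

  0≤-difference : ∀ {x y} → x ≤ y → 𝟘 ≤ y - x
  0≤-difference {x} {y} p = subst (_≤ y - x) (+-inverseʳ x) (+-mono-≤ p ≤-refl)

  difference-0≤ : ∀ {x y} → 𝟘 ≤ y - x → x ≤ y
  difference-0≤ {x} {y} p = subst₂ _≤_ (+-identityˡ x) ((ring (y ∷ x ∷ []) (X0 ⊖ X1 ⊕ X1) X0 refl)) (+-mono-≤ p ≤-refl)

  private
    cancel-positive : ∀ d x → 𝟘 ≤ ι (suc d) * x → 𝟘 ≤ x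
    cancel-positive d x p with ≤-total 𝟘 x
    ... | inj₁ q = q
    ... | inj₂ q = ≤-trans p (difference-0≤ (subst (𝟘 ≤_) eq (*-nonNeg (0≤ι d) (0≤-difference q))))
      where
      eq : ι d * (𝟘 - x) ≡ x - ι (suc d) * x
      eq = trans (ring (ι d ∷ x ∷ []) (X0 ⊗ (# 0 ⊖ X1)) (X1 ⊖ (# 1 ⊕ X0) ⊗ X1) refl) (cong (λ y → x - y * x) (sym (ι-suc d)))

  module _ (ρ : List 𝔽) where
    Holds : Expr × Expr → Set
    Holds (l , r) = ⟦_⟧ ρ l ≤ ⟦_⟧ ρ r

    private
      nth-holds : ∀ {hs} → All Holds hs → ∀ k → Holds (nth hs k)
      nth-holds [] k = ≤-refl
      nth-holds (p ∷ ps) zero = p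
      nth-holds (p ∷ ps) (suc k) = nth-holds ps k

      product-nonNeg : ∀ {hs} → All Holds hs → ∀ ks → 𝟘 ≤ ⟦_⟧ ρ (product-of hs ks)
      product-nonNeg ps [] = 0≤1
      product-nonNeg ps (k ∷ ks) = *-nonNeg (0≤-difference (nth-holds ps k)) (product-nonNeg ps ks)

      combination-nonNeg : ∀ {hs} → All Holds hs → ∀ cs → 𝟘 ≤ ⟦_⟧ ρ (combination hs cs)
      combination-nonNeg ps [] = ≤-refl
      combination-nonNeg {hs} ps ((d , ks) ∷ cs) = subst (_≤ ι d * ⟦_⟧ ρ (product-of hs ks) + ⟦_⟧ ρ (combination hs cs)) (+-identityˡ 𝟘) (+-mono-≤ (*-nonNeg (0≤ι d) (product-nonNeg ps ks)) (combination-nonNeg ps cs))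

    -- The multiplier of r - l is d + 1, hence never zero; it clears the denominators of the
    -- certificate. An equation among the hypotheses is passed as whichever of its two inequalities
    -- is needed. At each use `refl` makes the type checker expand both polynomials.
    farkas : ∀ hs (l r : Expr) d cs → isZero (norm (# (suc d) ⊗ (r ⊖ l) ⊖ combination hs cs)) ≡ true →
             All Holds hs → ⟦_⟧ ρ l ≤ ⟦_⟧ ρ r
    farkas hs l r d cs e ps = difference-0≤ (cancel-positive d _ (subst (𝟘 ≤_) (sym (ring ρ (# (suc d) ⊗ (r ⊖ l)) (combination hs cs) e)) (combination-nonNeg ps cs)))

  *-identityʳ : ∀ x → x * 𝟙 ≡ x
  *-identityʳ x = (ring (x ∷ []) (X0 ⊗ # 1) X0 refl)

  *-zeroʳ : ∀ x → x * 𝟘 ≡ 𝟘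
  *-zeroʳ x = (ring (x ∷ []) (X0 ⊗ # 0) (# 0) refl)

  *-exchange : ∀ x y z → x * (y * z) ≡ y * (x * z)
  *-exchange x y z = (ring (x ∷ y ∷ z ∷ []) (X0 ⊗ (X1 ⊗ X2)) (X1 ⊗ (X0 ⊗ X2)) refl)

  *-shrinkˡ : ∀ x y → x ≤ 𝟙 → 𝟘 ≤ y → x * y ≤ y
  *-shrinkˡ x y p q = (farkas (x ∷ y ∷ []) (X0 ≼ # 1 ∷ # 0 ≼ X1 ∷ []) (X0 ⊗ X1) X1 0 (1 ∙ 0 · 1 ∷ []) refl (p ∷ q ∷ []))

  *-shrinkʳ : ∀ x y → 𝟘 ≤ x → y ≤ 𝟙 → x * y ≤ x
  *-shrinkʳ x y p q = (farkas (x ∷ y ∷ []) (# 0 ≼ X0 ∷ X1 ≼ # 1 ∷ []) (X0 ⊗ X1) X0 0 (1 ∙ 0 · 1 ∷ []) refl (p ∷ q ∷ []))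

  *-monoʳ-≤ : ∀ x y z → 𝟘 ≤ x → y ≤ z → x * y ≤ x * z
  *-monoʳ-≤ x y z p q = (farkas (x ∷ y ∷ z ∷ []) (# 0 ≼ X0 ∷ X1 ≼ X2 ∷ []) (X0 ⊗ X1) (X0 ⊗ X2) 0 (1 ∙ 0 · 1 ∷ []) refl (p ∷ q ∷ []))

  complement-nonNeg : ∀ x → x ≤ 𝟙 → 𝟘 ≤ 𝟙 - x
  complement-nonNeg x p = (farkas (x ∷ []) (X0 ≼ # 1 ∷ []) (# 0) (# 1 ⊖ X0) 0 (1 ∙ 0 ∷ []) refl (p ∷ []))

  complement-≤1 : ∀ x → 𝟘 ≤ x → 𝟙 - x ≤ 𝟙
  complement-≤1 x p = (farkas (x ∷ []) (# 0 ≼ X0 ∷ []) (# 1 ⊖ X0) (# 1) 0 (1 ∙ 0 ∷ []) refl (p ∷ []))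

  -- Finite sums and enumerations

  ≤-by-contradiction : ∀ {x y} → (¬ x ≤ y → ⊥) → x ≤ y
  ≤-by-contradiction {x} {y} h with x ≤? y
  ... | yes p = p
  ... | no q = ⊥-elim (h q)

  ≰⇒≥ : ∀ {x y} → ¬ x ≤ y → y ≤ x
  ≰⇒≥ {x} {y} h with ≤-total x y
  ... | inj₁ p = ⊥-elim (h p)
  ... | inj₂ p = p

  ≥1⇒≰0 : ∀ {x} → 𝟙 ≤ x → ¬ x ≤ 𝟘
  ≥1⇒≰0 p q = 1≰0 (≤-trans p q)

  inv-nonNeg : ∀ {x} → ¬ x ≤ 𝟘 → 𝟘 ≤ inv x
  inv-nonNeg {x} x≰0 with ≤-total 𝟘 (inv x)
  ... | inj₁ p = p
  ... | inj₂ p = ⊥-elim (1≰0 (farkas (inv x ∷ x ∷ []) (X0 ≼ # 0 ∷ # 0 ≼ X1 ∷ # 1 ≼ X1 ⊗ X0 ∷ []) (# 1) (# 0) 0 (1 ∙ 2 ∷ 1 ∙ 0 · 1 ∷ []) refl (p ∷ (≰⇒≥ x≰0) ∷ (≥-reflexive (inv-inverse x≰0)) ∷ [])))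

  *-cancel-≤0 : ∀ {p y} → ¬ y ≤ 𝟘 → p * y ≤ 𝟘 → p ≤ 𝟘
  *-cancel-≤0 {p} {y} y≰0 h = subst (_≤ 𝟘) (trans (*-assoc p y (inv y)) (trans (cong (p *_) (inv-inverse y≰0)) (*-identityʳ p)))
    (farkas (p ∷ y ∷ inv y ∷ []) (X0 ⊗ X1 ≼ # 0 ∷ # 0 ≼ X2 ∷ []) (X0 ⊗ X1 ⊗ X2) (# 0) 0 (1 ∙ 0 · 1 ∷ []) refl (h ∷ (inv-nonNeg y≰0) ∷ []))

  *-mono-≤ : ∀ {a b x y} → 𝟘 ≤ a → 𝟘 ≤ x → a ≤ b → x ≤ y → a * x ≤ b * y
  *-mono-≤ {a} {b} {x} {y} p q r s = (farkas (a ∷ x ∷ b ∷ y ∷ []) (# 0 ≼ X0 ∷ # 0 ≼ X1 ∷ X0 ≼ X2 ∷ X1 ≼ X3 ∷ []) (X0 ⊗ X1) (X2 ⊗ X3) 0 (1 ∙ 0 · 3 ∷ 1 ∙ 1 · 2 ∷ 1 ∙ 2 · 3 ∷ []) refl (p ∷ q ∷ r ∷ s ∷ []))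

  square-nonNeg : ∀ x → 𝟘 ≤ x * x
  square-nonNeg x with ≤-total 𝟘 x
  ... | inj₁ p = *-nonNeg p p
  ... | inj₂ p = (farkas (x ∷ []) (X0 ≼ # 0 ∷ []) (# 0) (X0 ⊗ X0) 0 (1 ∙ 0 · 0 ∷ []) refl (p ∷ []))

  ^-nonNeg : ∀ {x} → 𝟘 ≤ x → ∀ k → 𝟘 ≤ x ^ k
  ^-nonNeg p zero = 0≤1
  ^-nonNeg p (suc k) = *-nonNeg p (^-nonNeg p k)

  ^-mono : ∀ {x y} → 𝟘 ≤ x → x ≤ y → ∀ k → x ^ k ≤ y ^ k
  ^-mono p q zero = ≤-refl
  ^-mono p q (suc k) = *-mono-≤ p (^-nonNeg p k) q (^-mono p q k)

  ^-≥1 : ∀ {x} → 𝟙 ≤ x → ∀ k → 𝟙 ≤ x ^ k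
  ^-≥1 p zero = ≤-refl
  ^-≥1 {x} p (suc k) = (farkas (x ∷ x ^ k ∷ []) (# 1 ≼ X0 ∷ # 1 ≼ X1 ∷ []) (# 1) (X0 ⊗ X1) 0 (1 ∙ 0 ∷ 1 ∙ 1 ∷ 1 ∙ 0 · 1 ∷ []) refl (p ∷ (^-≥1 p k) ∷ []))

  ^-≤1 : ∀ {x} → 𝟘 ≤ x → x ≤ 𝟙 → ∀ k → x ^ k ≤ 𝟙
  ^-≤1 p q zero = ≤-refl
  ^-≤1 {x} p q (suc k) = (farkas (x ∷ x ^ k ∷ []) (# 0 ≼ X0 ∷ X0 ≼ # 1 ∷ X1 ≼ # 1 ∷ []) (X0 ⊗ X1) (# 1) 0 (1 ∙ 1 ∷ 1 ∙ 0 · 2 ∷ []) refl (p ∷ q ∷ (^-≤1 p q k) ∷ []))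

  ^-+ : ∀ x j k → x ^ (j ℕ.+ k) ≡ x ^ j * x ^ k
  ^-+ x zero k = sym (*-identityˡ _)
  ^-+ x (suc j) k = trans (cong (x *_) (^-+ x j k)) (sym (*-assoc x _ _))

  ^-*-distrib : ∀ x y k → (x * y) ^ k ≡ x ^ k * y ^ k
  ^-*-distrib x y zero = sym (*-identityˡ 𝟙)
  ^-*-distrib x y (suc k) = trans (cong ((x * y) *_) (^-*-distrib x y k)) (ring (x ∷ y ∷ x ^ k ∷ y ^ k ∷ []) (X0 ⊗ X1 ⊗ (X2 ⊗ X3)) (X0 ⊗ X2 ⊗ (X1 ⊗ X3)) refl)

  ι-mono : ∀ {m n} → m ℕ.≤ n → ι m ≤ ι n
  ι-mono {n = n} ℕ.z≤n = 0≤ι n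
  ι-mono {suc m} {suc n} (ℕ.s≤s p) = subst₂ _≤_ (sym (ι-suc m)) (sym (ι-suc n)) (+-mono-≤ ≤-refl (ι-mono p))

  ι-cancel : ∀ {m n} → ι m ≤ ι n → m ℕ.≤ n
  ι-cancel {m} {n} p with m ℕP.≤? n
  ... | yes q = q
  ... | no q = ⊥-elim (1≰0 (farkas (ι m ∷ ι n ∷ ι (suc n) ∷ []) (X0 ≼ X1 ∷ X2 ≼ X0 ∷ # 1 ⊕ X1 ≼ X2 ∷ []) (# 1) (# 0) 0 (1 ∙ 0 ∷ 1 ∙ 1 ∷ 1 ∙ 2 ∷ []) refl (p ∷ (ι-mono (ℕP.≰⇒> q)) ∷ (≥-reflexive (ι-suc n)) ∷ [])))

  ι-^ : ∀ m k → ι (m ℕ.^ k) ≡ ι m ^ k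
  ι-^ m zero = refl
  ι-^ m (suc k) = trans (ι-* m (m ℕ.^ k)) (cong (ι m *_) (ι-^ m k))

  𝟏 : {P : Set} → Dec P → 𝔽
  𝟏 (yes _) = 𝟙
  𝟏 (no _) = 𝟘

  𝟏-yes : ∀ {P : Set} (d : Dec P) → P → 𝟏 d ≡ 𝟙
  𝟏-yes (yes _) p = refl
  𝟏-yes (no q) p = ⊥-elim (q p)

  𝟏-no : ∀ {P : Set} (d : Dec P) → ¬ P → 𝟏 d ≡ 𝟘
  𝟏-no (yes p) q = ⊥-elim (q p)
  𝟏-no (no _) q = refl

  𝟏-nonNeg : ∀ {P : Set} (d : Dec P) → 𝟘 ≤ 𝟏 d
  𝟏-nonNeg (yes _) = 0≤1
  𝟏-nonNeg (no _) = ≤-refl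

  𝟏-≤1 : ∀ {P : Set} (d : Dec P) → 𝟏 d ≤ 𝟙
  𝟏-≤1 (yes _) = ≤-refl
  𝟏-≤1 (no _) = 0≤1

  𝟏-mono : ∀ {P Q : Set} (d : Dec P) (e : Dec Q) → (P → Q) → 𝟏 d ≤ 𝟏 e
  𝟏-mono (yes p) e h = ≥-reflexive (𝟏-yes e (h p))
  𝟏-mono (no _) e h = 𝟏-nonNeg e

  𝟏-cong : ∀ {P Q : Set} (d : Dec P) (e : Dec Q) → (P → Q) → (Q → P) → 𝟏 d ≡ 𝟏 e
  𝟏-cong d e f g = ≤-antisym (𝟏-mono d e f) (𝟏-mono e d g)

  𝟏-*-mono : ∀ {P : Set} (d : Dec P) {x y} → (P → x ≤ y) → 𝟏 d * x ≤ 𝟏 d * y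
  𝟏-*-mono (yes p) {x} {y} h = (farkas (x ∷ y ∷ []) (X0 ≼ X1 ∷ []) (# 1 ⊗ X0) (# 1 ⊗ X1) 0 (1 ∙ 0 ∷ []) refl ((h p) ∷ []))
  𝟏-*-mono (no _) {x} {y} h = (farkas (x ∷ y ∷ []) ([]) (# 0 ⊗ X0) (# 0 ⊗ X1) 0 ([]) refl ([]))

  𝟏-*-cong : ∀ {P : Set} (d : Dec P) {x y} → (P → x ≡ y) → 𝟏 d * x ≡ 𝟏 d * y
  𝟏-*-cong d h = ≤-antisym (𝟏-*-mono d (≤-reflexive ∘ h)) (𝟏-*-mono d (≥-reflexive ∘ h))

  𝟏-positive : ∀ {P : Set} (d : Dec P) → ¬ 𝟏 d ≤ 𝟘 → P
  𝟏-positive (yes p) _ = p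
  𝟏-positive (no _) h = ⊥-elim (h ≤-refl)

  𝟏-× : ∀ {P Q R : Set} (d : Dec P) (e : Dec Q) (r : Dec R) → (R → P × Q) → (P → Q → R) → 𝟏 r ≡ 𝟏 d * 𝟏 e
  𝟏-× (yes p) (yes q) r f g = trans (𝟏-yes r (g p q)) (sym (*-identityˡ 𝟙))
  𝟏-× (yes p) (no q) r f g = trans (𝟏-no r (q ∘ proj₂ ∘ f)) (ring [] (# 0) (# 1 ⊗ # 0) refl)
  𝟏-× (no p) e r f g = trans (𝟏-no r (p ∘ proj₁ ∘ f)) (sym (*-zeroˡ (𝟏 e)))

  ∑ : {A : Set} → List A → (A → 𝔽) → 𝔽
  ∑ [] f = 𝟘
  ∑ (x ∷ xs) f = f x + ∑ xs f

  variable
    A B : Set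

  ∑-mono∈ : ∀ (xs : List A) {f g} → (∀ x → x ∈ xs → f x ≤ g x) → ∑ xs f ≤ ∑ xs g
  ∑-mono∈ [] h = ≤-refl
  ∑-mono∈ (x ∷ xs) h = +-mono-≤ (h x (here refl)) (∑-mono∈ xs (λ y → h y ∘ there))

  ∑-mono : ∀ (xs : List A) {f g} → (∀ x → f x ≤ g x) → ∑ xs f ≤ ∑ xs g
  ∑-mono xs h = ∑-mono∈ xs (λ x _ → h x)

  ∑-cong∈ : ∀ (xs : List A) {f g} → (∀ x → x ∈ xs → f x ≡ g x) → ∑ xs f ≡ ∑ xs g
  ∑-cong∈ [] h = refl
  ∑-cong∈ (x ∷ xs) h = cong₂ _+_ (h x (here refl)) (∑-cong∈ xs (λ y → h y ∘ there))

  ∑-cong : ∀ (xs : List A) {f g} → (∀ x → f x ≡ g x) → ∑ xs f ≡ ∑ xs g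
  ∑-cong xs h = ∑-cong∈ xs (λ x _ → h x)

  ∑-+ : ∀ (xs : List A) f g → ∑ xs (λ x → f x + g x) ≡ ∑ xs f + ∑ xs g
  ∑-+ [] f g = (ring [] (# 0) (# 0 ⊕ # 0) refl)
  ∑-+ (x ∷ xs) f g = trans (cong (f x + g x +_) (∑-+ xs f g)) (ring (f x ∷ g x ∷ ∑ xs f ∷ ∑ xs g ∷ []) (X0 ⊕ X1 ⊕ (X2 ⊕ X3)) (X0 ⊕ X2 ⊕ (X1 ⊕ X3)) refl)

  ∑-sub : ∀ (xs : List A) f g → ∑ xs (λ x → f x - g x) ≡ ∑ xs f - ∑ xs g
  ∑-sub [] f g = (ring [] (# 0) (# 0 ⊖ # 0) refl)
  ∑-sub (x ∷ xs) f g = trans (cong (f x - g x +_) (∑-sub xs f g)) (ring (f x ∷ g x ∷ ∑ xs f ∷ ∑ xs g ∷ []) (X0 ⊖ X1 ⊕ (X2 ⊖ X3)) (X0 ⊕ X2 ⊖ (X1 ⊕ X3)) refl)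

  ∑-*ˡ : ∀ (xs : List A) a f → ∑ xs (λ x → a * f x) ≡ a * ∑ xs f
  ∑-*ˡ [] a f = (ring (a ∷ []) (# 0) (X0 ⊗ # 0) refl)
  ∑-*ˡ (x ∷ xs) a f = trans (cong (a * f x +_) (∑-*ˡ xs a f)) (ring (a ∷ f x ∷ ∑ xs f ∷ []) (X0 ⊗ X1 ⊕ X0 ⊗ X2) (X0 ⊗ (X1 ⊕ X2)) refl)

  ∑-*ʳ : ∀ (xs : List A) a f → ∑ xs (λ x → f x * a) ≡ ∑ xs f * a
  ∑-*ʳ xs a f = trans (∑-cong xs (λ x → *-comm (f x) a)) (trans (∑-*ˡ xs a f) (*-comm a _))

  ∑-0 : ∀ (xs : List A) → ∑ xs (λ _ → 𝟘) ≡ 𝟘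
  ∑-0 [] = refl
  ∑-0 (x ∷ xs) = trans (+-identityˡ _) (∑-0 xs)

  ∑-const : ∀ (xs : List A) a → ∑ xs (λ _ → a) ≡ ι (length xs) * a
  ∑-const [] a = (sym (*-zeroˡ a))
  ∑-const (x ∷ xs) a = trans (cong (a +_) (∑-const xs a)) (trans (ring (a ∷ ι (length xs) ∷ []) (X0 ⊕ X1 ⊗ X0) ((# 1 ⊕ X1) ⊗ X0) refl) (cong (_* a) (sym (ι-suc (length xs)))))

  ∑-nonNeg : ∀ (xs : List A) {f} → (∀ x → 𝟘 ≤ f x) → 𝟘 ≤ ∑ xs f
  ∑-nonNeg xs h = subst (_≤ ∑ xs _) (∑-0 xs) (∑-mono xs h)

  ∑-++ : ∀ (xs ys : List A) f → ∑ (xs ++ ys) f ≡ ∑ xs f + ∑ ys f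
  ∑-++ [] ys f = sym (+-identityˡ _)
  ∑-++ (x ∷ xs) ys f = trans (cong (f x +_) (∑-++ xs ys f)) (sym (+-assoc _ _ _))

  ∑-map : ∀ (h : B → A) (xs : List B) f → ∑ (map h xs) f ≡ ∑ xs (f ∘ h)
  ∑-map h [] f = refl
  ∑-map h (x ∷ xs) f = cong (f (h x) +_) (∑-map h xs f)

  ∑-concatMap : ∀ (h : B → List A) (xs : List B) f → ∑ (concatMap h xs) f ≡ ∑ xs (λ x → ∑ (h x) f)
  ∑-concatMap h [] f = refl
  ∑-concatMap h (x ∷ xs) f = trans (∑-++ (h x) (concatMap h xs) f) (cong (∑ (h x) f +_) (∑-concatMap h xs f))

  ∑-swap : ∀ (xs : List A) (ys : List B) (f : A → B → 𝔽) → ∑ xs (λ x → ∑ ys (f x)) ≡ ∑ ys (λ y → ∑ xs (λ x → f x y))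
  ∑-swap [] ys f = sym (∑-0 ys)
  ∑-swap (x ∷ xs) ys f = trans (cong (∑ ys (f x) +_) (∑-swap xs ys f)) (sym (∑-+ ys (f x) _))

  ∑-term-≤ : ∀ {xs : List A} {f} → (∀ x → 𝟘 ≤ f x) → ∀ {x} → x ∈ xs → f x ≤ ∑ xs f
  ∑-term-≤ {xs = x ∷ xs} {f} h (here refl) = (farkas (f x ∷ ∑ xs f ∷ []) (# 0 ≼ X1 ∷ []) X0 (X0 ⊕ X1) 0 (1 ∙ 0 ∷ []) refl ((∑-nonNeg xs h) ∷ []))
  ∑-term-≤ {xs = y ∷ xs} {f} h {x = x} (there p) = (farkas (f x ∷ f y ∷ ∑ xs f ∷ []) (X0 ≼ X2 ∷ # 0 ≼ X1 ∷ []) X0 (X1 ⊕ X2) 0 (1 ∙ 0 ∷ 1 ∙ 1 ∷ []) refl ((∑-term-≤ h p) ∷ (h y) ∷ []))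

  ∑-positive : ∀ (xs : List A) f → ¬ ∑ xs f ≤ 𝟘 → ∃ λ x → x ∈ xs × ¬ f x ≤ 𝟘
  ∑-positive [] f h = ⊥-elim (h ≤-refl)
  ∑-positive (x ∷ xs) f h with f x ≤? 𝟘
  ... | no p = x , here refl , p
  ... | yes p with ∑-positive xs f (λ q → h (farkas (f x ∷ ∑ xs f ∷ []) (X0 ≼ # 0 ∷ X1 ≼ # 0 ∷ []) (X0 ⊕ X1) (# 0) 0 (1 ∙ 0 ∷ 1 ∙ 1 ∷ []) refl (p ∷ q ∷ [])))
  ...   | y , m , q = y , there m , q

  -- the method of conditional expectations
  below-average : ∀ {A : Set} (xs : List A) (p f : A → 𝔽) a → (∀ x → 𝟘 ≤ p x) → ∑ xs p ≡ 𝟙 → ∑ xs (λ x → p x * f x) ≤ a →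
                  ∃ λ x → x ∈ xs × f x ≤ a
  below-average {A} xs p f a p≥0 sum-p avg with any? (λ x → f x ≤? a) xs
  ... | yes w = satisfying w
    where
    satisfying : ∀ {ys} → Any (λ x → f x ≤ a) ys → ∃ λ x → x ∈ ys × f x ≤ a
    satisfying (here q) = _ , here refl , q
    satisfying (there w) with satisfying w
    ... | x , m , q = x , there m , q
  -- If all values exceeded `a`, the terms p x (f x - a) would be nonnegative with total at most 0.
  -- Each of them would vanish, and with it every p x, against their sum 1.
  ... | no none = ⊥-elim (1≰0 (subst (_≤ 𝟘) sum-p (subst (∑ xs p ≤_) (∑-0 xs) (∑-mono∈ xs p≤0))))
    where
    excess : A → 𝔽
    excess x = p x * (f x - a)
    above : ∀ {x} → x ∈ xs → ¬ f x - a ≤ 𝟘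
    above {x} m q = none (lose m (farkas (f x ∷ a ∷ []) (X0 ⊖ X1 ≼ # 0 ∷ []) X0 X1 0 (1 ∙ 0 ∷ []) refl (q ∷ [])))
      where
      lose : ∀ {ys} → x ∈ ys → f x ≤ a → Any (λ x → f x ≤ a) ys
      lose (here refl) r = here r
      lose (there m) r = there (lose m r)
    excess≥0 : ∀ {x} → x ∈ xs → 𝟘 ≤ excess x
    excess≥0 m = *-nonNeg (p≥0 _) (≰⇒≥ (above m))
    total : ∑ xs excess ≤ 𝟘
    total = subst (_≤ 𝟘) (sym (trans (∑-cong xs (λ x → (ring (p x ∷ f x ∷ a ∷ []) (X0 ⊗ (X1 ⊖ X2)) (X0 ⊗ X1 ⊖ X2 ⊗ X0) refl))) (trans (∑-sub xs _ _) (cong (λ z → ∑ xs (λ x → p x * f x) - z) (trans (∑-*ˡ xs a p) (cong (a *_) sum-p))))))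
      (farkas (∑ xs (λ x → p x * f x) ∷ a ∷ []) (X0 ≼ X1 ∷ []) (X0 ⊖ X1 ⊗ # 1) (# 0) 0 (1 ∙ 0 ∷ []) refl (avg ∷ []))
    each : ∀ {ys} → (∀ {x} → x ∈ ys → 𝟘 ≤ excess x) → ∑ ys excess ≤ 𝟘 → ∀ {x} → x ∈ ys → excess x ≤ 𝟘
    each {y ∷ ys} h q (here refl) = (farkas (excess y ∷ ∑ ys excess ∷ []) (X0 ⊕ X1 ≼ # 0 ∷ # 0 ≼ X1 ∷ []) X0 (# 0) 0 (1 ∙ 0 ∷ 1 ∙ 1 ∷ []) refl (q ∷ (subst (_≤ ∑ ys excess) (∑-0 ys) (∑-mono∈ ys (λ x m → h (there m)))) ∷ []))
    each {y ∷ ys} h q (there m) = each (h ∘ there) (farkas (∑ ys excess ∷ excess y ∷ []) (X1 ⊕ X0 ≼ # 0 ∷ # 0 ≼ X1 ∷ []) X0 (# 0) 0 (1 ∙ 0 ∷ 1 ∙ 1 ∷ []) refl (q ∷ (h (here refl)) ∷ [])) m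
    p≤0 : ∀ x → x ∈ xs → p x ≤ 𝟘
    p≤0 x m = *-cancel-≤0 (above m) (each excess≥0 total m)

  ∑-↭ : ∀ {xs ys : List A} → xs ↭ ys → ∀ f → ∑ xs f ≡ ∑ ys f
  ∑-↭ ↭-refl′ f = refl
  ∑-↭ (prep x p) f = cong (f x +_) (∑-↭ p f)
  ∑-↭ (swap {xs} {ys} x y p) f = trans (cong (λ s → f x + (f y + s)) (∑-↭ p f)) (ring (f x ∷ f y ∷ ∑ ys f ∷ []) (X0 ⊕ (X1 ⊕ X2)) (X1 ⊕ (X0 ⊕ X2)) refl)
  ∑-↭ (↭-trans′ p q) f = trans (∑-↭ p f) (∑-↭ q f)

  -- The law `pick` encodes that the list contains every element exactly once, in the form in which
  -- sums consume it: a Kronecker delta can be summed out.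
  record Enum (A : Set) : Set where
    field
      elems : List A
      _≟_ : DecidableEquality A
      pick : ∀ (f : A → 𝔽) y → ∑ elems (λ x → 𝟏 (x ≟ y) * f x) ≡ f y

    pick′ : ∀ (f : A → 𝔽) y → ∑ elems (λ x → 𝟏 (y ≟ x) * f x) ≡ f y
    pick′ f y = trans (∑-cong elems (λ x → cong (_* f x) (𝟏-cong (y ≟ x) (x ≟ y) sym sym))) (pick f y)

    pick-1 : ∀ y → ∑ elems (λ x → 𝟏 (x ≟ y)) ≡ 𝟙
    pick-1 y = trans (∑-cong elems (λ x → (sym (*-identityʳ (𝟏 (x ≟ y)))))) (pick (λ _ → 𝟙) y)

    pick-1′ : ∀ y → ∑ elems (λ x → 𝟏 (y ≟ x)) ≡ 𝟙
    pick-1′ y = trans (∑-cong elems (λ x → (sym (*-identityʳ (𝟏 (y ≟ x)))))) (pick′ (λ _ → 𝟙) y)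

    -- The tool for double counting: with it the edges of a partial packing are counted by row,
    -- column, colour or matching, as need be.
    fibres : ∀ {B : Set} (xs : List B) (π : B → A) (f : B → 𝔽) →
             ∑ elems (λ y → ∑ xs (λ x → 𝟏 (π x ≟ y) * f x)) ≡ ∑ xs f
    fibres xs π f = trans (∑-swap elems xs _) (∑-cong xs (λ x → trans (∑-*ʳ elems (f x) _) (trans (cong (_* f x) (pick-1′ (π x))) (*-identityˡ _))))

  open Enum using (elems) public

  allFin-suc : ∀ n (f : Fin (suc n) → 𝔽) → ∑ (allFin (suc n)) f ≡ f Fin.zero + ∑ (allFin n) (f ∘ Fin.suc)
  allFin-suc n f = cong (f Fin.zero +_) (trans (cong (λ l → ∑ l f) (sym (LP.map-tabulate (λ x → x) Fin.suc))) (∑-map Fin.suc (allFin n) f))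

  enumFin : ∀ n → Enum (Fin n)
  enumFin n = record { elems = allFin n ; _≟_ = FP._≟_ ; pick = pick-Fin n }
    where
    pick-Fin : ∀ n (f : Fin n → 𝔽) (y : Fin n) → ∑ (allFin n) (λ x → 𝟏 (x FP.≟ y) * f x) ≡ f y
    pick-Fin (suc n) f Fin.zero = trans (allFin-suc n _) (trans (cong (𝟙 * f Fin.zero +_) (trans (∑-cong (allFin n) (λ x → trans (cong (_* f (Fin.suc x)) (𝟏-no (Fin.suc x FP.≟ Fin.zero) λ ())) (*-zeroˡ (f (Fin.suc x))))) (∑-0 (allFin n)))) (ring (f Fin.zero ∷ []) (# 1 ⊗ X0 ⊕ # 0) X0 refl))
    pick-Fin (suc n) f (Fin.suc y) = trans (allFin-suc n _) (trans (cong₂ _+_ (trans (cong (_* f Fin.zero) (𝟏-no (Fin.zero FP.≟ Fin.suc y) λ ())) (*-zeroˡ (f Fin.zero))) (trans (∑-cong (allFin n) (λ x → cong (_* f (Fin.suc x)) (𝟏-cong (Fin.suc x FP.≟ Fin.suc y) (x FP.≟ y) FP.suc-injective (cong Fin.suc)))) (pick-Fin n (f ∘ Fin.suc) y))) (+-identityˡ _))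

  enum⊎ : ∀ {A B : Set} → Enum A → Enum B → Enum (A ⊎ B)
  enum⊎ {A} {B} EA EB = record { elems = map inj₁ (elems EA) ++ map inj₂ (elems EB) ; _≟_ = _≟⊎_ ; pick = pick⊎ }
    where
    _≟⊎_ : DecidableEquality (A ⊎ B)
    _≟⊎_ = SumP.≡-dec (Enum._≟_ EA) (Enum._≟_ EB)
    split : ∀ f → ∑ (map inj₁ (elems EA) ++ map inj₂ (elems EB)) f ≡ ∑ (elems EA) (f ∘ inj₁) + ∑ (elems EB) (f ∘ inj₂)
    split f = trans (∑-++ (map inj₁ (elems EA)) _ f) (cong₂ _+_ (∑-map inj₁ (elems EA) f) (∑-map inj₂ (elems EB) f))
    vanish : ∀ {C : Set} (xs : List C) (h : C → A ⊎ B) y (f : A ⊎ B → 𝔽) → (∀ x → h x ≢ y) → ∑ xs (λ x → 𝟏 (h x ≟⊎ y) * f (h x)) ≡ 𝟘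
    vanish xs h y f ne = trans (∑-cong xs (λ x → trans (cong (_* f (h x)) (𝟏-no (h x ≟⊎ y) (ne x))) (*-zeroˡ (f (h x))))) (∑-0 xs)
    inj₁-injective : ∀ {x y : A} → _≡_ {A = A ⊎ B} (inj₁ x) (inj₁ y) → x ≡ y
    inj₁-injective refl = refl
    inj₂-injective : ∀ {x y : B} → _≡_ {A = A ⊎ B} (inj₂ x) (inj₂ y) → x ≡ y
    inj₂-injective refl = refl
    pick⊎ : ∀ f y → ∑ (map inj₁ (elems EA) ++ map inj₂ (elems EB)) (λ x → 𝟏 (x ≟⊎ y) * f x) ≡ f y
    pick⊎ f (inj₁ y) = trans (split _) (trans (cong₂ _+_
      (trans (∑-cong (elems EA) (λ x → cong (_* f (inj₁ x)) (𝟏-cong (inj₁ x ≟⊎ inj₁ y) (Enum._≟_ EA x y) inj₁-injective (cong inj₁)))) (Enum.pick EA (f ∘ inj₁) y))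
      (vanish (elems EB) inj₂ (inj₁ y) f λ _ ())) (trans (+-comm _ _) (+-identityˡ _)))
    pick⊎ f (inj₂ y) = trans (split _) (trans (cong₂ _+_
      (vanish (elems EA) inj₁ (inj₂ y) f λ _ ())
      (trans (∑-cong (elems EB) (λ x → cong (_* f (inj₂ x)) (𝟏-cong (inj₂ x ≟⊎ inj₂ y) (Enum._≟_ EB x y) inj₂-injective (cong inj₂)))) (Enum.pick EB (f ∘ inj₂) y)))
      (+-identityˡ _))

  pairs : ∀ {A B : Set} → List A → List B → List (A × B)
  pairs xs ys = concatMap (λ x → map (x ,_) ys) xs

  ∑-pairs : ∀ {A B : Set} (xs : List A) (ys : List B) f → ∑ (pairs xs ys) f ≡ ∑ xs (λ x → ∑ ys (λ y → f (x , y)))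
  ∑-pairs xs ys f = trans (∑-concatMap (λ x → map (x ,_) ys) xs f) (∑-cong xs (λ x → ∑-map (x ,_) ys f))

  enum× : ∀ {A B : Set} → Enum A → Enum B → Enum (A × B)
  enum× {A} {B} EA EB = record { elems = pairs (elems EA) (elems EB) ; _≟_ = _≟×_ ; pick = pick× }
    where
    _≟×_ : DecidableEquality (A × B)
    _≟×_ = ProdP.≡-dec (Enum._≟_ EA) (Enum._≟_ EB)
    factor : ∀ x y x′ y′ → 𝟏 ((x , y) ≟× (x′ , y′)) ≡ 𝟏 (Enum._≟_ EA x x′) * 𝟏 (Enum._≟_ EB y y′)
    factor x y x′ y′ = 𝟏-× (Enum._≟_ EA x x′) (Enum._≟_ EB y y′) ((x , y) ≟× (x′ , y′)) (λ e → cong proj₁ e , cong proj₂ e) (λ p q → cong₂ _,_ p q)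
    pick× : ∀ f y → ∑ (pairs (elems EA) (elems EB)) (λ x → 𝟏 (x ≟× y) * f x) ≡ f y
    pick× f (a , b) = trans (∑-pairs (elems EA) (elems EB) _) (trans
      (∑-cong (elems EA) (λ x → trans (∑-cong (elems EB) (λ y → trans (cong (_* f (x , y)) (factor x y a b)) (*-assoc _ _ _)))
        (trans (∑-*ˡ (elems EB) _ _) (cong (𝟏 (Enum._≟_ EA x a) *_) (trans (∑-cong (elems EB) (λ y → refl)) (Enum.pick EB (λ y → f (x , y)) b))))))
      (Enum.pick EA (λ x → f (x , b)) a))

  elem-∈ : ∀ {A : Set} (EA : Enum A) y → y ∈ elems EA
  elem-∈ EA y = found (∑-positive (elems EA) (λ x → 𝟏 (Enum._≟_ EA x y)) λ h → 1≰0 (subst (_≤ 𝟘) (Enum.pick-1 EA y) h))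
    where
    found : (∃ λ x → x ∈ elems EA × ¬ 𝟏 (Enum._≟_ EA x y) ≤ 𝟘) → y ∈ elems EA
    found (x , m , h) = subst (_∈ elems EA) (𝟏-positive (Enum._≟_ EA x y) h) m

  -- Products and the Bonferroni inequalities

  ∏ : {A : Set} → List A → (A → 𝔽) → 𝔽
  ∏ [] f = 𝟙
  ∏ (x ∷ xs) f = f x * ∏ xs f

  ∏-* : ∀ (xs : List A) f g → ∏ xs (λ x → f x * g x) ≡ ∏ xs f * ∏ xs g
  ∏-* [] f g = (ring [] (# 1) (# 1 ⊗ # 1) refl)
  ∏-* (x ∷ xs) f g = trans (cong (f x * g x *_) (∏-* xs f g)) (ring (f x ∷ g x ∷ ∏ xs f ∷ ∏ xs g ∷ []) (X0 ⊗ X1 ⊗ (X2 ⊗ X3)) (X0 ⊗ X2 ⊗ (X1 ⊗ X3)) refl)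

  ∏-nonNeg : ∀ (xs : List A) {f} → (∀ x → 𝟘 ≤ f x) → 𝟘 ≤ ∏ xs f
  ∏-nonNeg [] h = 0≤1
  ∏-nonNeg (x ∷ xs) h = *-nonNeg (h x) (∏-nonNeg xs h)

  ∏-≤1 : ∀ (xs : List A) {f} → (∀ x → 𝟘 ≤ f x) → (∀ x → f x ≤ 𝟙) → ∏ xs f ≤ 𝟙
  ∏-≤1 [] h k = ≤-refl
  ∏-≤1 (x ∷ xs) {f} h k = (farkas (f x ∷ ∏ xs f ∷ []) (# 0 ≼ X0 ∷ X0 ≼ # 1 ∷ X1 ≼ # 1 ∷ []) (X0 ⊗ X1) (# 1) 0 (1 ∙ 1 ∷ 1 ∙ 0 · 2 ∷ []) refl ((h x) ∷ (k x) ∷ (∏-≤1 xs h k) ∷ []))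

  ∏-one : ∀ (xs : List A) f → (∀ x → x ∈ xs → f x ≡ 𝟙) → ∏ xs f ≡ 𝟙
  ∏-one [] f h = refl
  ∏-one (x ∷ xs) f h = trans (cong₂ _*_ (h x (here refl)) (∏-one xs f (λ y → h y ∘ there))) (ring [] (# 1 ⊗ # 1) (# 1) refl)

  ∑² : {A : Set} → List A → (A → A → 𝔽) → 𝔽
  ∑² [] g = 𝟘
  ∑² (x ∷ xs) g = ∑ xs (g x) + ∑² xs g

  module _ {A : Set} {x : A → 𝔽} (x≥0 : ∀ a → 𝟘 ≤ x a) (x≤1 : ∀ a → x a ≤ 𝟙) where
    bonferroni-lower : ∀ xs → 𝟙 - ∑ xs x ≤ ∏ xs (λ a → 𝟙 - x a)
    bonferroni-lower [] = (farkas [] ([]) (# 1 ⊖ # 0) (# 1) 0 ([]) refl ([]))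
    bonferroni-lower (a ∷ xs) = (farkas (x a ∷ ∑ xs x ∷ ∏ xs (λ a → 𝟙 - x a) ∷ []) (# 0 ≼ X0 ∷ # 1 ⊖ X1 ≼ X2 ∷ X0 ≼ # 1 ∷ # 0 ≼ X1 ∷ []) (# 1 ⊖ (X0 ⊕ X1)) ((# 1 ⊖ X0) ⊗ X2) 0 (1 ∙ 0 · 3 ∷ 1 ∙ 1 · 2 ∷ []) refl ((x≥0 a) ∷ (bonferroni-lower xs) ∷ (x≤1 a) ∷ (∑-nonNeg xs x≥0) ∷ []))

    -- Multiplying the inductive bound by 1 - x a subtracts x a times the old product. The lower
    -- bound 1 - ∑ x for that product supplies exactly the new pair terms.
    bonferroni-upper : ∀ xs → ∏ xs (λ a → 𝟙 - x a) ≤ 𝟙 - ∑ xs x + ∑² xs (λ a b → x a * x b)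
    bonferroni-upper [] = (farkas [] ([]) (# 1) (# 1 ⊖ # 0 ⊕ # 0) 0 ([]) refl ([]))
    bonferroni-upper (a ∷ xs) = subst (λ z → ∏ (a ∷ xs) (λ a → 𝟙 - x a) ≤ 𝟙 - (x a + ∑ xs x) + (z + ∑² xs (λ a b → x a * x b))) (sym (∑-*ˡ xs (x a) x))
      (farkas (x a ∷ ∏ xs (λ a → 𝟙 - x a) ∷ ∑ xs x ∷ ∑² xs (λ a b → x a * x b) ∷ []) (X1 ≼ # 1 ⊖ X2 ⊕ X3 ∷ # 0 ≼ X0 ∷ # 1 ⊖ X2 ≼ X1 ∷ []) ((# 1 ⊖ X0) ⊗ X1) (# 1 ⊖ (X0 ⊕ X2) ⊕ (X0 ⊗ X2 ⊕ X3)) 0 (1 ∙ 0 ∷ 1 ∙ 1 · 2 ∷ []) refl ((bonferroni-upper xs) ∷ (x≥0 a) ∷ (bonferroni-lower xs) ∷ []))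

  -- Multiplicities of elements in lists

  module Counting {A : Set} (EA : Enum A) where
    open Enum EA hiding (elems)

    count : A → List A → 𝔽
    count v xs = ∑ xs (λ u → 𝟏 (u ≟ v))

    count-nonNeg : ∀ v xs → 𝟘 ≤ count v xs
    count-nonNeg v xs = ∑-nonNeg xs (λ u → 𝟏-nonNeg (u ≟ v))

    rest : A → List A → List A
    rest v [] = []
    rest v (u ∷ xs) with u ≟ v
    ... | yes _ = rest v xs
    ... | no _ = u ∷ rest v xs

    count-∉ : ∀ {v} xs → All (v ≢_) xs → count v xs ≡ 𝟘
    count-∉ [] [] = refl
    count-∉ {v} (u ∷ xs) (h ∷ hs) = trans (cong₂ _+_ (𝟏-no (u ≟ v) (h ∘ sym)) (count-∉ xs hs)) (+-identityˡ 𝟘)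

    count-unique : ∀ v {xs} → Unique xs → count v xs ≡ 𝟘 ⊎ count v xs ≡ 𝟙
    count-unique v [] = inj₁ refl
    count-unique v {u ∷ xs} (h ∷ un) with u ≟ v
    ... | yes refl = inj₂ (trans (cong (𝟙 +_) (count-∉ xs h)) (ring [] (# 1 ⊕ # 0) (# 1) refl))
    ... | no _ with count-unique v un
    ...   | inj₁ e = inj₁ (trans (+-identityˡ _) e)
    ...   | inj₂ e = inj₂ (trans (+-identityˡ _) e)

    ∈-count : ∀ v xs → ¬ count v xs ≤ 𝟘 → v ∈ xs
    ∈-count v xs h = found (∑-positive xs _ h)
      where
      found : (∃ λ x → x ∈ xs × ¬ 𝟏 (x ≟ v) ≤ 𝟘) → v ∈ xs
      found (x , m , q) = subst (_∈ xs) (𝟏-positive (x ≟ v) q) m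

    count-≤1 : ∀ v {xs} → Unique xs → count v xs ≤ 𝟙
    count-≤1 v un with count-unique v un
    ... | inj₁ e = subst (_≤ 𝟙) (sym e) 0≤1
    ... | inj₂ e = ≤-reflexive e

    count-idem : ∀ v {xs} → Unique xs → count v xs * count v xs ≡ count v xs
    count-idem v un with count-unique v un
    ... | inj₁ e = subst (λ z → z * z ≡ z) (sym e) (ring [] (# 0 ⊗ # 0) (# 0) refl)
    ... | inj₂ e = subst (λ z → z * z ≡ z) (sym e) (ring [] (# 1 ⊗ # 1) (# 1) refl)

    count-* : ∀ v xs → (f : A → 𝔽) → (∀ u → u ∈ xs → f u ≡ 𝟙) → count v xs * f v ≡ count v xs
    count-* v [] f h = (*-zeroˡ (f v))
    count-* v (u ∷ xs) f h = trans (ring (𝟏 (u ≟ v) ∷ count v xs ∷ f v ∷ []) ((X0 ⊕ X1) ⊗ X2) (X0 ⊗ X2 ⊕ X1 ⊗ X2) refl)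
      (cong₂ _+_ (trans (𝟏-*-cong (u ≟ v) (λ { refl → h u (here refl) })) (*-identityʳ (𝟏 (u ≟ v)))) (count-* v xs f (λ y → h y ∘ there)))

    rest-length : ∀ v xs → ι (length (rest v xs)) ≡ ι (length xs) - count v xs
    rest-length v [] = (ring [] (# 0) (# 0 ⊖ # 0) refl)
    rest-length v (u ∷ xs) with u ≟ v
    ... | yes _ = trans (rest-length v xs) (trans (ring (ι (length xs) ∷ count v xs ∷ []) (X0 ⊖ X1) (# 1 ⊕ X0 ⊖ (# 1 ⊕ X1)) refl) (cong (λ z → z - (𝟙 + count v xs)) (sym (ι-suc (length xs)))))
    ... | no _ = trans (ι-suc (length (rest v xs))) (trans (cong (𝟙 +_) (rest-length v xs)) (trans (ring (ι (length xs) ∷ count v xs ∷ []) (# 1 ⊕ (X0 ⊖ X1)) (# 1 ⊕ X0 ⊖ (# 0 ⊕ X1)) refl) (cong (λ z → z - (𝟘 + count v xs)) (sym (ι-suc (length xs))))))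

    rest-≤ : ∀ v xs → length (rest v xs) ℕ.≤ length xs
    rest-≤ v [] = ℕ.z≤n
    rest-≤ v (u ∷ xs) with u ≟ v
    ... | yes _ = ℕP.m≤n⇒m≤1+n (rest-≤ v xs)
    ... | no _ = ℕ.s≤s (rest-≤ v xs)

    rest-All : ∀ {P : A → Set} v {xs} → All P xs → All P (rest v xs)
    rest-All v [] = []
    rest-All v {u ∷ xs} (p ∷ ps) with u ≟ v
    ... | yes _ = rest-All v ps
    ... | no _ = p ∷ rest-All v ps

    rest-unique : ∀ v {xs} → Unique xs → Unique (rest v xs)
    rest-unique v [] = []
    rest-unique v {u ∷ xs} (p ∷ ps) with u ≟ v
    ... | yes _ = rest-unique v ps
    ... | no _ = rest-All v p ∷ rest-unique v ps

    count-rest-≤ : ∀ u v xs → count u (rest v xs) ≤ count u xs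
    count-rest-≤ u v [] = ≤-refl
    count-rest-≤ u v (y ∷ xs) with y ≟ v
    ... | yes _ = (farkas (count u (rest v xs) ∷ 𝟏 (y ≟ u) ∷ count u xs ∷ []) (X0 ≼ X2 ∷ # 0 ≼ X1 ∷ []) X0 (X1 ⊕ X2) 0 (1 ∙ 0 ∷ 1 ∙ 1 ∷ []) refl ((count-rest-≤ u v xs) ∷ (𝟏-nonNeg (y ≟ u)) ∷ []))
    ... | no _ = +-mono-≤ ≤-refl (count-rest-≤ u v xs)

    count-rest-self : ∀ v xs → count v (rest v xs) ≡ 𝟘
    count-rest-self v [] = refl
    count-rest-self v (y ∷ xs) with y ≟ v
    ... | yes _ = count-rest-self v xs
    ... | no q = trans (cong₂ _+_ (𝟏-no (y ≟ v) q) (count-rest-self v xs)) (+-identityˡ 𝟘)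

    rest-∉ : ∀ {v xs} → All (v ≢_) xs → rest v xs ≡ xs
    rest-∉ [] = refl
    rest-∉ {v} {u ∷ xs} (h ∷ hs) with u ≟ v
    ... | yes e = ⊥-elim (h (sym e))
    ... | no _ = cong (u ∷_) (rest-∉ hs)

    -- The factor `count v xs` makes the identity hold also for absent v, so it can be applied
    -- inside sums over edges without distinguishing whether v lies on the edge.
    ∏-rest : ∀ v {xs} (f : A → 𝔽) → Unique xs → count v xs * ∏ xs f ≡ count v xs * (f v * ∏ (rest v xs) f)
    ∏-rest v f [] = (ring (f v ∷ []) (# 0 ⊗ # 1) (# 0 ⊗ (X0 ⊗ # 1)) refl)
    ∏-rest v {u ∷ xs} f (h ∷ un) with u ≟ v
    ... | yes refl = cong (λ l → (𝟙 + count v xs) * (f v * ∏ l f)) (sym (rest-∉ h))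
    ... | no _ = trans (ring (count v xs ∷ f u ∷ ∏ xs f ∷ []) ((# 0 ⊕ X0) ⊗ (X1 ⊗ X2)) (X1 ⊗ (X0 ⊗ X2)) refl) (trans (cong (f u *_) (∏-rest v f un)) (ring (f u ∷ count v xs ∷ f v ∷ ∏ (rest v xs) f ∷ []) (X0 ⊗ (X1 ⊗ (X2 ⊗ X3))) ((# 0 ⊕ X1) ⊗ (X2 ⊗ (X0 ⊗ X3))) refl))

    count-double : ∀ xs ys → ∑ xs (λ v → count v ys) ≡ ∑ ys (λ u → count u xs)
    count-double xs ys = trans (∑-swap xs ys _) (∑-cong ys (λ u → ∑-cong xs (λ v → 𝟏-cong (u ≟ v) (v ≟ u) sym sym)))

  -- Tracking several quantities by potentials

  power-growth : ∀ k {y d} → 𝟘 ≤ d → 𝟘 - d ≤ y → y ≤ d → ι k * d ≤ 𝟙 → (𝟙 + y) ^ k ≤ 𝟙 + ι k * y + ι k * ι k * (y * y)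
  power-growth zero {y} d≥0 lo hi h = (farkas (y ∷ []) ([]) (# 1) (# 1 ⊕ # 0 ⊗ X0 ⊕ # 0 ⊗ # 0 ⊗ (X0 ⊗ X0)) 0 ([]) refl ([]))
  power-growth (suc k) {y} {d} d≥0 lo hi h = ≤-trans step (≤-reflexive eq)
    where
    K = ι k
    h′ : 𝟙 * d + K * d ≤ 𝟙
    h′ = subst (_≤ 𝟙) (trans (cong (_* d) (ι-suc k)) (ring (K ∷ d ∷ []) ((# 1 ⊕ X0) ⊗ X1) (# 1 ⊗ X1 ⊕ X0 ⊗ X1) refl)) h
    Kd : 𝟘 ≤ K * d
    Kd = *-nonNeg (0≤ι k) d≥0
    kd : K * d ≤ 𝟙
    kd = (farkas (K ∷ d ∷ []) (# 1 ⊗ X1 ⊕ X0 ⊗ X1 ≼ # 1 ∷ # 0 ≼ X1 ∷ []) (X0 ⊗ X1) (# 1) 0 (1 ∙ 0 ∷ 1 ∙ 1 ∷ []) refl (h′ ∷ d≥0 ∷ []))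
    pos-1+y : 𝟘 ≤ 𝟙 + y
    pos-1+y = (farkas (y ∷ d ∷ K ∷ []) (# 1 ⊗ X1 ⊕ X2 ⊗ X1 ≼ # 1 ∷ # 0 ⊖ X1 ≼ X0 ∷ # 0 ≼ X2 ⊗ X1 ∷ []) (# 0) (# 1 ⊕ X0) 0 (1 ∙ 0 ∷ 1 ∙ 1 ∷ 1 ∙ 2 ∷ []) refl (h′ ∷ lo ∷ Kd ∷ []))
    ih = power-growth k d≥0 lo hi kd
    -- Multiplying out, the only term of the wrong kind is the cubic one, K² y³. It is at most K y²
    -- because y ≤ d and K d ≤ 1, and K² + 2K is below (K + 1)².
    step : (𝟙 + y) ^ suc k ≤ 𝟙 + (𝟙 + K) * y + (𝟙 + K) * (𝟙 + K) * (y * y)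
    step = (farkas (y ∷ (𝟙 + y) ^ k ∷ K ∷ d ∷ []) (# 0 ≼ # 1 ⊕ X0 ∷ X1 ≼ # 1 ⊕ X2 ⊗ X0 ⊕ X2 ⊗ X2 ⊗ (X0 ⊗ X0) ∷ # 0 ≼ X0 ⊗ X0 ∷ # 0 ≼ X2 ∷ X2 ⊗ X3 ≼ # 1 ∷ X0 ≼ X3 ∷ []) ((# 1 ⊕ X0) ⊗ X1) (# 1 ⊕ (# 1 ⊕ X2) ⊗ X0 ⊕ (# 1 ⊕ X2) ⊗ (# 1 ⊕ X2) ⊗ (X0 ⊗ X0)) 0 (1 ∙ 2 ∷ 1 ∙ 0 · 1 ∷ 1 ∙ 2 · 3 · 4 ∷ 1 ∙ 2 · 3 · 3 · 5 ∷ []) refl (pos-1+y ∷ ih ∷ (square-nonNeg y) ∷ (0≤ι k) ∷ kd ∷ hi ∷ []))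
    eq : 𝟙 + (𝟙 + K) * y + (𝟙 + K) * (𝟙 + K) * (y * y) ≡ 𝟙 + ι (suc k) * y + ι (suc k) * ι (suc k) * (y * y)
    eq = cong (λ z → 𝟙 + z * y + z * z * (y * y)) (sym (ι-suc k))

  ι-≤-square : ∀ n → ι n ≤ ι n * ι n
  ι-≤-square zero = (farkas [] ([]) (# 0) (# 0 ⊗ # 0) 0 ([]) refl ([]))
  ι-≤-square (suc n) = subst (λ z → z ≤ z * z) (sym (ι-suc n)) (farkas (ι n ∷ []) (# 0 ≼ X0 ∷ []) (# 1 ⊕ X0) ((# 1 ⊕ X0) ⊗ (# 1 ⊕ X0)) 0 (1 ∙ 0 ∷ 1 ∙ 0 · 0 ∷ []) refl ((0≤ι n) ∷ []))

  module Potential (N : ℕ) where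
    -- A rational substitute for an exponential moment: a change of x that is small against 1/N
    -- multiplies it by a factor near 1, wherever x is.
    Φ : 𝔽 → 𝔽
    Φ x = (𝟙 + x * x) ^ N

    base≥1 : ∀ x → 𝟙 ≤ 𝟙 + x * x
    base≥1 x = (farkas (x ∷ []) (# 0 ≼ X0 ⊗ X0 ∷ []) (# 1) (# 1 ⊕ X0 ⊗ X0) 0 (1 ∙ 0 ∷ []) refl ((square-nonNeg x) ∷ []))

    -- N times this is the logarithmic derivative of `Φ`. It lies between -1 and 1 because 2x is at
    -- most 1 + x² in absolute value, and this makes the relative growth of `Φ` controllable
    -- uniformly in x.
    slope : 𝔽 → 𝔽
    slope x = ι 2 * x * inv (𝟙 + x * x)

    Φ-nonNeg : ∀ x → 𝟘 ≤ Φ x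
    Φ-nonNeg x = ^-nonNeg (≤-trans 0≤1 (base≥1 x)) N

    module _ (x : 𝔽) where
      private
        S = 𝟙 + x * x
        u = inv S
        b = slope x
        su : S * u ≡ 𝟙
        su = inv-inverse (≥1⇒≰0 (base≥1 x))
        u≥0 : 𝟘 ≤ u
        u≥0 = inv-nonNeg (≥1⇒≰0 (base≥1 x))

      inv≤1 : u ≤ 𝟙
      inv≤1 = (farkas (u ∷ x ∷ []) ((# 1 ⊕ X1 ⊗ X1) ⊗ X0 ≼ # 1 ∷ # 0 ≼ X0 ∷ # 0 ≼ X1 ⊗ X1 ∷ []) X0 (# 1) 0 (1 ∙ 0 ∷ 1 ∙ 1 · 2 ∷ []) refl ((≤-reflexive (su)) ∷ u≥0 ∷ (square-nonNeg x) ∷ []))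

      slope≤1 : b ≤ 𝟙
      slope≤1 = (farkas (x ∷ u ∷ []) ((# 1 ⊕ X0 ⊗ X0) ⊗ X1 ≼ # 1 ∷ # 0 ≼ X1 ∷ # 0 ≼ (X0 ⊖ # 1) ⊗ (X0 ⊖ # 1) ∷ []) (# 2 ⊗ X0 ⊗ X1) (# 1) 0 (1 ∙ 0 ∷ 1 ∙ 1 · 2 ∷ []) refl ((≤-reflexive (su)) ∷ u≥0 ∷ (square-nonNeg (x - 𝟙)) ∷ []))

      slope≥-1 : 𝟘 - 𝟙 ≤ b
      slope≥-1 = (farkas (x ∷ u ∷ []) ((# 1 ⊕ X0 ⊗ X0) ⊗ X1 ≼ # 1 ∷ # 0 ≼ X1 ∷ # 0 ≼ (X0 ⊕ # 1) ⊗ (X0 ⊕ # 1) ∷ []) (# 0 ⊖ # 1) (# 2 ⊗ X0 ⊗ X1) 0 (1 ∙ 0 ∷ 1 ∙ 1 · 2 ∷ []) refl ((≤-reflexive (su)) ∷ u≥0 ∷ (square-nonNeg (x + 𝟙)) ∷ []))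

      -- The factorisation 1 + (x + δ)² = (1 + x²)(1 + y), where y = slope · δ + δ² / (1 + x²) is at
      -- most 2d in absolute value, reduces the claim to `power-growth`. The square of y is at most
      -- 4δ², and the second part of y adds one more δ², whence the 5.
      Φ-step : ∀ {δ d} → 𝟘 ≤ d → d ≤ 𝟙 → 𝟘 - d ≤ δ → δ ≤ d → ι N * (ι 2 * d) ≤ 𝟙 →
               Φ (x + δ) ≤ Φ x * (𝟙 + ι N * (b * δ) + ι 5 * (ι N * ι N) * (δ * δ))
      Φ-step {δ} {d} d≥0 d≤1 lo hi small = ≤-trans (≤-reflexive (trans (cong (_^ N) factor) (^-*-distrib S (𝟙 + y) N)))
        (farkas (S ^ N ∷ (𝟙 + y) ^ N ∷ n ∷ b ∷ δ ∷ []) (# 0 ≼ X0 ∷ X1 ≼ # 1 ⊕ X2 ⊗ (X3 ⊗ X4) ⊕ # 5 ⊗ (X2 ⊗ X2) ⊗ (X4 ⊗ X4) ∷ []) (X0 ⊗ X1) (X0 ⊗ (# 1 ⊕ X2 ⊗ (X3 ⊗ X4) ⊕ # 5 ⊗ (X2 ⊗ X2) ⊗ (X4 ⊗ X4))) 0 (1 ∙ 0 · 1 ∷ []) refl ((Φ-nonNeg x) ∷ growth ∷ []))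
        where
        n = ι N
        w = u * (δ * δ)
        y = b * δ + w
        δ² = square-nonNeg δ
        factor : 𝟙 + (x + δ) * (x + δ) ≡ S * (𝟙 + y)
        factor = trans (ring (x ∷ δ ∷ []) (# 1 ⊕ (X0 ⊕ X1) ⊗ (X0 ⊕ X1)) (# 1 ⊕ X0 ⊗ X0 ⊕ # 1 ⊗ (# 2 ⊗ X0 ⊗ X1 ⊕ X1 ⊗ X1)) refl)
          (trans (cong (λ z → S + z * (ι 2 * x * δ + δ * δ)) (sym su)) (ring (x ∷ u ∷ δ ∷ []) (# 1 ⊕ X0 ⊗ X0 ⊕ (# 1 ⊕ X0 ⊗ X0) ⊗ X1 ⊗ (# 2 ⊗ X0 ⊗ X2 ⊕ X2 ⊗ X2)) ((# 1 ⊕ X0 ⊗ X0) ⊗ (# 1 ⊕ (# 2 ⊗ X0 ⊗ X1 ⊗ X2 ⊕ X1 ⊗ (X2 ⊗ X2)))) refl))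
        δ²≤d : δ * δ ≤ d
        δ²≤d = (farkas (δ ∷ d ∷ []) (# 0 ⊖ X1 ≼ X0 ∷ X0 ≼ X1 ∷ X1 ≼ # 1 ∷ []) (X0 ⊗ X0) X1 1 (2 ∙ 0 · 1 ∷ 1 ∙ 0 · 2 ∷ 1 ∙ 1 · 2 ∷ []) refl (lo ∷ hi ∷ d≤1 ∷ []))
        w≥0 : 𝟘 ≤ w
        w≥0 = *-nonNeg u≥0 δ²
        w≤δ² : w ≤ δ * δ
        w≤δ² = (farkas (u ∷ δ ∷ []) (X0 ≼ # 1 ∷ # 0 ≼ X1 ⊗ X1 ∷ []) (X0 ⊗ (X1 ⊗ X1)) (X1 ⊗ X1) 0 (1 ∙ 0 · 1 ∷ []) refl (inv≤1 ∷ δ² ∷ []))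
        bδ≤d : b * δ ≤ d
        bδ≤d = (farkas (b ∷ δ ∷ d ∷ []) (X0 ≼ # 1 ∷ # 0 ⊖ # 1 ≼ X0 ∷ # 0 ⊖ X2 ≼ X1 ∷ X1 ≼ X2 ∷ []) (X0 ⊗ X1) X2 1 (1 ∙ 0 · 2 ∷ 1 ∙ 1 · 3 ∷ []) refl (slope≤1 ∷ slope≥-1 ∷ lo ∷ hi ∷ []))
        bδ≥-d : 𝟘 - d ≤ b * δ
        bδ≥-d = (farkas (d ∷ b ∷ δ ∷ []) (X1 ≼ # 1 ∷ # 0 ⊖ # 1 ≼ X1 ∷ # 0 ⊖ X0 ≼ X2 ∷ X2 ≼ X0 ∷ []) (# 0 ⊖ X0) (X1 ⊗ X2) 1 (1 ∙ 0 · 3 ∷ 1 ∙ 1 · 2 ∷ []) refl (slope≤1 ∷ slope≥-1 ∷ lo ∷ hi ∷ []))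
        b²≤1 : b * b ≤ 𝟙
        b²≤1 = (farkas (b ∷ []) (X0 ≼ # 1 ∷ # 0 ⊖ # 1 ≼ X0 ∷ []) (X0 ⊗ X0) (# 1) 0 (1 ∙ 0 · 1 ∷ []) refl (slope≤1 ∷ slope≥-1 ∷ []))
        w²≤δ² : w * w ≤ δ * δ
        w²≤δ² = (farkas (w ∷ δ ∷ d ∷ []) (# 0 ≼ X0 ∷ X0 ≼ X1 ⊗ X1 ∷ X1 ⊗ X1 ≼ X2 ∷ X2 ≼ # 1 ∷ []) (X0 ⊗ X0) (X1 ⊗ X1) 0 (1 ∙ 1 ∷ 1 ∙ 0 · 1 ∷ 1 ∙ 0 · 2 ∷ 1 ∙ 0 · 3 ∷ []) refl (w≥0 ∷ w≤δ² ∷ δ²≤d ∷ d≤1 ∷ []))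
        y²≤4δ² : y * y ≤ ι 4 * (δ * δ)
        y²≤4δ² = (farkas (b ∷ δ ∷ w ∷ []) (X0 ⊗ X0 ≼ # 1 ∷ # 0 ≼ X1 ⊗ X1 ∷ X2 ⊗ X2 ≼ X1 ⊗ X1 ∷ # 0 ≼ (X0 ⊗ X1 ⊖ X2) ⊗ (X0 ⊗ X1 ⊖ X2) ∷ []) ((X0 ⊗ X1 ⊕ X2) ⊗ (X0 ⊗ X1 ⊕ X2)) (# 4 ⊗ (X1 ⊗ X1)) 0 (2 ∙ 2 ∷ 1 ∙ 3 ∷ 2 ∙ 0 · 1 ∷ []) refl (b²≤1 ∷ δ² ∷ w²≤δ² ∷ (square-nonNeg (b * δ - w)) ∷ []))
        growth : (𝟙 + y) ^ N ≤ 𝟙 + n * (b * δ) + ι 5 * (n * n) * (δ * δ)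
        growth = ≤-trans (power-growth N {y} {ι 2 * d} (farkas (d ∷ []) (# 0 ≼ X0 ∷ []) (# 0) (# 2 ⊗ X0) 0 (2 ∙ 0 ∷ []) refl (d≥0 ∷ []))
          (farkas (d ∷ b ∷ δ ∷ w ∷ []) (# 0 ⊖ X0 ≼ X1 ⊗ X2 ∷ # 0 ≼ X3 ∷ # 0 ≼ X0 ∷ []) (# 0 ⊖ # 2 ⊗ X0) (X1 ⊗ X2 ⊕ X3) 0 (1 ∙ 0 ∷ 1 ∙ 1 ∷ 1 ∙ 2 ∷ []) refl (bδ≥-d ∷ w≥0 ∷ d≥0 ∷ []))
          (farkas (b ∷ δ ∷ w ∷ d ∷ []) (X0 ⊗ X1 ≼ X3 ∷ X2 ≼ X1 ⊗ X1 ∷ X1 ⊗ X1 ≼ X3 ∷ []) (X0 ⊗ X1 ⊕ X2) (# 2 ⊗ X3) 0 (1 ∙ 0 ∷ 1 ∙ 1 ∷ 1 ∙ 2 ∷ []) refl (bδ≤d ∷ w≤δ² ∷ δ²≤d ∷ [])) small)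
          (farkas (n ∷ b ∷ δ ∷ w ∷ y ∷ []) (# 0 ≼ X0 ∷ X3 ≼ X2 ⊗ X2 ∷ X4 ⊗ X4 ≼ # 4 ⊗ (X2 ⊗ X2) ∷ X0 ≼ X0 ⊗ X0 ∷ # 0 ≼ X2 ⊗ X2 ∷ []) (# 1 ⊕ X0 ⊗ (X1 ⊗ X2 ⊕ X3) ⊕ X0 ⊗ X0 ⊗ (X4 ⊗ X4)) (# 1 ⊕ X0 ⊗ (X1 ⊗ X2) ⊕ # 5 ⊗ (X0 ⊗ X0) ⊗ (X2 ⊗ X2)) 0 (1 ∙ 0 · 1 ∷ 1 ∙ 0 · 0 · 2 ∷ 1 ∙ 3 · 4 ∷ []) refl ((0≤ι N) ∷ w≤δ² ∷ y²≤4δ² ∷ (ι-≤-square N) ∷ δ² ∷ []))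

      moment : ∀ {O : Set} (os : List O) (p δ : O → 𝔽) {d μ v} → (∀ o → 𝟘 ≤ p o) → ∑ os p ≡ 𝟙 →
               𝟘 ≤ d → d ≤ 𝟙 → ι N * (ι 2 * d) ≤ 𝟙 → (∀ o → 𝟘 - d ≤ δ o) → (∀ o → δ o ≤ d) →
               𝟘 - μ ≤ ∑ os (λ o → p o * δ o) → ∑ os (λ o → p o * δ o) ≤ μ → ∑ os (λ o → p o * (δ o * δ o)) ≤ v →
               ∑ os (λ o → p o * Φ (x + δ o)) ≤ Φ x * (𝟙 + (ι N * μ + ι 5 * (ι N * ι N) * v))
      moment os p δ {d} {μ} {v} p≥0 sum-p d≥0 d≤1 small lo hi elo ehi var = ≤-trans
        (∑-mono os {g = λ o → Φ x * p o + (Φ x * (n * b) * (p o * δ o) + Φ x * (ι 5 * (n * n)) * (p o * (δ o * δ o)))} (λ o →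
          (farkas (p o ∷ Φ (x + δ o) ∷ Φ x ∷ n ∷ b ∷ δ o ∷ []) (# 0 ≼ X0 ∷ X1 ≼ X2 ⊗ (# 1 ⊕ X3 ⊗ (X4 ⊗ X5) ⊕ # 5 ⊗ (X3 ⊗ X3) ⊗ (X5 ⊗ X5)) ∷ []) (X0 ⊗ X1) (X2 ⊗ X0 ⊕ (X2 ⊗ (X3 ⊗ X4) ⊗ (X0 ⊗ X5) ⊕ X2 ⊗ (# 5 ⊗ (X3 ⊗ X3)) ⊗ (X0 ⊗ (X5 ⊗ X5)))) 0 (1 ∙ 0 · 1 ∷ []) refl ((p≥0 o) ∷ (Φ-step d≥0 d≤1 (lo o) (hi o) small) ∷ []))))
        (≤-trans (≤-reflexive (trans (∑-+ os _ _) (cong₂ _+_ (trans (∑-*ˡ os _ _) (cong (Φ x *_) sum-p)) (trans (∑-+ os _ _) (cong₂ _+_ (∑-*ˡ os _ _) (∑-*ˡ os _ _))))))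
          (farkas (Φ x ∷ n ∷ b ∷ E₁ ∷ E₂ ∷ μ ∷ v ∷ []) (# 0 ≼ X0 ∷ # 0 ≼ X1 ∷ X2 ⊗ X3 ≼ X5 ∷ X4 ≼ X6 ∷ []) (X0 ⊗ # 1 ⊕ (X0 ⊗ (X1 ⊗ X2) ⊗ X3 ⊕ X0 ⊗ (# 5 ⊗ (X1 ⊗ X1)) ⊗ X4)) (X0 ⊗ (# 1 ⊕ (X1 ⊗ X5 ⊕ # 5 ⊗ (X1 ⊗ X1) ⊗ X6))) 0 (1 ∙ 0 · 1 · 2 ∷ 5 ∙ 0 · 1 · 1 · 3 ∷ []) refl ((Φ-nonNeg x) ∷ (0≤ι N) ∷ bE ∷ var ∷ [])))
        where
        n = ι N
        E₁ = ∑ os (λ o → p o * δ o)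
        E₂ = ∑ os (λ o → p o * (δ o * δ o))
        bE : b * E₁ ≤ μ
        bE = (farkas (b ∷ E₁ ∷ μ ∷ []) (X0 ≼ # 1 ∷ # 0 ⊖ # 1 ≼ X0 ∷ # 0 ⊖ X2 ≼ X1 ∷ X1 ≼ X2 ∷ []) (X0 ⊗ X1) X2 1 (1 ∙ 0 · 2 ∷ 1 ∙ 1 · 3 ∷ []) refl (slope≤1 ∷ slope≥-1 ∷ elo ∷ ehi ∷ []))

    -- The data of one random step that make the expected potential grow by a relative amount of at
    -- most `budget`: the drift μ counts N times and the second moment v counts 5N² times.
    record Increment {O : Set} (os : List O) (p : O → 𝔽) (x : 𝔽) (x′ : O → 𝔽) (budget : 𝔽) : Set where
      field
        {d μ v} : 𝔽
        d≥0 : 𝟘 ≤ d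
        d≤1 : d ≤ 𝟙
        small : ι N * (ι 2 * d) ≤ 𝟙
        lower : ∀ o → 𝟘 - d ≤ x′ o - x
        upper : ∀ o → x′ o - x ≤ d
        drift-lower : 𝟘 - μ ≤ ∑ os (λ o → p o * (x′ o - x))
        drift-upper : ∑ os (λ o → p o * (x′ o - x)) ≤ μ
        variance : ∑ os (λ o → p o * ((x′ o - x) * (x′ o - x))) ≤ v
        within : ι N * μ + ι 5 * (ι N * ι N) * v ≤ budget

    record Round {Ω K : Set} (X : K → ℕ → Ω → 𝔽) (s : K → ℕ → 𝔽) (I : ℕ → Ω → Set) (j : ℕ) (ω : Ω) : Set₁ where
      field
        {O} : Set
        os : List O
        p : O → 𝔽
        next : O → Ω
        p≥0 : ∀ o → 𝟘 ≤ p o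
        sum-p : ∑ os p ≡ 𝟙
        invariant : ∀ {o} → o ∈ os → I (suc j) (next o)
        increment : ∀ k → Increment os p (X k j ω) (λ o → X k (suc j) (next o)) (s k (suc j) - s k j)

    module _ {Ω K : Set} (ks : List K) (X : K → ℕ → Ω → 𝔽) (s : K → ℕ → 𝔽) (I : ℕ → Ω → Set) (R : 𝔽) (J : ℕ)
      (R-large : ¬ (𝟙 + R * R) ^ N ≤ ι 2 * ι (length ks))
      (R≥0 : 𝟘 ≤ R)
      (s≥0 : ∀ k j → j ℕ.≤ J → 𝟘 ≤ s k j) (s≤½ : ∀ k j → j ℕ.≤ J → ι 2 * s k j ≤ 𝟙)
      (ω₀ : Ω) (I₀ : I 0 ω₀) (X₀ : ∀ k → X k 0 ω₀ ≡ 𝟘)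
      (ks-all : ∀ k → k ∈ ks)
      (step : ∀ j → j ℕ.< J → ∀ ω → I j ω → (∀ k → X k j ω * X k j ω ≤ R * R) → Round X s I j ω) where

      private
        -- The weights absorb the expected growth: (1 - s′)(1 + s′ - s) is at most 1 - s when 0 ≤ s
        -- ≤ s′, so the expected sum does not increase. As s stays below one half, the weights cost
        -- no more than a factor 2 in the end.
        Ψ : ℕ → Ω → 𝔽
        Ψ j ω = ∑ ks (λ k → (𝟙 - s k j) * Φ (X k j ω))

        -- A single quantity beyond R would have a potential of more than twice the number of
        -- quantities, hence a weighted potential of more than that number.
        bounded : ∀ j → j ℕ.≤ J → ∀ ω → Ψ j ω ≤ ι (length ks) → ∀ k → X k j ω * X k j ω ≤ R * R
        bounded j j≤J ω ψ k = ≤-by-contradiction λ q → R-large (≤-trans (^-mono base≥0 (farkas (R ∷ x ∷ []) (X0 ⊗ X0 ≼ X1 ⊗ X1 ∷ []) (# 1 ⊕ X0 ⊗ X0) (# 1 ⊕ X1 ⊗ X1) 0 (1 ∙ 0 ∷ []) refl ((≰⇒≥ q) ∷ [])) N)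
                 (farkas (Φ x ∷ L ∷ s k j ∷ Ψ j ω ∷ []) (# 2 ⊗ X2 ≼ # 1 ∷ # 0 ≼ X0 ∷ (# 1 ⊖ X2) ⊗ X0 ≼ X3 ∷ X3 ≼ X1 ∷ []) X0 (# 2 ⊗ X1) 0 (2 ∙ 2 ∷ 2 ∙ 3 ∷ 1 ∙ 0 · 1 ∷ []) refl ((s≤½ k j j≤J) ∷ (Φ-nonNeg x) ∷ term ∷ ψ ∷ [])))
          where
          x = X k j ω
          L = ι (length ks)
          base≥0 : 𝟘 ≤ 𝟙 + R * R
          base≥0 = (farkas (R ∷ []) (# 0 ≼ X0 ∷ []) (# 0) (# 1 ⊕ X0 ⊗ X0) 0 (1 ∙1 ∷ 1 ∙ 0 · 0 ∷ []) refl (R≥0 ∷ []))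
          term : (𝟙 - s k j) * Φ x ≤ Ψ j ω
          term = ∑-term-≤ {xs = ks} {λ k → (𝟙 - s k j) * Φ (X k j ω)} (λ k → (farkas (s k j ∷ Φ (X k j ω) ∷ []) (# 2 ⊗ X0 ≼ # 1 ∷ # 0 ≼ X1 ∷ []) (# 0) ((# 1 ⊖ X0) ⊗ X1) 1 (1 ∙ 1 ∷ 1 ∙ 0 · 1 ∷ []) refl ((s≤½ k j j≤J) ∷ (Φ-nonNeg (X k j ω)) ∷ []))) (ks-all k)

        choose : ∀ j → j ℕ.< J → ∀ ω → Ψ j ω ≤ ι (length ks) → Round X s I j ω → ∃ λ ω′ → I (suc j) ω′ × Ψ (suc j) ω′ ≤ ι (length ks)
        choose j j<J ω ψ r = select (below-average os p (λ o → Ψ (suc j) (next o)) _ p≥0 sum-p expectation)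
          where
          open Round r
          Φ′ : K → O → 𝔽
          Φ′ k o = Φ (X k (suc j) (next o))
          each : ∀ k → (𝟙 - s k (suc j)) * ∑ os (λ o → p o * Φ′ k o) ≤ (𝟙 - s k j) * Φ (X k j ω)
          each k = (farkas (s′ ∷ E ∷ σ ∷ F ∷ b ∷ []) (X0 ≼ # 1 ∷ # 0 ≼ X0 ∷ X1 ≼ X3 ⊗ (# 1 ⊕ X4) ∷ X4 ≼ X0 ⊖ X2 ∷ # 0 ≼ X3 ∷ # 0 ≼ X4 ∷ []) ((# 1 ⊖ X0) ⊗ X1) ((# 1 ⊖ X2) ⊗ X3) 0 (1 ∙ 0 · 2 ∷ 1 ∙ 0 · 3 · 4 ∷ 1 ∙ 1 · 4 · 5 ∷ 1 ∙ 1 · 3 · 4 ∷ []) refl (s′≤1 ∷ (s≥0 k (suc j) j<J) ∷ m ∷ w ∷ (Φ-nonNeg (X k j ω)) ∷ b≥0 ∷ []))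
            where
            open Increment (increment k)
            s′ = s k (suc j)
            σ = s k j
            F = Φ (X k j ω)
            E = ∑ os (λ o → p o * Φ′ k o)
            b = ι N * μ + ι 5 * (ι N * ι N) * v
            w = within
            s′≤1 : s′ ≤ 𝟙
            s′≤1 = (farkas (s′ ∷ []) (# 2 ⊗ X0 ≼ # 1 ∷ []) X0 (# 1) 1 (1 ∙1 ∷ 1 ∙ 0 ∷ []) refl ((s≤½ k (suc j) j<J) ∷ []))
            v≥0 : 𝟘 ≤ v
            v≥0 = ≤-trans (∑-nonNeg os (λ o → *-nonNeg (p≥0 o) (square-nonNeg _))) variance
            μ≥0 : 𝟘 ≤ μ
            μ≥0 = (farkas (μ ∷ []) (# 0 ⊖ X0 ≼ X0 ∷ []) (# 0) X0 1 (1 ∙ 0 ∷ []) refl ((≤-trans drift-lower drift-upper) ∷ []))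
            b≥0 : 𝟘 ≤ b
            b≥0 = (farkas (ι N ∷ μ ∷ v ∷ []) (# 0 ≼ X1 ∷ # 0 ≼ X2 ∷ # 0 ≼ X0 ∷ []) (# 0) (X0 ⊗ X1 ⊕ # 5 ⊗ (X0 ⊗ X0) ⊗ X2) 0 (1 ∙ 0 · 2 ∷ 5 ∙ 1 · 2 · 2 ∷ []) refl (μ≥0 ∷ v≥0 ∷ (0≤ι N) ∷ []))
            m : E ≤ F * (𝟙 + b)
            m = ≤-trans (≤-reflexive (∑-cong os (λ o → cong (λ z → p o * Φ z) (ring (X k (suc j) (next o) ∷ X k j ω ∷ []) X0 (X1 ⊕ (X0 ⊖ X1)) refl))))
              (moment (X k j ω) os p (λ o → X k (suc j) (next o) - X k j ω) p≥0 sum-p d≥0 d≤1 small lower upper drift-lower drift-upper variance)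
          expectation : ∑ os (λ o → p o * Ψ (suc j) (next o)) ≤ ι (length ks)
          expectation = ≤-trans (≤-reflexive (trans (∑-cong os (λ o → sym (∑-*ˡ ks (p o) _))) (trans (∑-swap os ks _)
              (∑-cong ks (λ k → trans (∑-cong os (λ o → (ring (p o ∷ s k (suc j) ∷ Φ′ k o ∷ []) (X0 ⊗ ((# 1 ⊖ X1) ⊗ X2)) ((# 1 ⊖ X1) ⊗ (X0 ⊗ X2)) refl))) (∑-*ˡ os _ _))))))
            (≤-trans (∑-mono ks each) ψ)
          select : (∃ λ o → o ∈ os × Ψ (suc j) (next o) ≤ ι (length ks)) → _
          select (o , m , ψ′) = next o , invariant m , ψ′

        run : ∀ j → j ℕ.≤ J → ∃ λ ω → I j ω × Ψ j ω ≤ ι (length ks)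
        run zero _ = ω₀ , I₀ , ≤-trans (∑-mono ks {g = λ _ → 𝟙} start) (≤-reflexive (trans (∑-const ks 𝟙) (*-identityʳ (ι (length ks)))))
          where
          start : ∀ k → (𝟙 - s k 0) * Φ (X k 0 ω₀) ≤ 𝟙
          start k = ≤-trans (≤-reflexive (cong (λ z → (𝟙 - s k 0) * z) (trans (cong Φ (X₀ k)) (trans (cong (_^ N) (ring [] (# 1 ⊕ # 0 ⊗ # 0) (# 1) refl)) (one N)))))
            (farkas (s k 0 ∷ []) (# 0 ≼ X0 ∷ []) ((# 1 ⊖ X0) ⊗ # 1) (# 1) 0 (1 ∙ 0 ∷ []) refl ((s≥0 k 0 ℕ.z≤n) ∷ []))
            where
            one : ∀ k → 𝟙 ^ k ≡ 𝟙
            one zero = refl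
            one (suc k) = trans (*-identityˡ _) (one k)
        run (suc j) j<J = advance (run j (ℕP.<⇒≤ j<J))
          where
          advance : (∃ λ ω → I j ω × Ψ j ω ≤ ι (length ks)) → ∃ λ ω → I (suc j) ω × Ψ (suc j) ω ≤ ι (length ks)
          advance (ω , i , ψ) = choose j j<J ω ψ (step j j<J ω i (bounded j (ℕP.<⇒≤ j<J) ω ψ))

      -- The round at time j may presuppose that all quantities are still within R. The potential
      -- guarantees this before every choice, so no stopping time is needed although the
      -- probabilities of the process make sense only near its expected course.
      tracking : ∃ λ ω → I J ω × (∀ k → X k J ω * X k J ω ≤ R * R)
      tracking = finish (run J ℕP.≤-refl)
        where
        finish : (∃ λ ω → I J ω × Ψ J ω ≤ ι (length ks)) → _
        finish (ω , i , ψ) = ω , i , bounded J ℕP.≤-refl ω ψ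

  -- The nibble in a weighted hypergraph

  ∑²-bound : ∀ {A : Set} {xs : List A} {g : A → A → 𝔽} {b} → Unique xs → 𝟘 ≤ b → (∀ {u v} → u ≢ v → g u v ≤ b) → ∑² xs g ≤ ι (length xs) * ι (length xs) * b
  ∑²-bound {b = b} [] b≥0 h = (farkas (b ∷ []) ([]) (# 0) (# 0 ⊗ # 0 ⊗ X0) 0 ([]) refl ([]))
  ∑²-bound {xs = x ∷ xs} {g} {b} (p ∷ un) b≥0 h = subst (λ z → ∑ xs (g x) + ∑² xs g ≤ z * z * b) (sym (ι-suc (length xs)))
    (farkas (∑ xs (g x) ∷ ∑² xs g ∷ ι (length xs) ∷ b ∷ []) (X0 ≼ X2 ⊗ X3 ∷ X1 ≼ X2 ⊗ X2 ⊗ X3 ∷ # 0 ≼ X3 ∷ # 0 ≼ X2 ∷ []) (X0 ⊕ X1) ((# 1 ⊕ X2) ⊗ (# 1 ⊕ X2) ⊗ X3) 0 (1 ∙ 0 ∷ 1 ∙ 1 ∷ 1 ∙ 2 ∷ 1 ∙ 2 · 3 ∷ []) refl (row ∷ (∑²-bound un b≥0 h) ∷ b≥0 ∷ (0≤ι (length xs)) ∷ []))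
    where
    row : ∑ xs (g x) ≤ ι (length xs) * b
    row = ≤-trans (∑-mono∈ xs (λ y m → h (All.lookup p m))) (≤-reflexive (∑-const xs b))

  ∑²-cong : ∀ (xs : List A) {f g : A → A → 𝔽} → (∀ u v → f u v ≡ g u v) → ∑² xs f ≡ ∑² xs g
  ∑²-cong [] h = refl
  ∑²-cong (x ∷ xs) h = cong₂ _+_ (∑-cong xs (h x)) (∑²-cong xs h)

  ∑²-swap : ∀ (xs : List A) (os : List B) (g : B → A → A → 𝔽) → ∑ os (λ o → ∑² xs (g o)) ≡ ∑² xs (λ u v → ∑ os (λ o → g o u v))
  ∑²-swap [] os g = ∑-0 os
  ∑²-swap (x ∷ xs) os g = trans (∑-+ os _ _) (cong₂ _+_ (∑-swap os xs _) (∑²-swap xs os g))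

  -- States of the process and the expected change in one step

  module Hypergraph {V E : Set} (EV : Enum V) (es : List E) (verts : E → List V) (w : E → 𝔽) where
    open Enum EV hiding (elems)
    open Counting EV public

    record State : Set where
      constructor state
      field
        alive killed : V → 𝔽
        chosen : List E
    open State public

    covered : List E → V → 𝔽
    covered M v = ∑ M (λ e → count v (verts e))

    -- The equation `balance` has nonnegative terms. It bounds every covering number by 1, so the
    -- chosen edges form a matching, and it expresses the uncovered vertices as the living ones plus
    -- the killed ones.
    record Valid (ω : State) : Set where
      field
        alive-01 : ∀ v → alive ω v ≡ 𝟘 ⊎ alive ω v ≡ 𝟙
        killed≥0 : ∀ v → 𝟘 ≤ killed ω v
        chosen⊆ : All (_∈ es) (chosen ω)
        balance : ∀ v → alive ω v + killed ω v + covered (chosen ω) v ≡ 𝟙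

    Option : Set
    Option = E ⊎ (V ⊎ ⊤)

    options : List Option
    options = map inj₁ es ++ (map (inj₂ ∘ inj₁) (elems EV) ++ inj₂ (inj₂ tt) ∷ [])

    ∑-options : ∀ f → ∑ options f ≡ ∑ es (f ∘ inj₁) + (∑ (elems EV) (f ∘ inj₂ ∘ inj₁) + f (inj₂ (inj₂ tt)))
    ∑-options f = trans (∑-++ (map inj₁ es) _ f) (cong₂ _+_ (∑-map inj₁ es f)
      (trans (∑-++ (map (inj₂ ∘ inj₁) (elems EV)) _ f) (cong₂ _+_ (∑-map (inj₂ ∘ inj₁) (elems EV) f) (ring (f (inj₂ (inj₂ tt)) ∷ []) (X0 ⊕ # 0) X0 refl))))

    when : {P C : Set} → Dec P → List C → List C
    when (yes _) xs = xs
    when (no _) xs = []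

    all-alive? : ∀ ω xs → Dec (All (λ v → 𝟙 ≤ alive ω v) xs)
    all-alive? ω xs = All.all? (λ v → 𝟙 ≤? alive ω v) xs

    -- An edge with a dead vertex may still be drawn; it then has no effect. The probability of an
    -- edge can thus be proportional to its weight whatever the state is.
    hit : State → Option → List V
    hit ω (inj₁ e) = when (all-alive? ω (verts e)) (verts e)
    hit ω (inj₂ (inj₁ v)) = when (all-alive? ω (v ∷ [])) (v ∷ [])
    hit ω (inj₂ (inj₂ tt)) = []

    kills : State → Option → V → 𝔽
    kills ω (inj₂ (inj₁ v)) u = count u (hit ω (inj₂ (inj₁ v)))
    kills ω _ u = 𝟘

    takes : State → Option → List E
    takes ω (inj₁ e) = when (all-alive? ω (verts e)) (e ∷ [])
    takes ω _ = []

    next : State → Option → State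
    next ω o = state (λ v → alive ω v * (𝟙 - count v (hit ω o))) (λ v → killed ω v + kills ω o v) (takes ω o ++ chosen ω)

    -- The common shape of the weighted degrees, with r = 3, and of the test sums, with r = 1. The
    -- field `len` is multiplied by the weight because sets of weight 0 may have another size. The
    -- field `spread` limits what the death of one vertex can destroy.
    record Family (θ : 𝔽) : Set₁ where
      field
        {Ix} : Set
        ix : List Ix
        a : Ix → 𝔽
        vs : Ix → List V
        r : ℕ
        a≥0 : ∀ i → 𝟘 ≤ a i
        r≤3 : r ℕ.≤ 3
        len : ∀ i → a i * ι (length (vs i)) ≡ a i * ι r
        len≤4 : ∀ i → length (vs i) ℕ.≤ 4
        unique : ∀ i → Unique (vs i)
        spread : ∀ v → ∑ ix (λ i → a i * count v (vs i)) ≤ θ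

      value : State → 𝔽
      value ω = ∑ ix (λ i → a i * ∏ (vs i) (alive ω))

    -- The vertex v itself is left out of the product. The degree is therefore meaningful for dead
    -- vertices too and follows the same curve, and the tracking needs no conditioning on survival.
    degree : State → V → 𝔽
    degree ω v = ∑ es (λ e → w e * count v (verts e) * ∏ (rest v (verts e)) (alive ω))

    module _ (verts-unique : ∀ e → Unique (verts e)) (verts-4 : ∀ e → length (verts e) ≡ 4) {ω : State} (valid : Valid ω) where
      open Valid valid

      alive≥0 : ∀ v → 𝟘 ≤ alive ω v
      alive≥0 v with alive-01 v
      ... | inj₁ e = ≥-reflexive e
      ... | inj₂ e = subst (𝟘 ≤_) (sym e) 0≤1

      alive≤1 : ∀ v → alive ω v ≤ 𝟙
      alive≤1 v with alive-01 v
      ... | inj₁ e = subst (_≤ 𝟙) (sym e) 0≤1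
      ... | inj₂ e = ≤-reflexive e

      alive-idem : ∀ v → alive ω v * alive ω v ≡ alive ω v
      alive-idem v with alive-01 v
      ... | inj₁ e = subst (λ z → z * z ≡ z) (sym e) (ring [] (# 0 ⊗ # 0) (# 0) refl)
      ... | inj₂ e = subst (λ z → z * z ≡ z) (sym e) (ring [] (# 1 ⊗ # 1) (# 1) refl)

      all-alive-∏ : ∀ xs → 𝟏 (all-alive? ω xs) ≡ ∏ xs (alive ω)
      all-alive-∏ xs = by (all-alive? ω xs)
        where
        zero-or-all : ∀ xs → ∏ xs (alive ω) ≡ 𝟘 ⊎ All (λ v → 𝟙 ≤ alive ω v) xs
        zero-or-all [] = inj₂ []
        zero-or-all (x ∷ xs) with alive-01 x | zero-or-all xs
        ... | inj₁ e | _ = inj₁ (trans (cong (_* ∏ xs (alive ω)) e) (*-zeroˡ (∏ xs (alive ω))))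
        ... | inj₂ e | inj₁ z = inj₁ (trans (cong (alive ω x *_) z) (*-zeroʳ (alive ω x)))
        ... | inj₂ e | inj₂ h = inj₂ (≥-reflexive e ∷ h)
        by : (d : Dec (All (λ v → 𝟙 ≤ alive ω v) xs)) → 𝟏 d ≡ ∏ xs (alive ω)
        by (yes h) = sym (∏-one xs (alive ω) (λ x m → ≤-antisym (alive≤1 x) (All.lookup h m)))
        by (no h) = no-case (zero-or-all xs)
          where
          no-case : ∏ xs (alive ω) ≡ 𝟘 ⊎ All (λ v → 𝟙 ≤ alive ω v) xs → 𝟘 ≡ ∏ xs (alive ω)
          no-case (inj₁ z) = sym z
          no-case (inj₂ h′) = ⊥-elim (h h′)

      count-when : ∀ {P : Set} (d : Dec P) v xs → count v (when d xs) ≡ 𝟏 d * count v xs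
      count-when (yes _) v xs = sym (*-identityˡ _)
      count-when (no _) v xs = (sym (*-zeroˡ (count v xs)))

      when-unique : ∀ {P : Set} (d : Dec P) {xs : List V} → Unique xs → Unique (when d xs)
      when-unique (yes _) u = u
      when-unique (no _) u = []

      hit-unique : ∀ o → Unique (hit ω o)
      hit-unique (inj₁ e) = when-unique (all-alive? ω (verts e)) (verts-unique e)
      hit-unique (inj₂ (inj₁ v)) = when-unique (all-alive? ω (v ∷ [])) ([] ∷ [])
      hit-unique (inj₂ (inj₂ tt)) = []

      hit-≤4 : ∀ o → ι (length (hit ω o)) ≤ ι 4
      hit-≤4 (inj₁ e) = by (all-alive? ω (verts e))
        where
        by : ∀ {P : Set} (d : Dec P) → ι (length (when d (verts e))) ≤ ι 4
        by (yes _) = ≤-reflexive (cong ι (verts-4 e))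
        by (no _) = 0≤ι 4
      hit-≤4 (inj₂ (inj₁ v)) = by (all-alive? ω (v ∷ []))
        where
        by : ∀ {P : Set} (d : Dec P) → ι (length (when d (v ∷ []))) ≤ ι 4
        by (yes _) = (farkas [] ([]) (# 1) (# 4) 0 (3 ∙1 ∷ []) refl ([]))
        by (no _) = 0≤ι 4
      hit-≤4 (inj₂ (inj₂ tt)) = 0≤ι 4

      hit-alive : ∀ o u → u ∈ hit ω o → alive ω u ≡ 𝟙
      hit-alive o u m = ≤-antisym (alive≤1 u) (by o m)
        where
        when-alive : ∀ {xs} (d : Dec (All (λ v → 𝟙 ≤ alive ω v) xs)) → u ∈ when d xs → 𝟙 ≤ alive ω u
        when-alive (yes h) m = All.lookup h m
        by : ∀ o → u ∈ hit ω o → 𝟙 ≤ alive ω u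
        by (inj₁ e) m = when-alive (all-alive? ω (verts e)) m
        by (inj₂ (inj₁ v)) m = when-alive (all-alive? ω (v ∷ [])) m

      x : Option → V → 𝔽
      x o v = count v (hit ω o)

      x≥0 : ∀ o v → 𝟘 ≤ x o v
      x≥0 o v = count-nonNeg v (hit ω o)

      x≤1 : ∀ o v → x o v ≤ 𝟙
      x≤1 o v = count-≤1 v (hit-unique o)

      x-alive : ∀ o v → x o v * alive ω v ≡ x o v
      x-alive o v = count-* v (hit ω o) (alive ω) (hit-alive o)

      next-valid : ∀ {o} → o ∈ options → Valid (next ω o)
      next-valid {o} o∈ = record { alive-01 = al ; killed≥0 = λ v → subst (_≤ killed ω v + kills ω o v) (+-identityˡ 𝟘) (+-mono-≤ (killed≥0 v) (kills≥0 o v)) ; chosen⊆ = AllP.++⁺ (takes⊆ o o∈) chosen⊆ ; balance = bal }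
        where
        al : ∀ v → alive ω v * (𝟙 - x o v) ≡ 𝟘 ⊎ alive ω v * (𝟙 - x o v) ≡ 𝟙
        al v with alive-01 v | count-unique v (hit-unique o)
        ... | inj₁ e | _ = inj₁ (trans (cong (_* (𝟙 - x o v)) e) (ring (x o v ∷ []) (# 0 ⊗ (# 1 ⊖ X0)) (# 0) refl))
        ... | inj₂ e | inj₁ h = inj₂ (trans (cong₂ (λ y z → y * (𝟙 - z)) e h) (ring [] (# 1 ⊗ (# 1 ⊖ # 0)) (# 1) refl))
        ... | inj₂ e | inj₂ h = inj₁ (trans (cong₂ (λ y z → y * (𝟙 - z)) e h) (ring [] (# 1 ⊗ (# 1 ⊖ # 1)) (# 0) refl))
        kills≥0 : ∀ o v → 𝟘 ≤ kills ω o v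
        kills≥0 (inj₁ e) v = ≤-refl
        kills≥0 (inj₂ (inj₁ u)) v = count-nonNeg v (hit ω (inj₂ (inj₁ u)))
        kills≥0 (inj₂ (inj₂ tt)) v = ≤-refl
        edge-∈ : ∀ {e} → inj₁ e ∈ options → e ∈ es
        edge-∈ m with MemP.∈-++⁻ (map inj₁ es) m
        ... | inj₁ m′ with MemP.∈-map⁻ inj₁ m′
        ...   | _ , q , refl = q
        edge-∈ m | inj₂ m′ with MemP.∈-++⁻ (map (inj₂ ∘ inj₁) (elems EV)) m′
        ... | inj₁ m″ with MemP.∈-map⁻ (inj₂ ∘ inj₁) m″
        ...   | _ , _ , ()
        edge-∈ m | inj₂ m′ | inj₂ (here ())
        takes⊆ : ∀ o → o ∈ options → All (_∈ es) (takes ω o)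
        takes⊆ (inj₁ e) m with all-alive? ω (verts e)
        ... | yes _ = edge-∈ m ∷ []
        ... | no _ = []
        takes⊆ (inj₂ (inj₁ v)) m = []
        takes⊆ (inj₂ (inj₂ tt)) m = []
        split : ∀ o v → kills ω o v + covered (takes ω o) v ≡ x o v
        split (inj₁ e) v = by (all-alive? ω (verts e))
          where
          by : ∀ {P : Set} (d : Dec P) → 𝟘 + covered (when d (e ∷ [])) v ≡ count v (when d (verts e))
          by (yes _) = (ring (count v (verts e) ∷ []) (# 0 ⊕ (X0 ⊕ # 0)) X0 refl)
          by (no _) = +-identityˡ 𝟘
        split (inj₂ (inj₁ u)) v = (ring (count v (hit ω (inj₂ (inj₁ u))) ∷ []) (X0 ⊕ # 0) X0 refl)
        split (inj₂ (inj₂ tt)) v = +-identityˡ 𝟘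
        bal : ∀ v → alive ω v * (𝟙 - x o v) + (killed ω v + kills ω o v) + covered (takes ω o ++ chosen ω) v ≡ 𝟙
        bal v = trans (cong (alive ω v * (𝟙 - x o v) + (killed ω v + kills ω o v) +_) (∑-++ (takes ω o) (chosen ω) _))
          (trans (ring (alive ω v ∷ x o v ∷ killed ω v ∷ kills ω o v ∷ covered (takes ω o) v ∷ covered (chosen ω) v ∷ []) (X0 ⊗ (# 1 ⊖ X1) ⊕ (X2 ⊕ X3) ⊕ (X4 ⊕ X5)) (X0 ⊕ X2 ⊕ X5 ⊕ (X3 ⊕ X4) ⊖ X1 ⊗ X0) refl)
          (trans (cong₂ (λ y z → y - z) (cong₂ _+_ (balance v) (split o v)) (x-alive o v)) (ring (x o v ∷ []) (# 1 ⊕ X0 ⊖ X0) (# 1) refl)))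

      module Expectation (p : Option → 𝔽) (p≥0 : ∀ o → 𝟘 ≤ p o) (sum-p : ∑ options p ≡ 𝟙) {β ζ : 𝔽} (β≥0 : 𝟘 ≤ β) (ζ≥0 : 𝟘 ≤ ζ)
        (death : ∀ v → ∑ options (λ o → p o * x o v) ≡ β * alive ω v)
        (pair : ∀ {u v} → u ≢ v → ∑ options (λ o → p o * (x o u * x o v)) ≤ ζ) where

        -- The probability that one step spares all of xs. Since every living vertex dies with the
        -- same probability β, the Bonferroni inequalities give it for living vertices up to an
        -- error of |xs|² ζ, however the deaths are correlated otherwise.
        survive : List V → 𝔽
        survive xs = ∑ options (λ o → p o * ∏ xs (λ v → 𝟙 - x o v))

        mean-hits : ∀ xs → ∑ options (λ o → p o * ∑ xs (x o)) ≡ β * ∑ xs (alive ω)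
        mean-hits xs = trans (∑-cong options (λ o → sym (∑-*ˡ xs (p o) (x o)))) (trans (∑-swap options xs _) (trans (∑-cong xs death) (∑-*ˡ xs β (alive ω))))

        survive-lower : ∀ xs → 𝟙 - β * ι (length xs) ≤ survive xs
        survive-lower xs = ≤-trans (farkas (β ∷ L ∷ ∑ xs (alive ω) ∷ []) (# 0 ≼ X0 ∷ X2 ≼ X1 ⊗ # 1 ∷ []) (# 1 ⊖ X0 ⊗ X1) (# 1 ⊖ X0 ⊗ X2) 0 (1 ∙ 0 · 1 ∷ []) refl (β≥0 ∷ (≤-trans (∑-mono xs alive≤1) (≤-reflexive (∑-const xs 𝟙))) ∷ []))
          (≤-trans (≤-reflexive (sym (trans (∑-cong options (λ o → (ring (p o ∷ ∑ xs (x o) ∷ []) (X0 ⊗ (# 1 ⊖ X1)) (X0 ⊖ X0 ⊗ X1) refl))) (trans (∑-sub options p _) (cong₂ _-_ sum-p (mean-hits xs))))))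
            (∑-mono options (λ o → (farkas (p o ∷ ∑ xs (x o) ∷ ∏ xs (λ v → 𝟙 - x o v) ∷ []) (# 0 ≼ X0 ∷ # 1 ⊖ X1 ≼ X2 ∷ []) (X0 ⊗ (# 1 ⊖ X1)) (X0 ⊗ X2) 0 (1 ∙ 0 · 1 ∷ []) refl ((p≥0 o) ∷ (bonferroni-lower (x≥0 o) (x≤1 o) xs) ∷ [])))))
          where L = ι (length xs)

        survive-upper : ∀ {xs} → Unique xs → survive xs ≤ 𝟙 - β * ∑ xs (alive ω) + ι (length xs) * ι (length xs) * ζ
        survive-upper {xs} un = ≤-trans
          (∑-mono options {g = λ o → p o - p o * ∑ xs (x o) + p o * Q o} (λ o → (farkas (p o ∷ ∏ xs (λ v → 𝟙 - x o v) ∷ ∑ xs (x o) ∷ Q o ∷ []) (# 0 ≼ X0 ∷ X1 ≼ # 1 ⊖ X2 ⊕ X3 ∷ []) (X0 ⊗ X1) (X0 ⊖ X0 ⊗ X2 ⊕ X0 ⊗ X3) 0 (1 ∙ 0 · 1 ∷ []) refl ((p≥0 o) ∷ (bonferroni-upper (x≥0 o) (x≤1 o) xs) ∷ []))))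
          (≤-trans (≤-reflexive (trans (∑-+ options _ _) (cong₂ _+_ (trans (∑-sub options p _) (cong₂ _-_ sum-p (mean-hits xs))) (trans (∑-cong options (λ o → push (p o) xs (λ u v → x o u * x o v))) (∑²-swap xs options _)))))
            (+-mono-≤ ≤-refl (∑²-bound un ζ≥0 pair)))
          where
          Q : Option → 𝔽
          Q o = ∑² xs (λ u v → x o u * x o v)
          push : ∀ b (xs : List V) g → b * ∑² xs g ≡ ∑² xs (λ u v → b * g u v)
          push b [] g = (*-zeroʳ b)
          push b (y ∷ ys) g = trans (ring (b ∷ ∑ ys (g y) ∷ ∑² ys g ∷ []) (X0 ⊗ (X1 ⊕ X2)) (X0 ⊗ X1 ⊕ X0 ⊗ X2) refl) (cong₂ _+_ (sym (∑-*ˡ ys b (g y))) (push b ys g))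

        -- Either all of xs live, and the sum is the length, or the product vanishes. Under the
        -- product the upper estimate for `survive` thus has the same first-order term as the lower
        -- one.
        ∏-alive-sum : ∀ xs → ∏ xs (alive ω) * ∑ xs (alive ω) ≡ ∏ xs (alive ω) * ι (length xs)
        ∏-alive-sum [] = refl
        ∏-alive-sum (y ∷ ys) = trans (ring (a ∷ P ∷ S ∷ []) (X0 ⊗ X1 ⊗ (X0 ⊕ X2)) (X0 ⊗ X0 ⊗ X1 ⊕ X0 ⊗ (X1 ⊗ X2)) refl) (trans (cong₂ (λ b d → b * P + a * d) (alive-idem y) (∏-alive-sum ys))
          (trans (ring (a ∷ P ∷ L ∷ []) (X0 ⊗ X1 ⊕ X0 ⊗ (X1 ⊗ X2)) (X0 ⊗ X1 ⊗ (# 1 ⊕ X2)) refl) (cong (a * P *_) (sym (ι-suc (length ys))))))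
          where
          a = alive ω y
          P = ∏ ys (alive ω)
          S = ∑ ys (alive ω)
          L = ι (length ys)

        module _ {θ : 𝔽} (F : Family θ) where
          open Family F

          private
            P : Ix → 𝔽
            P i = ∏ (vs i) (alive ω)
            P≥0 : ∀ i → 𝟘 ≤ P i
            P≥0 i = ∏-nonNeg (vs i) alive≥0
            P≤1 : ∀ i → P i ≤ 𝟙
            P≤1 i = ∏-≤1 (vs i) alive≥0 alive≤1

          value≥0 : 𝟘 ≤ value ω
          value≥0 = ∑-nonNeg ix (λ i → *-nonNeg (a≥0 i) (P≥0 i))

          next-value : ∀ o → value (next ω o) ≡ ∑ ix (λ i → a i * (P i * ∏ (vs i) (λ v → 𝟙 - x o v)))
          next-value o = ∑-cong ix (λ i → cong (a i *_) (∏-* (vs i) (alive ω) _))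

          mean-value : ∑ options (λ o → p o * value (next ω o)) ≡ ∑ ix (λ i → a i * (P i * survive (vs i)))
          mean-value = trans (∑-cong options (λ o → trans (cong (p o *_) (next-value o)) (sym (∑-*ˡ ix (p o) _)))) (trans (∑-swap options ix _)
            (∑-cong ix (λ i → trans (∑-cong options (λ o → (ring (p o ∷ a i ∷ P i ∷ ∏ (vs i) (λ v → 𝟙 - x o v) ∷ []) (X0 ⊗ (X1 ⊗ (X2 ⊗ X3))) (X1 ⊗ X2 ⊗ (X0 ⊗ X3)) refl))) (trans (∑-*ˡ options (a i * P i) _) (*-assoc _ _ _)))))

          mean-lower : value ω * (𝟙 - ι r * β) ≤ ∑ options (λ o → p o * value (next ω o))
          mean-lower = ≤-trans (≤-reflexive (sym (∑-*ʳ ix _ _))) (≤-trans (∑-mono ix (λ i →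
            (farkas (a i ∷ P i ∷ ι r ∷ β ∷ survive (vs i) ∷ ι (length (vs i)) ∷ []) (# 0 ≼ X0 ⊗ X1 ∷ # 1 ⊖ X3 ⊗ X5 ≼ X4 ∷ X1 ⊗ X3 ⊗ (X0 ⊗ X5) ≼ X1 ⊗ X3 ⊗ (X0 ⊗ X2) ∷ []) (X0 ⊗ X1 ⊗ (# 1 ⊖ X2 ⊗ X3)) (X0 ⊗ (X1 ⊗ X4)) 0 (1 ∙ 2 ∷ 1 ∙ 0 · 1 ∷ []) refl ((*-nonNeg (a≥0 i) (P≥0 i)) ∷ (survive-lower (vs i)) ∷ (≤-reflexive (cong (λ z → P i * β * z) (len i))) ∷ [])))) (≥-reflexive mean-value))

          -- The expectation contracts by 1 - rβ up to pair terms. The 16 is the square of 4, the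
          -- greatest size of the sets involved.
          mean-upper : ∑ options (λ o → p o * value (next ω o)) ≤ value ω * (𝟙 - ι r * β + ι 16 * ζ)
          mean-upper = ≤-trans (≤-reflexive mean-value) (≤-trans (∑-mono ix bound) (≤-reflexive (∑-*ʳ ix _ _)))
            where
            bound : ∀ i → a i * (P i * survive (vs i)) ≤ a i * P i * (𝟙 - ι r * β + ι 16 * ζ)
            bound i = (farkas (a i ∷ P i ∷ Y ∷ ι r ∷ β ∷ ζ ∷ S ∷ L ∷ []) (# 0 ≼ X0 ⊗ X1 ∷ X2 ≼ # 1 ⊖ X4 ⊗ X6 ⊕ X7 ⊗ X7 ⊗ X5 ∷ X0 ⊗ X4 ⊗ (X1 ⊗ X7) ≼ X0 ⊗ X4 ⊗ (X1 ⊗ X6) ∷ X1 ⊗ X4 ⊗ (X0 ⊗ X3) ≼ X1 ⊗ X4 ⊗ (X0 ⊗ X7) ∷ X7 ⊗ X7 ≼ # 16 ∷ # 0 ≼ X5 ∷ []) (X0 ⊗ (X1 ⊗ X2)) (X0 ⊗ X1 ⊗ (# 1 ⊖ X3 ⊗ X4 ⊕ # 16 ⊗ X5)) 0 (1 ∙ 2 ∷ 1 ∙ 3 ∷ 1 ∙ 0 · 1 ∷ 1 ∙ 0 · 4 · 5 ∷ []) refl ((*-nonNeg (a≥0 i) (P≥0 i)) ∷ (survive-upper (unique i)) ∷ (≥-reflexive (cong (λ z → a i * β * z) (∏-alive-sum (vs i)))) ∷ (≥-reflexive (cong (λ z → P i * β * z) (len i))) ∷ LL ∷ ζ≥0 ∷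 []))
              where
              L = ι (length (vs i))
              S = ∑ (vs i) (alive ω)
              Y = survive (vs i)
              LL : L * L ≤ ι 16
              LL = (farkas (L ∷ []) (# 0 ≼ X0 ∷ X0 ≼ # 4 ∷ []) (X0 ⊗ X0) (# 16) 0 (2 ∙ 0 · 1 ∷ 1 ∙ 1 · 1 ∷ []) refl ((0≤ι (length (vs i))) ∷ (ι-mono (len≤4 i)) ∷ []))

          loss≥0 : ∀ o → 𝟘 ≤ value ω - value (next ω o)
          loss≥0 o = (farkas (value ω ∷ value (next ω o) ∷ []) (X1 ≼ X0 ∷ []) (# 0) (X0 ⊖ X1) 0 (1 ∙ 0 ∷ []) refl ((≤-trans (≤-reflexive (next-value o)) (∑-mono ix λ i → (farkas (a i ∷ P i ∷ s i ∷ []) (# 0 ≼ X0 ⊗ X1 ∷ X2 ≼ # 1 ∷ []) (X0 ⊗ (X1 ⊗ X2)) (X0 ⊗ X1) 0 (1 ∙ 0 · 1 ∷ []) refl ((*-nonNeg (a≥0 i) (P≥0 i)) ∷ (∏-≤1 (vs i) (λ v → (complement-nonNeg (x o v) (x≤1 o v))) (λ v → (complement-≤1 (x o v) (x≥0 o v)))) ∷ [])))) ∷ []))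
            where
            s : Ix → 𝔽
            s i = ∏ (vs i) (λ v → 𝟙 - x o v)

          -- At most four vertices die in a step, and by `spread` each of them takes away at most θ.
          loss≤ : 𝟘 ≤ θ → ∀ o → value ω - value (next ω o) ≤ ι 4 * θ
          loss≤ θ≥0 o = ≤-trans (≤-reflexive (trans (cong (λ z → value ω - z) (next-value o)) (sym (∑-sub ix _ _))))
            (≤-trans (∑-mono ix (λ i → (farkas (a i ∷ P i ∷ s i ∷ ∑ (vs i) (x o) ∷ []) (# 0 ≼ X0 ∷ # 0 ≼ X1 ∷ X1 ≼ # 1 ∷ # 1 ⊖ X3 ≼ X2 ∷ # 0 ≼ X3 ∷ []) (X0 ⊗ X1 ⊖ X0 ⊗ (X1 ⊗ X2)) (X0 ⊗ X3) 0 (1 ∙ 0 · 1 · 3 ∷ 1 ∙ 0 · 2 · 4 ∷ []) refl ((a≥0 i) ∷ (P≥0 i) ∷ (P≤1 i) ∷ (bonferroni-lower (x≥0 o) (x≤1 o) (vs i)) ∷ (∑-nonNeg (vs i) (x≥0 o)) ∷ []))))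
            (≤-trans (≤-reflexive (trans (∑-cong ix (λ i → trans (cong (a i *_) (count-double (vs i) (hit ω o))) (sym (∑-*ˡ (hit ω o) (a i) _)))) (∑-swap ix (hit ω o) _)))
            (≤-trans (∑-mono (hit ω o) spread) (≤-trans (≤-reflexive (∑-const (hit ω o) θ)) (farkas (ι (length (hit ω o)) ∷ θ ∷ []) (X0 ≼ # 4 ∷ # 0 ≼ X1 ∷ []) (X0 ⊗ X1) (# 4 ⊗ X1) 0 (1 ∙ 0 · 1 ∷ []) refl ((hit-≤4 o) ∷ θ≥0 ∷ []))))))
            where
            s : Ix → 𝔽
            s i = ∏ (vs i) (λ v → 𝟙 - x o v)

  *-cancelˡ-≤ : ∀ {s a b} → 𝟙 ≤ s → s * a ≤ s * b → a ≤ b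
  *-cancelˡ-≤ {s} {a} {b} s≥1 h = (farkas (a ∷ b ∷ []) (X0 ⊖ X1 ≼ # 0 ∷ []) X0 X1 0 (1 ∙ 0 ∷ []) refl ((*-cancel-≤0 {a - b} {s} (≥1⇒≰0 s≥1) (farkas (a ∷ b ∷ s ∷ []) (X2 ⊗ X0 ≼ X2 ⊗ X1 ∷ []) ((X0 ⊖ X1) ⊗ X2) (# 0) 0 (1 ∙ 0 ∷ []) refl (h ∷ []))) ∷ []))

  square-≤ : ∀ {x y} → 𝟘 ≤ y → x * x ≤ y * y → x ≤ y
  square-≤ {x} {y} y≥0 h = ≤-by-contradiction λ q → q (farkas (x ∷ y ∷ []) (X0 ⊖ X1 ≼ # 0 ∷ []) X0 X1 0 (1 ∙ 0 ∷ []) refl ((*-cancel-≤0 {x - y} {x + y} (λ r → q (farkas (x ∷ y ∷ []) (X0 ⊕ X1 ≼ # 0 ∷ # 0 ≼ X1 ∷ []) X0 X1 0 (1 ∙ 0 ∷ 2 ∙ 1 ∷ []) refl (r ∷ y≥0 ∷ []))) (farkas (x ∷ y ∷ []) (X0 ⊗ X0 ≼ X1 ⊗ X1 ∷ []) ((X0 ⊖ X1) ⊗ (X0 ⊕ X1)) (# 0) 0 (1 ∙ 0 ∷ []) refl (h ∷ []))) ∷ []))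

  square-≥ : ∀ {x y} → 𝟘 ≤ y → x * x ≤ y * y → 𝟘 - y ≤ x
  square-≥ {x} {y} y≥0 h = (farkas (y ∷ x ∷ []) (# 0 ⊖ X1 ≼ X0 ∷ []) (# 0 ⊖ X0) X1 0 (1 ∙ 0 ∷ []) refl ((square-≤ {𝟘 - x} y≥0 (farkas (x ∷ y ∷ []) (X0 ⊗ X0 ≼ X1 ⊗ X1 ∷ []) ((# 0 ⊖ X0) ⊗ (# 0 ⊖ X0)) (X1 ⊗ X1) 0 (1 ∙ 0 ∷ []) refl (h ∷ []))) ∷ []))

  expect-affine : ∀ {O : Set} (os : List O) (p f : O → 𝔽) a b → ∑ os p ≡ 𝟙 → ∑ os (λ o → p o * (a + b * f o)) ≡ a + b * ∑ os (λ o → p o * f o)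
  expect-affine os p f a b sum-p = trans (∑-cong os (λ o → (ring (p o ∷ a ∷ b ∷ f o ∷ []) (X0 ⊗ (X1 ⊕ X2 ⊗ X3)) (X1 ⊗ X0 ⊕ X2 ⊗ (X0 ⊗ X3)) refl)))
    (trans (∑-+ os _ _) (cong₂ _+_ (trans (∑-*ˡ os a p) (trans (cong (a *_) sum-p) (*-identityʳ a))) (∑-*ˡ os b _)))

  -- The process and its deterministic curve

  module Nibbling {V E T : Set} (EV : Enum V) (ET : Enum T) (es : List E) (verts : E → List V) (w : E → 𝔽) (test : T → V → 𝔽)
    (N J : ℕ) (β θ ν lam R s₁ s₂ : 𝔽) where
    open Hypergraph EV es verts w
    open Enum EV hiding (elems)

    deg : V → 𝔽
    deg v = ∑ es (λ e → w e * count v (verts e))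

    -- Degrees deviate from 1 by at most `lam`, but downwards this is demanded only where a test has
    -- weight: other vertices may have smaller degrees and be killed more often, since their deaths
    -- are not counted as waste. The codegrees are at most θ, and `ν` bounds them in relation to the
    -- degrees shrunk by the process, which is the field `growth`.
    record Assumptions : Set where
      field
        w≥0 : ∀ e → 𝟘 ≤ w e
        verts-unique : ∀ e → Unique (verts e)
        verts-4 : ∀ e → length (verts e) ≡ 4
        deg-upper : ∀ v → deg v ≤ 𝟙 + lam
        deg-lower : ∀ τ v → test τ v * (𝟙 - lam) ≤ test τ v * deg v
        codegree : ∀ {u v} → u ≢ v → ∑ es (λ e → w e * (count u (verts e) * count v (verts e))) ≤ θ
        test≥0 : ∀ τ v → 𝟘 ≤ test τ v
        test-sum : ∀ τ → ∑ (elems EV) (test τ) ≤ 𝟙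
        test≤θ : ∀ τ v → test τ v ≤ θ
        β≥0 : 𝟘 ≤ β
        β≤⅓ : ι 3 * β ≤ 𝟙
        β≤ν : β ≤ ν
        lam≥0 : 𝟘 ≤ lam
        lam≤¼ : ι 4 * lam ≤ 𝟙
        θ≥0 : 𝟘 ≤ θ
        growth : (𝟙 + ι 3 * β) ^ J * θ ≤ ν
        room : β * ((𝟙 + ι 3 * β) ^ J * ∑ es w + ι (length (elems EV))) ≤ 𝟙
        R≥0 : 𝟘 ≤ R
        R≡ : R ≡ s₁ * lam
        s₁≥1 : 𝟙 ≤ s₁
        s₂≥1 : 𝟙 ≤ s₂
        N≥1 : 𝟙 ≤ ι N
        small₁ : ι N * (ι 2 * (s₁ * (ι 8 * ν))) ≤ 𝟙
        small₂ : ι N * (ι 2 * (s₂ * θ)) ≤ 𝟙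
        budget₁ : ι 2 * (ι J * (ι 1600 * (ι N * ι N) * (s₁ * s₁) * β * ν)) ≤ 𝟙
        budget₂ : ι 2 * (ι J * (ι 4 * β * lam * (ι N * s₂ + ι 5 * (ι N * ι N) * (s₂ * s₂ * θ)))) ≤ 𝟙
        R-large : ¬ (𝟙 + R * R) ^ N ≤ ι 2 * ι (length (elems (enum⊎ (enum⊎ EV ET) ET)))

    module _ (asm : Assumptions) where
      open Assumptions asm

      private
        κ = 𝟙 - ι 2 * lam
        ρ : ℕ → 𝔽
        ρ j = (𝟙 + ι 3 * β) ^ j

        κ≥0 : 𝟘 ≤ κ
        κ≥0 = (farkas (lam ∷ []) (# 4 ⊗ X0 ≼ # 1 ∷ []) (# 0) (# 1 ⊖ # 2 ⊗ X0) 1 (1 ∙1 ∷ 1 ∙ 0 ∷ []) refl (lam≤¼ ∷ []))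
        κ≤1 : κ ≤ 𝟙
        κ≤1 = (farkas (lam ∷ []) (# 0 ≼ X0 ∷ []) (# 1 ⊖ # 2 ⊗ X0) (# 1) 0 (2 ∙ 0 ∷ []) refl (lam≥0 ∷ []))
        ν≥0 : 𝟘 ≤ ν
        ν≥0 = ≤-trans β≥0 β≤ν

        1+3β≥1 : 𝟙 ≤ 𝟙 + ι 3 * β
        1+3β≥1 = (farkas (β ∷ []) (# 0 ≼ X0 ∷ []) (# 1) (# 1 ⊕ # 3 ⊗ X0) 0 (3 ∙ 0 ∷ []) refl (β≥0 ∷ []))
        ρ≥1 : ∀ j → 𝟙 ≤ ρ j
        ρ≥1 j = ^-≥1 1+3β≥1 j
        ρ-mono : ∀ {j} → j ℕ.≤ J → ρ j ≤ ρ J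
        ρ-mono {j} j≤J = subst (ρ j ≤_) (trans (sym (^-+ _ j (J ℕ.∸ j))) (cong ρ (ℕP.m+[n∸m]≡n j≤J)))
          (farkas (ρ j ∷ (𝟙 + ι 3 * β) ^ (J ℕ.∸ j) ∷ []) (# 1 ≼ X0 ∷ # 1 ≼ X1 ∷ []) X0 (X0 ⊗ X1) 0 (1 ∙ 1 ∷ 1 ∙ 0 · 1 ∷ []) refl ((ρ≥1 j) ∷ (^-≥1 1+3β≥1 (J ℕ.∸ j)) ∷ []))

        -- A living v is taken by some edge with probability β κ r D, where D is its degree; the
        -- killing probability tops this up to exactly β. The factor κ = 1 - 2 lam keeps the
        -- supplement nonnegative, since r D is at most 1 + 2 lam and (1 - 2 lam)(1 + 2 lam) ≤ 1.
        prob : 𝔽 → State → Option → 𝔽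
        prob r ω (inj₁ e) = β * κ * r * w e
        prob r ω (inj₂ (inj₁ v)) = β * (𝟙 - κ * r * degree ω v)
        prob r ω (inj₂ (inj₂ tt)) = 𝟙 - (∑ es (λ e → β * κ * r * w e) + ∑ (elems EV) (λ v → β * (𝟙 - κ * r * degree ω v)))

        prob-sum : ∀ r ω → ∑ options (prob r ω) ≡ 𝟙
        prob-sum r ω = trans (∑-options (prob r ω)) (ring (a ∷ b ∷ []) (X0 ⊕ (X1 ⊕ (# 1 ⊖ (X0 ⊕ X1)))) (# 1) refl)
          where
          a = ∑ es (λ e → β * κ * r * w e)
          b = ∑ (elems EV) (λ v → β * (𝟙 - κ * r * degree ω v))

        degF : V → Family θ
        degF v = record
          { ix = es ; a = λ e → w e * count v (verts e) ; vs = λ e → rest v (verts e) ; r = 3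
          ; a≥0 = λ e → *-nonNeg (w≥0 e) (count-nonNeg v (verts e))
          ; r≤3 = ℕP.≤-refl
          -- If v lies on e, three of its four vertices remain; otherwise the weight is 0. The
          -- idempotence of `count` covers both cases at once.
          ; len = λ e → trans (cong (w e * count v (verts e) *_) (trans (rest-length v (verts e)) (cong (λ l → ι l - count v (verts e)) (verts-4 e))))
              (trans (ring (w e ∷ k e ∷ []) (X0 ⊗ X1 ⊗ (# 4 ⊖ X1)) (X0 ⊗ (# 4 ⊗ X1 ⊖ X1 ⊗ X1)) refl) (trans (cong (λ z → w e * (ι 4 * k e - z)) (count-idem v (verts-unique e))) (ring (w e ∷ k e ∷ []) (X0 ⊗ (# 4 ⊗ X1 ⊖ X1)) (X0 ⊗ X1 ⊗ # 3) refl)))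
          ; len≤4 = λ e → ℕP.≤-trans (rest-≤ v (verts e)) (ℕP.≤-reflexive (verts-4 e))
          ; unique = λ e → rest-unique v (verts-unique e)
          ; spread = spread }
          where
          k : E → 𝔽
          k e = count v (verts e)
          spread : ∀ u → ∑ es (λ e → w e * k e * count u (rest v (verts e))) ≤ θ
          spread u with u ≟ v
          ... | yes refl = subst (_≤ θ) (sym (trans (∑-cong es (λ e → trans (cong (w e * k e *_) (count-rest-self v (verts e))) (ring (w e ∷ k e ∷ []) (X0 ⊗ X1 ⊗ # 0) (# 0) refl))) (∑-0 es))) θ≥0
          ... | no u≢v = ≤-trans (∑-mono es (λ e → (farkas (w e ∷ k e ∷ count u (rest v (verts e)) ∷ count u (verts e) ∷ []) (# 0 ≼ X0 ⊗ X1 ∷ X2 ≼ X3 ∷ []) (X0 ⊗ X1 ⊗ X2) (X0 ⊗ (X3 ⊗ X1)) 0 (1 ∙ 0 · 1 ∷ []) refl ((*-nonNeg (w≥0 e) (count-nonNeg v (verts e))) ∷ (count-rest-≤ u v (verts e)) ∷ [])))) (codegree u≢v)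

        testF : T → Family θ
        testF τ = record
          { ix = elems EV ; a = test τ ; vs = λ v → v ∷ [] ; r = 1 ; a≥0 = test≥0 τ ; r≤3 = ℕ.s≤s ℕ.z≤n ; len = λ v → refl ; len≤4 = λ v → ℕ.s≤s ℕ.z≤n
          ; unique = λ v → [] ∷ []
          ; spread = λ u → subst (_≤ θ) (sym (trans (∑-cong (elems EV) (λ v → (ring (test τ v ∷ 𝟏 (v ≟ u) ∷ []) (X0 ⊗ (X1 ⊕ # 0)) (X1 ⊗ X0) refl))) (pick (test τ) u))) (test≤θ τ u) }

        family : V ⊎ T → Family θ
        family (inj₁ v) = degF v
        family (inj₂ τ) = testF τ

        ω₀ : State
        ω₀ = state (λ _ → 𝟙) (λ _ → 𝟘) []

        ω₀-valid : Valid ω₀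
        ω₀-valid = record { alive-01 = λ _ → inj₂ refl ; killed≥0 = λ _ → ≤-refl ; chosen⊆ = [] ; balance = λ _ → (ring [] (# 1 ⊕ # 0 ⊕ # 0) (# 1) refl) }

        initial : V ⊎ T → 𝔽
        initial k = Family.value (family k) ω₀

        initial-deg : ∀ v → initial (inj₁ v) ≡ deg v
        initial-deg v = ∑-cong es (λ e → trans (cong (w e * count v (verts e) *_) (∏-one (rest v (verts e)) _ (λ _ _ → refl))) (ring (w e ∷ count v (verts e) ∷ []) (X0 ⊗ X1 ⊗ # 1) (X0 ⊗ X1) refl))

        initial≤ : ∀ k → initial k ≤ 𝟙 + lam
        initial≤ (inj₁ v) = subst (_≤ 𝟙 + lam) (sym (initial-deg v)) (deg-upper v)
        initial≤ (inj₂ τ) = ≤-trans (≤-reflexive (∑-cong (elems EV) (λ v → (ring (test τ v ∷ []) (X0 ⊗ (# 1 ⊗ # 1)) X0 refl)))) (farkas (∑ (elems EV) (test τ) ∷ lam ∷ []) (X0 ≼ # 1 ∷ # 0 ≼ X1 ∷ []) X0 (# 1 ⊕ X1) 0 (1 ∙ 0 ∷ 1 ∙ 1 ∷ []) refl ((test-sum τ) ∷ lam≥0 ∷ []))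

        waste : T → State → 𝔽
        waste τ ω = ∑ (elems EV) (λ v → test τ v * killed ω v)

        K : Set
        K = (V ⊎ T) ⊎ T

        -- The factor (1 + rβ)^j undoes the expected decay by 1 - rβ per step up to second order, so
        -- hardly any drift is left. The magnifications s₁ and s₂ translate the common threshold R
        -- into an error of `lam` for the families and of R / s₂ for the waste.
        X : K → ℕ → State → 𝔽
        X (inj₁ k) j ω = s₁ * ((𝟙 + ι (Family.r (family k)) * β) ^ j * Family.value (family k) ω - initial k)
        X (inj₂ τ) j ω = s₂ * waste τ ω

        -- The growth of the potential granted to each step. Its J-fold is kept below one half by
        -- `budget₁` and `budget₂`.
        η : K → 𝔽
        η (inj₁ _) = ι 1600 * (ι N * ι N) * (s₁ * s₁) * β * ν
        η (inj₂ _) = ι 4 * β * lam * (ι N * s₂ + ι 5 * (ι N * ι N) * (s₂ * s₂ * θ))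

        open Potential N

        module Turn {j} (j<J : j ℕ.< J) {ω} (valid : Valid ω) (tracked : ∀ k → X k j ω * X k j ω ≤ R * R) where
          hx : Option → V → 𝔽
          hx = x verts-unique verts-4 valid

          tracked-upper : ∀ k → (𝟙 + ι (Family.r (family k)) * β) ^ j * Family.value (family k) ω ≤ initial k + lam
          tracked-upper k = (farkas (y ∷ initial k ∷ lam ∷ []) (X0 ⊖ X1 ≼ X2 ∷ []) X0 (X1 ⊕ X2) 0 (1 ∙ 0 ∷ []) refl ((*-cancelˡ-≤ s₁≥1 (subst (s₁ * (y - initial k) ≤_) R≡ (square-≤ R≥0 (tracked (inj₁ k))))) ∷ []))
            where y = (𝟙 + ι (Family.r (family k)) * β) ^ j * Family.value (family k) ω

          tracked-lower : ∀ k → initial k - lam ≤ (𝟙 + ι (Family.r (family k)) * β) ^ j * Family.value (family k) ω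
          tracked-lower k = (farkas (initial k ∷ lam ∷ y ∷ []) (# 0 ⊖ X1 ≼ X2 ⊖ X0 ∷ []) (X0 ⊖ X1) X2 0 (1 ∙ 0 ∷ []) refl ((*-cancelˡ-≤ s₁≥1 (farkas (s₁ ∷ lam ∷ y ∷ initial k ∷ R ∷ []) (# 0 ⊖ X4 ≼ X0 ⊗ (X2 ⊖ X3) ∷ X4 ≼ X0 ⊗ X1 ∷ []) (X0 ⊗ (# 0 ⊖ X1)) (X0 ⊗ (X2 ⊖ X3)) 0 (1 ∙ 0 ∷ 1 ∙ 1 ∷ []) refl ((square-≥ R≥0 (tracked (inj₁ k))) ∷ (≤-reflexive (R≡)) ∷ []))) ∷ []))
            where y = (𝟙 + ι (Family.r (family k)) * β) ^ j * Family.value (family k) ω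

          ρD≤ : ∀ v → ρ j * degree ω v ≤ 𝟙 + ι 2 * lam
          ρD≤ v = (farkas (y ∷ lam ∷ initial (inj₁ v) ∷ []) (X0 ≼ X2 ⊕ X1 ∷ X2 ≼ # 1 ⊕ X1 ∷ []) X0 (# 1 ⊕ # 2 ⊗ X1) 0 (1 ∙ 0 ∷ 1 ∙ 1 ∷ []) refl ((tracked-upper (inj₁ v)) ∷ (initial≤ (inj₁ v)) ∷ []))
            where y = ρ j * degree ω v

          D≥0 : ∀ v → 𝟘 ≤ degree ω v
          D≥0 v = ∑-nonNeg es (λ e → *-nonNeg (*-nonNeg (w≥0 e) (count-nonNeg v (verts e))) (∏-nonNeg (rest v (verts e)) (alive≥0 verts-unique verts-4 valid)))

          kill≥0 : ∀ v → 𝟘 ≤ 𝟙 - κ * ρ j * degree ω v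
          kill≥0 v = (farkas (lam ∷ ρ j ∷ degree ω v ∷ []) (X1 ⊗ X2 ≼ # 1 ⊕ # 2 ⊗ X0 ∷ # 0 ≼ # 1 ⊖ # 2 ⊗ X0 ∷ # 0 ≼ X0 ⊗ X0 ∷ []) (# 0) (# 1 ⊖ (# 1 ⊖ # 2 ⊗ X0) ⊗ X1 ⊗ X2) 0 (4 ∙ 2 ∷ 1 ∙ 0 · 1 ∷ []) refl ((ρD≤ v) ∷ κ≥0 ∷ (square-nonNeg lam) ∷ []))

          -- Where the test has weight, the rescaled degree is at least 1 - 2 lam: one `lam` for the
          -- initial degree and one for the tracking error. The supplement is then at most 1 - (1 -
          -- 2 lam)², which is below 4 lam.
          kill-test : ∀ τ v → test τ v * (𝟙 - κ * ρ j * degree ω v) ≤ test τ v * (ι 4 * lam)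
          kill-test τ v = (farkas (t ∷ lam ∷ ρ j ∷ degree ω v ∷ deg v ∷ []) (# 0 ≼ X0 ∷ X4 ⊖ X1 ≼ X2 ⊗ X3 ∷ X0 ⊗ (# 1 ⊖ X1) ≼ X0 ⊗ X4 ∷ # 0 ≼ # 1 ⊖ # 2 ⊗ X1 ∷ # 0 ≼ X1 ⊗ X1 ∷ []) (X0 ⊗ (# 1 ⊖ (# 1 ⊖ # 2 ⊗ X1) ⊗ X2 ⊗ X3)) (X0 ⊗ (# 4 ⊗ X1)) 0 (1 ∙ 0 · 1 · 3 ∷ 1 ∙ 2 · 3 ∷ 4 ∙ 0 · 4 ∷ []) refl ((test≥0 τ v) ∷ (subst (λ z → z - lam ≤ ρ j * degree ω v) (initial-deg v) (tracked-lower (inj₁ v))) ∷ (deg-lower τ v) ∷ κ≥0 ∷ (square-nonNeg lam) ∷ []))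
            where t = test τ v

          p : Option → 𝔽
          p = prob (ρ j) ω

          W≥0 : 𝟘 ≤ ∑ es w
          W≥0 = ∑-nonNeg es w≥0

          ρ≥0 : 𝟘 ≤ ρ j
          ρ≥0 = ≤-trans 0≤1 (ρ≥1 j)

          p≥0 : ∀ o → 𝟘 ≤ p o
          p≥0 (inj₁ e) = *-nonNeg (*-nonNeg (*-nonNeg β≥0 κ≥0) ρ≥0) (w≥0 e)
          p≥0 (inj₂ (inj₁ v)) = *-nonNeg β≥0 (kill≥0 v)
          -- Idling takes the remaining probability. It is nonnegative by `room`, which bounds the
          -- total probability of all edges and all vertices.
          p≥0 (inj₂ (inj₂ tt)) = (farkas (a ∷ b ∷ β ∷ ρ J ∷ W ∷ L ∷ []) (X0 ≼ X2 ⊗ X3 ⊗ X4 ∷ X1 ≼ X2 ⊗ X5 ∷ X2 ⊗ (X3 ⊗ X4 ⊕ X5) ≼ # 1 ∷ []) (# 0) (# 1 ⊖ (X0 ⊕ X1)) 0 (1 ∙ 0 ∷ 1 ∙ 1 ∷ 1 ∙ 2 ∷ []) refl (edges ∷ vertices ∷ room ∷ []))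
            where
            W = ∑ es w
            L = ι (length (elems EV))
            a = ∑ es (λ e → β * κ * ρ j * w e)
            b = ∑ (elems EV) (λ v → β * (𝟙 - κ * ρ j * degree ω v))
            edges : a ≤ β * ρ J * W
            edges = ≤-trans (≤-reflexive (∑-*ˡ es _ w)) (farkas (β ∷ κ ∷ ρ j ∷ W ∷ ρ J ∷ []) (# 0 ≼ X0 ⊗ X3 ∷ X1 ≼ # 1 ∷ X2 ≼ X4 ∷ # 0 ≼ X2 ∷ []) (X0 ⊗ X1 ⊗ X2 ⊗ X3) (X0 ⊗ X4 ⊗ X3) 0 (1 ∙ 0 · 2 ∷ 1 ∙ 0 · 1 · 3 ∷ []) refl ((*-nonNeg β≥0 W≥0) ∷ κ≤1 ∷ (ρ-mono (ℕP.<⇒≤ j<J)) ∷ ρ≥0 ∷ []))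
            vertices : b ≤ β * L
            vertices = ≤-trans (∑-mono (elems EV) {g = λ _ → β} (λ v → (farkas (β ∷ κ ∷ ρ j ∷ degree ω v ∷ []) (# 0 ≼ X0 ⊗ X1 ⊗ X2 ⊗ X3 ∷ []) (X0 ⊗ (# 1 ⊖ X1 ⊗ X2 ⊗ X3)) X0 0 (1 ∙ 0 ∷ []) refl ((*-nonNeg (*-nonNeg (*-nonNeg β≥0 κ≥0) ρ≥0) (D≥0 v)) ∷ [])))) (≤-reflexive (trans (∑-const (elems EV) β) (*-comm L β)))

          hit-edge : ∀ e v → hx (inj₁ e) v ≡ ∏ (verts e) (alive ω) * count v (verts e)
          hit-edge e v = trans (count-when verts-unique verts-4 valid (all-alive? ω (verts e)) v (verts e)) (cong (_* count v (verts e)) (all-alive-∏ verts-unique verts-4 valid (verts e)))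

          hit-kill : ∀ u v → hx (inj₂ (inj₁ u)) v ≡ 𝟏 (u ≟ v) * alive ω u
          hit-kill u v = trans (count-when verts-unique verts-4 valid (all-alive? ω (u ∷ [])) v (u ∷ [])) (trans (cong (_* count v (u ∷ [])) (all-alive-∏ verts-unique verts-4 valid (u ∷ []))) (ring (alive ω u ∷ 𝟏 (u ≟ v) ∷ []) (X0 ⊗ # 1 ⊗ (X1 ⊕ # 0)) (X1 ⊗ X0) refl))

          death : ∀ v → ∑ options (λ o → p o * hx o v) ≡ β * alive ω v
          death v = trans (∑-options _) (trans (cong₂ _+_
            (trans (∑-cong es edge) (∑-*ˡ es _ _))
            (cong (_+ p (inj₂ (inj₂ tt)) * 𝟘) (trans (∑-cong (elems EV) (λ u → trans (cong (p (inj₂ (inj₁ u)) *_) (hit-kill u v)) (*-exchange (P u) (𝟏 (u ≟ v)) (alive ω u)))) (pick (λ u → P u * alive ω u) v))))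
            (ring (β ∷ κ ∷ ρ j ∷ alive ω v ∷ degree ω v ∷ p (inj₂ (inj₂ tt)) ∷ []) (X0 ⊗ X1 ⊗ X2 ⊗ X3 ⊗ X4 ⊕ (X0 ⊗ (# 1 ⊖ X1 ⊗ X2 ⊗ X4) ⊗ X3 ⊕ X5 ⊗ # 0)) (X0 ⊗ X3) refl))
            where
            P : V → 𝔽
            P u = p (inj₂ (inj₁ u))
            edge : ∀ e → p (inj₁ e) * hx (inj₁ e) v ≡ β * κ * ρ j * alive ω v * (w e * count v (verts e) * ∏ (rest v (verts e)) (alive ω))
            edge e = trans (cong (p (inj₁ e) *_) (trans (hit-edge e v) (trans (*-comm _ _) (∏-rest v (alive ω) (verts-unique e)))))
              (ring (β ∷ κ ∷ ρ j ∷ w e ∷ count v (verts e) ∷ alive ω v ∷ ∏ (rest v (verts e)) (alive ω) ∷ []) (X0 ⊗ X1 ⊗ X2 ⊗ X3 ⊗ (X4 ⊗ (X5 ⊗ X6))) (X0 ⊗ X1 ⊗ X2 ⊗ X5 ⊗ (X3 ⊗ X4 ⊗ X6)) refl)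

          ρθ≤ν : ρ j * θ ≤ ν
          ρθ≤ν = (farkas (ρ j ∷ θ ∷ ν ∷ ρ J ∷ []) (X3 ⊗ X1 ≼ X2 ∷ X0 ≼ X3 ∷ # 0 ≼ X1 ∷ []) (X0 ⊗ X1) X2 0 (1 ∙ 0 ∷ 1 ∙ 1 · 2 ∷ []) refl (growth ∷ (ρ-mono (ℕP.<⇒≤ j<J)) ∷ θ≥0 ∷ []))

          -- A kill concerns one vertex only, so just the edges through both u and v contribute, and
          -- these have total probability at most β ρ j θ.
          pair : ∀ {u v} → u ≢ v → ∑ options (λ o → p o * (hx o u * hx o v)) ≤ β * ν
          pair {u} {v} u≢v = ≤-trans (≤-reflexive (∑-options _)) (≤-trans
            (farkas (Sₑ ∷ Sᵥ ∷ p (inj₂ (inj₂ tt)) ∷ C ∷ S ∷ ∑ es (λ e → C * f e) ∷ []) (X0 ≼ X5 ∷ X5 ≼ X3 ⊗ X4 ∷ X1 ≼ # 0 ∷ []) (X0 ⊕ (X1 ⊕ X2 ⊗ (# 0 ⊗ # 0))) (X3 ⊗ X4) 0 (1 ∙ 0 ∷ 1 ∙ 1 ∷ 1 ∙ 2 ∷ []) refl ((∑-mono es edge) ∷ (≤-reflexive (∑-*ˡ es C f)) ∷ (≤-reflexive (none)) ∷ []))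
            (farkas (C ∷ S ∷ β ∷ ν ∷ θ ∷ ρ j ∷ κ ∷ []) (X1 ≼ X4 ∷ # 0 ≼ X0 ∷ X5 ⊗ X4 ≼ X3 ∷ # 0 ≼ X2 ∷ X6 ≼ # 1 ∷ X0 ≼ X2 ⊗ X6 ⊗ X5 ∷ # 0 ≼ X2 ⊗ (X5 ⊗ X4) ∷ # 0 ≼ X4 ∷ []) (X0 ⊗ X1) (X2 ⊗ X3) 0 (1 ∙ 0 · 1 ∷ 1 ∙ 2 · 3 ∷ 1 ∙ 4 · 6 ∷ 1 ∙ 5 · 7 ∷ []) refl ((codegree u≢v) ∷ (*-nonNeg (*-nonNeg β≥0 κ≥0) ρ≥0) ∷ ρθ≤ν ∷ β≥0 ∷ κ≤1 ∷ (≤-reflexive (refl)) ∷ (*-nonNeg β≥0 (*-nonNeg ρ≥0 θ≥0)) ∷ θ≥0 ∷ [])))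
            where
            C = β * κ * ρ j
            f : E → 𝔽
            f e = w e * (count u (verts e) * count v (verts e))
            S = ∑ es f
            Sₑ = ∑ es (λ e → p (inj₁ e) * (hx (inj₁ e) u * hx (inj₁ e) v))
            Sᵥ = ∑ (elems EV) (λ y → p (inj₂ (inj₁ y)) * (hx (inj₂ (inj₁ y)) u * hx (inj₂ (inj₁ y)) v))
            edge : ∀ e → p (inj₁ e) * (hx (inj₁ e) u * hx (inj₁ e) v) ≤ C * f e
            edge e = ≤-trans (≤-reflexive (cong₂ (λ y z → p (inj₁ e) * (y * z)) (hit-edge e u) (hit-edge e v)))
              (farkas (C ∷ w e ∷ a ∷ cu ∷ cv ∷ []) (# 0 ≼ X0 ⊗ X1 ⊗ (X3 ⊗ X4) ∷ X2 ≼ # 1 ∷ # 0 ≼ X2 ∷ []) (X0 ⊗ X1 ⊗ (X2 ⊗ X3 ⊗ (X2 ⊗ X4))) (X0 ⊗ (X1 ⊗ (X3 ⊗ X4))) 0 (1 ∙ 0 · 1 ∷ 1 ∙ 0 · 1 · 2 ∷ []) refl ((*-nonNeg (p≥0 (inj₁ e)) (*-nonNeg (count-nonNeg u (verts e)) (count-nonNeg v (verts e)))) ∷ (∏-≤1 (verts e) (alive≥0 verts-unique verts-4 valid) (alive≤1 verts-unique verts-4 valid)) ∷ (∏-nonNeg (verts e) (alive≥0 verts-unique verts-4 valid)) ∷ []))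
              where
              a = ∏ (verts e) (alive ω)
              cu = count u (verts e)
              cv = count v (verts e)
            disjoint : ∀ y → 𝟏 (y ≟ u) * 𝟏 (y ≟ v) ≡ 𝟘
            disjoint y = trans (𝟏-*-cong (y ≟ u) {y = 𝟘} (λ { refl → 𝟏-no (y ≟ v) u≢v })) (*-zeroʳ (𝟏 (y ≟ u)))
            none : Sᵥ ≡ 𝟘
            none = trans (∑-cong (elems EV) (λ y → trans (cong₂ (λ a b → p (inj₂ (inj₁ y)) * (a * b)) (hit-kill y u) (hit-kill y v))
              (trans (ring (P y ∷ 𝟏 (y ≟ u) ∷ alive ω y ∷ 𝟏 (y ≟ v) ∷ []) (X0 ⊗ (X1 ⊗ X2 ⊗ (X3 ⊗ X2))) (X0 ⊗ X2 ⊗ X2 ⊗ (X1 ⊗ X3)) refl) (trans (cong (P y * alive ω y * alive ω y *_) (disjoint y)) (ring (P y ∷ alive ω y ∷ []) (X0 ⊗ X1 ⊗ X1 ⊗ # 0) (# 0) refl))))) (∑-0 (elems EV))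
              where
              P : V → 𝔽
              P u = p (inj₂ (inj₁ u))

          open Expectation verts-unique verts-4 valid p p≥0 (prob-sum (ρ j) ω) β≥0 (*-nonNeg β≥0 ν≥0) death pair

          module _ (k : V ⊎ T) where
            open Family (family k) hiding (a; vs; ix)

            private
              r̂ = ι r
              c = (𝟙 + r̂ * β) ^ j
              val = value ω
              val′ : Option → 𝔽
              val′ o = value (next ω o)
              Ē = ∑ options (λ o → p o * val′ o)
              b = (𝟙 + r̂ * β) * c
              g : Option → 𝔽
              g o = b * val′ o - c * val

              r̂≥0 : 𝟘 ≤ r̂
              r̂≥0 = 0≤ι r
              r̂≤3 : r̂ ≤ ι 3
              r̂≤3 = ι-mono r≤3
              r̂β≤3β : r̂ * β ≤ ι 3 * β
              r̂β≤3β = (farkas (r̂ ∷ β ∷ []) (X0 ≼ # 3 ∷ # 0 ≼ X1 ∷ []) (X0 ⊗ X1) (# 3 ⊗ X1) 0 (1 ∙ 0 · 1 ∷ []) refl (r̂≤3 ∷ β≥0 ∷ []))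
              r̂β≥0 : 𝟘 ≤ r̂ * β
              r̂β≥0 = *-nonNeg r̂≥0 β≥0
              r̂β≤1 : r̂ * β ≤ 𝟙
              r̂β≤1 = ≤-trans r̂β≤3β β≤⅓
              c≥0 : 𝟘 ≤ c
              c≥0 = ^-nonNeg (farkas (r̂ ∷ β ∷ []) (# 0 ≼ X0 ⊗ X1 ∷ []) (# 0) (# 1 ⊕ X0 ⊗ X1) 0 (1 ∙1 ∷ 1 ∙ 0 ∷ []) refl (r̂β≥0 ∷ [])) j
              cθ≤ν : c * θ ≤ ν
              cθ≤ν = (farkas (c ∷ θ ∷ ν ∷ ρ j ∷ []) (X0 ≼ X3 ∷ X3 ⊗ X1 ≼ X2 ∷ # 0 ≼ X1 ∷ []) (X0 ⊗ X1) X2 0 (1 ∙ 1 ∷ 1 ∙ 0 · 2 ∷ []) refl ((^-mono (farkas (r̂ ∷ β ∷ []) (# 0 ≼ X0 ⊗ X1 ∷ []) (# 0) (# 1 ⊕ X0 ⊗ X1) 0 (1 ∙1 ∷ 1 ∙ 0 ∷ []) refl (r̂β≥0 ∷ [])) (farkas (r̂ ∷ β ∷ []) (X0 ⊗ X1 ≼ # 3 ⊗ X1 ∷ []) (# 1 ⊕ X0 ⊗ X1) (# 1 ⊕ # 3 ⊗ X1) 0 (1 ∙ 0 ∷ []) refl (r̂β≤3β ∷ [])) j) ∷ ρθ≤ν ∷ θ≥0 ∷ []))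
              val≥0 : 𝟘 ≤ val
              val≥0 = value≥0 (family k)
              cval≥0 : 𝟘 ≤ c * val
              cval≥0 = *-nonNeg c≥0 val≥0
              cval≤2 : c * val ≤ ι 2
              cval≤2 = (farkas (c ∷ val ∷ initial k ∷ lam ∷ []) (X0 ⊗ X1 ≼ X2 ⊕ X3 ∷ X2 ≼ # 1 ⊕ X3 ∷ # 4 ⊗ X3 ≼ # 1 ∷ []) (X0 ⊗ X1) (# 2) 1 (1 ∙1 ∷ 2 ∙ 0 ∷ 2 ∙ 1 ∷ 1 ∙ 2 ∷ []) refl ((tracked-upper k) ∷ (initial≤ k) ∷ lam≤¼ ∷ []))
              b≥0 : 𝟘 ≤ b
              b≥0 = (farkas (r̂ ∷ β ∷ c ∷ []) (# 0 ≼ X2 ∷ # 0 ≼ X0 ⊗ X1 ∷ []) (# 0) ((# 1 ⊕ X0 ⊗ X1) ⊗ X2) 0 (1 ∙ 0 ∷ 1 ∙ 0 · 1 ∷ []) refl (c≥0 ∷ r̂β≥0 ∷ []))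
              b≤2c : b ≤ ι 2 * c
              b≤2c = (farkas (r̂ ∷ β ∷ c ∷ []) (# 0 ≼ X2 ∷ X0 ⊗ X1 ≼ # 1 ∷ []) ((# 1 ⊕ X0 ⊗ X1) ⊗ X2) (# 2 ⊗ X2) 0 (1 ∙ 0 · 1 ∷ []) refl (c≥0 ∷ r̂β≤1 ∷ []))
              -- The increment is split into a deterministic gain `z` from the rescaling, at most
              -- 6β, and a random loss `D`, at most 8ν. As the mean of `D` is only of order β, the
              -- second moment is of order βν and not ν²; this keeps its sum over the J steps small.
              D : Option → 𝔽
              D o = b * (val - val′ o)
              D≥0′ : ∀ o → 𝟘 ≤ D o
              D≥0′ o = *-nonNeg b≥0 (loss≥0 (family k) o)
              D≤8ν : ∀ o → D o ≤ ι 8 * ν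
              D≤8ν o = (farkas (b ∷ val ∷ val′ o ∷ ν ∷ θ ∷ c ∷ []) (X1 ⊖ X2 ≼ # 4 ⊗ X4 ∷ # 0 ≼ X0 ∷ X0 ≼ # 2 ⊗ X5 ∷ # 0 ≼ X4 ∷ X5 ⊗ X4 ≼ X3 ∷ []) (X0 ⊗ (X1 ⊖ X2)) (# 8 ⊗ X3) 0 (8 ∙ 4 ∷ 1 ∙ 0 · 1 ∷ 4 ∙ 2 · 3 ∷ []) refl ((loss≤ (family k) θ≥0 o) ∷ b≥0 ∷ b≤2c ∷ θ≥0 ∷ cθ≤ν ∷ []))
              z = r̂ * β * (c * val)
              z≥0 : 𝟘 ≤ z
              z≥0 = *-nonNeg r̂β≥0 cval≥0
              z≤6β : z ≤ ι 6 * β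
              z≤6β = (farkas (r̂ ∷ β ∷ c ∷ val ∷ []) (X0 ⊗ X1 ≼ # 3 ⊗ X1 ∷ # 0 ≼ X0 ⊗ X1 ∷ X2 ⊗ X3 ≼ # 2 ∷ []) (X0 ⊗ X1 ⊗ (X2 ⊗ X3)) (# 6 ⊗ X1) 0 (2 ∙ 0 ∷ 1 ∙ 1 · 2 ∷ []) refl (r̂β≤3β ∷ r̂β≥0 ∷ cval≤2 ∷ []))
              g-split : ∀ o → g o ≡ z - D o
              g-split o = (ring (r̂ ∷ β ∷ c ∷ val′ o ∷ val ∷ []) ((# 1 ⊕ X0 ⊗ X1) ⊗ X2 ⊗ X3 ⊖ X2 ⊗ X4) (X0 ⊗ X1 ⊗ (X2 ⊗ X4) ⊖ (# 1 ⊕ X0 ⊗ X1) ⊗ X2 ⊗ (X4 ⊖ X3)) refl)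
              X-step : ∀ o → X (inj₁ k) (suc j) (next ω o) - X (inj₁ k) j ω ≡ s₁ * g o
              X-step o = (ring (s₁ ∷ r̂ ∷ β ∷ c ∷ val′ o ∷ initial k ∷ val ∷ []) (X0 ⊗ ((# 1 ⊕ X1 ⊗ X2) ⊗ X3 ⊗ X4 ⊖ X5) ⊖ X0 ⊗ (X3 ⊗ X6 ⊖ X5)) (X0 ⊗ ((# 1 ⊕ X1 ⊗ X2) ⊗ X3 ⊗ X4 ⊖ X3 ⊗ X6)) refl)
              mean-D : ∑ options (λ o → p o * D o) ≤ ι 12 * β
              mean-D = ≤-trans (≤-reflexive (trans (∑-cong options (λ o → (ring (p o ∷ b ∷ val ∷ val′ o ∷ []) (X0 ⊗ (X1 ⊗ (X2 ⊖ X3))) (X0 ⊗ (X1 ⊗ X2 ⊕ (# 0 ⊖ X1) ⊗ X3)) refl))) (expect-affine options p val′ (b * val) (𝟘 - b) (prob-sum (ρ j) ω))))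
                (farkas (b ∷ val ∷ Ē ∷ β ∷ r̂ ∷ c ∷ []) (X1 ⊗ (# 1 ⊖ X4 ⊗ X3) ≼ X2 ∷ # 0 ≼ X0 ∷ X0 ≼ # 2 ⊗ X5 ∷ # 0 ≼ X1 ⊗ (X4 ⊗ X3) ∷ X4 ⊗ X3 ⊗ (X5 ⊗ X1) ≼ # 6 ⊗ X3 ∷ []) (X0 ⊗ X1 ⊕ (# 0 ⊖ X0) ⊗ X2) (# 12 ⊗ X3) 0 (2 ∙ 4 ∷ 1 ∙ 0 · 1 ∷ 1 ∙ 2 · 3 ∷ []) refl ((mean-lower (family k)) ∷ b≥0 ∷ b≤2c ∷ (*-nonNeg val≥0 r̂β≥0) ∷ z≤6β ∷ []))
              ββ≤βν : β * β ≤ β * ν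
              ββ≤βν = (farkas (β ∷ ν ∷ []) (# 0 ≼ X0 ∷ X0 ≼ X1 ∷ []) (X0 ⊗ X0) (X0 ⊗ X1) 0 (1 ∙ 0 · 1 ∷ []) refl (β≥0 ∷ β≤ν ∷ []))
              mean-g : ∑ options (λ o → p o * g o) ≡ b * Ē - c * val
              mean-g = trans (∑-cong options (λ o → (ring (p o ∷ b ∷ val′ o ∷ c ∷ val ∷ []) (X0 ⊗ (X1 ⊗ X2 ⊖ X3 ⊗ X4)) (X0 ⊗ (# 0 ⊖ X3 ⊗ X4 ⊕ X1 ⊗ X2)) refl))) (trans (expect-affine options p val′ _ b (prob-sum (ρ j) ω)) (ring (c ∷ val ∷ b ∷ Ē ∷ []) (# 0 ⊖ X0 ⊗ X1 ⊕ X2 ⊗ X3) (X2 ⊗ X3 ⊖ X0 ⊗ X1) refl))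
              r̂²β²cval : r̂ * β * z ≤ ι 18 * (β * ν)
              r̂²β²cval = (farkas (r̂ ∷ β ∷ z ∷ ν ∷ []) (X0 ⊗ X1 ≼ # 3 ⊗ X1 ∷ # 0 ≼ X2 ∷ X2 ≼ # 6 ⊗ X1 ∷ # 0 ≼ X1 ∷ X1 ⊗ X1 ≼ X1 ⊗ X3 ∷ []) (X0 ⊗ X1 ⊗ X2) (# 18 ⊗ (X1 ⊗ X3)) 0 (18 ∙ 4 ∷ 1 ∙ 0 · 1 ∷ 3 ∙ 2 · 3 ∷ []) refl (r̂β≤3β ∷ z≥0 ∷ z≤6β ∷ β≥0 ∷ ββ≤βν ∷ []))
              mean-g-lower : 𝟘 - ι 64 * (β * ν) ≤ ∑ options (λ o → p o * g o)
              mean-g-lower = subst (𝟘 - ι 64 * (β * ν) ≤_) (sym mean-g)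
                (farkas (β ∷ ν ∷ b ∷ Ē ∷ c ∷ val ∷ r̂ ∷ []) (X5 ⊗ (# 1 ⊖ X6 ⊗ X0) ≼ X3 ∷ # 0 ≼ X2 ∷ X6 ⊗ X0 ⊗ (X6 ⊗ X0 ⊗ (X4 ⊗ X5)) ≼ # 18 ⊗ (X0 ⊗ X1) ∷ # 0 ≼ X0 ⊗ X1 ∷ (# 1 ⊕ X6 ⊗ X0) ⊗ X4 ⊗ (X5 ⊗ (# 1 ⊖ X6 ⊗ X0)) ≼ X2 ⊗ (X5 ⊗ (# 1 ⊖ X6 ⊗ X0)) ∷ []) (# 0 ⊖ # 64 ⊗ (X0 ⊗ X1)) (X2 ⊗ X3 ⊖ X4 ⊗ X5) 0 (1 ∙ 2 ∷ 46 ∙ 3 ∷ 1 ∙ 4 ∷ 1 ∙ 0 · 1 ∷ []) refl ((mean-lower (family k)) ∷ b≥0 ∷ r̂²β²cval ∷ (*-nonNeg β≥0 ν≥0) ∷ (≥-reflexive (cong (λ y → y * (val * (𝟙 - r̂ * β))) (refl {x = b}))) ∷ []))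
              mean-g-upper : ∑ options (λ o → p o * g o) ≤ ι 64 * (β * ν)
              mean-g-upper = subst (_≤ ι 64 * (β * ν)) (sym mean-g)
                (farkas (b ∷ Ē ∷ c ∷ val ∷ β ∷ ν ∷ r̂ ∷ []) (X1 ≼ X3 ⊗ (# 1 ⊖ X6 ⊗ X4 ⊕ # 16 ⊗ (X4 ⊗ X5)) ∷ # 0 ≼ X0 ∷ X0 ≼ # 2 ⊗ X2 ∷ # 0 ≼ X3 ⊗ (X4 ⊗ X5) ∷ X2 ⊗ X3 ≼ # 2 ∷ # 0 ≼ X4 ⊗ X5 ∷ X0 ⊗ (X3 ⊗ (# 1 ⊖ X6 ⊗ X4)) ≼ (# 1 ⊕ X6 ⊗ X4) ⊗ X2 ⊗ (X3 ⊗ (# 1 ⊖ X6 ⊗ X4)) ∷ # 0 ≼ X6 ⊗ X4 ⊗ (X6 ⊗ X4 ⊗ (X2 ⊗ X3)) ∷ []) (X0 ⊗ X1 ⊖ X2 ⊗ X3) (# 64 ⊗ (X4 ⊗ X5)) 0 (1 ∙ 6 ∷ 1 ∙ 7 ∷ 1 ∙ 0 · 1 ∷ 16 ∙ 2 · 3 ∷ 32 ∙ 4 · 5 ∷ []) refl ((mean-upper (family k)) ∷ b≥0 ∷ b≤2c ∷ (*-nonNeg val≥0 (*-nonNeg β≥0 ν≥0)) ∷ cval≤2 ∷ (*-nonNeg β≥0 ν≥0) ∷ (≤-reflexive (cong (λ y → y * (val * (𝟙 - r̂ * β))) (refl {x = b}))) ∷ (*-nonNeg r̂β≥0 z≥0)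 ∷ []))
              g² : ∀ o → g o * g o ≤ ι 72 * (β * ν) + ι 16 * ν * D o
              g² o = subst (λ y → y * y ≤ ι 72 * (β * ν) + ι 16 * ν * D o) (sym (g-split o))
                (farkas (z ∷ D o ∷ β ∷ ν ∷ []) (# 0 ≼ (X0 ⊕ X1) ⊗ (X0 ⊕ X1) ∷ # 0 ≼ X0 ∷ X0 ≼ # 6 ⊗ X2 ∷ # 0 ≼ X2 ∷ X2 ⊗ X2 ≼ X2 ⊗ X3 ∷ # 0 ≼ X1 ∷ X1 ≼ # 8 ⊗ X3 ∷ []) ((X0 ⊖ X1) ⊗ (X0 ⊖ X1)) (# 72 ⊗ (X2 ⊗ X3) ⊕ # 16 ⊗ X3 ⊗ X1) 0 (1 ∙ 0 ∷ 72 ∙ 4 ∷ 2 ∙ 1 · 2 ∷ 12 ∙ 2 · 3 ∷ 2 ∙ 5 · 6 ∷ []) refl ((square-nonNeg (z + D o)) ∷ z≥0 ∷ z≤6β ∷ β≥0 ∷ ββ≤βν ∷ (D≥0′ o) ∷ (D≤8ν o) ∷ []))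
              mean-g² : ∑ options (λ o → p o * (g o * g o)) ≤ ι 300 * (β * ν)
              mean-g² = ≤-trans (∑-mono options (λ o → (farkas (p o ∷ g o ∷ β ∷ ν ∷ D o ∷ []) (# 0 ≼ X0 ∷ X1 ⊗ X1 ≼ # 72 ⊗ (X2 ⊗ X3) ⊕ # 16 ⊗ X3 ⊗ X4 ∷ []) (X0 ⊗ (X1 ⊗ X1)) (X0 ⊗ (# 72 ⊗ (X2 ⊗ X3) ⊕ # 16 ⊗ X3 ⊗ X4)) 0 (1 ∙ 0 · 1 ∷ []) refl ((p≥0 o) ∷ (g² o) ∷ []))))
                (≤-trans (≤-reflexive (expect-affine options p D _ _ (prob-sum (ρ j) ω))) (farkas (β ∷ ν ∷ ∑ options (λ o → p o * D o) ∷ []) (X2 ≼ # 12 ⊗ X0 ∷ # 0 ≼ X1 ∷ # 0 ≼ X0 ⊗ X1 ∷ []) (# 72 ⊗ (X0 ⊗ X1) ⊕ # 16 ⊗ X1 ⊗ X2) (# 300 ⊗ (X0 ⊗ X1)) 0 (36 ∙ 2 ∷ 16 ∙ 0 · 1 ∷ []) refl (mean-D ∷ ν≥0 ∷ (*-nonNeg β≥0 ν≥0) ∷ [])))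
              s₁≥0 : 𝟘 ≤ s₁
              s₁≥0 = ≤-trans 0≤1 s₁≥1
              mean-X : ∑ options (λ o → p o * (X (inj₁ k) (suc j) (next ω o) - X (inj₁ k) j ω)) ≡ s₁ * ∑ options (λ o → p o * g o)
              mean-X = trans (∑-cong options (λ o → trans (cong (p o *_) (X-step o)) (*-exchange (p o) s₁ (g o)))) (∑-*ˡ options s₁ _)

            family-increment : Increment options p (X (inj₁ k) j ω) (λ o → X (inj₁ k) (suc j) (next ω o)) (ι (suc j) * η (inj₁ k) - ι j * η (inj₁ k))
            family-increment = record
              { d = d ; μ = s₁ * (ι 64 * (β * ν)) ; v = s₁ * s₁ * (ι 300 * (β * ν))
              ; d≥0 = *-nonNeg s₁≥0 (farkas (ν ∷ []) (# 0 ≼ X0 ∷ []) (# 0) (# 8 ⊗ X0) 0 (8 ∙ 0 ∷ []) refl (ν≥0 ∷ []))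
              ; d≤1 = (farkas (d ∷ ι N ∷ []) (X1 ⊗ (# 2 ⊗ X0) ≼ # 1 ∷ # 1 ≼ X1 ∷ # 0 ≼ X0 ∷ []) X0 (# 1) 1 (1 ∙1 ∷ 1 ∙ 0 ∷ 2 ∙ 1 · 2 ∷ []) refl (small₁ ∷ N≥1 ∷ (*-nonNeg s₁≥0 (farkas (ν ∷ []) (# 0 ≼ X0 ∷ []) (# 0) (# 8 ⊗ X0) 0 (8 ∙ 0 ∷ []) refl (ν≥0 ∷ []))) ∷ []))
              ; small = small₁
              ; lower = λ o → subst (𝟘 - d ≤_) (sym (X-step o)) (farkas (s₁ ∷ ν ∷ g o ∷ z ∷ D o ∷ []) (X3 ⊖ X4 ≼ X2 ∷ # 0 ≼ X3 ∷ X4 ≼ # 8 ⊗ X1 ∷ # 0 ≼ X0 ∷ []) (# 0 ⊖ X0 ⊗ (# 8 ⊗ X1)) (X0 ⊗ X2) 0 (1 ∙ 0 · 3 ∷ 1 ∙ 1 · 3 ∷ 1 ∙ 2 · 3 ∷ []) refl ((≥-reflexive (g-split o)) ∷ z≥0 ∷ (D≤8ν o) ∷ s₁≥0 ∷ []))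
              ; upper = λ o → subst (_≤ d) (sym (X-step o)) (farkas (s₁ ∷ g o ∷ ν ∷ z ∷ D o ∷ β ∷ []) (X1 ≼ X3 ⊖ X4 ∷ X3 ≼ # 6 ⊗ X5 ∷ # 0 ≼ X4 ∷ # 0 ≼ X0 ∷ X5 ≼ X2 ∷ # 0 ≼ X2 ∷ []) (X0 ⊗ X1) (X0 ⊗ (# 8 ⊗ X2)) 0 (1 ∙ 0 · 3 ∷ 1 ∙ 1 · 3 ∷ 1 ∙ 2 · 3 ∷ 6 ∙ 3 · 4 ∷ 2 ∙ 3 · 5 ∷ []) refl ((≤-reflexive (g-split o)) ∷ z≤6β ∷ (D≥0′ o) ∷ s₁≥0 ∷ β≤ν ∷ ν≥0 ∷ []))
              ; drift-lower = subst (𝟘 - s₁ * (ι 64 * (β * ν)) ≤_) (sym mean-X) (farkas (s₁ ∷ β ∷ ν ∷ ∑ options (λ o → p o * g o) ∷ []) (# 0 ⊖ # 64 ⊗ (X1 ⊗ X2) ≼ X3 ∷ # 0 ≼ X0 ∷ []) (# 0 ⊖ X0 ⊗ (# 64 ⊗ (X1 ⊗ X2))) (X0 ⊗ X3) 0 (1 ∙ 0 · 1 ∷ []) refl (mean-g-lower ∷ s₁≥0 ∷ []))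
              ; drift-upper = subst (_≤ s₁ * (ι 64 * (β * ν))) (sym mean-X) (farkas (s₁ ∷ ∑ options (λ o → p o * g o) ∷ β ∷ ν ∷ []) (X1 ≼ # 64 ⊗ (X2 ⊗ X3) ∷ # 0 ≼ X0 ∷ []) (X0 ⊗ X1) (X0 ⊗ (# 64 ⊗ (X2 ⊗ X3))) 0 (1 ∙ 0 · 1 ∷ []) refl (mean-g-upper ∷ s₁≥0 ∷ []))
              ; variance = ≤-trans (≤-reflexive (trans (∑-cong options (λ o → trans (cong (λ y → p o * (y * y)) (X-step o)) (ring (p o ∷ s₁ ∷ g o ∷ []) (X0 ⊗ (X1 ⊗ X2 ⊗ (X1 ⊗ X2))) (X1 ⊗ X1 ⊗ (X0 ⊗ (X2 ⊗ X2))) refl))) (∑-*ˡ options (s₁ * s₁) _)))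
                  (farkas (s₁ ∷ ∑ options (λ o → p o * (g o * g o)) ∷ β ∷ ν ∷ []) (X1 ≼ # 300 ⊗ (X2 ⊗ X3) ∷ # 0 ≼ X0 ⊗ X0 ∷ []) (X0 ⊗ X0 ⊗ X1) (X0 ⊗ X0 ⊗ (# 300 ⊗ (X2 ⊗ X3))) 0 (1 ∙ 0 · 1 ∷ []) refl (mean-g² ∷ (square-nonNeg s₁) ∷ []))
              -- The 1600 in `η` covers 64 from the drift and 5 · 300 from the second moment.
              ; within = subst (λ y → n * (s₁ * (ι 64 * (β * ν))) + ι 5 * (n * n) * (s₁ * s₁ * (ι 300 * (β * ν))) ≤ y * η (inj₁ k) - ι j * η (inj₁ k)) (sym (ι-suc j))
                  (farkas (n ∷ s₁ ∷ β ∷ ν ∷ ι j ∷ []) (X0 ⊗ X1 ≼ X0 ⊗ X0 ⊗ (X1 ⊗ X1) ∷ # 0 ≼ X2 ⊗ X3 ∷ # 0 ≼ X0 ⊗ X0 ⊗ (X1 ⊗ X1) ∷ []) (X0 ⊗ (X1 ⊗ (# 64 ⊗ (X2 ⊗ X3))) ⊕ # 5 ⊗ (X0 ⊗ X0) ⊗ (X1 ⊗ X1 ⊗ (# 300 ⊗ (X2 ⊗ X3)))) ((# 1 ⊕ X4) ⊗ (# 1600 ⊗ (X0 ⊗ X0) ⊗ (X1 ⊗ X1) ⊗ X2 ⊗ X3) ⊖ X4 ⊗ (# 1600 ⊗ (X0 ⊗ X0) ⊗ (X1 ⊗ X1) ⊗ X2 ⊗ X3)) 0 (64 ∙ 0 ·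 1 ∷ 36 ∙ 1 · 2 ∷ []) refl ((*-mono-≤ (≤-trans 0≤1 N≥1) s₁≥0 (ι-≤-square N) s₁≤s₁²) ∷ (*-nonNeg β≥0 ν≥0) ∷ (*-nonNeg (square-nonNeg n) (square-nonNeg s₁)) ∷ [])) }
              where
              n = ι N
              d = s₁ * (ι 8 * ν)
              s₁≤s₁² : s₁ ≤ s₁ * s₁
              s₁≤s₁² = (farkas (s₁ ∷ []) (# 1 ≼ X0 ∷ []) X0 (X0 ⊗ X0) 0 (1 ∙ 0 ∷ 1 ∙ 0 · 0 ∷ []) refl (s₁≥1 ∷ []))

          module _ (τ : T) where
            private
              Y : Option → 𝔽
              Y o = ∑ (elems EV) (λ v → test τ v * kills ω o v)
              Y-kill : ∀ u → Y (inj₂ (inj₁ u)) ≡ alive ω u * test τ u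
              Y-kill u = trans (∑-cong (elems EV) (λ v → trans (cong (test τ v *_) (trans (hit-kill u v) refl)) (ring (test τ v ∷ 𝟏 (u ≟ v) ∷ alive ω u ∷ []) (X0 ⊗ (X1 ⊗ X2)) (X2 ⊗ (X1 ⊗ X0)) refl))) (trans (∑-*ˡ (elems EV) (alive ω u) _) (cong (alive ω u *_) (pick′ (test τ) u)))
              zero-sum : ∑ (elems EV) (λ v → test τ v * 𝟘) ≡ 𝟘
              zero-sum = trans (∑-cong (elems EV) (λ v → (*-zeroʳ (test τ v)))) (∑-0 (elems EV))
              al≥0 = alive≥0 verts-unique verts-4 valid
              al≤1 = alive≤1 verts-unique verts-4 valid
              Y≥0 : ∀ o → 𝟘 ≤ Y o
              Y≥0 (inj₁ e) = ≥-reflexive zero-sum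
              Y≥0 (inj₂ (inj₁ u)) = subst (𝟘 ≤_) (sym (Y-kill u)) (*-nonNeg (al≥0 u) (test≥0 τ u))
              Y≥0 (inj₂ (inj₂ tt)) = ≥-reflexive zero-sum
              Y≤θ : ∀ o → Y o ≤ θ
              Y≤θ (inj₁ e) = subst (_≤ θ) (sym zero-sum) θ≥0
              Y≤θ (inj₂ (inj₁ u)) = subst (_≤ θ) (sym (Y-kill u)) (farkas (alive ω u ∷ test τ u ∷ θ ∷ []) (X0 ≼ # 1 ∷ # 0 ≼ X1 ∷ X1 ≼ X2 ∷ []) (X0 ⊗ X1) X2 0 (1 ∙ 2 ∷ 1 ∙ 0 · 1 ∷ []) refl ((al≤1 u) ∷ (test≥0 τ u) ∷ (test≤θ τ u) ∷ []))
              Y≤θ (inj₂ (inj₂ tt)) = subst (_≤ θ) (sym zero-sum) θ≥0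
              mean-Y : ∑ options (λ o → p o * Y o) ≤ ι 4 * (β * lam)
              mean-Y = ≤-trans (≤-reflexive (trans (∑-options _) (trans (cong₂ (λ a b → a + (∑ (elems EV) (λ v → p (inj₂ (inj₁ v)) * Y (inj₂ (inj₁ v))) + b))
                  (trans (∑-cong es (λ e → trans (cong (p (inj₁ e) *_) zero-sum) (*-zeroʳ (p (inj₁ e))))) (∑-0 es)) (trans (cong (p (inj₂ (inj₂ tt)) *_) zero-sum) (*-zeroʳ (p (inj₂ (inj₂ tt)))))) (ring (∑ (elems EV) (λ v → p (inj₂ (inj₁ v)) * Y (inj₂ (inj₁ v))) ∷ []) (# 0 ⊕ (X0 ⊕ # 0)) X0 refl))))
                (≤-trans (∑-mono (elems EV) each) (≤-trans (≤-reflexive (∑-*ˡ (elems EV) (ι 4 * (β * lam)) (test τ)))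
                  (farkas (β ∷ lam ∷ ∑ (elems EV) (test τ) ∷ []) (X2 ≼ # 1 ∷ # 0 ≼ X0 ⊗ X1 ∷ []) (# 4 ⊗ (X0 ⊗ X1) ⊗ X2) (# 4 ⊗ (X0 ⊗ X1)) 0 (4 ∙ 0 · 1 ∷ []) refl ((test-sum τ) ∷ (*-nonNeg β≥0 lam≥0) ∷ []))))
                where
                each : ∀ u → p (inj₂ (inj₁ u)) * Y (inj₂ (inj₁ u)) ≤ ι 4 * (β * lam) * test τ u
                each u = subst (λ y → p (inj₂ (inj₁ u)) * y ≤ ι 4 * (β * lam) * test τ u) (sym (Y-kill u))
                  (farkas (β ∷ q ∷ alive ω u ∷ test τ u ∷ lam ∷ []) (X3 ⊗ X1 ≼ X3 ⊗ (# 4 ⊗ X4) ∷ # 0 ≼ X0 ∷ X2 ≼ # 1 ∷ # 0 ≼ X0 ⊗ (X3 ⊗ X1) ∷ []) (X0 ⊗ X1 ⊗ (X2 ⊗ X3)) (# 4 ⊗ (X0 ⊗ X4) ⊗ X3) 0 (1 ∙ 0 · 1 ∷ 1 ∙ 2 · 3 ∷ []) refl ((kill-test τ u) ∷ β≥0 ∷ (al≤1 u) ∷ (*-nonNeg β≥0 (*-nonNeg (test≥0 τ u) (kill≥0 u))) ∷ []))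
                  where q = 𝟙 - κ * ρ j * degree ω u
              X-step : ∀ o → X (inj₂ τ) (suc j) (next ω o) - X (inj₂ τ) j ω ≡ s₂ * Y o
              X-step o = trans (cong (λ y → s₂ * y - s₂ * waste τ ω) (trans (∑-cong (elems EV) (λ v → (ring (test τ v ∷ killed ω v ∷ kills ω o v ∷ []) (X0 ⊗ (X1 ⊕ X2)) (X0 ⊗ X1 ⊕ X0 ⊗ X2) refl))) (∑-+ (elems EV) _ _)))
                (ring (s₂ ∷ waste τ ω ∷ Y o ∷ []) (X0 ⊗ (X1 ⊕ X2) ⊖ X0 ⊗ X1) (X0 ⊗ X2) refl)
              s₂≥0 : 𝟘 ≤ s₂
              s₂≥0 = ≤-trans 0≤1 s₂≥1
              mean-X : ∑ options (λ o → p o * (X (inj₂ τ) (suc j) (next ω o) - X (inj₂ τ) j ω)) ≡ s₂ * ∑ options (λ o → p o * Y o)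
              mean-X = trans (∑-cong options (λ o → trans (cong (p o *_) (X-step o)) (*-exchange (p o) s₂ (Y o)))) (∑-*ˡ options s₂ _)

            -- The waste is not rescaled: it only increases. Its mean increase of at most 4 β lam is
            -- charged as drift, and since no increase exceeds θ, the second moment is at most θ
            -- times the mean.
            waste-increment : Increment options p (X (inj₂ τ) j ω) (λ o → X (inj₂ τ) (suc j) (next ω o)) (ι (suc j) * η (inj₂ τ) - ι j * η (inj₂ τ))
            waste-increment = record
              { d = d ; μ = s₂ * (ι 4 * (β * lam)) ; v = s₂ * s₂ * (θ * (ι 4 * (β * lam)))
              ; d≥0 = *-nonNeg s₂≥0 θ≥0
              ; d≤1 = (farkas (d ∷ ι N ∷ []) (X1 ⊗ (# 2 ⊗ X0) ≼ # 1 ∷ # 1 ≼ X1 ∷ # 0 ≼ X0 ∷ []) X0 (# 1) 1 (1 ∙1 ∷ 1 ∙ 0 ∷ 2 ∙ 1 · 2 ∷ []) refl (small₂ ∷ N≥1 ∷ (*-nonNeg s₂≥0 θ≥0) ∷ []))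
              ; small = small₂
              ; lower = λ o → subst (𝟘 - d ≤_) (sym (X-step o)) (farkas (d ∷ s₂ ∷ Y o ∷ []) (# 0 ≼ X1 ⊗ X2 ∷ # 0 ≼ X0 ∷ []) (# 0 ⊖ X0) (X1 ⊗ X2) 0 (1 ∙ 0 ∷ 1 ∙ 1 ∷ []) refl ((*-nonNeg s₂≥0 (Y≥0 o)) ∷ (*-nonNeg s₂≥0 θ≥0) ∷ []))
              ; upper = λ o → subst (_≤ d) (sym (X-step o)) (*-monoʳ-≤ s₂ (Y o) θ s₂≥0 (Y≤θ o))
              ; drift-lower = subst (𝟘 - s₂ * (ι 4 * (β * lam)) ≤_) (sym mean-X) (farkas (s₂ ∷ β ∷ lam ∷ m ∷ []) (# 0 ≼ X0 ⊗ X3 ∷ # 0 ≼ X0 ⊗ (X1 ⊗ X2) ∷ []) (# 0 ⊖ X0 ⊗ (# 4 ⊗ (X1 ⊗ X2))) (X0 ⊗ X3) 0 (1 ∙ 0 ∷ 4 ∙ 1 ∷ []) refl ((*-nonNeg s₂≥0 (∑-nonNeg options (λ o → *-nonNeg (p≥0 o) (Y≥0 o)))) ∷ (*-nonNeg s₂≥0 (*-nonNeg β≥0 lam≥0)) ∷ []))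
              ; drift-upper = subst (_≤ s₂ * (ι 4 * (β * lam))) (sym mean-X) (farkas (s₂ ∷ m ∷ β ∷ lam ∷ []) (X1 ≼ # 4 ⊗ (X2 ⊗ X3) ∷ # 0 ≼ X0 ∷ []) (X0 ⊗ X1) (X0 ⊗ (# 4 ⊗ (X2 ⊗ X3))) 0 (1 ∙ 0 · 1 ∷ []) refl (mean-Y ∷ s₂≥0 ∷ []))
              ; variance = ≤-trans (∑-mono options (λ o → ≤-trans (≤-reflexive (cong (λ y → p o * (y * y)) (X-step o)))
                    (farkas (p o ∷ s₂ ∷ Y o ∷ θ ∷ []) (# 0 ≼ X1 ⊗ X1 ⊗ (X0 ⊗ X2) ∷ X2 ≼ X3 ∷ []) (X0 ⊗ (X1 ⊗ X2 ⊗ (X1 ⊗ X2))) (X1 ⊗ X1 ⊗ X3 ⊗ (X0 ⊗ X2)) 0 (1 ∙ 0 · 1 ∷ []) refl ((*-nonNeg (square-nonNeg s₂) (*-nonNeg (p≥0 o) (Y≥0 o))) ∷ (Y≤θ o) ∷ []))))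
                  (≤-trans (≤-reflexive (∑-*ˡ options (s₂ * s₂ * θ) _)) (farkas (s₂ ∷ θ ∷ m ∷ β ∷ lam ∷ []) (X2 ≼ # 4 ⊗ (X3 ⊗ X4) ∷ # 0 ≼ X0 ⊗ X0 ⊗ X1 ∷ []) (X0 ⊗ X0 ⊗ X1 ⊗ X2) (X0 ⊗ X0 ⊗ (X1 ⊗ (# 4 ⊗ (X3 ⊗ X4)))) 0 (1 ∙ 0 · 1 ∷ []) refl (mean-Y ∷ (*-nonNeg (square-nonNeg s₂) θ≥0) ∷ [])))
              ; within = ≤-reflexive (trans (ring (n ∷ s₂ ∷ β ∷ lam ∷ θ ∷ ι j ∷ []) (X0 ⊗ (X1 ⊗ (# 4 ⊗ (X2 ⊗ X3))) ⊕ # 5 ⊗ (X0 ⊗ X0) ⊗ (X1 ⊗ X1 ⊗ (X4 ⊗ (# 4 ⊗ (X2 ⊗ X3))))) ((# 1 ⊕ X5) ⊗ (# 4 ⊗ X2 ⊗ X3 ⊗ (X0 ⊗ X1 ⊕ # 5 ⊗ (X0 ⊗ X0) ⊗ (X1 ⊗ X1 ⊗ X4))) ⊖ X5 ⊗ (# 4 ⊗ X2 ⊗ X3 ⊗ (X0 ⊗ X1 ⊕ # 5 ⊗ (X0 ⊗ X0) ⊗ (X1 ⊗ X1 ⊗ X4)))) refl)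
                  (cong (λ y → y * η (inj₂ τ) - ι j * η (inj₂ τ)) (sym (ι-suc j)))) }
              where
              n = ι N
              d = s₂ * θ
              m = ∑ options (λ o → p o * Y o)

          round : Round X (λ k i → ι i * η k) (λ _ → Valid) j ω
          round = record { os = options ; p = p ; next = next ω ; p≥0 = p≥0 ; sum-p = prob-sum (ρ j) ω
            ; invariant = next-valid verts-unique verts-4 valid ; increment = inc }
            where
            inc : ∀ k → Increment options p (X k j ω) (λ o → X k (suc j) (next ω o)) (ι (suc j) * η k - ι j * η k)
            inc (inj₁ k) = family-increment k
            inc (inj₂ τ) = waste-increment τ

        η≥0 : ∀ k → 𝟘 ≤ η k
        η≥0 (inj₁ _) = *-nonNeg (*-nonNeg (*-nonNeg (*-nonNeg (0≤ι 1600) (square-nonNeg (ι N))) (square-nonNeg s₁)) β≥0) ν≥0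
        η≥0 (inj₂ _) = *-nonNeg (*-nonNeg (*-nonNeg (0≤ι 4) β≥0) lam≥0) (farkas (ι N ∷ s₂ ∷ θ ∷ []) (# 0 ≼ X0 ⊗ X1 ∷ # 0 ≼ X0 ⊗ X0 ⊗ (X1 ⊗ X1 ⊗ X2) ∷ []) (# 0) (X0 ⊗ X1 ⊕ # 5 ⊗ (X0 ⊗ X0) ⊗ (X1 ⊗ X1 ⊗ X2)) 0 (1 ∙ 0 ∷ 5 ∙ 1 ∷ []) refl ((*-nonNeg (0≤ι N) (≤-trans 0≤1 s₂≥1)) ∷ (*-nonNeg (square-nonNeg (ι N)) (*-nonNeg (square-nonNeg s₂) θ≥0)) ∷ []))

        final : ∃ λ ω → Valid ω × (∀ k → X k J ω * X k J ω ≤ R * R)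
        final = tracking (elems EK) X (λ k i → ι i * η k) (λ _ → Valid) R J R-large R≥0
          (λ k i _ → *-nonNeg (0≤ι i) (η≥0 k)) half ω₀ ω₀-valid start (elem-∈ EK) (λ j j<J ω valid tr → Turn.round j<J valid tr)
          where
          EK : Enum K
          EK = enum⊎ (enum⊎ EV ET) ET
          full : ∀ k → ι 2 * (ι J * η k) ≤ 𝟙
          full (inj₁ _) = budget₁
          full (inj₂ _) = budget₂
          half : ∀ k i → i ℕ.≤ J → ι 2 * (ι i * η k) ≤ 𝟙
          half k i i≤J = (farkas (ι i ∷ η k ∷ ι J ∷ []) (# 2 ⊗ (X2 ⊗ X1) ≼ # 1 ∷ # 0 ≼ X1 ∷ X0 ≼ X2 ∷ []) (# 2 ⊗ (X0 ⊗ X1)) (# 1) 0 (1 ∙ 0 ∷ 2 ∙ 1 · 2 ∷ []) refl ((full k) ∷ (η≥0 k) ∷ (ι-mono i≤J) ∷ []))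
          start : ∀ k → X k 0 ω₀ ≡ 𝟘
          start (inj₁ k) = (ring (s₁ ∷ initial k ∷ []) (X0 ⊗ (# 1 ⊗ X1 ⊖ X1)) (# 0) refl)
          start (inj₂ τ) = trans (cong (s₂ *_) (trans (∑-cong (elems EV) (λ v → (*-zeroʳ (test τ v)))) (∑-0 (elems EV)))) (*-zeroʳ s₂)

      -- By `balance` the uncovered mass of a test is its living mass plus its waste. The living
      -- mass times (1 + β)^J is at most 1 + 2 lam, hence below 2, which gives the summand g; the
      -- waste is tracked and gives ε.
      near-perfect : ∀ {g ε} → R ≤ s₂ * ε → ι 2 ≤ g * (𝟙 + ι 1 * β) ^ J →
        ∃ λ M → All (_∈ es) M × (∀ v → covered M v ≤ 𝟙) × (∀ τ → ∑ (elems EV) (λ v → test τ v * (𝟙 - covered M v)) ≤ g + ε)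
      near-perfect {g} {ε} R≤ g-large = conclude final
        where
        conclude : (∃ λ ω → Valid ω × (∀ k → X k J ω * X k J ω ≤ R * R)) → _
        conclude (ω , valid , tr) = chosen ω , Valid.chosen⊆ valid , covered≤1 , uncovered
          where
          covered≤1 : ∀ v → covered (chosen ω) v ≤ 𝟙
          covered≤1 v = (farkas (covered (chosen ω) v ∷ alive ω v ∷ killed ω v ∷ []) (X1 ⊕ X2 ⊕ X0 ≼ # 1 ∷ # 0 ≼ X1 ∷ # 0 ≼ X2 ∷ []) X0 (# 1) 0 (1 ∙ 0 ∷ 1 ∙ 1 ∷ 1 ∙ 2 ∷ []) refl ((≤-reflexive (Valid.balance valid v)) ∷ (alive≥0 verts-unique verts-4 valid v) ∷ (Valid.killed≥0 valid v) ∷ []))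
          uncovered : ∀ τ → ∑ (elems EV) (λ v → test τ v * (𝟙 - covered (chosen ω) v)) ≤ g + ε
          uncovered τ = ≤-trans (≤-reflexive (trans (∑-cong (elems EV) (λ v → trans (cong (λ y → test τ v * (y - covered (chosen ω) v)) (sym (Valid.balance valid v)))
              (ring (test τ v ∷ alive ω v ∷ killed ω v ∷ covered (chosen ω) v ∷ []) (X0 ⊗ (X1 ⊕ X2 ⊕ X3 ⊖ X3)) (X0 ⊗ (X1 ⊗ # 1) ⊕ X0 ⊗ X2) refl))) (∑-+ (elems EV) _ _)))
            (+-mono-≤ alive-bound waste-bound)
            where
            al = Family.value (family (inj₂ τ)) ω
            c = (𝟙 + ι 1 * β) ^ J
            c≥1 : 𝟙 ≤ c
            c≥1 = ^-≥1 (farkas (β ∷ []) (# 0 ≼ X0 ∷ []) (# 1) (# 1 ⊕ # 1 ⊗ X0) 0 (1 ∙ 0 ∷ []) refl (β≥0 ∷ [])) J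
            alive-bound : al ≤ g
            alive-bound = *-cancelˡ-≤ c≥1 (farkas (c ∷ al ∷ g ∷ initial (inj₂ τ) ∷ lam ∷ []) (# 2 ≼ X2 ⊗ X0 ∷ X0 ⊗ X1 ⊖ X3 ≼ X4 ∷ X3 ≼ # 1 ⊕ X4 ∷ # 4 ⊗ X4 ≼ # 1 ∷ []) (X0 ⊗ X1) (X0 ⊗ X2) 1 (1 ∙1 ∷ 2 ∙ 0 ∷ 2 ∙ 1 ∷ 2 ∙ 2 ∷ 1 ∙ 3 ∷ []) refl (g-large ∷ (*-cancelˡ-≤ s₁≥1 (subst (s₁ * (c * al - initial (inj₂ τ)) ≤_) R≡ (square-≤ R≥0 (tr (inj₁ (inj₂ τ)))))) ∷ (initial≤ (inj₂ τ)) ∷ lam≤¼ ∷ []))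
            waste-bound : waste τ ω ≤ ε
            waste-bound = *-cancelˡ-≤ s₂≥1 (≤-trans (square-≤ R≥0 (tr (inj₂ τ))) R≤)

  -- Random assignments of 0 and 1

  at-most-one : ∀ {A : Set} (EA : Enum A) {P : A → Set} (P? : ∀ x → Dec (P x)) → (∀ {x y} → P x → P y → x ≡ y) → ∑ (elems EA) (λ x → 𝟏 (P? x)) ≤ 𝟙
  at-most-one EA P? h = ≤-by-contradiction λ q → q (bounded (∑-positive (elems EA) _ (λ r → q (≤-trans r 0≤1))))
    where
    bounded : (∃ λ x → x ∈ elems EA × ¬ 𝟏 (P? x) ≤ 𝟘) → ∑ (elems EA) (λ x → 𝟏 (P? x)) ≤ 𝟙
    bounded (y , _ , q) = ≤-trans (∑-mono (elems EA) (λ x → 𝟏-mono (P? x) (Enum._≟_ EA x y) (λ p → h p (𝟏-positive (P? y) q)))) (≤-reflexive (Enum.pick-1 EA y))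

  module Assignment (K : ℕ) where
    colours = allFin K

    upd : (Fin K → 𝔽) → Fin K → 𝔽 → Fin K → 𝔽
    upd ξ k x a = ξ a + 𝟏 (a FP.≟ k) * (x - ξ k)

    Unit : (Fin K → 𝔽) → Set
    Unit ξ = ∀ k → 𝟘 ≤ ξ k × ξ k ≤ 𝟙

    record Stat (θ : 𝔽) : Set where
      field
        T : (Fin K → 𝔽) → 𝔽
        D : (Fin K → 𝔽) → Fin K → 𝔽
        d : Fin K → 𝔽
        affine : ∀ ξ k x → T (upd ξ k x) ≡ T ξ + (x - ξ k) * D ξ k
        D≥0 : ∀ {ξ} → Unit ξ → ∀ k → 𝟘 ≤ D ξ k
        D≤d : ∀ {ξ} → Unit ξ → ∀ k → D ξ k ≤ d k
        d≤θ : ∀ k → d k ≤ θ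
        d-sum : ∑ colours d ≤ ι 2

    module _ {A : Set} (EA : Enum A) (a : A → Fin K) (a-injective : ∀ {x y} → a x ≡ a y → x ≡ y) where
      fibre≤1 : ∀ k → ∑ (elems EA) (λ x → 𝟏 (a x FP.≟ k)) ≤ 𝟙
      fibre≤1 k = at-most-one EA (λ x → a x FP.≟ k) (λ p q → a-injective (trans p (sym q)))

      weighted-fibre : ∀ {u : A → 𝔽} {m} → 𝟘 ≤ m → (∀ x → u x ≤ m) → ∀ k → ∑ (elems EA) (λ x → 𝟏 (a x FP.≟ k) * u x) ≤ m
      weighted-fibre {u} {m} m≥0 h k = ≤-trans (∑-mono (elems EA) {g = λ x → 𝟏 (a x FP.≟ k) * m} (λ x → 𝟏-*-mono (a x FP.≟ k) (λ _ → h x)))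
        (≤-trans (≤-reflexive (∑-*ʳ (elems EA) m _)) (*-shrinkˡ (∑ (elems EA) (λ x → 𝟏 (a x FP.≟ k))) m (fibre≤1 k) m≥0))

      linear : ∀ {θ} (u : A → 𝔽) → (∀ x → 𝟘 ≤ u x) → (∀ x → u x ≤ θ) → 𝟘 ≤ θ → ∑ (elems EA) u ≤ 𝟙 → Stat θ
      linear {θ} u u≥0 u≤θ θ≥0 u-sum = record
        { T = λ ξ → ∑ (elems EA) (λ x → u x * ξ (a x))
        ; D = λ ξ → dd ; d = dd
        ; affine = λ ξ k y → trans (∑-cong (elems EA) (λ x → (ring (u x ∷ ξ (a x) ∷ 𝟏 (a x FP.≟ k) ∷ y ∷ ξ k ∷ []) (X0 ⊗ (X1 ⊕ X2 ⊗ (X3 ⊖ X4))) (X0 ⊗ X1 ⊕ (X3 ⊖ X4) ⊗ (X2 ⊗ X0)) refl)))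
            (trans (∑-+ (elems EA) _ _) (cong (∑ (elems EA) (λ x → u x * ξ (a x)) +_) (∑-*ˡ (elems EA) _ _)))
        ; D≥0 = λ _ k → ∑-nonNeg (elems EA) (λ x → *-nonNeg (𝟏-nonNeg (a x FP.≟ k)) (u≥0 x))
        ; D≤d = λ _ k → ≤-refl
        ; d≤θ = weighted-fibre θ≥0 u≤θ
        ; d-sum = ≤-trans (≤-reflexive (Enum.fibres (enumFin K) (elems EA) a u)) (farkas (∑ (elems EA) u ∷ []) (X0 ≼ # 1 ∷ []) X0 (# 2) 0 (1 ∙1 ∷ 1 ∙ 0 ∷ []) refl (u-sum ∷ [])) }
        where
        dd : Fin K → 𝔽
        dd k = ∑ (elems EA) (λ x → 𝟏 (a x FP.≟ k) * u x)

      -- A coordinate that occurred twice in one product would enter quadratically. The last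
      -- hypothesis excludes this wherever the weight u is not 0, so the statistic is still affine
      -- in each coordinate.
      bilinear : ∀ {θ} (b : A → Fin K) → (∀ {x y} → b x ≡ b y → x ≡ y) → (u : 𝔽) → 𝟘 ≤ u → ι 2 * u ≤ θ → ι (length (elems EA)) * u ≤ 𝟙 →
                 (∀ x k → u * (𝟏 (a x FP.≟ k) * 𝟏 (b x FP.≟ k)) ≡ 𝟘) → Stat θ
      bilinear {θ} b b-injective u u≥0 u≤θ u-sum disjoint = record
        { T = λ ξ → ∑ (elems EA) (λ x → u * (ξ (a x) * ξ (b x)))
        ; D = λ ξ k → ∑ (elems EA) (λ x → u * (𝟏 (a x FP.≟ k) * ξ (b x) + 𝟏 (b x FP.≟ k) * ξ (a x)))
        ; d = dd
        ; affine = λ ξ k y → trans (∑-cong (elems EA) (λ x → trans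
            (ring (u ∷ ξ (a x) ∷ 𝟏 (a x FP.≟ k) ∷ y ∷ ξ k ∷ ξ (b x) ∷ 𝟏 (b x FP.≟ k) ∷ []) (X0 ⊗ ((X1 ⊕ X2 ⊗ (X3 ⊖ X4)) ⊗ (X5 ⊕ X6 ⊗ (X3 ⊖ X4)))) (X0 ⊗ (X1 ⊗ X5) ⊕ (X3 ⊖ X4) ⊗ (X0 ⊗ (X2 ⊗ X5 ⊕ X6 ⊗ X1)) ⊕ (X3 ⊖ X4) ⊗ (X3 ⊖ X4) ⊗ (X0 ⊗ (X2 ⊗ X6))) refl)
            (trans (cong (λ z → u * (ξ (a x) * ξ (b x)) + (y - ξ k) * (u * (𝟏 (a x FP.≟ k) * ξ (b x) + 𝟏 (b x FP.≟ k) * ξ (a x))) + (y - ξ k) * (y - ξ k) * z) (disjoint x k))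
              (ring (u ∷ ξ (a x) ∷ ξ (b x) ∷ y ∷ ξ k ∷ 𝟏 (a x FP.≟ k) ∷ 𝟏 (b x FP.≟ k) ∷ []) (X0 ⊗ (X1 ⊗ X2) ⊕ (X3 ⊖ X4) ⊗ (X0 ⊗ (X5 ⊗ X2 ⊕ X6 ⊗ X1)) ⊕ (X3 ⊖ X4) ⊗ (X3 ⊖ X4) ⊗ # 0) (X0 ⊗ (X1 ⊗ X2) ⊕ (X3 ⊖ X4) ⊗ (X0 ⊗ (X5 ⊗ X2 ⊕ X6 ⊗ X1))) refl))))
            (trans (∑-+ (elems EA) _ _) (cong (∑ (elems EA) (λ x → u * (ξ (a x) * ξ (b x))) +_) (∑-*ˡ (elems EA) _ _)))
        ; D≥0 = λ {ξ} h k → ∑-nonNeg (elems EA) (λ x → *-nonNeg u≥0 (subst (_≤ 𝟏 (a x FP.≟ k) * ξ (b x) + 𝟏 (b x FP.≟ k) * ξ (a x)) (+-identityˡ 𝟘) (+-mono-≤ (*-nonNeg (𝟏-nonNeg (a x FP.≟ k)) (proj₁ (h (b x)))) (*-nonNeg (𝟏-nonNeg (b x FP.≟ k)) (proj₁ (h (a x)))))))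
        ; D≤d = λ {ξ} h k → ∑-mono (elems EA) (λ x → (farkas (u ∷ 𝟏 (a x FP.≟ k) ∷ ξ (b x) ∷ 𝟏 (b x FP.≟ k) ∷ ξ (a x) ∷ []) (# 0 ≼ X0 ⊗ X1 ∷ # 0 ≼ X0 ⊗ X3 ∷ X2 ≼ # 1 ∷ X4 ≼ # 1 ∷ []) (X0 ⊗ (X1 ⊗ X2 ⊕ X3 ⊗ X4)) (X0 ⊗ (X1 ⊕ X3)) 0 (1 ∙ 0 · 2 ∷ 1 ∙ 1 · 3 ∷ []) refl ((*-nonNeg u≥0 (𝟏-nonNeg (a x FP.≟ k))) ∷ (*-nonNeg u≥0 (𝟏-nonNeg (b x FP.≟ k))) ∷ (proj₂ (h (b x))) ∷ (proj₂ (h (a x))) ∷ [])))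
        ; d≤θ = λ k → ≤-trans (≤-reflexive (trans (∑-*ˡ (elems EA) u _) (cong (u *_) (∑-+ (elems EA) _ _)))) (farkas (u ∷ Sa k ∷ Sb k ∷ θ ∷ []) (# 2 ⊗ X0 ≼ X3 ∷ # 0 ≼ X0 ∷ X1 ≼ # 1 ∷ X2 ≼ # 1 ∷ []) (X0 ⊗ (X1 ⊕ X2)) X3 0 (1 ∙ 0 ∷ 1 ∙ 1 · 2 ∷ 1 ∙ 1 · 3 ∷ []) refl (u≤θ ∷ u≥0 ∷ (fibre≤1 k) ∷ (at-most-one EA (λ x → b x FP.≟ k) (λ p q → b-injective (trans p (sym q)))) ∷ []))
        ; d-sum = ≤-trans (≤-reflexive (trans (∑-swap colours (elems EA) _) (trans (∑-cong (elems EA) (λ x → trans (∑-*ˡ colours u _) (trans (cong (u *_) (trans (∑-+ colours _ _) (cong₂ _+_ (Enum.pick-1′ (enumFin K) (a x)) (Enum.pick-1′ (enumFin K) (b x))))) (ring (u ∷ []) (X0 ⊗ (# 1 ⊕ # 1)) (# 2 ⊗ X0) refl)))) (∑-const (elems EA) (ι 2 * u)))))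
            (farkas (ι (length (elems EA)) ∷ u ∷ []) (X0 ⊗ X1 ≼ # 1 ∷ []) (X0 ⊗ (# 2 ⊗ X1)) (# 2) 0 (2 ∙ 0 ∷ []) refl (u-sum ∷ [])) }
        where
        Sa Sb dd : Fin K → 𝔽
        Sa k = ∑ (elems EA) (λ x → 𝟏 (a x FP.≟ k))
        Sb k = ∑ (elems EA) (λ x → 𝟏 (b x FP.≟ k))
        dd k = ∑ (elems EA) (λ x → u * (𝟏 (a x FP.≟ k) + 𝟏 (b x FP.≟ k)))

    module _ {Ix : Set} (EI : Enum Ix) (N : ℕ) {θ q R s lam : 𝔽} (stat : Ix → Stat θ)
      (θ≥0 : 𝟘 ≤ θ) (q≥0 : 𝟘 ≤ q) (q≤1 : q ≤ 𝟙) (R≥0 : 𝟘 ≤ R) (R≡ : R ≡ s * lam) (s≥1 : 𝟙 ≤ s) (N≥1 : 𝟙 ≤ ι N)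
      (small : ι N * (ι 2 * (s * θ)) ≤ 𝟙)
      (budget : ι 2 * (ι 5 * (ι N * ι N) * (s * s * θ) * ι 2) ≤ 𝟙)
      (R-large : ¬ (𝟙 + R * R) ^ N ≤ ι 2 * ι (length (elems EI))) where
      open Potential N

      private
        s≥0 : 𝟘 ≤ s
        s≥0 = ≤-trans 0≤1 s≥1

        ξ₀ : Fin K → 𝔽
        ξ₀ _ = q

        X : Ix → ℕ → (Fin K → 𝔽) → 𝔽
        X τ _ ξ = s * (Stat.T (stat τ) ξ - Stat.T (stat τ) ξ₀)

        -- The variance spent so far, up to the factor `weight`: each coordinate is charged its own
        -- influence instead of a uniform share, because there may be far more coordinates than the
        -- total influence 2 would allow at θ each.
        past : Ix → ℕ → 𝔽
        past τ j = ∑ colours (λ k → 𝟏 (toℕ k ℕP.<? j) * Stat.d (stat τ) k)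

        weight : 𝔽
        weight = ι 5 * (ι N * ι N) * (s * s * θ)

        weight≥0 : 𝟘 ≤ weight
        weight≥0 = (farkas (ι N ∷ s ∷ θ ∷ []) (# 0 ≼ X0 ⊗ X0 ⊗ (X1 ⊗ X1 ⊗ X2) ∷ []) (# 0) (# 5 ⊗ (X0 ⊗ X0) ⊗ (X1 ⊗ X1 ⊗ X2)) 0 (5 ∙ 0 ∷ []) refl ((*-nonNeg (square-nonNeg (ι N)) (*-nonNeg (square-nonNeg s) θ≥0)) ∷ []))

        record Invariant (j : ℕ) (ξ : Fin K → 𝔽) : Set where
          field
            decided : ∀ k → toℕ k ℕ.< j → ξ k ≡ 𝟘 ⊎ ξ k ≡ 𝟙
            undecided : ∀ k → ¬ toℕ k ℕ.< j → ξ k ≡ q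
            unit : Unit ξ

        d≥0 : ∀ τ k → 𝟘 ≤ Stat.d (stat τ) k
        d≥0 τ k = ≤-trans (Stat.D≥0 (stat τ) {ξ₀} (λ _ → q≥0 , q≤1) k) (Stat.D≤d (stat τ) {ξ₀} (λ _ → q≥0 , q≤1) k)

        past≥0 : ∀ τ j → 𝟘 ≤ past τ j
        past≥0 τ j = ∑-nonNeg colours (λ k → *-nonNeg (𝟏-nonNeg (toℕ k ℕP.<? j)) (d≥0 τ k))

        past≤2 : ∀ τ j → past τ j ≤ ι 2
        past≤2 τ j = ≤-trans (∑-mono colours (λ k → (*-shrinkˡ (𝟏 (toℕ k ℕP.<? j)) (Stat.d (stat τ) k) (𝟏-≤1 (toℕ k ℕP.<? j)) (d≥0 τ k)))) (Stat.d-sum (stat τ))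

        module Turn {j} (j<K : j ℕ.< K) {ξ} (inv : Invariant j ξ) where
          open Invariant inv
          k₀ = Data.Fin.fromℕ< j<K
          toℕ-k₀ : toℕ k₀ ≡ j
          toℕ-k₀ = FP.toℕ-fromℕ< j<K
          ξk₀ : ξ k₀ ≡ q
          ξk₀ = undecided k₀ (λ h → ℕP.<-irrefl (toℕ-k₀) h)

          choice prob : Bool → 𝔽
          choice true = 𝟙
          choice false = 𝟘
          prob true = q
          prob false = 𝟙 - q

          ∑-choices : ∀ f → ∑ (true ∷ false ∷ []) f ≡ f true + f false
          ∑-choices f = (ring (f true ∷ f false ∷ []) (X0 ⊕ (X1 ⊕ # 0)) (X0 ⊕ X1) refl)

          prob≥0 : ∀ o → 𝟘 ≤ prob o
          prob≥0 true = q≥0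
          prob≥0 false = (complement-nonNeg q q≤1)

          next : Bool → Fin K → 𝔽
          next o = upd ξ k₀ (choice o)

          next-same : ∀ o k → k ≡ k₀ → next o k ≡ choice o
          next-same o k e = trans (cong₂ (λ y z → y + z * (choice o - ξ k₀)) (cong ξ e) (𝟏-yes (k FP.≟ k₀) e)) (ring (ξ k₀ ∷ choice o ∷ []) (X0 ⊕ # 1 ⊗ (X1 ⊖ X0)) X1 refl)

          next-other : ∀ o k → k ≢ k₀ → next o k ≡ ξ k
          next-other o k ne = trans (cong (λ z → ξ k + z * (choice o - ξ k₀)) (𝟏-no (k FP.≟ k₀) ne)) (ring (ξ k ∷ choice o ∷ ξ k₀ ∷ []) (X0 ⊕ # 0 ⊗ (X1 ⊖ X2)) X0 refl)

          choice-01 : ∀ o → choice o ≡ 𝟘 ⊎ choice o ≡ 𝟙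
          choice-01 true = inj₂ refl
          choice-01 false = inj₁ refl

          choice-unit : ∀ o → 𝟘 ≤ choice o × choice o ≤ 𝟙
          choice-unit true = 0≤1 , ≤-refl
          choice-unit false = ≤-refl , 0≤1

          invariant : ∀ o → Invariant (suc j) (next o)
          invariant o = record { decided = dec ; undecided = undec ; unit = un }
            where
            dec : ∀ k → toℕ k ℕ.< suc j → next o k ≡ 𝟘 ⊎ next o k ≡ 𝟙
            dec k lt with k FP.≟ k₀
            ... | yes e = subst (λ z → z ≡ 𝟘 ⊎ z ≡ 𝟙) (sym (trans (cong (λ y → y + 𝟙 * (choice o - ξ k₀)) (cong ξ e)) (ring (ξ k₀ ∷ choice o ∷ []) (X0 ⊕ # 1 ⊗ (X1 ⊖ X0)) X1 refl))) (choice-01 o)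
            ... | no ne = subst (λ z → z ≡ 𝟘 ⊎ z ≡ 𝟙) (ring (ξ k ∷ choice o ∷ ξ k₀ ∷ []) X0 (X0 ⊕ # 0 ⊗ (X1 ⊖ X2)) refl) (decided k (ℕP.≤∧≢⇒< (ℕP.≤-pred lt) (λ e → ne (FP.toℕ-injective (trans e (sym toℕ-k₀))))))
            undec : ∀ k → ¬ toℕ k ℕ.< suc j → next o k ≡ q
            undec k h = trans (next-other o k (λ e → h (ℕP.≤-reflexive (cong suc (trans (cong toℕ e) toℕ-k₀))))) (undecided k (λ l → h (ℕP.m≤n⇒m≤1+n l)))
            un : Unit (next o)
            un k = by (k FP.≟ k₀)
              where
              by : Dec (k ≡ k₀) → 𝟘 ≤ next o k × next o k ≤ 𝟙
              by (yes e) = subst (λ z → 𝟘 ≤ z × z ≤ 𝟙) (sym (next-same o k e)) (choice-unit o)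
              by (no ne) = subst (λ z → 𝟘 ≤ z × z ≤ 𝟙) (sym (next-other o k ne)) (unit k)

          module _ (τ : Ix) where
            open Stat (stat τ)
            D₀ = D ξ k₀
            dk = d k₀
            δ : Bool → 𝔽
            δ o = X τ (suc j) (next o) - X τ j ξ
            δ-eq : ∀ o → δ o ≡ s * ((choice o - q) * D₀)
            δ-eq o = trans (cong (λ z → s * (z - T ξ₀) - s * (T ξ - T ξ₀)) (trans (affine ξ k₀ (choice o)) (cong (λ y → T ξ + (choice o - y) * D₀) ξk₀))) (ring (s ∷ T ξ ∷ choice o ∷ q ∷ D₀ ∷ T ξ₀ ∷ []) (X0 ⊗ (X1 ⊕ (X2 ⊖ X3) ⊗ X4 ⊖ X5) ⊖ X0 ⊗ (X1 ⊖ X5)) (X0 ⊗ ((X2 ⊖ X3) ⊗ X4)) refl)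
            D₀≥0 : 𝟘 ≤ D₀
            D₀≥0 = D≥0 unit k₀
            D₀≤dk : D₀ ≤ dk
            D₀≤dk = D≤d unit k₀
            D₀≤θ : D₀ ≤ θ
            D₀≤θ = ≤-trans D₀≤dk (d≤θ k₀)
            sD≥0 : 𝟘 ≤ s * D₀
            sD≥0 = *-nonNeg s≥0 D₀≥0
            sD≤sθ : s * D₀ ≤ s * θ
            sD≤sθ = (*-monoʳ-≤ s D₀ θ s≥0 D₀≤θ)
            abs : ∀ o → 𝟘 - 𝟙 ≤ choice o - q × choice o - q ≤ 𝟙
            abs true = (farkas (q ∷ []) (X0 ≼ # 1 ∷ []) (# 0 ⊖ # 1) (# 1 ⊖ X0) 0 (1 ∙1 ∷ 1 ∙ 0 ∷ []) refl (q≤1 ∷ [])) , (complement-≤1 q q≥0)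
            abs false = (farkas (q ∷ []) (X0 ≼ # 1 ∷ []) (# 0 ⊖ # 1) (# 0 ⊖ X0) 0 (1 ∙ 0 ∷ []) refl (q≤1 ∷ [])) , (farkas (q ∷ []) (# 0 ≼ X0 ∷ []) (# 0 ⊖ X0) (# 1) 0 (1 ∙1 ∷ 1 ∙ 0 ∷ []) refl (q≥0 ∷ []))
            mean : ∑ (true ∷ false ∷ []) (λ o → prob o * δ o) ≡ 𝟘
            mean = trans (∑-choices (λ o → prob o * δ o)) (trans (cong₂ (λ y z → q * y + (𝟙 - q) * z) (δ-eq true) (δ-eq false)) (ring (q ∷ s ∷ D₀ ∷ []) (X0 ⊗ (X1 ⊗ ((# 1 ⊖ X0) ⊗ X2)) ⊕ (# 1 ⊖ X0) ⊗ (X1 ⊗ ((# 0 ⊖ X0) ⊗ X2))) (# 0) refl))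
            δ² : ∀ o → δ o * δ o ≤ s * s * θ * dk
            δ² o = subst (λ z → z * z ≤ s * s * θ * dk) (sym (δ-eq o)) (≤-trans
              (farkas (s ∷ a ∷ D₀ ∷ []) (# 0 ⊖ # 1 ≼ X1 ∷ X1 ≼ # 1 ∷ # 0 ≼ X0 ⊗ X2 ⊗ (X0 ⊗ X2) ∷ []) (X0 ⊗ (X1 ⊗ X2) ⊗ (X0 ⊗ (X1 ⊗ X2))) (X0 ⊗ X0 ⊗ (X2 ⊗ X2)) 0 (1 ∙ 0 · 1 · 2 ∷ []) refl ((proj₁ (abs o)) ∷ (proj₂ (abs o)) ∷ (square-nonNeg (s * D₀)) ∷ []))
              (farkas (s ∷ D₀ ∷ θ ∷ dk ∷ []) (# 0 ≼ X0 ⊗ X0 ∷ X1 ⊗ X1 ≼ X2 ⊗ X3 ∷ []) (X0 ⊗ X0 ⊗ (X1 ⊗ X1)) (X0 ⊗ X0 ⊗ X2 ⊗ X3) 0 (1 ∙ 0 · 1 ∷ []) refl ((square-nonNeg s) ∷ (*-mono-≤ D₀≥0 D₀≥0 D₀≤θ D₀≤dk) ∷ [])))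
              where a = choice o - q
            past-step : past τ (suc j) ≡ past τ j + dk
            past-step = trans (∑-cong colours (λ k → trans (cong (_* d k) (ind k)) (*-distribʳ-+ (d k) _ _))) (trans (∑-+ colours _ _) (cong (past τ j +_) (Enum.pick (enumFin K) d k₀)))
              where
              ind : ∀ k → 𝟏 (toℕ k ℕP.<? suc j) ≡ 𝟏 (toℕ k ℕP.<? j) + 𝟏 (k FP.≟ k₀)
              ind k = by (k FP.≟ k₀)
                where
                by : (e : Dec (k ≡ k₀)) → 𝟏 (toℕ k ℕP.<? suc j) ≡ 𝟏 (toℕ k ℕP.<? j) + 𝟏 e
                by (yes e) = trans (𝟏-yes (toℕ k ℕP.<? suc j) (ℕP.≤-reflexive (cong suc k≡j))) (trans (ring [] (# 1) (# 0 ⊕ # 1) refl) (cong (_+ 𝟙) (sym (𝟏-no (toℕ k ℕP.<? j) (ℕP.<-irrefl k≡j)))))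
                  where
                  k≡j : toℕ k ≡ j
                  k≡j = trans (cong toℕ e) toℕ-k₀
                by (no ne) = trans (𝟏-cong (toℕ k ℕP.<? suc j) (toℕ k ℕP.<? j) (λ lt → ℕP.≤∧≢⇒< (ℕP.≤-pred lt) (λ e → ne (FP.toℕ-injective (trans e (sym toℕ-k₀))))) ℕP.m≤n⇒m≤1+n) (ring (𝟏 (toℕ k ℕP.<? j) ∷ []) X0 (X0 ⊕ # 0) refl)

            increment : Increment (true ∷ false ∷ []) prob (X τ j ξ) (λ o → X τ (suc j) (next o)) (weight * past τ (suc j) - weight * past τ j)
            increment = record
              { d = s * θ ; μ = 𝟘 ; v = s * s * θ * dk
              ; d≥0 = *-nonNeg s≥0 θ≥0
              ; d≤1 = (farkas (s ∷ θ ∷ ι N ∷ []) (X2 ⊗ (# 2 ⊗ (X0 ⊗ X1)) ≼ # 1 ∷ # 1 ≼ X2 ∷ # 0 ≼ X0 ⊗ X1 ∷ []) (X0 ⊗ X1) (# 1) 1 (1 ∙1 ∷ 1 ∙ 0 ∷ 2 ∙ 1 · 2 ∷ []) refl (small ∷ N≥1 ∷ (*-nonNeg s≥0 θ≥0) ∷ []))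
              ; small = small
              ; lower = λ o → subst (𝟘 - s * θ ≤_) (sym (δ-eq o)) (farkas (s ∷ θ ∷ choice o ∷ q ∷ D₀ ∷ []) (# 0 ⊖ # 1 ≼ X2 ⊖ X3 ∷ # 0 ≼ X0 ⊗ X4 ∷ X0 ⊗ X4 ≼ X0 ⊗ X1 ∷ []) (# 0 ⊖ X0 ⊗ X1) (X0 ⊗ ((X2 ⊖ X3) ⊗ X4)) 0 (1 ∙ 2 ∷ 1 ∙ 0 · 1 ∷ []) refl ((proj₁ (abs o)) ∷ sD≥0 ∷ sD≤sθ ∷ []))
              ; upper = λ o → subst (_≤ s * θ) (sym (δ-eq o)) (farkas (s ∷ choice o ∷ q ∷ D₀ ∷ θ ∷ []) (X1 ⊖ X2 ≼ # 1 ∷ # 0 ≼ X0 ⊗ X3 ∷ X0 ⊗ X3 ≼ X0 ⊗ X4 ∷ []) (X0 ⊗ ((X1 ⊖ X2) ⊗ X3)) (X0 ⊗ X4) 0 (1 ∙ 2 ∷ 1 ∙ 0 · 1 ∷ []) refl ((proj₂ (abs o)) ∷ sD≥0 ∷ sD≤sθ ∷ []))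
              ; drift-lower = (farkas (m ∷ []) (# 0 ≼ X0 ∷ []) (# 0 ⊖ # 0) X0 0 (1 ∙ 0 ∷ []) refl ((≥-reflexive (mean)) ∷ []))
              ; drift-upper = ≤-reflexive mean
              ; variance = ≤-trans (∑-mono (true ∷ false ∷ []) {g = λ o → prob o * (s * s * θ * dk)} (λ o → (farkas (prob o ∷ δ o ∷ s ∷ θ ∷ dk ∷ []) (# 0 ≼ X0 ∷ X1 ⊗ X1 ≼ X2 ⊗ X2 ⊗ X3 ⊗ X4 ∷ []) (X0 ⊗ (X1 ⊗ X1)) (X0 ⊗ (X2 ⊗ X2 ⊗ X3 ⊗ X4)) 0 (1 ∙ 0 · 1 ∷ []) refl ((prob≥0 o) ∷ (δ² o) ∷ []))))
                  (≤-reflexive (trans (∑-choices (λ o → prob o * (s * s * θ * dk))) (ring (q ∷ s ∷ θ ∷ dk ∷ []) (X0 ⊗ (X1 ⊗ X1 ⊗ X2 ⊗ X3) ⊕ (# 1 ⊖ X0) ⊗ (X1 ⊗ X1 ⊗ X2 ⊗ X3)) (X1 ⊗ X1 ⊗ X2 ⊗ X3) refl)))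
              ; within = ≤-reflexive (trans (ring (ι N ∷ s ∷ θ ∷ dk ∷ past τ j ∷ []) (X0 ⊗ # 0 ⊕ # 5 ⊗ (X0 ⊗ X0) ⊗ (X1 ⊗ X1 ⊗ X2 ⊗ X3)) (# 5 ⊗ (X0 ⊗ X0) ⊗ (X1 ⊗ X1 ⊗ X2) ⊗ (X4 ⊕ X3) ⊖ # 5 ⊗ (X0 ⊗ X0) ⊗ (X1 ⊗ X1 ⊗ X2) ⊗ X4) refl) (cong (λ z → weight * z - weight * past τ j) (sym past-step))) }
              where
              m = ∑ (true ∷ false ∷ []) (λ o → prob o * δ o)

          round : Round X (λ τ i → weight * past τ i) Invariant j ξ
          round = record { os = true ∷ false ∷ [] ; p = prob ; next = next ; p≥0 = prob≥0 ; sum-p = trans (∑-choices prob) (ring (q ∷ []) (X0 ⊕ (# 1 ⊖ X0)) (# 1) refl)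
            ; invariant = λ {o} _ → invariant o ; increment = increment }

      assignment : ∃ λ ξ → (∀ k → ξ k ≡ 𝟘 ⊎ ξ k ≡ 𝟙) ×
        (∀ τ → Stat.T (stat τ) (λ _ → q) - lam ≤ Stat.T (stat τ) ξ × Stat.T (stat τ) ξ ≤ Stat.T (stat τ) (λ _ → q) + lam)
      assignment = conclude (tracking (elems EI) X (λ τ i → weight * past τ i) Invariant R K R-large R≥0
          (λ τ i _ → *-nonNeg weight≥0 (past≥0 τ i))
          (λ τ i _ → (farkas (weight ∷ past τ i ∷ []) (# 2 ⊗ (X0 ⊗ # 2) ≼ # 1 ∷ # 0 ≼ X0 ∷ X1 ≼ # 2 ∷ []) (# 2 ⊗ (X0 ⊗ X1)) (# 1) 0 (1 ∙ 0 ∷ 2 ∙ 1 · 2 ∷ []) refl (budget ∷ weight≥0 ∷ (past≤2 τ i) ∷ [])))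
          ξ₀ (record { decided = λ _ () ; undecided = λ _ _ → refl ; unit = λ _ → q≥0 , q≤1 })
          (λ τ → (ring (s ∷ Stat.T (stat τ) ξ₀ ∷ []) (X0 ⊗ (X1 ⊖ X1)) (# 0) refl)) (elem-∈ EI)
          (λ j j<K ξ inv _ → Turn.round j<K inv))
        where
        conclude : (∃ λ ξ → Invariant K ξ × (∀ τ → X τ K ξ * X τ K ξ ≤ R * R)) → ∃ λ ξ → (∀ k → ξ k ≡ 𝟘 ⊎ ξ k ≡ 𝟙) ×
          (∀ τ → Stat.T (stat τ) (λ _ → q) - lam ≤ Stat.T (stat τ) ξ × Stat.T (stat τ) ξ ≤ Stat.T (stat τ) (λ _ → q) + lam)
        conclude (ξ , inv , tr) = ξ , (λ k → Invariant.decided inv k (FP.toℕ<n k)) , λ τ →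
          (farkas (Stat.T (stat τ) ξ₀ ∷ lam ∷ Stat.T (stat τ) ξ ∷ []) (# 0 ⊖ X1 ≼ X2 ⊖ X0 ∷ []) (X0 ⊖ X1) X2 0 (1 ∙ 0 ∷ []) refl ((*-cancelˡ-≤ s≥1 (farkas (s ∷ lam ∷ Stat.T (stat τ) ξ ∷ Stat.T (stat τ) ξ₀ ∷ R ∷ []) (# 0 ⊖ X4 ≼ X0 ⊗ (X2 ⊖ X3) ∷ X4 ≼ X0 ⊗ X1 ∷ []) (X0 ⊗ (# 0 ⊖ X1)) (X0 ⊗ (X2 ⊖ X3)) 0 (1 ∙ 0 ∷ 1 ∙ 1 ∷ []) refl ((square-≥ R≥0 (tr τ)) ∷ (≤-reflexive (R≡)) ∷ []))) ∷ [])) ,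
          (farkas (Stat.T (stat τ) ξ ∷ Stat.T (stat τ) ξ₀ ∷ lam ∷ []) (X0 ⊖ X1 ≼ X2 ∷ []) X0 (X1 ⊕ X2) 0 (1 ∙ 0 ∷ []) refl ((*-cancelˡ-≤ s≥1 (subst (s * (Stat.T (stat τ) ξ - Stat.T (stat τ) ξ₀) ≤_) R≡ (square-≤ R≥0 (tr τ)))) ∷ []))

  -- Weights that favour the small colours

  length-allFin : ∀ n → length (allFin n) ≡ n
  length-allFin n = LP.length-tabulate (λ (i : Fin n) → i)

  ∑-Fin-const : ∀ n a → ∑ (allFin n) (λ _ → a) ≡ ι n * a
  ∑-Fin-const n a = trans (∑-const (allFin n) a) (cong (λ m → ι m * a) (length-allFin n))

  module Weighting {n K : ℕ} (c : Fin n → Fin n → Fin K)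
    (row-proper : ∀ i {j j′} → c i j ≡ c i j′ → j ≡ j′) (col-proper : ∀ j {i i′} → c i j ≡ c i′ j → i ≡ i′)
    (t : ℕ) (ν τ γ : 𝔽) (νn : ν * ι n ≡ 𝟙) (νt : ν * ι t ≡ 𝟙 - γ) (ν≥0 : 𝟘 ≤ ν) (τ≥0 : 𝟘 ≤ τ) (2τ≤1 : ι 2 * τ ≤ 𝟙) (4τ≤γ : ι 4 * τ ≤ γ) where

    private
      Fn = allFin n

    size : Fin K → 𝔽
    size k = ∑ Fn (λ i → ∑ Fn (λ j → 𝟏 (c i j FP.≟ k)))

    huge? : ∀ k → Dec (¬ size k ≤ ι t)
    huge? k = ¬? (size k ≤? ι t)

    row-fibre : ∀ i k → ∑ Fn (λ j → 𝟏 (c i j FP.≟ k)) ≤ 𝟙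
    row-fibre i k = at-most-one (enumFin n) (λ j → c i j FP.≟ k) (λ p q → row-proper i (trans p (sym q)))

    col-fibre : ∀ j k → ∑ Fn (λ i → 𝟏 (c i j FP.≟ k)) ≤ 𝟙
    col-fibre j k = at-most-one (enumFin n) (λ i → c i j FP.≟ k) (λ p q → col-proper j (trans p (sym q)))

    private
      hu : Fin n → Fin n → 𝔽
      hu i j = 𝟏 (huge? (c i j))
      h h′ : Fin n → 𝔽
      h i = ∑ Fn (hu i)
      h′ j = ∑ Fn (λ i → hu i j)
      H = ∑ Fn h

      -- Minus the doubly centred indicator of the cells with huge colours. All its row and column
      -- sums vanish, so the weights stay doubly stochastic for every τ.
      z : Fin n → Fin n → 𝔽
      z i j = ν * h i + ν * h′ j - ν * (ν * H) - hu i j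

    weight : Fin n → Fin n → 𝔽
    weight i j = ν * (𝟙 + τ * z i j)

    module _ (few-huge : ∑ (allFin K) (λ k → 𝟏 (huge? k)) ≤ ι t) where
      private
        n≥0 : 𝟘 ≤ ι n
        n≥0 = 0≤ι n

        sum-ones : ∑ Fn (λ _ → 𝟙) ≡ ι n
        sum-ones = trans (∑-Fin-const n 𝟙) (*-identityʳ (ι n))

        νsum≤1 : ∀ {f : Fin n → 𝔽} → (∀ i → f i ≤ 𝟙) → ν * ∑ Fn f ≤ 𝟙
        νsum≤1 {f} q = (farkas (ν ∷ ∑ Fn f ∷ ι n ∷ []) (X0 ⊗ X2 ≼ # 1 ∷ X1 ≼ X2 ∷ # 0 ≼ X0 ∷ []) (X0 ⊗ X1) (# 1) 0 (1 ∙ 0 ∷ 1 ∙ 1 · 2 ∷ []) refl ((≤-reflexive (νn)) ∷ (subst (∑ Fn f ≤_) sum-ones (∑-mono Fn q)) ∷ ν≥0 ∷ []))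

        size≤n : ∀ k → size k ≤ ι n
        size≤n k = subst (size k ≤_) sum-ones (∑-mono Fn (λ i → row-fibre i k))

        H′ : ∑ Fn h′ ≡ H
        H′ = ∑-swap Fn Fn (λ j i → hu i j)

        H-by-colour : H ≡ ∑ (allFin K) (λ k → 𝟏 (huge? k) * size k)
        H-by-colour = trans (∑-cong Fn (λ i → ∑-cong Fn (λ j → sym (Enum.pick′ (enumFin K) (λ k → 𝟏 (huge? k)) (c i j)))))
          (trans (∑-cong Fn (λ i → ∑-swap Fn (allFin K) _)) (trans (∑-swap Fn (allFin K) _) (∑-cong (allFin K) (λ k →
            trans (∑-cong Fn (λ i → ∑-*ʳ Fn (𝟏 (huge? k)) _)) (trans (∑-*ʳ Fn (𝟏 (huge? k)) _) (*-comm _ _))))))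

        H≤ : H ≤ ι n * ι t
        H≤ = ≤-trans (≤-reflexive H-by-colour) (≤-trans (∑-mono (allFin K) (λ k → (farkas (𝟏 (huge? k) ∷ size k ∷ ι n ∷ []) (# 0 ≼ X0 ∷ X1 ≼ X2 ∷ []) (X0 ⊗ X1) (X2 ⊗ X0) 0 (1 ∙ 0 · 1 ∷ []) refl ((𝟏-nonNeg (huge? k)) ∷ (size≤n k) ∷ []))))
          (≤-trans (≤-reflexive (∑-*ˡ (allFin K) (ι n) _)) (farkas (ι n ∷ s ∷ ι t ∷ []) (X1 ≼ X2 ∷ # 0 ≼ X0 ∷ []) (X0 ⊗ X1) (X0 ⊗ X2) 0 (1 ∙ 0 · 1 ∷ []) refl (few-huge ∷ n≥0 ∷ []))))
          where s = ∑ (allFin K) (λ k → 𝟏 (huge? k))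

        hu≥0 : ∀ i j → 𝟘 ≤ hu i j
        hu≥0 i j = 𝟏-nonNeg (huge? (c i j))
        hu≤1 : ∀ i j → hu i j ≤ 𝟙
        hu≤1 i j = 𝟏-≤1 (huge? (c i j))
        h≥0 : ∀ i → 𝟘 ≤ h i
        h≥0 i = ∑-nonNeg Fn (hu≥0 i)
        h′≥0 : ∀ j → 𝟘 ≤ h′ j
        h′≥0 j = ∑-nonNeg Fn (λ i → hu≥0 i j)
        H≥0 : 𝟘 ≤ H
        H≥0 = ∑-nonNeg Fn h≥0
        νh≤1 : ∀ i → ν * h i ≤ 𝟙
        νh≤1 i = νsum≤1 (hu≤1 i)
        νh′≤1 : ∀ j → ν * h′ j ≤ 𝟙
        νh′≤1 j = νsum≤1 (λ i → hu≤1 i j)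
        y = ν * (ν * H)
        -- Here `y` is the density of the cells with huge colours: there are at most t such colours,
        -- each with at most n cells, and t / n = 1 - γ.
        y≤ : y ≤ 𝟙 - γ
        y≤ = (farkas (ν ∷ H ∷ γ ∷ ι n ∷ ι t ∷ []) (X1 ≼ X3 ⊗ X4 ∷ # 0 ≼ X0 ⊗ X0 ∷ X0 ⊗ X3 ⊗ (X0 ⊗ X4) ≼ # 1 ⊗ (X0 ⊗ X4) ∷ X0 ⊗ X4 ≼ # 1 ⊖ X2 ∷ []) (X0 ⊗ (X0 ⊗ X1)) (# 1 ⊖ X2) 0 (1 ∙ 2 ∷ 1 ∙ 3 ∷ 1 ∙ 0 · 1 ∷ []) refl (H≤ ∷ (square-nonNeg ν) ∷ (≤-reflexive (cong (λ a → a * (ν * ι t)) νn)) ∷ (≤-reflexive (νt)) ∷ []))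
        y≥0 : 𝟘 ≤ y
        y≥0 = *-nonNeg ν≥0 (*-nonNeg ν≥0 H≥0)
        γ≥0 : 𝟘 ≤ γ
        γ≥0 = (farkas (γ ∷ τ ∷ []) (# 4 ⊗ X1 ≼ X0 ∷ # 0 ≼ X1 ∷ []) (# 0) X0 0 (1 ∙ 0 ∷ 4 ∙ 1 ∷ []) refl (4τ≤γ ∷ τ≥0 ∷ []))

        z≤2 : ∀ i j → z i j ≤ ι 2
        z≤2 i j = (farkas (ν ∷ h i ∷ h′ j ∷ H ∷ hu i j ∷ []) (X0 ⊗ X1 ≼ # 1 ∷ X0 ⊗ X2 ≼ # 1 ∷ # 0 ≼ X0 ⊗ (X0 ⊗ X3) ∷ # 0 ≼ X4 ∷ []) (X0 ⊗ X1 ⊕ X0 ⊗ X2 ⊖ X0 ⊗ (X0 ⊗ X3) ⊖ X4) (# 2) 0 (1 ∙ 0 ∷ 1 ∙ 1 ∷ 1 ∙ 2 ∷ 1 ∙ 3 ∷ []) refl ((νh≤1 i) ∷ (νh′≤1 j) ∷ y≥0 ∷ (hu≥0 i j) ∷ []))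
        z≥-2 : ∀ i j → 𝟘 - ι 2 ≤ z i j
        z≥-2 i j = (farkas (ν ∷ h i ∷ h′ j ∷ H ∷ hu i j ∷ γ ∷ []) (# 0 ≼ X0 ⊗ X1 ∷ # 0 ≼ X0 ⊗ X2 ∷ X0 ⊗ (X0 ⊗ X3) ≼ # 1 ⊖ X5 ∷ # 0 ≼ X5 ∷ X4 ≼ # 1 ∷ []) (# 0 ⊖ # 2) (X0 ⊗ X1 ⊕ X0 ⊗ X2 ⊖ X0 ⊗ (X0 ⊗ X3) ⊖ X4) 0 (1 ∙ 0 ∷ 1 ∙ 1 ∷ 1 ∙ 2 ∷ 1 ∙ 3 ∷ 1 ∙ 4 ∷ []) refl ((*-nonNeg ν≥0 (h≥0 i)) ∷ (*-nonNeg ν≥0 (h′≥0 j)) ∷ y≤ ∷ γ≥0 ∷ (hu≤1 i j) ∷ []))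

        sum-weight : ∀ (f : Fin n → 𝔽) → ∑ Fn (λ i → ν * (𝟙 + τ * f i)) ≡ ν * ι n + ν * τ * ∑ Fn f
        sum-weight f = trans (∑-cong Fn (λ i → (ring (ν ∷ τ ∷ f i ∷ []) (X0 ⊗ (# 1 ⊕ X1 ⊗ X2)) (X0 ⊗ # 1 ⊕ X0 ⊗ X1 ⊗ X2) refl))) (trans (∑-+ Fn _ _) (cong₂ _+_ (trans (∑-*ˡ Fn ν _) (cong (ν *_) sum-ones)) (∑-*ˡ Fn (ν * τ) f)))

        sum-const : ∀ a → ∑ Fn (λ _ → a) ≡ ι n * a
        sum-const = ∑-Fin-const n

      weight-≥0 : ∀ i j → 𝟘 ≤ weight i j
      weight-≥0 i j = *-nonNeg ν≥0 (farkas (τ ∷ z i j ∷ []) (# 0 ⊖ # 2 ≼ X1 ∷ # 0 ≼ X0 ∷ # 2 ⊗ X0 ≼ # 1 ∷ []) (# 0) (# 1 ⊕ X0 ⊗ X1) 0 (1 ∙ 2 ∷ 1 ∙ 0 · 1 ∷ []) refl ((z≥-2 i j) ∷ τ≥0 ∷ 2τ≤1 ∷ []))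

      weight-≤ : ∀ i j → weight i j ≤ ν * (𝟙 + ι 2 * τ)
      weight-≤ i j = (farkas (ν ∷ τ ∷ z i j ∷ []) (# 0 ≼ X0 ⊗ X1 ∷ X2 ≼ # 2 ∷ []) (X0 ⊗ (# 1 ⊕ X1 ⊗ X2)) (X0 ⊗ (# 1 ⊕ # 2 ⊗ X1)) 0 (1 ∙ 0 · 1 ∷ []) refl ((*-nonNeg ν≥0 τ≥0) ∷ (z≤2 i j) ∷ []))

      weight-≤2ν : ∀ i j → weight i j ≤ ι 2 * ν
      weight-≤2ν i j = (farkas (weight i j ∷ ν ∷ τ ∷ []) (X0 ≼ X1 ⊗ (# 1 ⊕ # 2 ⊗ X2) ∷ # 0 ≼ X1 ∷ # 2 ⊗ X2 ≼ # 1 ∷ []) X0 (# 2 ⊗ X1) 0 (1 ∙ 0 ∷ 1 ∙ 1 · 2 ∷ []) refl ((weight-≤ i j) ∷ ν≥0 ∷ 2τ≤1 ∷ []))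

      row-sum : ∀ i → ∑ Fn (weight i) ≡ 𝟙
      row-sum i = trans (sum-weight (z i)) (trans (cong₂ (λ a b → a + ν * τ * b) νn zero-sum) (ring (ν ∷ τ ∷ []) (# 1 ⊕ X0 ⊗ X1 ⊗ # 0) (# 1) refl))
        where
        zero-sum : ∑ Fn (z i) ≡ 𝟘
        zero-sum = trans (∑-sub Fn _ _) (trans (cong (_- h i) (trans (∑-sub Fn _ _) (cong₂ _-_ (trans (∑-+ Fn _ _) (cong₂ _+_ (sum-const (ν * h i)) (trans (∑-*ˡ Fn ν h′) (cong (ν *_) H′)))) (sum-const y))))
          (trans (ring (ι n ∷ ν ∷ h i ∷ H ∷ []) (X0 ⊗ (X1 ⊗ X2) ⊕ X1 ⊗ X3 ⊖ X0 ⊗ (X1 ⊗ (X1 ⊗ X3)) ⊖ X2) (X1 ⊗ X0 ⊗ (X2 ⊖ X1 ⊗ X3) ⊕ X1 ⊗ X3 ⊖ X2) refl) (trans (cong (λ a → a * (h i - ν * H) + ν * H - h i) νn) (ring (h i ∷ ν ∷ H ∷ []) (# 1 ⊗ (X0 ⊖ X1 ⊗ X2) ⊕ X1 ⊗ X2 ⊖ X0) (# 0) refl))))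

      col-sum : ∀ j → ∑ Fn (λ i → weight i j) ≡ 𝟙
      col-sum j = trans (sum-weight (λ i → z i j)) (trans (cong₂ (λ a b → a + ν * τ * b) νn zero-sum) (ring (ν ∷ τ ∷ []) (# 1 ⊕ X0 ⊗ X1 ⊗ # 0) (# 1) refl))
        where
        zero-sum : ∑ Fn (λ i → z i j) ≡ 𝟘
        zero-sum = trans (∑-sub Fn _ _) (trans (cong (_- h′ j) (trans (∑-sub Fn _ _) (cong₂ _-_ (trans (∑-+ Fn _ _) (cong₂ _+_ (∑-*ˡ Fn ν h) (sum-const (ν * h′ j)))) (sum-const y))))
          (trans (ring (ν ∷ H ∷ ι n ∷ h′ j ∷ []) (X0 ⊗ X1 ⊕ X2 ⊗ (X0 ⊗ X3) ⊖ X2 ⊗ (X0 ⊗ (X0 ⊗ X1)) ⊖ X3) (X0 ⊗ X2 ⊗ (X3 ⊖ X0 ⊗ X1) ⊕ X0 ⊗ X1 ⊖ X3) refl) (trans (cong (λ a → a * (h′ j - ν * H) + ν * H - h′ j) νn) (ring (h′ j ∷ ν ∷ H ∷ []) (# 1 ⊗ (X0 ⊖ X1 ⊗ X2) ⊕ X1 ⊗ X2 ⊖ X0) (# 0) refl))))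

      private
        slack : (𝟙 - γ) * (𝟙 + ι 2 * τ) ≤ 𝟙 - ι 4 * (τ * τ)
        slack = (farkas (γ ∷ τ ∷ []) (# 4 ⊗ X1 ≼ X0 ∷ # 0 ≼ X1 ∷ # 0 ≼ X0 ∷ []) ((# 1 ⊖ X0) ⊗ (# 1 ⊕ # 2 ⊗ X1)) (# 1 ⊖ # 4 ⊗ (X1 ⊗ X1)) 1 (1 ∙ 0 ∷ 1 ∙ 2 ∷ 2 ∙ 0 · 1 ∷ 2 ∙ 1 · 2 ∷ []) refl (4τ≤γ ∷ τ≥0 ∷ γ≥0 ∷ []))

      cell-sum : ∀ i j → ι t * weight i j ≤ 𝟙 - ι 4 * (τ * τ)
      cell-sum i j = ≤-trans (farkas (ι t ∷ weight i j ∷ γ ∷ τ ∷ ν ∷ []) (X1 ≼ X4 ⊗ (# 1 ⊕ # 2 ⊗ X3) ∷ # 0 ≼ X0 ∷ X4 ⊗ X0 ⊗ (# 1 ⊕ # 2 ⊗ X3) ≼ (# 1 ⊖ X2) ⊗ (# 1 ⊕ # 2 ⊗ X3) ∷ []) (X0 ⊗ X1) ((# 1 ⊖ X2) ⊗ (# 1 ⊕ # 2 ⊗ X3)) 0 (1 ∙ 2 ∷ 1 ∙ 0 · 1 ∷ []) refl ((weight-≤ i j) ∷ (0≤ι t) ∷ (≤-reflexive (cong (_* (𝟙 + ι 2 * τ)) νt)) ∷ [])) slack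

      -- A colour that is not huge has at most t cells of weight at most ν (1 + 2τ). A huge colour
      -- of relative size x ≤ 1 receives at most x + τ (2y - y x - x): the row and column
      -- corrections add at most 2y, since a colour meets each line at most once. At x = 1 this is 1
      -- - τ (1 - y) with 1 - y ≥ γ ≥ 4τ.
      colour-sum : ∀ k → ∑ Fn (λ i → ∑ Fn (λ j → 𝟏 (c i j FP.≟ k) * weight i j)) ≤ 𝟙 - ι 4 * (τ * τ)
      colour-sum k = by (huge? k) refl
        where
        x = ν * size k
        x≤1 : x ≤ 𝟙
        x≤1 = νsum≤1 (λ i → row-fibre i k)
        total : 𝔽
        total = ∑ Fn (λ i → ∑ Fn (λ j → 𝟏 (c i j FP.≟ k) * weight i j))
        by : (d : Dec (¬ size k ≤ ι t)) → huge? k ≡ d → total ≤ 𝟙 - ι 4 * (τ * τ)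
        by (no small) _ = ≤-trans (∑-mono Fn (λ i → ∑-mono Fn (λ j → 𝟏-*-mono (c i j FP.≟ k) (λ _ → weight-≤ i j))))
          (≤-trans (≤-reflexive (trans (∑-cong Fn (λ i → ∑-*ʳ Fn _ _)) (∑-*ʳ Fn _ _)))
          (≤-trans (farkas (size k ∷ ν ∷ τ ∷ γ ∷ ι t ∷ []) (X0 ≼ X4 ∷ # 0 ≼ X1 ⊗ (# 1 ⊕ # 2 ⊗ X2) ∷ X1 ⊗ X4 ⊗ (# 1 ⊕ # 2 ⊗ X2) ≼ (# 1 ⊖ X3) ⊗ (# 1 ⊕ # 2 ⊗ X2) ∷ []) (X0 ⊗ (X1 ⊗ (# 1 ⊕ # 2 ⊗ X2))) ((# 1 ⊖ X3) ⊗ (# 1 ⊕ # 2 ⊗ X2)) 0 (1 ∙ 2 ∷ 1 ∙ 0 · 1 ∷ []) refl ((≤-by-contradiction small) ∷ (*-nonNeg ν≥0 (farkas (τ ∷ []) (# 0 ≼ X0 ∷ []) (# 0) (# 1 ⊕ # 2 ⊗ X0) 0 (1 ∙1 ∷ 2 ∙ 0 ∷ []) refl (τ≥0 ∷ []))) ∷ (≤-reflexive (cong (_* (𝟙 + ι 2 * τ)) νt)) ∷ [])) slack))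
        by (yes _) e = ≤-trans (≤-reflexive split) (≤-trans
            (farkas (ν ∷ size k ∷ τ ∷ S₁ ∷ S₂ ∷ y ∷ x ∷ H ∷ []) (X3 ≼ X7 ∷ X4 ≼ X7 ∷ # 0 ≼ X0 ⊗ X2 ⊗ X0 ∷ X0 ⊗ X1 ≼ X6 ∷ X2 ⊗ (X5 ⊗ X6) ≼ X2 ⊗ (X5 ⊗ (X0 ⊗ X1)) ∷ X2 ⊗ X6 ≼ X2 ⊗ (X0 ⊗ X1) ∷ []) (X0 ⊗ X1 ⊕ X0 ⊗ X2 ⊗ (X0 ⊗ X3 ⊕ X0 ⊗ X4 ⊖ X5 ⊗ X1 ⊖ X1)) (X6 ⊕ X2 ⊗ (# 2 ⊗ (X0 ⊗ (X0 ⊗ X7)) ⊖ X5 ⊗ X6 ⊖ X6)) 0 (1 ∙ 3 ∷ 1 ∙ 4 ∷ 1 ∙ 5 ∷ 1 ∙ 0 · 2 ∷ 1 ∙ 1 · 2 ∷ []) refl (S₁≤H ∷ S₂≤H ∷ (*-nonNeg (*-nonNeg ν≥0 τ≥0) ν≥0) ∷ (≥-reflexive (refl)) ∷ (≤-reflexive (cong (λ a → τ * (y * a)) (refl {x = x}))) ∷ (≤-reflexive (cong (τ *_) (refl {x = x}))) ∷ []))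
            (farkas (x ∷ τ ∷ y ∷ γ ∷ []) (X0 ≼ # 1 ∷ # 0 ≼ X1 ∷ X2 ≼ # 1 ⊖ X3 ∷ # 2 ⊗ X1 ≼ # 1 ∷ # 4 ⊗ X1 ≼ X3 ∷ # 0 ≼ X3 ∷ []) (X0 ⊕ X1 ⊗ (# 2 ⊗ X2 ⊖ X2 ⊗ X0 ⊖ X0)) (# 1 ⊖ # 4 ⊗ (X1 ⊗ X1)) 0 (1 ∙ 0 · 3 ∷ 1 ∙ 0 · 1 · 2 ∷ 1 ∙ 1 · 2 ∷ 1 ∙ 1 · 4 ∷ 1 ∙ 0 · 1 · 5 ∷ []) refl (x≤1 ∷ τ≥0 ∷ y≤ ∷ 2τ≤1 ∷ 4τ≤γ ∷ γ≥0 ∷ [])))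
          where
          P : Fin n → Fin n → 𝔽
          P i j = 𝟏 (c i j FP.≟ k)
          S₁ = ∑ Fn (λ i → ∑ Fn (λ j → P i j * h i))
          S₂ = ∑ Fn (λ i → ∑ Fn (λ j → P i j * h′ j))
          S₁≤H : S₁ ≤ H
          S₁≤H = ∑-mono Fn (λ i → ≤-trans (≤-reflexive (∑-*ʳ Fn (h i) _)) (*-shrinkˡ (∑ Fn (P i)) (h i) (row-fibre i k) (h≥0 i)))
          S₂≤H : S₂ ≤ H
          S₂≤H = ≤-trans (≤-reflexive (∑-swap Fn Fn _)) (≤-trans (∑-mono Fn (λ j → ≤-trans (≤-reflexive (∑-*ʳ Fn (h′ j) _)) (*-shrinkˡ (∑ Fn (λ i → P i j)) (h′ j) (col-fibre j k) (h′≥0 j)))) (≤-reflexive H′))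
          is-huge : ∀ i j → P i j * hu i j ≡ P i j
          is-huge i j = trans (𝟏-*-cong (c i j FP.≟ k) (λ q → trans (cong (λ a → 𝟏 (huge? a)) q) (cong 𝟏 e))) (*-identityʳ (P i j))
          split : total ≡ ν * size k + ν * τ * (ν * S₁ + ν * S₂ - y * size k - size k)
          split = trans (∑-cong Fn (λ i → trans (∑-cong Fn (λ j → trans (ring (P i j ∷ ν ∷ τ ∷ h i ∷ h′ j ∷ H ∷ hu i j ∷ []) (X0 ⊗ (X1 ⊗ (# 1 ⊕ X2 ⊗ (X1 ⊗ X3 ⊕ X1 ⊗ X4 ⊖ X1 ⊗ (X1 ⊗ X5) ⊖ X6)))) (X1 ⊗ X0 ⊕ X1 ⊗ X2 ⊗ (X1 ⊗ (X0 ⊗ X3) ⊕ X1 ⊗ (X0 ⊗ X4) ⊖ X1 ⊗ (X1 ⊗ X5) ⊗ X0 ⊖ X0 ⊗ X6)) refl)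
                (cong (λ a → ν * P i j + ν * τ * (ν * (P i j * h i) + ν * (P i j * h′ j) - ν * (ν * H) * P i j - a)) (is-huge i j))))
              (trans (∑-+ Fn _ _) (cong₂ _+_ (∑-*ˡ Fn ν _) (trans (∑-*ˡ Fn (ν * τ) _) (cong (ν * τ *_) (trans (∑-sub Fn _ _) (cong (_- ∑ Fn (P i)) (trans (∑-sub Fn _ _) (cong₂ _-_ (trans (∑-+ Fn _ _) (cong₂ _+_ (∑-*ˡ Fn ν _) (∑-*ˡ Fn ν _))) (∑-*ˡ Fn y _)))))))))))
            (trans (∑-+ Fn _ _) (cong₂ _+_ (∑-*ˡ Fn ν _) (trans (∑-*ˡ Fn (ν * τ) _) (cong (ν * τ *_) (trans (∑-sub Fn _ _) (cong (_- size k) (trans (∑-sub Fn _ _) (cong₂ _-_ (trans (∑-+ Fn _ _) (cong₂ _+_ (∑-*ˡ Fn ν _) (∑-*ˡ Fn ν _))) (∑-*ˡ Fn y _)))))))))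

  -- Quasirandom matrices

  module Discrepancy {n : ℕ} (F : Fin n → Fin n → 𝔽) (ν q lam h : 𝔽)
    (F≥0 : ∀ i j → 𝟘 ≤ F i j) (F≤1 : ∀ i j → F i j ≤ 𝟙)
    (νn : ν * ι n ≡ 𝟙) (ν≥0 : 𝟘 ≤ ν) (q≥0 : 𝟘 ≤ q) (q≤1 : q ≤ 𝟙) (lam≥0 : 𝟘 ≤ lam)
    (degree-lower : ∀ i → q - lam ≤ ν * ∑ (allFin n) (F i))
    (codegree-upper : ∀ i i′ → i ≢ i′ → ν * ∑ (allFin n) (λ j → F i j * F i′ j) ≤ q * q + lam)
    (h≥0 : ¬ h ≤ 𝟘) (small : ι 3 * lam + ν ≤ ι 4 * (h * h)) where

    private
      Fn = allFin n

    mean-≤1 : ∀ {f : Fin n → 𝔽} → (∀ i → f i ≤ 𝟙) → ν * ∑ Fn f ≤ 𝟙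
    mean-≤1 {f} p = (farkas (ν ∷ ∑ Fn f ∷ ι n ∷ []) (X0 ⊗ X2 ≼ # 1 ∷ X1 ≼ X2 ∷ # 0 ≼ X0 ∷ []) (X0 ⊗ X1) (# 1) 0 (1 ∙ 0 ∷ 1 ∙ 1 · 2 ∷ []) refl ((≤-reflexive (νn)) ∷ (≤-trans (∑-mono Fn p) (≤-reflexive (trans (∑-Fin-const n 𝟙) (*-identityʳ (ι n))))) ∷ ν≥0 ∷ []))

    square-sum : ∀ (f : Fin n → 𝔽) → ∑ Fn f * ∑ Fn f ≡ ∑ Fn (λ i → ∑ Fn (λ i′ → f i * f i′))
    square-sum f = trans (sym (∑-*ʳ Fn _ f)) (∑-cong Fn (λ i → sym (∑-*ˡ Fn (f i) f)))

    module _ (α β : Fin n → 𝔽) (α≥0 : ∀ i → 𝟘 ≤ α i) (α≤1 : ∀ i → α i ≤ 𝟙) (β≥0 : ∀ i → 𝟘 ≤ β i) (β≤1 : ∀ i → β i ≤ 𝟙) where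
      private
        a = ν * ∑ Fn α
        a≥0 : 𝟘 ≤ a
        a≥0 = *-nonNeg ν≥0 (∑-nonNeg Fn α≥0)
        a≤1 : a ≤ 𝟙
        a≤1 = mean-≤1 α≤1
        y z : Fin n → 𝔽
        y j = ν * ∑ Fn (λ i → α i * F i j)
        z j = y j - q * a
        G : Fin n → Fin n → 𝔽
        G i i′ = ν * ∑ Fn (λ j → F i j * F i′ j)
        Y₁ = ν * ∑ Fn y
        Y₂ = ν * ∑ Fn (λ j → y j * y j)

        Y₁-≥ : a * (q - lam) ≤ Y₁
        Y₁-≥ = ≤-trans (≤-reflexive (trans (ring (ν ∷ ∑ Fn α ∷ q ∷ lam ∷ []) (X0 ⊗ X1 ⊗ (X2 ⊖ X3)) (X0 ⊗ ((X2 ⊖ X3) ⊗ X1)) refl) (cong (ν *_) (sym (∑-*ˡ Fn (q - lam) α)))))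
          (≤-trans (*-monoʳ-≤ ν (∑ Fn (λ i → (q - lam) * α i)) (∑ Fn (λ i → α i * (ν * ∑ Fn (F i)))) ν≥0 (∑-mono Fn (λ i → (farkas (q ∷ lam ∷ α i ∷ ν ∷ ∑ Fn (F i) ∷ []) (# 0 ≼ X2 ∷ X0 ⊖ X1 ≼ X3 ⊗ X4 ∷ []) ((X0 ⊖ X1) ⊗ X2) (X2 ⊗ (X3 ⊗ X4)) 0 (1 ∙ 0 · 1 ∷ []) refl ((α≥0 i) ∷ (degree-lower i) ∷ [])))))
            (≤-reflexive (cong (ν *_) (trans (∑-cong Fn (λ i → trans (*-exchange (α i) ν (∑ Fn (F i))) (cong (ν *_) (sym (∑-*ˡ Fn (α i) (F i)))))) (trans (∑-*ˡ Fn ν _) (trans (cong (ν *_) (∑-swap Fn Fn _)) (sym (∑-*ˡ Fn ν _))))))))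

        G≤1 : ∀ i i′ → G i i′ ≤ 𝟙
        G≤1 i i′ = mean-≤1 (λ j → (farkas (F i j ∷ F i′ j ∷ []) (# 0 ≼ X0 ∷ X0 ≼ # 1 ∷ X1 ≼ # 1 ∷ []) (X0 ⊗ X1) (# 1) 0 (1 ∙ 1 ∷ 1 ∙ 0 · 2 ∷ []) refl ((F≥0 i j) ∷ (F≤1 i j) ∷ (F≤1 i′ j) ∷ [])))

        G≤ : ∀ i i′ → G i i′ ≤ (q * q + lam) + 𝟏 (i FP.≟ i′)
        G≤ i i′ with i FP.≟ i′
        ... | yes _ = (farkas (G i i′ ∷ q ∷ lam ∷ []) (X0 ≼ # 1 ∷ # 0 ≼ X1 ∷ # 0 ≼ X2 ∷ []) X0 (X1 ⊗ X1 ⊕ X2 ⊕ # 1) 0 (1 ∙ 0 ∷ 1 ∙ 2 ∷ 1 ∙ 1 · 1 ∷ []) refl ((G≤1 i i′) ∷ q≥0 ∷ lam≥0 ∷ []))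
        ... | no ne = (farkas (G i i′ ∷ q ∷ lam ∷ []) (X0 ≼ X1 ⊗ X1 ⊕ X2 ∷ []) X0 (X1 ⊗ X1 ⊕ X2 ⊕ # 0) 0 (1 ∙ 0 ∷ []) refl ((codegree-upper i i′ ne) ∷ []))

        Y₂-expand : Y₂ ≡ ν * ν * ∑ Fn (λ i → ∑ Fn (λ i′ → α i * α i′ * G i i′))
        Y₂-expand = trans (cong (ν *_) (trans (∑-cong Fn (λ j → trans (ring (ν ∷ s j ∷ []) (X0 ⊗ X1 ⊗ (X0 ⊗ X1)) (X0 ⊗ X0 ⊗ (X1 ⊗ X1)) refl) (cong (ν * ν *_) (square-sum _)))) (∑-*ˡ Fn (ν * ν) _)))
          (trans (cong (λ x → ν * (ν * ν * x)) (trans (∑-swap Fn Fn _) (∑-cong Fn (λ i → trans (∑-swap Fn Fn _) (∑-cong Fn (λ i′ → trans (∑-cong Fn (λ j → (ring (α i ∷ F i j ∷ α i′ ∷ F i′ j ∷ []) (X0 ⊗ X1 ⊗ (X2 ⊗ X3)) (X0 ⊗ X2 ⊗ (X1 ⊗ X3)) refl))) (∑-*ˡ Fn (α i * α i′) _)))))))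
            (trans (trans (ring (ν ∷ X ∷ []) (X0 ⊗ (X0 ⊗ X0 ⊗ X1)) (X0 ⊗ X0 ⊗ (X0 ⊗ X1)) refl) (cong (ν * ν *_) (sym (∑-*ˡ Fn ν _)))) (cong (ν * ν *_) (∑-cong Fn (λ i → trans (sym (∑-*ˡ Fn ν _)) (∑-cong Fn (λ i′ → (ring (ν ∷ α i ∷ α i′ ∷ S i i′ ∷ []) (X0 ⊗ (X1 ⊗ X2 ⊗ X3)) (X1 ⊗ X2 ⊗ (X0 ⊗ X3)) refl))))))))
          where
          s : Fin n → 𝔽
          s j = ∑ Fn (λ i → α i * F i j)
          S : Fin n → Fin n → 𝔽
          S i i′ = ∑ Fn (λ j → F i j * F i′ j)
          X = ∑ Fn (λ i → ∑ Fn (λ i′ → α i * α i′ * S i i′))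

        αα≥0 : ∀ i i′ → 𝟘 ≤ α i * α i′
        αα≥0 i i′ = *-nonNeg (α≥0 i) (α≥0 i′)

        Y₂-≤ : Y₂ ≤ (q * q + lam) * (a * a) + ν
        Y₂-≤ = ≤-trans (≤-reflexive Y₂-expand) (≤-trans
          (farkas (ν ∷ X ∷ X′ ∷ []) (# 0 ≼ X0 ⊗ X0 ∷ X1 ≼ X2 ∷ []) (X0 ⊗ X0 ⊗ X1) (X0 ⊗ X0 ⊗ X2) 0 (1 ∙ 0 · 1 ∷ []) refl ((square-nonNeg ν) ∷ (∑-mono Fn (λ i → ∑-mono Fn (λ i′ → (farkas (α i ∷ α i′ ∷ G i i′ ∷ q ∷ lam ∷ 𝟏 (i FP.≟ i′) ∷ []) (# 0 ≼ X0 ⊗ X1 ∷ X2 ≼ X3 ⊗ X3 ⊕ X4 ⊕ X5 ∷ []) (X0 ⊗ X1 ⊗ X2) ((X3 ⊗ X3 ⊕ X4) ⊗ (X0 ⊗ X1) ⊕ X5 ⊗ (X0 ⊗ X1)) 0 (1 ∙ 0 · 1 ∷ []) refl ((αα≥0 i i′) ∷ (G≤ i i′) ∷ []))))) ∷ []))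
          (≤-trans (≤-reflexive (cong (ν * ν *_) X′-eq))
            (farkas (ν ∷ q ∷ lam ∷ ∑ Fn α ∷ D ∷ []) (X0 ⊗ X4 ≼ # 1 ∷ # 0 ≼ X0 ∷ []) (X0 ⊗ X0 ⊗ ((X1 ⊗ X1 ⊕ X2) ⊗ (X3 ⊗ X3) ⊕ X4)) ((X1 ⊗ X1 ⊕ X2) ⊗ (X0 ⊗ X3 ⊗ (X0 ⊗ X3)) ⊕ X0) 0 (1 ∙ 0 · 1 ∷ []) refl ((mean-≤1 (λ i → (farkas (α i ∷ []) (# 0 ≼ X0 ∷ X0 ≼ # 1 ∷ []) (X0 ⊗ X0) (# 1) 0 (1 ∙ 1 ∷ 1 ∙ 0 · 1 ∷ []) refl ((α≥0 i) ∷ (α≤1 i) ∷ [])))) ∷ ν≥0 ∷ []))))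
          where
          X = ∑ Fn (λ i → ∑ Fn (λ i′ → α i * α i′ * G i i′))
          X′ = ∑ Fn (λ i → ∑ Fn (λ i′ → (q * q + lam) * (α i * α i′) + 𝟏 (i FP.≟ i′) * (α i * α i′)))
          D = ∑ Fn (λ i → α i * α i)
          X′-eq : X′ ≡ (q * q + lam) * (∑ Fn α * ∑ Fn α) + D
          X′-eq = trans (∑-cong Fn (λ i → trans (∑-+ Fn _ _) (cong₂ _+_ (∑-*ˡ Fn _ _) (Enum.pick′ (enumFin n) (λ i′ → α i * α i′) i)))) (trans (∑-+ Fn _ _) (cong (_+ D) (trans (∑-*ˡ Fn _ _) (cong ((q * q + lam) *_) (sym (square-sum α))))))

        Z₂ = ν * ∑ Fn (λ j → z j * z j)

        Z₂-eq : Z₂ ≡ Y₂ - ι 2 * (q * a) * Y₁ + (q * a) * (q * a)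
        Z₂-eq = trans (cong (ν *_) (trans (∑-cong Fn (λ j → (ring (y j ∷ q ∷ a ∷ []) ((X0 ⊖ X1 ⊗ X2) ⊗ (X0 ⊖ X1 ⊗ X2)) (X0 ⊗ X0 ⊖ # 2 ⊗ (X1 ⊗ X2) ⊗ X0 ⊕ X1 ⊗ X2 ⊗ (X1 ⊗ X2)) refl)))
            (trans (∑-+ Fn _ _) (cong₂ _+_ (trans (∑-sub Fn _ _) (cong (λ b → ∑ Fn (λ j → y j * y j) - b) (∑-*ˡ Fn _ y))) (∑-Fin-const n _)))))
          (trans (ring (ν ∷ ∑ Fn (λ j → y j * y j) ∷ q ∷ a ∷ ∑ Fn y ∷ ι n ∷ Y₂′ ∷ []) (X0 ⊗ (X1 ⊖ # 2 ⊗ (X2 ⊗ X3) ⊗ X4 ⊕ X5 ⊗ (X2 ⊗ X3 ⊗ (X2 ⊗ X3)))) (X6 ⊖ # 2 ⊗ (X2 ⊗ X3) ⊗ (X0 ⊗ X4) ⊕ X0 ⊗ X5 ⊗ (X2 ⊗ X3 ⊗ (X2 ⊗ X3)) ⊕ (X0 ⊗ X1 ⊖ X6)) refl)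
            (trans (cong (λ b → Y₂′ - ι 2 * (q * a) * (ν * ∑ Fn y) + b * ((q * a) * (q * a)) + (ν * ∑ Fn (λ j → y j * y j) - Y₂′)) νn) (ring (Y₂ ∷ q ∷ a ∷ Y₁ ∷ []) (X0 ⊖ # 2 ⊗ (X1 ⊗ X2) ⊗ X3 ⊕ # 1 ⊗ (X1 ⊗ X2 ⊗ (X1 ⊗ X2)) ⊕ (X0 ⊖ X0)) (X0 ⊖ # 2 ⊗ (X1 ⊗ X2) ⊗ X3 ⊕ X1 ⊗ X2 ⊗ (X1 ⊗ X2)) refl)))
          where Y₂′ = Y₂

        Z₂-≤ : Z₂ ≤ ι 4 * (h * h)
        Z₂-≤ = ≤-trans (≤-reflexive Z₂-eq) (≤-trans
          (farkas (Y₂ ∷ q ∷ a ∷ Y₁ ∷ lam ∷ ν ∷ []) (X0 ≼ (X1 ⊗ X1 ⊕ X4) ⊗ (X2 ⊗ X2) ⊕ X5 ∷ X2 ⊗ (X1 ⊖ X4) ≼ X3 ∷ # 0 ≼ X1 ⊗ X2 ∷ []) (X0 ⊖ # 2 ⊗ (X1 ⊗ X2) ⊗ X3 ⊕ X1 ⊗ X2 ⊗ (X1 ⊗ X2)) (X4 ⊗ (X2 ⊗ X2) ⊕ # 2 ⊗ (X1 ⊗ (X2 ⊗ X2)) ⊗ X4 ⊕ X5) 0 (1 ∙ 0 ∷ 2 ∙ 1 · 2 ∷ []) refl (Y₂-≤ ∷ Y₁-≥ ∷ (*-nonNeg q≥0 a≥0) ∷ []))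
          (farkas (lam ∷ a ∷ q ∷ ν ∷ h ∷ []) (# 3 ⊗ X0 ⊕ X3 ≼ # 4 ⊗ (X4 ⊗ X4) ∷ # 0 ≼ X0 ∷ X1 ⊗ X1 ≼ # 1 ⊗ # 1 ∷ X2 ⊗ (X1 ⊗ X1) ≼ # 1 ⊗ (# 1 ⊗ # 1) ∷ []) (X0 ⊗ (X1 ⊗ X1) ⊕ # 2 ⊗ (X2 ⊗ (X1 ⊗ X1)) ⊗ X0 ⊕ X3) (# 4 ⊗ (X4 ⊗ X4)) 0 (1 ∙ 0 ∷ 1 ∙ 1 · 2 ∷ 2 ∙ 1 · 3 ∷ []) refl (small ∷ lam≥0 ∷ (*-mono-≤ a≥0 a≥0 a≤1 a≤1) ∷ (*-mono-≤ q≥0 (square-nonNeg a) q≤1 (*-mono-≤ a≥0 a≥0 a≤1 a≤1)) ∷ [])))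

        -- This takes the place of Cauchy-Schwarz and spares a square root: the expression is β (z +
        -- 2h)² + (1 - β)(z² + 4h²), with β and z taken at j.
        pointwise : ∀ j → 𝟘 ≤ ι 4 * h * (β j * z j) + ι 4 * (h * h) + z j * z j
        pointwise j = (farkas (h ∷ β j ∷ z j ∷ []) (# 0 ≼ X1 ∷ X1 ≼ # 1 ∷ # 0 ≼ (X2 ⊕ # 2 ⊗ X0) ⊗ (X2 ⊕ # 2 ⊗ X0) ∷ # 0 ≼ X2 ⊗ X2 ∷ # 0 ≼ X0 ⊗ X0 ∷ []) (# 0) (# 4 ⊗ X0 ⊗ (X1 ⊗ X2) ⊕ # 4 ⊗ (X0 ⊗ X0) ⊕ X2 ⊗ X2) 0 (1 ∙ 0 · 2 ∷ 1 ∙ 1 · 3 ∷ 4 ∙ 1 · 4 ∷ []) refl ((β≥0 j) ∷ (β≤1 j) ∷ (square-nonNeg (z j + ι 2 * h)) ∷ (square-nonNeg (z j)) ∷ (square-nonNeg h) ∷ []))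

        βz = ν * ∑ Fn (λ j → β j * z j)

        total : 𝟘 ≤ ι 4 * h * βz + ι 4 * (h * h) + Z₂
        total = ≤-trans (*-nonNeg ν≥0 (∑-nonNeg Fn pointwise)) (≤-reflexive (trans (cong (ν *_) (trans (∑-+ Fn _ _) (cong (_+ ∑ Fn (λ j → z j * z j)) (trans (∑-+ Fn _ _) (cong₂ _+_ (∑-*ˡ Fn _ _) (∑-Fin-const n _))))))
          (trans (ring (ν ∷ h ∷ s ∷ ι n ∷ s₂ ∷ []) (X0 ⊗ (# 4 ⊗ X1 ⊗ X2 ⊕ X3 ⊗ (# 4 ⊗ (X1 ⊗ X1)) ⊕ X4)) (# 4 ⊗ X1 ⊗ (X0 ⊗ X2) ⊕ X0 ⊗ X3 ⊗ (# 4 ⊗ (X1 ⊗ X1)) ⊕ X0 ⊗ X4) refl) (trans (cong (λ b → ι 4 * h * (ν * s) + b * (ι 4 * (h * h)) + ν * s₂) νn) (ring (h ∷ ν ∷ s ∷ s₂ ∷ []) (# 4 ⊗ X0 ⊗ (X1 ⊗ X2) ⊕ # 1 ⊗ (# 4 ⊗ (X0 ⊗ X0)) ⊕ X1 ⊗ X3) (# 4 ⊗ X0 ⊗ (X1 ⊗ X2) ⊕ # 4 ⊗ (X0 ⊗ X0) ⊕ X1 ⊗ X3) refl)))))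
          where
          s = ∑ Fn (λ j → β j * z j)
          s₂ = ∑ Fn (λ j → z j * z j)

        βz-≥ : 𝟘 - ι 2 * h ≤ βz
        βz-≥ = (farkas (h ∷ βz ∷ []) (# 0 ⊖ # 2 ⊗ X0 ⊖ X1 ≼ # 0 ∷ []) (# 0 ⊖ # 2 ⊗ X0) X1 0 (1 ∙ 0 ∷ []) refl ((*-cancel-≤0 {𝟘 - ι 2 * h - βz} {h} h≥0 (farkas (h ∷ βz ∷ Z₂ ∷ []) (# 0 ≼ # 4 ⊗ X0 ⊗ X1 ⊕ # 4 ⊗ (X0 ⊗ X0) ⊕ X2 ∷ X2 ≼ # 4 ⊗ (X0 ⊗ X0) ∷ []) ((# 0 ⊖ # 2 ⊗ X0 ⊖ X1) ⊗ X0) (# 0) 3 (1 ∙ 0 ∷ 1 ∙ 1 ∷ []) refl (total ∷ Z₂-≤ ∷ []))) ∷ []))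

      -- A second-moment argument. Let `y j` be the normalised weight that α has in column j. The
      -- row degrees bound the mean of `y` from below by about q a, the codegrees bound its mean
      -- square from above by about q² a², and the diagonal pairs add ν. So `z` = y - q a is small
      -- in mean square, and averaging it against β changes the count little.
      discrepancy : q * (ν * ∑ Fn α) * (ν * ∑ Fn β) - ι 2 * h ≤ ν * (ν * ∑ Fn (λ j → β j * ∑ Fn (λ i → α i * F i j)))
      discrepancy = (farkas (q ∷ a ∷ b ∷ h ∷ e ∷ βz ∷ []) (# 0 ⊖ # 2 ⊗ X3 ≼ X5 ∷ X5 ≼ X4 ⊖ X0 ⊗ X1 ⊗ X2 ∷ []) (X0 ⊗ X1 ⊗ X2 ⊖ # 2 ⊗ X3) X4 0 (1 ∙ 0 ∷ 1 ∙ 1 ∷ []) refl (βz-≥ ∷ (≤-reflexive (split)) ∷ []))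
        where
        b = ν * ∑ Fn β
        e = ν * (ν * ∑ Fn (λ j → β j * ∑ Fn (λ i → α i * F i j)))
        split : βz ≡ e - q * a * b
        split = trans (cong (ν *_) (trans (∑-cong Fn (λ j → (ring (β j ∷ ν ∷ ∑ Fn (λ i → α i * F i j) ∷ q ∷ a ∷ []) (X0 ⊗ (X1 ⊗ X2 ⊖ X3 ⊗ X4)) (X1 ⊗ (X0 ⊗ X2) ⊖ X3 ⊗ X4 ⊗ X0) refl))) (trans (∑-sub Fn _ _) (cong₂ _-_ (∑-*ˡ Fn ν _) (∑-*ˡ Fn (q * a) β)))))
          (ring (ν ∷ S ∷ q ∷ a ∷ ∑ Fn β ∷ []) (X0 ⊗ (X0 ⊗ X1 ⊖ X2 ⊗ X3 ⊗ X4)) (X0 ⊗ (X0 ⊗ X1) ⊖ X2 ⊗ X3 ⊗ (X0 ⊗ X4)) refl)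
          where S = ∑ Fn (λ j → β j * ∑ Fn (λ i → α i * F i j))

  -- Completing partial matchings by switching

  mult : {E W₁ W₂ : Set} → Enum W₁ → Enum W₂ → (E → W₁) → (E → W₂) → List E → W₁ → W₂ → 𝔽
  mult E₁ E₂ π₁ π₂ M w₁ w₂ = ∑ M (λ e → 𝟏 (Enum._≟_ E₁ (π₁ e) w₁) * 𝟏 (Enum._≟_ E₂ (π₂ e) w₂))

  module Multiplicity {E W₁ W₂ : Set} (E₁ : Enum W₁) (E₂ : Enum W₂) (π₁ : E → W₁) (π₂ : E → W₂) where
    open Enum E₁ using () renaming (_≟_ to _≟₁_)
    open Enum E₂ using () renaming (_≟_ to _≟₂_)

    term : W₁ → W₂ → E → 𝔽
    term w₁ w₂ e = 𝟏 (π₁ e ≟₁ w₁) * 𝟏 (π₂ e ≟₂ w₂)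

    term-≥0 : ∀ w₁ w₂ e → 𝟘 ≤ term w₁ w₂ e
    term-≥0 w₁ w₂ e = *-nonNeg (𝟏-nonNeg (π₁ e ≟₁ w₁)) (𝟏-nonNeg (π₂ e ≟₂ w₂))

    term-same : ∀ w₁ w₂ e → π₁ e ≡ w₁ → π₂ e ≡ w₂ → term w₁ w₂ e ≡ 𝟙
    term-same w₁ w₂ e p q = trans (cong₂ _*_ (𝟏-yes (π₁ e ≟₁ w₁) p) (𝟏-yes (π₂ e ≟₂ w₂) q)) (ring [] (# 1 ⊗ # 1) (# 1) refl)

    term-dec : ∀ w₁ w₂ e → (π₁ e ≡ w₁ × π₂ e ≡ w₂) ⊎ term w₁ w₂ e ≡ 𝟘
    term-dec w₁ w₂ e with π₁ e ≟₁ w₁ | π₂ e ≟₂ w₂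
    ... | yes p | yes q = inj₁ (p , q)
    ... | yes p | no q = inj₂ (ring [] (# 1 ⊗ # 0) (# 0) refl)
    ... | no p | d = inj₂ (*-zeroˡ (𝟏 d))

    mult-≥0 : ∀ M w₁ w₂ → 𝟘 ≤ mult E₁ E₂ π₁ π₂ M w₁ w₂
    mult-≥0 M w₁ w₂ = ∑-nonNeg M (term-≥0 w₁ w₂)

    member : ∀ M w₁ w₂ → ¬ mult E₁ E₂ π₁ π₂ M w₁ w₂ ≤ 𝟘 → ∃ λ e → e ∈ M × π₁ e ≡ w₁ × π₂ e ≡ w₂
    member M w₁ w₂ h = found (∑-positive M _ h)
      where
      found : (∃ λ e → e ∈ M × ¬ term w₁ w₂ e ≤ 𝟘) → ∃ λ e → e ∈ M × π₁ e ≡ w₁ × π₂ e ≡ w₂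
      found (e , m , q) = by (term-dec w₁ w₂ e)
        where
        by : (π₁ e ≡ w₁ × π₂ e ≡ w₂) ⊎ term w₁ w₂ e ≡ 𝟘 → _
        by (inj₁ (a , b)) = e , m , a , b
        by (inj₂ z) = ⊥-elim (q (≤-reflexive z))

    mult-≥1 : ∀ {M w₁ w₂ e} → e ∈ M → π₁ e ≡ w₁ → π₂ e ≡ w₂ → 𝟙 ≤ mult E₁ E₂ π₁ π₂ M w₁ w₂
    mult-≥1 {M} {w₁} {w₂} {e} m p q = subst (_≤ mult E₁ E₂ π₁ π₂ M w₁ w₂) (term-same w₁ w₂ e p q) (∑-term-≤ {xs = M} {term w₁ w₂} (term-≥0 w₁ w₂) m)

    mult-0 : ∀ M w₁ w₂ → ¬ 𝟙 ≤ mult E₁ E₂ π₁ π₂ M w₁ w₂ → mult E₁ E₂ π₁ π₂ M w₁ w₂ ≡ 𝟘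
    mult-0 M w₁ w₂ h = ≤-antisym (≤-by-contradiction λ q → contra (member M w₁ w₂ q)) (mult-≥0 M w₁ w₂)
      where
      contra : (∃ λ e → e ∈ M × π₁ e ≡ w₁ × π₂ e ≡ w₂) → ⊥
      contra (e , m , p , q) = h (mult-≥1 m p q)

    mult-≤1-unique : ∀ {M w₁ w₂} → mult E₁ E₂ π₁ π₂ M w₁ w₂ ≤ 𝟙 → ∀ {x y} M₀ → M ↭ (x ∷ y ∷ M₀) → π₁ x ≡ w₁ → π₂ x ≡ w₂ → π₁ y ≡ w₁ → π₂ y ≡ w₂ → ⊥
    mult-≤1-unique {M} {w₁} {w₂} h {x} {y} M₀ perm a b a′ b′ = 1≰0 (farkas (m ∷ term w₁ w₂ x ∷ term w₁ w₂ y ∷ ∑ M₀ (term w₁ w₂) ∷ []) (X0 ≼ # 1 ∷ X1 ⊕ (X2 ⊕ X3) ≼ X0 ∷ # 1 ≼ X1 ∷ # 1 ≼ X2 ∷ # 0 ≼ X3 ∷ []) (# 1) (# 0) 0 (1 ∙ 0 ∷ 1 ∙ 1 ∷ 1 ∙ 2 ∷ 1 ∙ 3 ∷ 1 ∙ 4 ∷ []) refl (h ∷ (≥-reflexive (∑-↭ perm (term w₁ w₂))) ∷ (≥-reflexive (term-same w₁ w₂ x a b)) ∷ (≥-reflexive (term-same w₁ w₂ y a′ b′)) ∷ (mult-≥0 M₀ w₁ w₂) ∷ []))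
      where m = mult E₁ E₂ π₁ π₂ M w₁ w₂

    -- For the pairs (row, matching), (column, matching), (colour, matching) and (row, column) this
    -- says in turn that every matching uses each row, column and colour at most once and that
    -- different matchings share no cell.
    Once : List E → Set
    Once M = ∀ w₁ w₂ → mult E₁ E₂ π₁ π₂ M w₁ w₂ ≤ 𝟙

    Free : List E → E → Set
    Free M e = mult E₁ E₂ π₁ π₂ M (π₁ e) (π₂ e) ≡ 𝟘

    Apart : E → E → Set
    Apart d e = π₁ d ≡ π₁ e → π₂ d ≡ π₂ e → ⊥

    term-free : ∀ M {e} → Free M e → ∀ w₁ w₂ → term w₁ w₂ e ≡ 𝟘 ⊎ (term w₁ w₂ e ≡ 𝟙 × mult E₁ E₂ π₁ π₂ M w₁ w₂ ≡ 𝟘 × π₁ e ≡ w₁ × π₂ e ≡ w₂)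
    term-free M {e} f w₁ w₂ = by (term-dec w₁ w₂ e)
      where
      by : (π₁ e ≡ w₁ × π₂ e ≡ w₂) ⊎ term w₁ w₂ e ≡ 𝟘 → _
      by (inj₁ (p , q)) = inj₂ (term-same w₁ w₂ e p q , subst₂ (λ a b → mult E₁ E₂ π₁ π₂ M a b ≡ 𝟘) p q f , p , q)
      by (inj₂ z) = inj₁ z

    free-one : ∀ M {e} → Once M → Free M e → ∀ w₁ w₂ → mult E₁ E₂ π₁ π₂ M w₁ w₂ + term w₁ w₂ e ≤ 𝟙
    free-one M {e} once f w₁ w₂ = by (term-free M f w₁ w₂)
      where
      m = mult E₁ E₂ π₁ π₂ M w₁ w₂
      by : _ → m + term w₁ w₂ e ≤ 𝟙
      by (inj₁ z) = (farkas (m ∷ term w₁ w₂ e ∷ []) (X0 ≼ # 1 ∷ X1 ≼ # 0 ∷ []) (X0 ⊕ X1) (# 1) 0 (1 ∙ 0 ∷ 1 ∙ 1 ∷ []) refl ((once w₁ w₂) ∷ (≤-reflexive (z)) ∷ []))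
      by (inj₂ (o , z , _)) = (farkas (m ∷ term w₁ w₂ e ∷ []) (X0 ≼ # 0 ∷ X1 ≼ # 1 ∷ []) (X0 ⊕ X1) (# 1) 0 (1 ∙ 0 ∷ 1 ∙ 1 ∷ []) refl ((≤-reflexive (z)) ∷ (≤-reflexive (o)) ∷ []))

    free-three : ∀ M {p₁ p₂ p₃} → Once M → Free M p₁ → Free M p₂ → Free M p₃ → Apart p₁ p₂ → Apart p₁ p₃ → Apart p₂ p₃ →
                 ∀ w₁ w₂ → mult E₁ E₂ π₁ π₂ M w₁ w₂ + (term w₁ w₂ p₁ + term w₁ w₂ p₂ + term w₁ w₂ p₃) ≤ 𝟙
    free-three M {p₁} {p₂} {p₃} once f₁ f₂ f₃ a₁₂ a₁₃ a₂₃ w₁ w₂ = by (term-free M f₁ w₁ w₂) (term-free M f₂ w₁ w₂) (term-free M f₃ w₁ w₂)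
      where
      m = mult E₁ E₂ π₁ π₂ M w₁ w₂
      t₁ = term w₁ w₂ p₁
      t₂ = term w₁ w₂ p₂
      t₃ = term w₁ w₂ p₃
      Case : E → Set
      Case e = term w₁ w₂ e ≡ 𝟘 ⊎ (term w₁ w₂ e ≡ 𝟙 × m ≡ 𝟘 × π₁ e ≡ w₁ × π₂ e ≡ w₂)
      by : Case p₁ → Case p₂ → Case p₃ → m + (t₁ + t₂ + t₃) ≤ 𝟙
      by (inj₁ z₁) (inj₁ z₂) (inj₁ z₃) = (farkas (m ∷ t₁ ∷ t₂ ∷ t₃ ∷ []) (X0 ≼ # 1 ∷ X1 ≼ # 0 ∷ X2 ≼ # 0 ∷ X3 ≼ # 0 ∷ []) (X0 ⊕ (X1 ⊕ X2 ⊕ X3)) (# 1) 0 (1 ∙ 0 ∷ 1 ∙ 1 ∷ 1 ∙ 2 ∷ 1 ∙ 3 ∷ []) refl ((once w₁ w₂) ∷ (≤-reflexive (z₁)) ∷ (≤-reflexive (z₂)) ∷ (≤-reflexive (z₃)) ∷ []))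
      by (inj₁ z₁) (inj₁ z₂) (inj₂ (z₃ , z , _)) = (farkas (m ∷ t₁ ∷ t₂ ∷ t₃ ∷ []) (X0 ≼ # 0 ∷ X1 ≼ # 0 ∷ X2 ≼ # 0 ∷ X3 ≼ # 1 ∷ []) (X0 ⊕ (X1 ⊕ X2 ⊕ X3)) (# 1) 0 (1 ∙ 0 ∷ 1 ∙ 1 ∷ 1 ∙ 2 ∷ 1 ∙ 3 ∷ []) refl ((≤-reflexive (z)) ∷ (≤-reflexive (z₁)) ∷ (≤-reflexive (z₂)) ∷ (≤-reflexive (z₃)) ∷ []))
      by (inj₁ z₁) (inj₂ (z₂ , z , _)) (inj₁ z₃) = (farkas (m ∷ t₁ ∷ t₂ ∷ t₃ ∷ []) (X0 ≼ # 0 ∷ X1 ≼ # 0 ∷ X2 ≼ # 1 ∷ X3 ≼ # 0 ∷ []) (X0 ⊕ (X1 ⊕ X2 ⊕ X3)) (# 1) 0 (1 ∙ 0 ∷ 1 ∙ 1 ∷ 1 ∙ 2 ∷ 1 ∙ 3 ∷ []) refl ((≤-reflexive (z)) ∷ (≤-reflexive (z₁)) ∷ (≤-reflexive (z₂)) ∷ (≤-reflexive (z₃)) ∷ []))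
      by (inj₂ (z₁ , z , _)) (inj₁ z₂) (inj₁ z₃) = (farkas (m ∷ t₁ ∷ t₂ ∷ t₃ ∷ []) (X0 ≼ # 0 ∷ X1 ≼ # 1 ∷ X2 ≼ # 0 ∷ X3 ≼ # 0 ∷ []) (X0 ⊕ (X1 ⊕ X2 ⊕ X3)) (# 1) 0 (1 ∙ 0 ∷ 1 ∙ 1 ∷ 1 ∙ 2 ∷ 1 ∙ 3 ∷ []) refl ((≤-reflexive (z)) ∷ (≤-reflexive (z₁)) ∷ (≤-reflexive (z₂)) ∷ (≤-reflexive (z₃)) ∷ []))
      by (inj₁ _) (inj₂ (_ , _ , b , b′)) (inj₂ (_ , _ , d , d′)) = ⊥-elim (a₂₃ (trans b (sym d)) (trans b′ (sym d′)))
      by (inj₂ (_ , _ , b , b′)) (inj₂ (_ , _ , d , d′)) _ = ⊥-elim (a₁₂ (trans b (sym d)) (trans b′ (sym d′)))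
      by (inj₂ (_ , _ , b , b′)) (inj₁ _) (inj₂ (_ , _ , d , d′)) = ⊥-elim (a₁₃ (trans b (sym d)) (trans b′ (sym d′)))

  extract : ∀ {E : Set} {x : E} {M} → x ∈ M → ∃ λ M₀ → M ↭ (x ∷ M₀)
  extract {x = x} {M} m = by (MemP.∈-∃++ m)
    where
    by : (∃ λ ys → ∃ λ zs → M ≡ ys ++ x ∷ zs) → _
    by (ys , zs , refl) = ys ++ zs , PermP.shift x ys zs

  extract₂ : ∀ {E : Set} {x y : E} {M} → x ∈ M → y ∈ M → x ≢ y → ∃ λ M₀ → M ↭ (x ∷ y ∷ M₀)
  extract₂ {x = x} {y} {M} mx my ne = by (extract mx)
    where
    tail : ∀ {M₀} → y ∈ (x ∷ M₀) → y ∈ M₀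
    tail (here e) = ⊥-elim (ne (sym e))
    tail (there m) = m
    by : (∃ λ M₀ → M ↭ (x ∷ M₀)) → _
    by (M₀ , p) = again (extract (tail (PermP.∈-resp-↭ p my)))
      where
      again : (∃ λ M₁ → M₀ ↭ (y ∷ M₁)) → _
      again (M₁ , r) = M₁ , ↭-trans′ p (prep x r)

  -- Switches and their invariants

  module Switching {n t K : ℕ} (c : Fin n → Fin n → Fin K)
    (row-proper : ∀ i {j j′} → c i j ≡ c i j′ → j ≡ j′) (col-proper : ∀ j {i i′} → c i j ≡ c i′ j → i ≡ i′)
    {Q : Fin K → Set} (Q? : ∀ k → Dec (Q k)) (ℓ B : 𝔽) where

    Edge : Set
    Edge = Fin n × Fin n × Fin t

    rowOf colOf : Edge → Fin n
    rowOf e = proj₁ e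
    colOf e = proj₁ (proj₂ e)

    matchOf : Edge → Fin t
    matchOf e = proj₂ (proj₂ e)

    colourOf : Edge → Fin K
    colourOf e = c (rowOf e) (colOf e)

    F : Fin n → Fin n → 𝔽
    F i j = 𝟏 (Q? (c i j))

    reserved : Edge → 𝔽
    reserved e = 𝟏 (Q? (colourOf e))

    module Rows = Multiplicity (enumFin n) (enumFin t) rowOf matchOf
    module Cols = Multiplicity (enumFin n) (enumFin t) colOf matchOf
    module Syms = Multiplicity (enumFin K) (enumFin t) colourOf matchOf
    module Cells = Multiplicity (enumFin n) (enumFin n) rowOf colOf

    rows cols : List Edge → Fin n → Fin t → 𝔽
    rows = mult (enumFin n) (enumFin t) rowOf matchOf
    cols = mult (enumFin n) (enumFin t) colOf matchOf

    syms : List Edge → Fin K → Fin t → 𝔽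
    syms = mult (enumFin K) (enumFin t) colourOf matchOf

    cells : List Edge → Fin n → Fin n → 𝔽
    cells = mult (enumFin n) (enumFin n) rowOf colOf

    -- the number of matchings whose edge at the line i is missing or reserved
    load : (Edge → Fin n) → List Edge → Fin n → 𝔽
    load π M i = ι t - ∑ M (λ e → 𝟏 (π e FP.≟ i) * (𝟙 - reserved e))

    -- three times the number of missing rows of the matching s, plus its number of reserved edges
    debt : List Edge → Fin t → 𝔽
    debt M s = ι 3 * ι n - ∑ M (λ e → 𝟏 (matchOf e FP.≟ s) * (ι 3 - reserved e))

    -- The debts control the disturbance inside one matching, namely missing lines and reserved
    -- colours in use. The loads control it along one line across all matchings, namely reserved
    -- cells in use.
    record Good (M : List Edge) : Set where
      field
        rows-once : Rows.Once M
        cols-once : Cols.Once M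
        syms-once : Syms.Once M
        cells-once : Cells.Once M
        debt≤ : ∀ s → debt M s ≤ ℓ
        row-load≤ : ∀ i → load rowOf M i ≤ B
        col-load≤ : ∀ j → load colOf M j ≤ B

    record Switchable (M : List Edge) (s : Fin t) (a b i₁ j₁ i₂ j₂ : Fin n) : Set where
      field
        row-free : rows M a s ≡ 𝟘
        col-free : cols M b s ≡ 𝟘
        reserved₁ : Q (c a j₁)
        reserved₂ : Q (c i₁ j₂)
        reserved₃ : Q (c i₂ b)
        sym₁ : syms M (c a j₁) s ≡ 𝟘
        sym₂ : syms M (c i₁ j₂) s ≡ 𝟘
        sym₃ : syms M (c i₂ b) s ≡ 𝟘
        sym₁₂ : c a j₁ ≢ c i₁ j₂
        sym₁₃ : c a j₁ ≢ c i₂ b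
        sym₂₃ : c i₁ j₂ ≢ c i₂ b
        cell₁ : cells M a j₁ ≡ 𝟘
        cell₂ : cells M i₁ j₂ ≡ 𝟘
        cell₃ : cells M i₂ b ≡ 𝟘
        i₁≢i₂ : i₁ ≢ i₂
        j₁≢j₂ : j₁ ≢ j₂
        load-i₁ : load rowOf M i₁ + 𝟙 ≤ B
        load-i₂ : load rowOf M i₂ + 𝟙 ≤ B
        load-j₁ : load colOf M j₁ + 𝟙 ≤ B
        load-j₂ : load colOf M j₂ + 𝟙 ≤ B

    -- One missing row is filled, which lowers the debt by 3, and three reserved edges come in,
    -- which raises it by at most 3. At the lines a and b a missing edge turns into a reserved one,
    -- so their loads do not grow; only the lines of the two removed edges can gain, and each of
    -- these gains at most 1.
    switch : ∀ {M M₀ s a b i₁ j₁ i₂ j₂} → Good M → M ↭ ((i₁ , j₁ , s) ∷ (i₂ , j₂ , s) ∷ M₀) → Switchable M s a b i₁ j₁ i₂ j₂ →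
             Good ((a , j₁ , s) ∷ (i₁ , j₂ , s) ∷ (i₂ , b , s) ∷ M₀)
    switch {M} {M₀} {s} {a} {b} {i₁} {j₁} {i₂} {j₂} good perm sw = record
      { rows-once = λ i s′ → ≤-trans (≤-reflexive (trans (exchange (Rows.term i s′)) (ring (rows M i s′ ∷ r i₁ s′ i ∷ r i₂ s′ i ∷ r a s′ i ∷ []) (X0 ⊖ X1 ⊖ X2 ⊕ (X3 ⊕ X1 ⊕ X2)) (X0 ⊕ X3) refl))) (Rows.free-one M {p₁} rows-once row-free i s′)
      ; cols-once = λ j s′ → ≤-trans (≤-reflexive (trans (exchange (Cols.term j s′)) (ring (cols M j s′ ∷ r j₁ s′ j ∷ r j₂ s′ j ∷ r b s′ j ∷ []) (X0 ⊖ X1 ⊖ X2 ⊕ (X1 ⊕ X2 ⊕ X3)) (X0 ⊕ X3) refl))) (Cols.free-one M {p₃} cols-once col-free j s′)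
      ; syms-once = λ k s′ → drop (Syms.term k s′) (Syms.term-≥0 k s′) (Syms.free-three M {p₁} {p₂} {p₃} syms-once sym₁ sym₂ sym₃ (λ e _ → sym₁₂ e) (λ e _ → sym₁₃ e) (λ e _ → sym₂₃ e) k s′)
      ; cells-once = λ i j → drop (Cells.term i j) (Cells.term-≥0 i j) (Cells.free-three M {p₁} {p₂} {p₃} cells-once cell₁ cell₂ cell₃ (λ e _ → a≢i₁ e) (λ e _ → a≢i₂ e) (λ e _ → i₁≢i₂ e) i j)
      ; debt≤ = new-debt
      ; row-load≤ = new-load rowOf i₁≢i₂ load-i₁ load-i₂ row-load≤
      ; col-load≤ = new-load colOf j₁≢j₂ load-j₁ load-j₂ col-load≤ }
      where
      open Good good
      open Switchable sw
      x y p₁ p₂ p₃ : Edge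
      x = i₁ , j₁ , s
      y = i₂ , j₂ , s
      p₁ = a , j₁ , s
      p₂ = i₁ , j₂ , s
      p₃ = i₂ , b , s
      M′ = p₁ ∷ p₂ ∷ p₃ ∷ M₀
      r : Fin n → Fin t → Fin n → 𝔽
      r i s′ i′ = 𝟏 (i FP.≟ i′) * 𝟏 (s FP.≟ s′)
      exchange : ∀ f → ∑ M′ f ≡ ∑ M f - f x - f y + (f p₁ + f p₂ + f p₃)
      exchange f = trans (ring (f p₁ ∷ f p₂ ∷ f p₃ ∷ ∑ M₀ f ∷ f x ∷ f y ∷ []) (X0 ⊕ (X1 ⊕ (X2 ⊕ X3))) (X4 ⊕ (X5 ⊕ X3) ⊖ X4 ⊖ X5 ⊕ (X0 ⊕ X1 ⊕ X2)) refl) (cong (λ z → z - f x - f y + (f p₁ + f p₂ + f p₃)) (sym (∑-↭ perm f)))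
      drop : ∀ f → (∀ e → 𝟘 ≤ f e) → ∑ M f + (f p₁ + f p₂ + f p₃) ≤ 𝟙 → ∑ M′ f ≤ 𝟙
      drop f f≥0 h = (farkas (∑ M′ f ∷ ∑ M f ∷ f x ∷ f y ∷ f p₁ ∷ f p₂ ∷ f p₃ ∷ []) (X0 ≼ X1 ⊖ X2 ⊖ X3 ⊕ (X4 ⊕ X5 ⊕ X6) ∷ # 0 ≼ X2 ∷ # 0 ≼ X3 ∷ X1 ⊕ (X4 ⊕ X5 ⊕ X6) ≼ # 1 ∷ []) X0 (# 1) 0 (1 ∙ 0 ∷ 1 ∙ 1 ∷ 1 ∙ 2 ∷ 1 ∙ 3 ∷ []) refl ((≤-reflexive (exchange f)) ∷ (f≥0 x) ∷ (f≥0 y) ∷ h ∷ []))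
      x∈M : x ∈ M
      x∈M = PermP.∈-resp-↭ (↭-sym perm) (here refl)
      y∈M : y ∈ M
      y∈M = PermP.∈-resp-↭ (↭-sym perm) (there (here refl))
      a≢i₁ : a ≢ i₁
      a≢i₁ refl = 1≰0 (subst (𝟙 ≤_) row-free (Rows.mult-≥1 x∈M refl refl))
      a≢i₂ : a ≢ i₂
      a≢i₂ refl = 1≰0 (subst (𝟙 ≤_) row-free (Rows.mult-≥1 y∈M refl refl))
      reserved-1 : ∀ e → Q (colourOf e) → reserved e ≡ 𝟙
      reserved-1 e = 𝟏-yes (Q? (colourOf e))
      new-debt : ∀ s′ → debt M′ s′ ≤ ℓ
      new-debt s′ = ≤-trans (farkas (ι n ∷ ∑ M′ f ∷ ∑ M f ∷ f x ∷ f y ∷ f p₁ ∷ f p₂ ∷ f p₃ ∷ d ∷ []) (X2 ⊖ X3 ⊖ X4 ⊕ (X5 ⊕ X6 ⊕ X7) ≼ X1 ∷ X8 ⊗ (# 3 ⊖ # 1) ≼ X5 ∷ X8 ⊗ (# 3 ⊖ # 1) ≼ X6 ∷ X8 ⊗ (# 3 ⊖ # 1) ≼ X7 ∷ X3 ≼ X8 ⊗ # 3 ∷ X4 ≼ X8 ⊗ # 3 ∷ []) (# 3 ⊗ X0 ⊖ X1) (# 3 ⊗ X0 ⊖ X2) 0 (1 ∙ 0 ∷ 1 ∙ 1 ∷ 1 ∙ 2 ∷ 1 ∙ 3 ∷ 1 ∙ 4 ∷ 1 ∙ 5 ∷ []) refl ((≥-reflexive (exchange f)) ∷ (≥-reflexive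 (cong (λ z → d * (ι 3 - z)) (reserved-1 p₁ reserved₁))) ∷ (≥-reflexive (cong (λ z → d * (ι 3 - z)) (reserved-1 p₂ reserved₂))) ∷ (≥-reflexive (cong (λ z → d * (ι 3 - z)) (reserved-1 p₃ reserved₃))) ∷ (f≤ x) ∷ (f≤ y) ∷ [])) (debt≤ s′)
        where
        d = 𝟏 (s FP.≟ s′)
        f : Edge → 𝔽
        f e = 𝟏 (matchOf e FP.≟ s′) * (ι 3 - reserved e)
        f≤ : ∀ e → f e ≤ 𝟏 (matchOf e FP.≟ s′) * ι 3
        f≤ e = (farkas (𝟏 (matchOf e FP.≟ s′) ∷ reserved e ∷ []) (# 0 ≼ X0 ∷ # 0 ≼ X1 ∷ []) (X0 ⊗ (# 3 ⊖ X1)) (X0 ⊗ # 3) 0 (1 ∙ 0 · 1 ∷ []) refl ((𝟏-nonNeg (matchOf e FP.≟ s′)) ∷ (𝟏-nonNeg (Q? (colourOf e))) ∷ []))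
      new-load : ∀ (π : Edge → Fin n) → π x ≢ π y → load π M (π x) + 𝟙 ≤ B → load π M (π y) + 𝟙 ≤ B → (∀ i → load π M i ≤ B) → ∀ i → load π M′ i ≤ B
      new-load π ne h₁ h₂ old i = by (π x FP.≟ i) (π y FP.≟ i) bound
        where
        f : Edge → 𝔽
        f e = 𝟏 (π e FP.≟ i) * (𝟙 - reserved e)
        zero-term : ∀ e → Q (colourOf e) → f e ≡ 𝟘
        zero-term e q = trans (cong (λ z → 𝟏 (π e FP.≟ i) * (𝟙 - z)) (reserved-1 e q)) (ring (𝟏 (π e FP.≟ i) ∷ []) (X0 ⊗ (# 1 ⊖ # 1)) (# 0) refl)
        f≤ : ∀ e → f e ≤ 𝟏 (π e FP.≟ i)
        f≤ e = (farkas (𝟏 (π e FP.≟ i) ∷ reserved e ∷ []) (# 0 ≼ X0 ∷ # 0 ≼ X1 ∷ []) (X0 ⊗ (# 1 ⊖ X1)) X0 0 (1 ∙ 0 · 1 ∷ []) refl ((𝟏-nonNeg (π e FP.≟ i)) ∷ (𝟏-nonNeg (Q? (colourOf e))) ∷ []))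
        bound : load π M′ i ≤ load π M i + (𝟏 (π x FP.≟ i) + 𝟏 (π y FP.≟ i))
        bound = (farkas (ι t ∷ ∑ M′ f ∷ ∑ M f ∷ 𝟏 (π x FP.≟ i) ∷ 𝟏 (π y FP.≟ i) ∷ f x ∷ f y ∷ f p₁ ∷ f p₂ ∷ f p₃ ∷ []) (X2 ⊖ X5 ⊖ X6 ⊕ (X7 ⊕ X8 ⊕ X9) ≼ X1 ∷ # 0 ≼ X7 ∷ # 0 ≼ X8 ∷ # 0 ≼ X9 ∷ X5 ≼ X3 ∷ X6 ≼ X4 ∷ []) (X0 ⊖ X1) (X0 ⊖ X2 ⊕ (X3 ⊕ X4)) 0 (1 ∙ 0 ∷ 1 ∙ 1 ∷ 1 ∙ 2 ∷ 1 ∙ 3 ∷ 1 ∙ 4 ∷ 1 ∙ 5 ∷ []) refl ((≥-reflexive (exchange f)) ∷ (≥-reflexive (zero-term p₁ reserved₁)) ∷ (≥-reflexive (zero-term p₂ reserved₂)) ∷ (≥-reflexive (zero-term p₃ reserved₃)) ∷ (f≤ x) ∷ (f≤ y) ∷ []))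
        by : (d₁ : Dec (π x ≡ i)) (d₂ : Dec (π y ≡ i)) → load π M′ i ≤ load π M i + (𝟏 d₁ + 𝟏 d₂) → load π M′ i ≤ B
        by (yes e₁) (yes e₂) _ = ⊥-elim (ne (trans e₁ (sym e₂)))
        by (yes e) (no _) h = (farkas (load π M′ i ∷ B ∷ load π M i ∷ []) (X0 ≼ X2 ⊕ (# 1 ⊕ # 0) ∷ X2 ⊕ # 1 ≼ X1 ∷ []) X0 X1 0 (1 ∙ 0 ∷ 1 ∙ 1 ∷ []) refl (h ∷ (subst (λ z → load π M z + 𝟙 ≤ B) e h₁) ∷ []))
        by (no _) (yes e) h = (farkas (load π M′ i ∷ B ∷ load π M i ∷ []) (X0 ≼ X2 ⊕ (# 0 ⊕ # 1) ∷ X2 ⊕ # 1 ≼ X1 ∷ []) X0 X1 0 (1 ∙ 0 ∷ 1 ∙ 1 ∷ []) refl (h ∷ (subst (λ z → load π M z + 𝟙 ≤ B) e h₂) ∷ []))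
        by (no _) (no _) h = (farkas (load π M′ i ∷ B ∷ load π M i ∷ []) (X0 ≼ X2 ⊕ (# 0 ⊕ # 0) ∷ X2 ≼ X1 ∷ []) X0 X1 0 (1 ∙ 0 ∷ 1 ∙ 1 ∷ []) refl (h ∷ (old i) ∷ []))

    private
      Fn = allFin n
      Ft = allFin t

    F≥0 : ∀ i j → 𝟘 ≤ F i j
    F≥0 i j = 𝟏-nonNeg (Q? (c i j))

    F≤1 : ∀ i j → F i j ≤ 𝟙
    F≤1 i j = 𝟏-≤1 (Q? (c i j))

    spread-row : ∀ i (G : Fin K → 𝔽) → (∀ k → 𝟘 ≤ G k) → ∑ Fn (λ j → G (c i j)) ≤ ∑ (allFin K) G
    spread-row i G G≥0 = ≤-trans (≤-reflexive (trans (∑-cong Fn (λ j → sym (Enum.pick′ (enumFin K) G (c i j)))) (trans (∑-swap Fn (allFin K) _) (∑-cong (allFin K) (λ k → ∑-*ʳ Fn (G k) _)))))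
      (∑-mono (allFin K) (λ k → (*-shrinkˡ (∑ Fn (λ j → 𝟏 (c i j FP.≟ k))) (G k) (at-most-one (enumFin n) (λ j → c i j FP.≟ k) (λ p q → row-proper i (trans p (sym q)))) (G≥0 k))))

    spread-col : ∀ j (G : Fin K → 𝔽) → (∀ k → 𝟘 ≤ G k) → ∑ Fn (λ i → G (c i j)) ≤ ∑ (allFin K) G
    spread-col j G G≥0 = ≤-trans (≤-reflexive (trans (∑-cong Fn (λ i → sym (Enum.pick′ (enumFin K) G (c i j)))) (trans (∑-swap Fn (allFin K) _) (∑-cong (allFin K) (λ k → ∑-*ʳ Fn (G k) _)))))
      (∑-mono (allFin K) (λ k → (*-shrinkˡ (∑ Fn (λ i → 𝟏 (c i j FP.≟ k))) (G k) (at-most-one (enumFin n) (λ i → c i j FP.≟ k) (λ p q → col-proper j (trans p (sym q)))) (G≥0 k))))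

    module Loads {M : List Edge} (good : Good M) (t≤n : ι t ≤ ι n) (ℓ≥0 : 𝟘 ≤ ℓ) where
      open Good good

      present : Fin t → 𝔽
      present s = ∑ M (λ e → 𝟏 (matchOf e FP.≟ s))

      Once′ : (Edge → Fin n) → Set
      Once′ π = ∀ i s → ∑ M (λ e → 𝟏 (π e FP.≟ i) * 𝟏 (matchOf e FP.≟ s)) ≤ 𝟙

      present-by : ∀ π s → ∑ Fn (λ i → ∑ M (λ e → 𝟏 (π e FP.≟ i) * 𝟏 (matchOf e FP.≟ s))) ≡ present s
      present-by π s = Enum.fibres (enumFin n) M π (λ e → 𝟏 (matchOf e FP.≟ s))

      present≤n : ∀ s → present s ≤ ι n
      present≤n s = ≤-trans (≤-reflexive (sym (present-by rowOf s))) (≤-trans (∑-mono Fn (λ i → rows-once i s)) (≤-reflexive (trans (∑-Fin-const n 𝟙) (*-identityʳ (ι n)))))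

      reserved-in : Fin t → 𝔽
      reserved-in s = ∑ M (λ e → 𝟏 (matchOf e FP.≟ s) * reserved e)

      debt-eq : ∀ s → debt M s ≡ ι 3 * (ι n - present s) + reserved-in s
      debt-eq s = trans (cong (λ z → ι 3 * ι n - z) (trans (∑-cong M (λ e → (ring (𝟏 (matchOf e FP.≟ s) ∷ reserved e ∷ []) (X0 ⊗ (# 3 ⊖ X1)) (# 3 ⊗ X0 ⊖ X0 ⊗ X1) refl))) (trans (∑-sub M _ _) (cong (_- reserved-in s) (∑-*ˡ M (ι 3) _)))))
        (ring (ι n ∷ present s ∷ reserved-in s ∷ []) (# 3 ⊗ X0 ⊖ (# 3 ⊗ X1 ⊖ X2)) (# 3 ⊗ (X0 ⊖ X1) ⊕ X2) refl)

      reserved-in≥0 : ∀ s → 𝟘 ≤ reserved-in s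
      reserved-in≥0 s = ∑-nonNeg M (λ e → *-nonNeg (𝟏-nonNeg (matchOf e FP.≟ s)) (𝟏-nonNeg (Q? (colourOf e))))

      reserved-in≤ : ∀ s → reserved-in s ≤ ℓ
      reserved-in≤ s = (farkas (reserved-in s ∷ ℓ ∷ debt M s ∷ ι n ∷ present s ∷ []) (X2 ≼ X1 ∷ # 3 ⊗ (X3 ⊖ X4) ⊕ X0 ≼ X2 ∷ X4 ≼ X3 ∷ []) X0 X1 0 (1 ∙ 0 ∷ 1 ∙ 1 ∷ 3 ∙ 2 ∷ []) refl ((debt≤ s) ∷ (≥-reflexive (debt-eq s)) ∷ (present≤n s) ∷ []))

      missing≤ : ∀ s → ι n - present s ≤ ℓ
      missing≤ s = (farkas (ι n ∷ present s ∷ ℓ ∷ debt M s ∷ reserved-in s ∷ []) (X3 ≼ X2 ∷ # 3 ⊗ (X0 ⊖ X1) ⊕ X4 ≼ X3 ∷ X1 ≼ X0 ∷ # 0 ≼ X4 ∷ []) (X0 ⊖ X1) X2 0 (1 ∙ 0 ∷ 1 ∙ 1 ∷ 2 ∙ 2 ∷ 1 ∙ 3 ∷ []) refl ((debt≤ s) ∷ (≥-reflexive (debt-eq s)) ∷ (present≤n s) ∷ (reserved-in≥0 s) ∷ []))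

      syms-total : ∀ s → ∑ (allFin K) (λ k → 𝟏 (Q? k) * syms M k s) ≡ reserved-in s
      syms-total s = trans (∑-cong (allFin K) (λ k → trans (sym (∑-*ˡ M _ _)) (∑-cong M (λ e → trans (ring (𝟏 (Q? k) ∷ 𝟏 (colourOf e FP.≟ k) ∷ 𝟏 (matchOf e FP.≟ s) ∷ []) (X0 ⊗ (X1 ⊗ X2)) (X1 ⊗ (X2 ⊗ X0)) refl)
          (𝟏-*-cong (colourOf e FP.≟ k) (λ { refl → refl }))))))
        (Enum.fibres (enumFin K) M colourOf (λ e → 𝟏 (matchOf e FP.≟ s) * reserved e))

      reserved-at : (Edge → Fin n) → Fin n → 𝔽
      reserved-at π i = ∑ M (λ e → 𝟏 (π e FP.≟ i) * reserved e)

      module Line (π : Edge → Fin n) (once : Once′ π) where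
        on : Fin n → 𝔽
        on i = ∑ M (λ e → 𝟏 (π e FP.≟ i))

        on≤t : ∀ i → on i ≤ ι t
        on≤t i = ≤-trans (≤-reflexive (sym (trans (∑-cong Ft (λ s → ∑-cong M (λ e → *-comm _ _))) (Enum.fibres (enumFin t) M matchOf (λ e → 𝟏 (π e FP.≟ i))))))
          (≤-trans (∑-mono Ft (once i)) (≤-reflexive (trans (∑-Fin-const t 𝟙) (*-identityʳ (ι t)))))

        load-eq : ∀ i → load π M i ≡ ι t - on i + reserved-at π i
        load-eq i = trans (cong (λ z → ι t - z) (trans (∑-cong M (λ e → (ring (𝟏 (π e FP.≟ i) ∷ reserved e ∷ []) (X0 ⊗ (# 1 ⊖ X1)) (X0 ⊖ X0 ⊗ X1) refl))) (∑-sub M _ _))) (ring (ι t ∷ on i ∷ reserved-at π i ∷ []) (X0 ⊖ (X1 ⊖ X2)) (X0 ⊖ X1 ⊕ X2) refl)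

        reserved-at≥0 : ∀ i → 𝟘 ≤ reserved-at π i
        reserved-at≥0 i = ∑-nonNeg M (λ e → *-nonNeg (𝟏-nonNeg (π e FP.≟ i)) (𝟏-nonNeg (Q? (colourOf e))))

        reserved-at≤ : ∀ i → reserved-at π i ≤ load π M i
        reserved-at≤ i = (farkas (reserved-at π i ∷ load π M i ∷ ι t ∷ on i ∷ []) (X2 ⊖ X3 ⊕ X0 ≼ X1 ∷ X3 ≼ X2 ∷ []) X0 X1 0 (1 ∙ 0 ∷ 1 ∙ 1 ∷ []) refl ((≥-reflexive (load-eq i)) ∷ (on≤t i) ∷ []))

        load≥0 : ∀ i → 𝟘 ≤ load π M i
        load≥0 i = ≤-trans (reserved-at≥0 i) (reserved-at≤ i)

        -- Summed over all lines and counted by matchings instead, the loads count the missing and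
        -- the reserved edges of each matching, and its debt is at least that number.
        load-total : ∑ Fn (load π M) ≤ ι n * ℓ
        load-total = ≤-trans (≤-reflexive by-matching) (≤-trans (∑-mono Ft each) (≤-trans (≤-reflexive (∑-Fin-const t ℓ)) (farkas (ι t ∷ ℓ ∷ ι n ∷ []) (X0 ≼ X2 ∷ # 0 ≼ X1 ∷ []) (X0 ⊗ X1) (X2 ⊗ X1) 0 (1 ∙ 0 · 1 ∷ []) refl (t≤n ∷ ℓ≥0 ∷ []))))
          where
          free : Edge → 𝔽
          free e = 𝟙 - reserved e
          by-matching : ∑ Fn (load π M) ≡ ∑ Ft (λ s → ι n - ∑ M (λ e → 𝟏 (matchOf e FP.≟ s) * free e))
          by-matching = trans (∑-sub Fn _ _) (trans (cong₂ _-_ (∑-Fin-const n (ι t)) (Enum.fibres (enumFin n) M π free))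
            (trans (cong₂ _-_ (trans (*-comm (ι n) (ι t)) (sym (∑-Fin-const t (ι n)))) (sym (Enum.fibres (enumFin t) M matchOf free))) (sym (∑-sub Ft _ _))))
          each : ∀ s → ι n - ∑ M (λ e → 𝟏 (matchOf e FP.≟ s) * free e) ≤ ℓ
          each s = (farkas (ι n ∷ ∑ M (λ e → 𝟏 (matchOf e FP.≟ s) * free e) ∷ ℓ ∷ debt M s ∷ present s ∷ reserved-in s ∷ []) (X3 ≼ X2 ∷ # 3 ⊗ (X0 ⊖ X4) ⊕ X5 ≼ X3 ∷ X4 ≼ X0 ∷ X4 ⊖ X5 ≼ X1 ∷ []) (X0 ⊖ X1) X2 0 (1 ∙ 0 ∷ 1 ∙ 1 ∷ 2 ∙ 2 ∷ 1 ∙ 3 ∷ []) refl ((debt≤ s) ∷ (≥-reflexive (debt-eq s)) ∷ (present≤n s) ∷ (≥-reflexive (trans (∑-cong M (λ e → (ring (𝟏 (matchOf e FP.≟ s) ∷ reserved e ∷ []) (X0 ⊗ (# 1 ⊖ X1)) (X0 ⊖ X0 ⊗ X1) refl))) (∑-sub M _ _))) ∷ []))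

        overloaded? : ∀ i → Dec (¬ load π M i + 𝟙 ≤ B)
        overloaded? i = ¬? ((load π M i + 𝟙) ≤? B)

        -- Markov's inequality: an overloaded line has load at least B - 1, and the average load is
        -- at most ℓ.
        overloaded-total : ∀ {ν o} → ν * ι n ≡ 𝟙 → 𝟘 ≤ ν → ι 2 ≤ B → ℓ ≤ o * (B - 𝟙) → ν * ∑ Fn (λ i → 𝟏 (overloaded? i)) ≤ o
        overloaded-total {ν} {o} νn ν≥0 B≥2 ℓ≤ = *-cancelˡ-≤ {B - 𝟙} (farkas (B ∷ []) (# 2 ≼ X0 ∷ []) (# 1) (X0 ⊖ # 1) 0 (1 ∙ 0 ∷ []) refl (B≥2 ∷ []))
          (farkas (B ∷ ν ∷ S ∷ o ∷ ι n ∷ ℓ ∷ []) ((X0 ⊖ # 1) ⊗ X2 ≼ X4 ⊗ X5 ∷ # 0 ≼ X1 ∷ X1 ⊗ X4 ⊗ X5 ≼ # 1 ⊗ X5 ∷ X5 ≼ X3 ⊗ (X0 ⊖ # 1) ∷ []) ((X0 ⊖ # 1) ⊗ (X1 ⊗ X2)) ((X0 ⊖ # 1) ⊗ X3) 0 (1 ∙ 2 ∷ 1 ∙ 3 ∷ 1 ∙ 0 · 1 ∷ []) refl (sum ∷ ν≥0 ∷ (≤-reflexive (cong (_* ℓ) νn)) ∷ ℓ≤ ∷ []))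
          where
          S = ∑ Fn (λ i → 𝟏 (overloaded? i))
          each : ∀ i → (B - 𝟙) * 𝟏 (overloaded? i) ≤ load π M i
          each i = by (overloaded? i)
            where
            by : (d : Dec (¬ load π M i + 𝟙 ≤ B)) → (B - 𝟙) * 𝟏 d ≤ load π M i
            by (yes h) = (farkas (B ∷ load π M i ∷ []) (X0 ≼ X1 ⊕ # 1 ∷ []) ((X0 ⊖ # 1) ⊗ # 1) X1 0 (1 ∙ 0 ∷ []) refl ((≰⇒≥ h) ∷ []))
            by (no _) = (farkas (B ∷ load π M i ∷ []) (# 0 ≼ X1 ∷ []) ((X0 ⊖ # 1) ⊗ # 0) X1 0 (1 ∙ 0 ∷ []) refl ((load≥0 i) ∷ []))
          sum : (B - 𝟙) * S ≤ ι n * ℓ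
          sum = ≤-trans (≤-reflexive (sym (∑-*ˡ Fn _ _))) (≤-trans (∑-mono Fn each) load-total)

      module RowLine = Line rowOf rows-once
      module ColLine = Line colOf cols-once

      cells-row : ∀ i → ∑ Fn (λ j → F i j * cells M i j) ≡ reserved-at rowOf i
      cells-row i = trans (∑-cong Fn (λ j → trans (sym (∑-*ˡ M _ _)) (∑-cong M (λ e → (ring (F i j ∷ 𝟏 (rowOf e FP.≟ i) ∷ 𝟏 (colOf e FP.≟ j) ∷ []) (X0 ⊗ (X1 ⊗ X2)) (X2 ⊗ (X1 ⊗ X0)) refl)))))
        (trans (∑-cong Fn (λ j → ∑-cong M (λ e → trans (𝟏-*-cong (colOf e FP.≟ j) (λ { refl → 𝟏-*-cong (rowOf e FP.≟ i) {y = reserved e} (λ { refl → refl }) })) refl)))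
        (Enum.fibres (enumFin n) M colOf (λ e → 𝟏 (rowOf e FP.≟ i) * reserved e)))

      cells-col : ∀ j → ∑ Fn (λ i → F i j * cells M i j) ≡ reserved-at colOf j
      cells-col j = trans (∑-cong Fn (λ i → trans (sym (∑-*ˡ M _ _)) (∑-cong M (λ e → (ring (F i j ∷ 𝟏 (rowOf e FP.≟ i) ∷ 𝟏 (colOf e FP.≟ j) ∷ []) (X0 ⊗ (X1 ⊗ X2)) (X1 ⊗ (X2 ⊗ X0)) refl)))))
        (trans (∑-cong Fn (λ i → ∑-cong M (λ e → 𝟏-*-cong (rowOf e FP.≟ i) (λ { refl → 𝟏-*-cong (colOf e FP.≟ j) {y = reserved e} (λ { refl → refl }) }))))
        (Enum.fibres (enumFin n) M rowOf (λ e → 𝟏 (colOf e FP.≟ j) * reserved e)))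

      syms≥0 : ∀ s k → 𝟘 ≤ 𝟏 (Q? k) * syms M k s
      syms≥0 s k = *-nonNeg (𝟏-nonNeg (Q? k)) (Syms.mult-≥0 M k s)

      syms-row : ∀ i s → ∑ Fn (λ j → F i j * syms M (c i j) s) ≤ ℓ
      syms-row i s = ≤-trans (spread-row i (λ k → 𝟏 (Q? k) * syms M k s) (syms≥0 s)) (≤-trans (≤-reflexive (syms-total s)) (reserved-in≤ s))

      syms-col : ∀ j s → ∑ Fn (λ i → F i j * syms M (c i j) s) ≤ ℓ
      syms-col j s = ≤-trans (spread-col j (λ k → 𝟏 (Q? k) * syms M k s) (syms≥0 s)) (≤-trans (≤-reflexive (syms-total s)) (reserved-in≤ s))

      cells-row≤ : ∀ i → ∑ Fn (λ j → F i j * cells M i j) ≤ B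
      cells-row≤ i = ≤-trans (≤-reflexive (cells-row i)) (≤-trans (RowLine.reserved-at≤ i) (row-load≤ i))

      cells-col≤ : ∀ j → ∑ Fn (λ i → F i j * cells M i j) ≤ B
      cells-col≤ j = ≤-trans (≤-reflexive (cells-col j)) (≤-trans (ColLine.reserved-at≤ j) (col-load≤ j))

      cells-total : ∑ Fn (λ i → ∑ Fn (λ j → F i j * cells M i j)) ≤ ι n * ℓ
      cells-total = ≤-trans (∑-mono Fn (λ i → ≤-trans (≤-reflexive (cells-row i)) (RowLine.reserved-at≤ i))) RowLine.load-total

  -- Counting the pairs of edges that admit a switch

  module Searching {n t K : ℕ} (c : Fin n → Fin n → Fin K)
    (row-proper : ∀ i {j j′} → c i j ≡ c i j′ → j ≡ j′) (col-proper : ∀ j {i i′} → c i j ≡ c i′ j → i ≡ i′)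
    {Q : Fin K → Set} (Q? : ∀ k → Dec (Q k)) (ℓ B : 𝔽) where
    open Switching {t = t} c row-proper col-proper Q? ℓ B

    private
      Fn = allFin n

    module Search {M : List Edge} (good : Good M) (s : Fin t) (a b : Fin n) (row-free : rows M a s ≡ 𝟘) (col-free : cols M b s ≡ 𝟘)
      (t≤n : ι t ≤ ι n) (ℓ≥0 : 𝟘 ≤ ℓ) (B≥2 : ι 2 ≤ B) (ν q lam h o : 𝔽) (νn : ν * ι n ≡ 𝟙) (ν≥0 : 𝟘 ≤ ν) (q≥0 : 𝟘 ≤ q) (q≤1 : q ≤ 𝟙) (lam≥0 : 𝟘 ≤ lam)
      (row-degree : ∀ i → q - lam ≤ ν * ∑ Fn (F i)) (col-degree : ∀ j → q - lam ≤ ν * ∑ Fn (λ i → F i j))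
      (codegree : ∀ i i′ → i ≢ i′ → ν * ∑ Fn (λ j → F i j * F i′ j) ≤ q * q + lam)
      (h>0 : ¬ h ≤ 𝟘) (h-large : ι 3 * lam + ν ≤ ι 4 * (h * h)) (o-large : ℓ ≤ o * (B - 𝟙))
      (X≥0 : 𝟘 ≤ q - lam - ν * ℓ)
      (many : ¬ q * (q - lam - ν * ℓ) * (q - lam - ν * ℓ) ≤ ι 2 * h + ι 2 * (ν * B) + ι 4 * (ν * ℓ) + ι 5 * ν + ι 4 * o) where
      open Good good
      open Loads good t≤n ℓ≥0

      private
        nn = ι n
        σ : Edge → 𝔽
        σ e = 𝟏 (matchOf e FP.≟ s)
        σ≥0 : ∀ e → 𝟘 ≤ σ e
        σ≥0 e = 𝟏-nonNeg (matchOf e FP.≟ s)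
        σ≤1 : ∀ e → σ e ≤ 𝟙
        σ≤1 e = 𝟏-≤1 (matchOf e FP.≟ s)
        Fa Fb : Edge → 𝔽
        Fa x = F a (colOf x)
        Fb y = F (rowOf y) b
        Fxy : Edge → Edge → 𝔽
        Fxy x y = F (rowOf x) (colOf y)

        -- Used to replace sums over the edges of the matching s by sums over lines, where the
        -- degree and load estimates live.
        over : ∀ (π : Edge → Fin n) → (∀ i → ∑ M (λ e → 𝟏 (π e FP.≟ i) * σ e) ≤ 𝟙) → ∀ g → (∀ i → 𝟘 ≤ g i) → ∑ M (λ e → σ e * g (π e)) ≤ ∑ Fn g
        over π once g g≥0 = ≤-trans (≤-reflexive (trans (∑-cong M (λ e → trans (cong (σ e *_) (sym (Enum.pick′ (enumFin n) g (π e)))) (sym (∑-*ˡ Fn (σ e) _)))) (trans (∑-swap M Fn _)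
            (∑-cong Fn (λ i → trans (∑-cong M (λ e → (ring (σ e ∷ 𝟏 (π e FP.≟ i) ∷ g i ∷ []) (X0 ⊗ (X1 ⊗ X2)) (X1 ⊗ X0 ⊗ X2) refl))) (∑-*ʳ M (g i) _))))))
          (∑-mono Fn (λ i → (*-shrinkˡ (∑ M (λ e → 𝟏 (π e FP.≟ i) * σ e)) (g i) (once i) (g≥0 i))))

        over-rows = over rowOf (λ i → rows-once i s)
        over-cols = over colOf (λ j → cols-once j s)

        m : 𝔽
        m = ∑ M σ
        m≤n : m ≤ nn
        m≤n = present≤n s
        m≥0 : 𝟘 ≤ m
        m≥0 = ∑-nonNeg M σ≥0

        -- The candidates: x and y belong to s, and the three cells that would replace them, in row
        -- a, in column b and in the row of x with the column of y, have reserved colours.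
        W : Edge → Edge → 𝔽
        W x y = σ x * Fa x * (σ y * Fb y) * Fxy x y

        Fa≥0 : ∀ x → 𝟘 ≤ Fa x
        Fa≥0 x = F≥0 a (colOf x)
        Fa≤1 : ∀ x → Fa x ≤ 𝟙
        Fa≤1 x = F≤1 a (colOf x)
        Fb≥0 : ∀ x → 𝟘 ≤ Fb x
        Fb≥0 x = F≥0 (rowOf x) b
        Fb≤1 : ∀ x → Fb x ≤ 𝟙
        Fb≤1 x = F≤1 (rowOf x) b
        Fxy≥0 : ∀ x y → 𝟘 ≤ Fxy x y
        Fxy≥0 x y = F≥0 (rowOf x) (colOf y)
        Fxy≤1 : ∀ x y → Fxy x y ≤ 𝟙
        Fxy≤1 x y = F≤1 (rowOf x) (colOf y)
        Ax≥0 : ∀ x → 𝟘 ≤ σ x * Fa x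
        Ax≥0 x = *-nonNeg (σ≥0 x) (Fa≥0 x)
        By≥0 : ∀ y → 𝟘 ≤ σ y * Fb y
        By≥0 y = *-nonNeg (σ≥0 y) (Fb≥0 y)
        Ax≤σ : ∀ x → σ x * Fa x ≤ σ x
        Ax≤σ x = (*-shrinkʳ (σ x) (Fa x) (σ≥0 x) (Fa≤1 x))
        By≤σ : ∀ y → σ y * Fb y ≤ σ y
        By≤σ y = (*-shrinkʳ (σ y) (Fb y) (σ≥0 y) (Fb≤1 y))
        W≥0 : ∀ x y → 𝟘 ≤ W x y
        W≥0 x y = *-nonNeg (*-nonNeg (Ax≥0 x) (By≥0 y)) (Fxy≥0 x y)
        W≤AB : ∀ x y → W x y ≤ σ x * Fa x * (σ y * Fb y)
        W≤AB x y = (farkas (W x y ∷ σ x ∷ Fa x ∷ σ y ∷ Fb y ∷ Fxy x y ∷ []) (# 0 ≼ X1 ⊗ X2 ⊗ (X3 ⊗ X4) ∷ X5 ≼ # 1 ∷ X0 ≼ X1 ⊗ X2 ⊗ (X3 ⊗ X4) ⊗ X5 ∷ []) X0 (X1 ⊗ X2 ⊗ (X3 ⊗ X4)) 0 (1 ∙ 2 ∷ 1 ∙ 0 · 1 ∷ []) refl ((*-nonNeg (Ax≥0 x) (By≥0 y)) ∷ (Fxy≤1 x y) ∷ (≤-reflexive (refl)) ∷ []))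
        σσ≥ : ∀ x y → σ x * Fa x * (σ y * Fb y) ≤ σ x * σ y
        σσ≥ x y = *-mono-≤ (Ax≥0 x) (By≥0 y) (Ax≤σ x) (By≤σ y)

        S₂ : (Edge → Edge → 𝔽) → 𝔽
        S₂ v = ∑ M (λ x → ∑ M (λ y → W x y * v x y))

        S₂-+ : ∀ u v → S₂ (λ x y → u x y + v x y) ≡ S₂ u + S₂ v
        S₂-+ u v = trans (∑-cong M (λ x → trans (∑-cong M (λ y → (ring (W x y ∷ u x y ∷ v x y ∷ []) (X0 ⊗ (X1 ⊕ X2)) (X0 ⊗ X1 ⊕ X0 ⊗ X2) refl))) (∑-+ M _ _))) (∑-+ M _ _)

        from-x : ∀ (u : Edge → 𝔽) → (∀ x → 𝟘 ≤ u x) → ∀ {C} → 𝟘 ≤ C → ∑ M (λ x → σ x * (Fa x * u x)) ≤ C → S₂ (λ x y → u x) ≤ C * nn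
        from-x u u≥0 {C} C≥0 h = ≤-trans (∑-mono M (λ x → ≤-trans (∑-mono M (λ y →
              (farkas (W x y ∷ u x ∷ σ x ∷ Fa x ∷ σ y ∷ Fb y ∷ []) (X0 ≼ X2 ⊗ X3 ⊗ (X4 ⊗ X5) ∷ # 0 ≼ X1 ∷ X4 ⊗ X5 ≼ X4 ∷ # 0 ≼ X2 ⊗ X3 ∷ []) (X0 ⊗ X1) (X2 ⊗ (X3 ⊗ X1) ⊗ X4) 0 (1 ∙ 0 · 1 ∷ 1 ∙ 1 · 2 · 3 ∷ []) refl ((W≤AB x y) ∷ (u≥0 x) ∷ (By≤σ y) ∷ (Ax≥0 x) ∷ [])))) (≤-reflexive (∑-*ˡ M _ σ))))
          (≤-trans (≤-reflexive (∑-*ʳ M m _)) (*-mono-≤ (∑-nonNeg M (λ x → *-nonNeg (σ≥0 x) (*-nonNeg (Fa≥0 x) (u≥0 x)))) m≥0 h m≤n))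

        from-y : ∀ (u : Edge → 𝔽) → (∀ x → 𝟘 ≤ u x) → ∀ {C} → 𝟘 ≤ C → ∑ M (λ y → σ y * (Fb y * u y)) ≤ C → S₂ (λ x y → u y) ≤ C * nn
        from-y u u≥0 {C} C≥0 h = ≤-trans (∑-mono M (λ x → ≤-trans (∑-mono M (λ y →
              (farkas (W x y ∷ u y ∷ σ x ∷ σ y ∷ Fb y ∷ Fa x ∷ []) (X0 ≼ X2 ⊗ X5 ⊗ (X3 ⊗ X4) ∷ # 0 ≼ X1 ∷ # 0 ≼ X3 ⊗ X4 ∷ X2 ⊗ X5 ≼ X2 ∷ []) (X0 ⊗ X1) (X2 ⊗ (X3 ⊗ (X4 ⊗ X1))) 0 (1 ∙ 0 · 1 ∷ 1 ∙ 1 · 2 · 3 ∷ []) refl ((W≤AB x y) ∷ (u≥0 y) ∷ (By≥0 y) ∷ (Ax≤σ x) ∷ [])))) (≤-reflexive (∑-*ˡ M (σ x) _))))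
          (≤-trans (≤-reflexive (trans (∑-*ʳ M _ σ) (*-comm _ _))) (*-mono-≤ (∑-nonNeg M (λ y → *-nonNeg (σ≥0 y) (*-nonNeg (Fb≥0 y) (u≥0 y)))) m≥0 h m≤n))

        W≤σσF : ∀ x y → W x y ≤ σ x * σ y * Fxy x y
        W≤σσF x y = *-mono-≤ (*-nonNeg (Ax≥0 x) (By≥0 y)) (Fxy≥0 x y) (σσ≥ x y) ≤-refl

        from-xy : ∀ (u : Edge → Edge → 𝔽) → (∀ x y → 𝟘 ≤ u x y) → ∀ (C : Edge → 𝔽) → (∀ x → ∑ M (λ y → σ y * (Fxy x y * u x y)) ≤ C x) → S₂ u ≤ ∑ M (λ x → σ x * C x)
        from-xy u u≥0 C h = ∑-mono M (λ x → ≤-trans (∑-mono M (λ y → (farkas (W x y ∷ u x y ∷ σ x ∷ σ y ∷ Fxy x y ∷ []) (X0 ≼ X2 ⊗ X3 ⊗ X4 ∷ # 0 ≼ X1 ∷ []) (X0 ⊗ X1) (X2 ⊗ (X3 ⊗ (X4 ⊗ X1))) 0 (1 ∙ 0 · 1 ∷ []) refl ((W≤σσF x y) ∷ (u≥0 x y) ∷ []))))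
          (≤-trans (≤-reflexive (∑-*ˡ M (σ x) _)) (*-monoʳ-≤ (σ x) (∑ M (λ y → σ y * (Fxy x y * u x y))) (C x) (σ≥0 x) (h x))))

        const-bound : ∀ {C} → 𝟘 ≤ C → ∑ M (λ x → σ x * C) ≤ C * nn
        const-bound {C} C≥0 = ≤-trans (≤-reflexive (∑-*ʳ M C σ)) (farkas (m ∷ C ∷ nn ∷ []) (X0 ≼ X2 ∷ # 0 ≼ X1 ∷ []) (X0 ⊗ X1) (X1 ⊗ X2) 0 (1 ∙ 0 · 1 ∷ []) refl (m≤n ∷ C≥0 ∷ []))

        drop-F : ∀ x (u : Edge → 𝔽) → (∀ y → 𝟘 ≤ u y) → ∑ M (λ y → σ y * (Fxy x y * u y)) ≤ ∑ M (λ y → σ y * u y)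
        drop-F x u u≥0 = ∑-mono M (λ y → (farkas (σ y ∷ Fxy x y ∷ u y ∷ []) (# 0 ≼ X0 ⊗ X2 ∷ X1 ≼ # 1 ∷ []) (X0 ⊗ (X1 ⊗ X2)) (X0 ⊗ X2) 0 (1 ∙ 0 · 1 ∷ []) refl ((*-nonNeg (σ≥0 y) (u≥0 y)) ∷ (Fxy≤1 x y) ∷ [])))

        overR overC : Fin n → 𝔽
        overR i = 𝟏 (RowLine.overloaded? i)
        overC j = 𝟏 (ColLine.overloaded? j)

        -- The ways in which a candidate pair can fail: a new cell is in use (v₁ to v₃), a new
        -- colour is in use in s (v₄ to v₆), two new colours agree (v₇ to v₉), the pair shares a row
        -- or a column (w₁, w₂), or a line is overloaded (w₃ to w₆). As `bad` adds up 0-1 indicators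
        -- and multiplicities, none of these occurs where it is below 1. For v₂ no row or column is
        -- fixed beforehand, so it is bounded by the total load.
        v₁ v₂ v₃ v₄ v₅ v₆ v₇ v₈ v₉ w₁ w₂ w₃ w₄ w₅ w₆ bad : Edge → Edge → 𝔽
        v₁ x y = cells M a (colOf x)
        v₂ x y = cells M (rowOf x) (colOf y)
        v₃ x y = cells M (rowOf y) b
        v₄ x y = syms M (c a (colOf x)) s
        v₅ x y = syms M (c (rowOf x) (colOf y)) s
        v₆ x y = syms M (c (rowOf y) b) s
        v₇ x y = 𝟏 (c (rowOf x) (colOf y) FP.≟ c a (colOf x))
        v₈ x y = 𝟏 (c (rowOf y) b FP.≟ c a (colOf x))
        v₉ x y = 𝟏 (c (rowOf x) (colOf y) FP.≟ c (rowOf y) b)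
        w₁ x y = 𝟏 (rowOf y FP.≟ rowOf x)
        w₂ x y = 𝟏 (colOf y FP.≟ colOf x)
        w₃ x y = overR (rowOf x)
        w₄ x y = overR (rowOf y)
        w₅ x y = overC (colOf x)
        w₆ x y = overC (colOf y)
        bad x y = (v₁ x y + v₂ x y + v₃ x y) + (v₄ x y + v₅ x y + v₆ x y) + (v₇ x y + v₈ x y + v₉ x y) + (w₁ x y + w₂ x y + w₃ x y) + (w₄ x y + w₅ x y + w₆ x y)

        cells≥0 : ∀ i j → 𝟘 ≤ cells M i j
        cells≥0 = Cells.mult-≥0 M
        syms≥0′ : ∀ k → 𝟘 ≤ syms M k s
        syms≥0′ k = Syms.mult-≥0 M k s
        B≥0 : 𝟘 ≤ B
        B≥0 = (farkas (B ∷ []) (# 2 ≼ X0 ∷ []) (# 0) X0 0 (2 ∙1 ∷ 1 ∙ 0 ∷ []) refl (B≥2 ∷ []))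

        b₁ : S₂ v₁ ≤ B * nn
        b₁ = from-x (λ x → cells M a (colOf x)) (λ x → cells≥0 a (colOf x)) B≥0 (≤-trans (over-cols (λ j → F a j * cells M a j) (λ j → *-nonNeg (F≥0 a j) (cells≥0 a j))) (cells-row≤ a))

        b₃ : S₂ v₃ ≤ B * nn
        b₃ = from-y (λ y → cells M (rowOf y) b) (λ y → cells≥0 (rowOf y) b) B≥0 (≤-trans (over-rows (λ i → F i b * cells M i b) (λ i → *-nonNeg (F≥0 i b) (cells≥0 i b))) (cells-col≤ b))

        b₂ : S₂ v₂ ≤ nn * ℓ
        b₂ = ≤-trans (from-xy v₂ (λ x y → cells≥0 (rowOf x) (colOf y)) (λ x → ∑ Fn (λ j → F (rowOf x) j * cells M (rowOf x) j)) (λ x → over-cols (λ j → F (rowOf x) j * cells M (rowOf x) j) (λ j → *-nonNeg (F≥0 (rowOf x) j) (cells≥0 (rowOf x) j))))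
          (≤-trans (over-rows (λ i → ∑ Fn (λ j → F i j * cells M i j)) (λ i → ∑-nonNeg Fn (λ j → *-nonNeg (F≥0 i j) (cells≥0 i j)))) cells-total)

        b₄ : S₂ v₄ ≤ ℓ * nn
        b₄ = from-x (λ x → syms M (c a (colOf x)) s) (λ x → syms≥0′ (c a (colOf x))) ℓ≥0 (≤-trans (over-cols (λ j → F a j * syms M (c a j) s) (λ j → *-nonNeg (F≥0 a j) (syms≥0′ (c a j)))) (syms-row a s))

        b₆ : S₂ v₆ ≤ ℓ * nn
        b₆ = from-y (λ y → syms M (c (rowOf y) b) s) (λ x → syms≥0′ (c (rowOf x) b)) ℓ≥0 (≤-trans (over-rows (λ i → F i b * syms M (c i b) s) (λ i → *-nonNeg (F≥0 i b) (syms≥0′ (c i b)))) (syms-col b s))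

        b₅ : S₂ v₅ ≤ ℓ * nn
        b₅ = ≤-trans (from-xy v₅ (λ x y → syms≥0′ (c (rowOf x) (colOf y))) (λ _ → ℓ) (λ x → ≤-trans (over-cols (λ j → F (rowOf x) j * syms M (c (rowOf x) j) s) (λ j → *-nonNeg (F≥0 (rowOf x) j) (syms≥0′ (c (rowOf x) j)))) (syms-row (rowOf x) s))) (const-bound ℓ≥0)

        unit-xy : ∀ (u : Edge → Edge → 𝔽) → (∀ x y → 𝟘 ≤ u x y) → (∀ x → ∑ M (λ y → σ y * u x y) ≤ 𝟙) → S₂ u ≤ 𝟙 * nn
        unit-xy u u≥0 h = ≤-trans (from-xy u u≥0 (λ _ → 𝟙) (λ x → ≤-trans (drop-F x (u x) (u≥0 x)) (h x))) (const-bound 0≤1)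

        b₇ : S₂ v₇ ≤ 𝟙 * nn
        b₇ = unit-xy v₇ (λ x y → 𝟏-nonNeg (c (rowOf x) (colOf y) FP.≟ c a (colOf x))) (λ x → ≤-trans (over-cols (λ j → 𝟏 (c (rowOf x) j FP.≟ c a (colOf x))) (λ j → 𝟏-nonNeg (c (rowOf x) j FP.≟ c a (colOf x))))
          (at-most-one (enumFin n) (λ j → c (rowOf x) j FP.≟ c a (colOf x)) (λ p r → row-proper (rowOf x) (trans p (sym r)))))

        b₈ : S₂ v₈ ≤ 𝟙 * nn
        b₈ = unit-xy v₈ (λ x y → 𝟏-nonNeg (c (rowOf y) b FP.≟ c a (colOf x))) (λ x → ≤-trans (over-rows (λ i → 𝟏 (c i b FP.≟ c a (colOf x))) (λ i → 𝟏-nonNeg (c i b FP.≟ c a (colOf x))))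
          (at-most-one (enumFin n) (λ i → c i b FP.≟ c a (colOf x)) (λ p r → col-proper b (trans p (sym r)))))

        b₉ : S₂ v₉ ≤ 𝟙 * nn
        b₉ = ≤-trans (∑-mono M (λ x → ∑-mono M (λ y → (farkas (W x y ∷ v₉ x y ∷ σ x ∷ σ y ∷ Fa x ∷ Fb y ∷ []) (X0 ≼ X2 ⊗ X4 ⊗ (X3 ⊗ X5) ∷ X2 ⊗ X4 ⊗ (X3 ⊗ X5) ≼ X2 ⊗ X3 ∷ # 0 ≼ X1 ∷ []) (X0 ⊗ X1) (X2 ⊗ X1 ⊗ X3) 0 (1 ∙ 0 · 2 ∷ 1 ∙ 1 · 2 ∷ []) refl ((W≤AB x y) ∷ (σσ≥ x y) ∷ (𝟏-nonNeg (c (rowOf x) (colOf y) FP.≟ c (rowOf y) b)) ∷ [])))))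
          (≤-trans (≤-reflexive (trans (∑-swap M M _) (∑-cong M (λ y → trans (∑-*ʳ M (σ y) _) (*-comm _ _)))))
          (≤-trans (∑-mono M (λ y → (farkas (σ y ∷ ∑ M (λ x → σ x * v₉ x y) ∷ []) (# 0 ≼ X0 ∷ X1 ≼ # 1 ∷ []) (X0 ⊗ X1) (X0 ⊗ # 1) 0 (1 ∙ 0 · 1 ∷ []) refl ((σ≥0 y) ∷ (col y) ∷ [])))) (const-bound 0≤1)))
          where
          col : ∀ y → ∑ M (λ x → σ x * v₉ x y) ≤ 𝟙
          col y = ≤-trans (over-rows (λ i → 𝟏 (c i (colOf y) FP.≟ c (rowOf y) b)) (λ i → 𝟏-nonNeg (c i (colOf y) FP.≟ c (rowOf y) b))) (at-most-one (enumFin n) (λ i → c i (colOf y) FP.≟ c (rowOf y) b) (λ p r → col-proper (colOf y) (trans p (sym r))))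

        d₁ : S₂ w₁ ≤ 𝟙 * nn
        d₁ = unit-xy w₁ (λ x y → 𝟏-nonNeg (rowOf y FP.≟ rowOf x)) (λ x → ≤-trans (over-rows (λ i → 𝟏 (i FP.≟ rowOf x)) (λ i → 𝟏-nonNeg (i FP.≟ rowOf x))) (≤-reflexive (Enum.pick-1 (enumFin n) (rowOf x))))

        d₂ : S₂ w₂ ≤ 𝟙 * nn
        d₂ = unit-xy w₂ (λ x y → 𝟏-nonNeg (colOf y FP.≟ colOf x)) (λ x → ≤-trans (over-cols (λ i → 𝟏 (i FP.≟ colOf x)) (λ i → 𝟏-nonNeg (i FP.≟ colOf x))) (≤-reflexive (Enum.pick-1 (enumFin n) (colOf x))))

        Orow Ocol : 𝔽
        Orow = ∑ Fn overR
        Ocol = ∑ Fn overC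
        overR≥0 : ∀ i → 𝟘 ≤ overR i
        overR≥0 i = 𝟏-nonNeg (RowLine.overloaded? i)
        overC≥0 : ∀ i → 𝟘 ≤ overC i
        overC≥0 i = 𝟏-nonNeg (ColLine.overloaded? i)

        drop-x : ∀ (u : Edge → 𝔽) (G : Edge → 𝔽) → (∀ y → 𝟘 ≤ u y) → (∀ y → G y ≤ 𝟙) → ∑ M (λ y → σ y * (G y * u y)) ≤ ∑ M (λ y → σ y * u y)
        drop-x u G u≥0 G≤1 = ∑-mono M (λ y → (farkas (σ y ∷ G y ∷ u y ∷ []) (# 0 ≼ X0 ⊗ X2 ∷ X1 ≼ # 1 ∷ []) (X0 ⊗ (X1 ⊗ X2)) (X0 ⊗ X2) 0 (1 ∙ 0 · 1 ∷ []) refl ((*-nonNeg (σ≥0 y) (u≥0 y)) ∷ (G≤1 y) ∷ [])))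

        d₃ : S₂ w₃ ≤ Orow * nn
        d₃ = from-x (λ x → overR (rowOf x)) (λ x → overR≥0 (rowOf x)) (∑-nonNeg Fn overR≥0) (≤-trans (drop-x (λ x → overR (rowOf x)) Fa (λ x → overR≥0 (rowOf x)) Fa≤1) (over-rows overR overR≥0))
        d₄ : S₂ w₄ ≤ Orow * nn
        d₄ = from-y (λ x → overR (rowOf x)) (λ x → overR≥0 (rowOf x)) (∑-nonNeg Fn overR≥0) (≤-trans (drop-x (λ x → overR (rowOf x)) Fb (λ x → overR≥0 (rowOf x)) Fb≤1) (over-rows overR overR≥0))
        d₅ : S₂ w₅ ≤ Ocol * nn
        d₅ = from-x (λ x → overC (colOf x)) (λ x → overC≥0 (colOf x)) (∑-nonNeg Fn overC≥0) (≤-trans (drop-x (λ x → overC (colOf x)) Fa (λ x → overC≥0 (colOf x)) Fa≤1) (over-cols overC overC≥0))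
        d₆ : S₂ w₆ ≤ Ocol * nn
        d₆ = from-y (λ x → overC (colOf x)) (λ x → overC≥0 (colOf x)) (∑-nonNeg Fn overC≥0) (≤-trans (drop-x (λ x → overC (colOf x)) Fb (λ x → overC≥0 (colOf x)) Fb≤1) (over-cols overC overC≥0))

        S₂-bad : S₂ bad ≡ (S₂ v₁ + S₂ v₂ + S₂ v₃) + (S₂ v₄ + S₂ v₅ + S₂ v₆) + (S₂ v₇ + S₂ v₈ + S₂ v₉) + (S₂ w₁ + S₂ w₂ + S₂ w₃) + (S₂ w₄ + S₂ w₅ + S₂ w₆)
        S₂-bad = add (add (add (add (three v₁ v₂ v₃) (three v₄ v₅ v₆)) (three v₇ v₈ v₉)) (three w₁ w₂ w₃)) (three w₄ w₅ w₆)
          where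
          three : ∀ u v w → S₂ (λ x y → u x y + v x y + w x y) ≡ S₂ u + S₂ v + S₂ w
          three u v w = trans (S₂-+ (λ x y → u x y + v x y) w) (cong (_+ S₂ w) (S₂-+ u v))
          add : ∀ {u v p r} → S₂ u ≡ p → S₂ v ≡ r → S₂ (λ x y → u x y + v x y) ≡ p + r
          add {u} {v} e f = trans (S₂-+ u v) (cong₂ _+_ e f)

        νO : ν * Orow ≤ o
        νO = RowLine.overloaded-total νn ν≥0 B≥2 o-large
        νO′ : ν * Ocol ≤ o
        νO′ = ColLine.overloaded-total νn ν≥0 B≥2 o-large

        scaled : ∀ {x y} → x ≤ y * nn → ν * (ν * x) ≤ ν * y
        scaled {x} {y} h = (farkas (ν ∷ x ∷ y ∷ nn ∷ []) (X1 ≼ X2 ⊗ X3 ∷ # 0 ≼ X0 ⊗ X0 ∷ X0 ⊗ X3 ⊗ (X0 ⊗ X2) ≼ # 1 ⊗ (X0 ⊗ X2) ∷ []) (X0 ⊗ (X0 ⊗ X1)) (X0 ⊗ X2) 0 (1 ∙ 2 ∷ 1 ∙ 0 · 1 ∷ []) refl (h ∷ (square-nonNeg ν) ∷ (≤-reflexive (cong (_* (ν * y)) νn)) ∷ []))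

        bad-total : ν * (ν * S₂ bad) ≤ ι 2 * (ν * B) + ι 4 * (ν * ℓ) + ι 5 * ν + ι 4 * o
        bad-total = ≤-trans (≤-reflexive (cong (λ z → ν * (ν * z)) S₂-bad))
          (farkas (ν ∷ S₂ v₁ ∷ S₂ v₂ ∷ S₂ v₃ ∷ S₂ v₄ ∷ S₂ v₅ ∷ S₂ v₆ ∷ S₂ v₇ ∷ S₂ v₈ ∷ S₂ v₉ ∷ S₂ w₁ ∷ S₂ w₂ ∷ S₂ w₃ ∷ S₂ w₄ ∷ S₂ w₅ ∷ S₂ w₆ ∷ B ∷ ℓ ∷ o ∷ Orow ∷ Ocol ∷ []) (X0 ⊗ (X0 ⊗ X1) ≼ X0 ⊗ X16 ∷ X0 ⊗ (X0 ⊗ X2) ≼ X0 ⊗ X17 ∷ X0 ⊗ (X0 ⊗ X3) ≼ X0 ⊗ X16 ∷ X0 ⊗ (X0 ⊗ X4) ≼ X0 ⊗ X17 ∷ X0 ⊗ (X0 ⊗ X5) ≼ X0 ⊗ X17 ∷ X0 ⊗ (X0 ⊗ X6) ≼ X0 ⊗ X17 ∷ X0 ⊗ (X0 ⊗ X7) ≼ X0 ⊗ # 1 ∷ X0 ⊗ (X0 ⊗ X8) ≼ X0 ⊗ # 1 ∷ X0 ⊗ (X0 ⊗ X9) ≼ X0 ⊗ # 1 ∷ X0 ⊗ (X0 ⊗ X10) ≼ X0 ⊗ # 1 ∷ X0 ⊗ (X0 ⊗ X11) ≼ X0 ⊗ # 1 ∷ X0 ⊗ (X0 ⊗ X12) ≼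 X0 ⊗ X19 ∷ X0 ⊗ (X0 ⊗ X13) ≼ X0 ⊗ X19 ∷ X0 ⊗ (X0 ⊗ X14) ≼ X0 ⊗ X20 ∷ X0 ⊗ (X0 ⊗ X15) ≼ X0 ⊗ X20 ∷ X0 ⊗ X19 ≼ X18 ∷ X0 ⊗ X20 ≼ X18 ∷ []) (X0 ⊗ (X0 ⊗ (X1 ⊕ X2 ⊕ X3 ⊕ (X4 ⊕ X5 ⊕ X6) ⊕ (X7 ⊕ X8 ⊕ X9) ⊕ (X10 ⊕ X11 ⊕ X12) ⊕ (X13 ⊕ X14 ⊕ X15)))) (# 2 ⊗ (X0 ⊗ X16) ⊕ # 4 ⊗ (X0 ⊗ X17) ⊕ # 5 ⊗ X0 ⊕ # 4 ⊗ X18) 0 (1 ∙ 0 ∷ 1 ∙ 1 ∷ 1 ∙ 2 ∷ 1 ∙ 3 ∷ 1 ∙ 4 ∷ 1 ∙ 5 ∷ 1 ∙ 6 ∷ 1 ∙ 7 ∷ 1 ∙ 8 ∷ 1 ∙ 9 ∷ 1 ∙ 10 ∷ 1 ∙ 11 ∷ 1 ∙ 12 ∷ 1 ∙ 13 ∷ 1 ∙ 14 ∷ 2 ∙ 15 ∷ 2 ∙ 16 ∷ []) refl ((scaled b₁) ∷ (scaled (≤-trans b₂ (≤-reflexive (*-comm nn ℓ)))) ∷ (scaled b₃) ∷ (scaled b₄) ∷ (scaled b₅) ∷ (scaled b₆) ∷ (scaled b₇) ∷ (scaled b₈) ∷ (scaled b₉) ∷ (scaled d₁) ∷ (scaled d₂)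 ∷ (scaled d₃) ∷ (scaled d₄) ∷ (scaled d₅) ∷ (scaled d₆) ∷ νO ∷ νO′ ∷ []))

        -- The reserved neighbourhoods of a and b carried along the matching: α marks the rows whose
        -- edge in s ends in a column j with (a, j) reserved, β the columns whose edge in s starts
        -- in a row i with (i, b) reserved. Candidate pairs correspond to reserved cells between
        -- these two sets, which `discrepancy` bounds from below.
        α β : Fin n → 𝔽
        α i = ∑ M (λ x → 𝟏 (rowOf x FP.≟ i) * (σ x * Fa x))
        β j = ∑ M (λ y → 𝟏 (colOf y FP.≟ j) * (σ y * Fb y))

        α≥0 : ∀ i → 𝟘 ≤ α i
        α≥0 i = ∑-nonNeg M (λ x → *-nonNeg (𝟏-nonNeg (rowOf x FP.≟ i)) (Ax≥0 x))
        β≥0 : ∀ i → 𝟘 ≤ β i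
        β≥0 i = ∑-nonNeg M (λ x → *-nonNeg (𝟏-nonNeg (colOf x FP.≟ i)) (By≥0 x))
        α≤1 : ∀ i → α i ≤ 𝟙
        α≤1 i = ≤-trans (∑-mono M (λ x → (farkas (𝟏 (rowOf x FP.≟ i) ∷ σ x ∷ Fa x ∷ []) (# 0 ≼ X0 ∷ X1 ⊗ X2 ≼ X1 ∷ []) (X0 ⊗ (X1 ⊗ X2)) (X0 ⊗ X1) 0 (1 ∙ 0 · 1 ∷ []) refl ((𝟏-nonNeg (rowOf x FP.≟ i)) ∷ (Ax≤σ x) ∷ [])))) (rows-once i s)
        β≤1 : ∀ i → β i ≤ 𝟙
        β≤1 i = ≤-trans (∑-mono M (λ x → (farkas (𝟏 (colOf x FP.≟ i) ∷ σ x ∷ Fb x ∷ []) (# 0 ≼ X0 ∷ X1 ⊗ X2 ≼ X1 ∷ []) (X0 ⊗ (X1 ⊗ X2)) (X0 ⊗ X1) 0 (1 ∙ 0 · 1 ∷ []) refl ((𝟏-nonNeg (colOf x FP.≟ i)) ∷ (By≤σ x) ∷ [])))) (cols-once i s)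

        -- Restricting a reserved degree to the lines met by s loses at most the number of lines
        -- that s misses, and this is at most ℓ.
        lower : ∀ (π : Edge → Fin n) → (∀ i → ∑ M (λ e → 𝟏 (π e FP.≟ i) * σ e) ≤ 𝟙) → ∀ (G : Fin n → 𝔽) → (∀ i → 𝟘 ≤ G i) → (∀ i → G i ≤ 𝟙) → q - lam ≤ ν * ∑ Fn G → q - lam - ν * ℓ ≤ ν * ∑ M (λ e → σ e * G (π e))
        lower π once G G≥0 G≤1 deg = (farkas (q ∷ lam ∷ ν ∷ ℓ ∷ A′ ∷ ∑ Fn G ∷ nn ∷ m ∷ []) (X0 ⊖ X1 ≼ X2 ⊗ X5 ∷ X5 ≼ X4 ⊕ (X6 ⊖ X7) ∷ X6 ⊖ X7 ≼ X3 ∷ # 0 ≼ X2 ∷ []) (X0 ⊖ X1 ⊖ X2 ⊗ X3) (X2 ⊗ X4) 0 (1 ∙ 0 ∷ 1 ∙ 1 · 3 ∷ 1 ∙ 2 · 3 ∷ []) refl (deg ∷ gap ∷ (missing≤ s) ∷ ν≥0 ∷ []))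
          where
          A′ = ∑ M (λ e → σ e * G (π e))
          P : Fin n → 𝔽
          P i = ∑ M (λ e → 𝟏 (π e FP.≟ i) * σ e)
          A-eq : ∑ Fn (λ i → P i * G i) ≡ A′
          A-eq = trans (∑-cong Fn (λ i → trans (sym (∑-*ʳ M (G i) _)) (∑-cong M (λ e → trans (*-assoc _ _ _) (𝟏-*-cong (π e FP.≟ i) (λ { refl → refl })))))) (Enum.fibres (enumFin n) M π (λ e → σ e * G (π e)))
          gap : ∑ Fn G ≤ A′ + (nn - m)
          gap = ≤-trans (∑-mono Fn (λ i → (farkas (G i ∷ P i ∷ []) (X1 ≼ # 1 ∷ X0 ≼ # 1 ∷ []) X0 (X1 ⊗ X0 ⊕ (# 1 ⊖ X1)) 0 (1 ∙ 0 · 1 ∷ []) refl ((once i) ∷ (G≤1 i) ∷ []))))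
            (≤-reflexive (trans (∑-+ Fn _ _) (cong₂ _+_ A-eq (trans (∑-sub Fn _ _) (cong₂ _-_ (trans (∑-Fin-const n 𝟙) (*-identityʳ nn)) (present-by π s))))))

        α-large : q - lam - ν * ℓ ≤ ν * ∑ Fn α
        α-large = subst (λ z → q - lam - ν * ℓ ≤ ν * z) (sym (Enum.fibres (enumFin n) M rowOf (λ x → σ x * Fa x))) (lower colOf (λ j → cols-once j s) (F a) (F≥0 a) (F≤1 a) (row-degree a))
        β-large : q - lam - ν * ℓ ≤ ν * ∑ Fn β
        β-large = subst (λ z → q - lam - ν * ℓ ≤ ν * z) (sym (Enum.fibres (enumFin n) M colOf (λ x → σ x * Fb x))) (lower rowOf (λ i → rows-once i s) (λ i → F i b) (λ i → F≥0 i b) (λ i → F≤1 i b) (col-degree b))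

        S₂-one : ∑ Fn (λ j → β j * ∑ Fn (λ i → α i * F i j)) ≡ ∑ M (λ x → ∑ M (λ y → W x y))
        S₂-one = trans (∑-cong Fn (λ j → trans (cong (β j *_) (inner j)) (trans (sym (∑-*ʳ M _ _)) (∑-cong M (λ y → *-assoc _ _ _)))))
          (trans (trans (∑-cong Fn (λ j → ∑-cong M (λ y → 𝟏-*-cong (colOf y FP.≟ j) {y = σ y * Fb y * ∑ M (λ x → σ x * Fa x * Fxy x y)} (λ { refl → refl }))))
            (Enum.fibres (enumFin n) M colOf (λ y → σ y * Fb y * ∑ M (λ x → σ x * Fa x * Fxy x y))))
          (trans (∑-cong M (λ y → trans (sym (∑-*ˡ M _ _)) (∑-cong M (λ x → (ring (σ y ∷ Fb y ∷ σ x ∷ Fa x ∷ Fxy x y ∷ []) (X0 ⊗ X1 ⊗ (X2 ⊗ X3 ⊗ X4)) (X2 ⊗ X3 ⊗ (X0 ⊗ X1) ⊗ X4) refl))))) (∑-swap M M _)))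
          where
          inner : ∀ j → ∑ Fn (λ i → α i * F i j) ≡ ∑ M (λ x → σ x * Fa x * F (rowOf x) j)
          inner j = trans (∑-cong Fn (λ i → trans (sym (∑-*ʳ M (F i j) _)) (∑-cong M (λ x → trans (*-assoc _ _ _) (𝟏-*-cong (rowOf x FP.≟ i) (λ { refl → refl })))))) (Enum.fibres (enumFin n) M rowOf (λ x → σ x * Fa x * F (rowOf x) j))

        Wtotal = ∑ M (λ x → ∑ M (λ y → W x y))

        W-large : q * (q - lam - ν * ℓ) * (q - lam - ν * ℓ) - ι 2 * h ≤ ν * (ν * Wtotal)
        W-large = ≤-trans (farkas (q ∷ X ∷ h ∷ a′ ∷ b′ ∷ []) (X1 ≼ X3 ∷ X1 ≼ X4 ∷ # 0 ≼ X1 ∷ # 0 ≼ X0 ∷ []) (X0 ⊗ X1 ⊗ X1 ⊖ # 2 ⊗ X2) (X0 ⊗ X3 ⊗ X4 ⊖ # 2 ⊗ X2) 0 (1 ∙ 0 · 1 · 3 ∷ 1 ∙ 0 · 2 · 3 ∷ 1 ∙ 1 · 2 · 3 ∷ []) refl (α-large ∷ β-large ∷ X≥0 ∷ q≥0 ∷ []))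
          (subst (λ z → q * (ν * ∑ Fn α) * (ν * ∑ Fn β) - ι 2 * h ≤ ν * (ν * z)) S₂-one (Discrepancy.discrepancy F ν q lam h F≥0 F≤1 νn ν≥0 q≥0 q≤1 lam≥0 row-degree codegree h>0 h-large α β α≥0 α≤1 β≥0 β≤1))
          where
          X = q - lam - ν * ℓ
          a′ = ν * ∑ Fn α
          b′ = ν * ∑ Fn β

        good-pair : ¬ ∑ M (λ x → ∑ M (λ y → W x y * (𝟙 - bad x y))) ≤ 𝟘
        good-pair le = many (farkas (q ∷ X ∷ h ∷ ν ∷ B ∷ ℓ ∷ o ∷ Wtotal ∷ S₂ bad ∷ D ∷ []) (X0 ⊗ X1 ⊗ X1 ⊖ # 2 ⊗ X2 ≼ X3 ⊗ (X3 ⊗ X7) ∷ X3 ⊗ (X3 ⊗ X8) ≼ # 2 ⊗ (X3 ⊗ X4) ⊕ # 4 ⊗ (X3 ⊗ X5) ⊕ # 5 ⊗ X3 ⊕ # 4 ⊗ X6 ∷ X9 ≼ # 0 ∷ # 0 ≼ X3 ⊗ X3 ∷ X3 ⊗ (X3 ⊗ (X7 ⊖ X8)) ≼ X3 ⊗ (X3 ⊗ X9) ∷ []) (X0 ⊗ X1 ⊗ X1) (# 2 ⊗ X2 ⊕ # 2 ⊗ (X3 ⊗ X4) ⊕ # 4 ⊗ (X3 ⊗ X5) ⊕ # 5 ⊗ X3 ⊕ # 4 ⊗ X6) 0 (1 ∙ 0 ∷ 1 ∙ 1 ∷ 1 ∙ 4 ∷ 1 ∙ 2 · 3 ∷ [])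 refl (W-large ∷ bad-total ∷ le ∷ (square-nonNeg ν) ∷ (≥-reflexive (cong (λ z → ν * (ν * z)) difference)) ∷ []))
          where
          X = q - lam - ν * ℓ
          D = ∑ M (λ x → ∑ M (λ y → W x y * (𝟙 - bad x y)))
          difference : D ≡ Wtotal - S₂ bad
          difference = trans (∑-cong M (λ x → trans (∑-cong M (λ y → (ring (W x y ∷ bad x y ∷ []) (X0 ⊗ (# 1 ⊖ X1)) (X0 ⊖ X0 ⊗ X1) refl))) (∑-sub M _ _))) (∑-sub M _ _)

      Found : Set
      Found = ∃ λ i₁ → ∃ λ j₁ → ∃ λ i₂ → ∃ λ j₂ → ∃ λ M₀ → M ↭ ((i₁ , j₁ , s) ∷ (i₂ , j₂ , s) ∷ M₀) × Switchable M s a b i₁ j₁ i₂ j₂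

      private
        examine : ∀ x y → x ∈ M → y ∈ M → ¬ W x y * (𝟙 - bad x y) ≤ 𝟘 → Found
        examine x@(i₁ , j₁ , s₁) y@(i₂ , j₂ , s₂) x∈ y∈ nonzero = assemble (extract₂ x∈ y∈ (λ e → i₁≢i₂ (cong rowOf e)))
          where
          W>0 : ¬ W x y ≤ 𝟘
          W>0 le = nonzero (≤-reflexive (trans (cong (_* (𝟙 - bad x y)) (≤-antisym le (W≥0 x y))) (ring (bad x y ∷ []) (# 0 ⊗ (# 1 ⊖ X0)) (# 0) refl)))
          bad<1 : ¬ 𝟙 ≤ bad x y
          bad<1 le = nonzero (farkas (W x y ∷ bad x y ∷ []) (# 0 ≼ X0 ∷ # 1 ≼ X1 ∷ []) (X0 ⊗ (# 1 ⊖ X1)) (# 0) 0 (1 ∙ 0 · 1 ∷ []) refl ((W≥0 x y) ∷ le ∷ []))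
          positive : ∀ {P : Set} (d : Dec P) → W x y ≤ 𝟏 d → P
          positive d h = 𝟏-positive d (λ le → W>0 (≤-trans h le))
          W≤σσ : W x y ≤ σ x * σ y
          W≤σσ = ≤-trans (W≤AB x y) (σσ≥ x y)
          s₁≡s : s₁ ≡ s
          s₁≡s = positive (s₁ FP.≟ s) (≤-trans W≤σσ (*-shrinkʳ (σ x) (σ y) (σ≥0 x) (σ≤1 y)))
          s₂≡s : s₂ ≡ s
          s₂≡s = positive (s₂ FP.≟ s) (≤-trans W≤σσ (*-shrinkˡ (σ x) (σ y) (σ≤1 x) (σ≥0 y)))
          AB≤ : σ x * Fa x ≤ Fa x
          AB≤ = (*-shrinkˡ (σ x) (Fa x) (σ≤1 x) (Fa≥0 x))
          By≤ : σ y * Fb y ≤ Fb y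
          By≤ = (*-shrinkˡ (σ y) (Fb y) (σ≤1 y) (Fb≥0 y))
          W≤FaFb : W x y ≤ Fa x * Fb y
          W≤FaFb = ≤-trans (W≤AB x y) (*-mono-≤ (Ax≥0 x) (By≥0 y) AB≤ By≤)
          q₁ : Q (c a j₁)
          q₁ = positive (Q? (c a j₁)) (≤-trans W≤FaFb (*-shrinkʳ (Fa x) (Fb y) (Fa≥0 x) (Fb≤1 y)))
          q₃ : Q (c i₂ b)
          q₃ = positive (Q? (c i₂ b)) (≤-trans W≤FaFb (*-shrinkˡ (Fa x) (Fb y) (Fa≤1 x) (Fb≥0 y)))
          q₂ : Q (c i₁ j₂)
          q₂ = positive (Q? (c i₁ j₂)) (farkas (W x y ∷ Fxy x y ∷ σ x ∷ σ y ∷ []) (X0 ≼ X2 ⊗ X3 ⊗ X1 ∷ X2 ⊗ X3 ≼ # 1 ⊗ # 1 ∷ # 0 ≼ X1 ∷ []) X0 X1 0 (1 ∙ 0 ∷ 1 ∙ 1 · 2 ∷ []) refl ((W≤σσF x y) ∷ (*-mono-≤ (σ≥0 x) (σ≥0 y) (σ≤1 x) (σ≤1 y)) ∷ (Fxy≥0 x y) ∷ []))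
          n₁ = cells≥0 a j₁
          n₂ = cells≥0 i₁ j₂
          n₃ = cells≥0 i₂ b
          n₄ = syms≥0′ (c a j₁)
          n₅ = syms≥0′ (c i₁ j₂)
          n₆ = syms≥0′ (c i₂ b)
          n₇ = 𝟏-nonNeg (c i₁ j₂ FP.≟ c a j₁)
          n₈ = 𝟏-nonNeg (c i₂ b FP.≟ c a j₁)
          n₉ = 𝟏-nonNeg (c i₁ j₂ FP.≟ c i₂ b)
          m₁ = 𝟏-nonNeg (i₂ FP.≟ i₁)
          m₂ = 𝟏-nonNeg (j₂ FP.≟ j₁)
          m₃ = overR≥0 i₁
          m₄ = overR≥0 i₂
          m₅ = overC≥0 j₁
          m₆ = overC≥0 j₂
          add₃ : ∀ {u v w} → 𝟘 ≤ u → 𝟘 ≤ v → 𝟘 ≤ w → 𝟘 ≤ u + v + w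
          add₃ {u} {v} {w} p r z = (farkas (u ∷ v ∷ w ∷ []) (# 0 ≼ X0 ∷ # 0 ≼ X1 ∷ # 0 ≼ X2 ∷ []) (# 0) (X0 ⊕ X1 ⊕ X2) 0 (1 ∙ 0 ∷ 1 ∙ 1 ∷ 1 ∙ 2 ∷ []) refl (p ∷ r ∷ z ∷ []))
          g₁ = add₃ n₁ n₂ n₃
          g₂ = add₃ n₄ n₅ n₆
          g₃ = add₃ n₇ n₈ n₉
          g₄ = add₃ m₁ m₂ m₃
          g₅ = add₃ m₄ m₅ m₆
          in-bad : ∀ {z A₁ A₂ A₃ A₄ A₅} → bad x y ≡ A₁ + A₂ + A₃ + A₄ + A₅ → 𝟘 ≤ A₁ → 𝟘 ≤ A₂ → 𝟘 ≤ A₃ → 𝟘 ≤ A₄ → 𝟘 ≤ A₅ → z ≤ A₁ ⊎ z ≤ A₂ ⊎ z ≤ A₃ ⊎ z ≤ A₄ ⊎ z ≤ A₅ → ¬ 𝟙 ≤ z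
          in-bad {z} {A₁} {A₂} {A₃} {A₄} {A₅} e p₁ p₂ p₃ p₄ p₅ w le = bad<1 (subst (𝟙 ≤_) (sym e) (by w))
            where
            by : z ≤ A₁ ⊎ z ≤ A₂ ⊎ z ≤ A₃ ⊎ z ≤ A₄ ⊎ z ≤ A₅ → 𝟙 ≤ A₁ + A₂ + A₃ + A₄ + A₅
            by (inj₁ k) = (farkas (A₁ ∷ A₂ ∷ A₃ ∷ A₄ ∷ A₅ ∷ z ∷ []) (# 1 ≼ X5 ∷ X5 ≼ X0 ∷ # 0 ≼ X1 ∷ # 0 ≼ X2 ∷ # 0 ≼ X3 ∷ # 0 ≼ X4 ∷ []) (# 1) (X0 ⊕ X1 ⊕ X2 ⊕ X3 ⊕ X4) 0 (1 ∙ 0 ∷ 1 ∙ 1 ∷ 1 ∙ 2 ∷ 1 ∙ 3 ∷ 1 ∙ 4 ∷ 1 ∙ 5 ∷ []) refl (le ∷ k ∷ p₂ ∷ p₃ ∷ p₄ ∷ p₅ ∷ []))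
            by (inj₂ (inj₁ k)) = (farkas (A₁ ∷ A₂ ∷ A₃ ∷ A₄ ∷ A₅ ∷ z ∷ []) (# 1 ≼ X5 ∷ X5 ≼ X1 ∷ # 0 ≼ X0 ∷ # 0 ≼ X2 ∷ # 0 ≼ X3 ∷ # 0 ≼ X4 ∷ []) (# 1) (X0 ⊕ X1 ⊕ X2 ⊕ X3 ⊕ X4) 0 (1 ∙ 0 ∷ 1 ∙ 1 ∷ 1 ∙ 2 ∷ 1 ∙ 3 ∷ 1 ∙ 4 ∷ 1 ∙ 5 ∷ []) refl (le ∷ k ∷ p₁ ∷ p₃ ∷ p₄ ∷ p₅ ∷ []))
            by (inj₂ (inj₂ (inj₁ k))) = (farkas (A₁ ∷ A₂ ∷ A₃ ∷ A₄ ∷ A₅ ∷ z ∷ []) (# 1 ≼ X5 ∷ X5 ≼ X2 ∷ # 0 ≼ X1 ∷ # 0 ≼ X0 ∷ # 0 ≼ X3 ∷ # 0 ≼ X4 ∷ []) (# 1) (X0 ⊕ X1 ⊕ X2 ⊕ X3 ⊕ X4) 0 (1 ∙ 0 ∷ 1 ∙ 1 ∷ 1 ∙ 2 ∷ 1 ∙ 3 ∷ 1 ∙ 4 ∷ 1 ∙ 5 ∷ []) refl (le ∷ k ∷ p₂ ∷ p₁ ∷ p₄ ∷ p₅ ∷ []))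
            by (inj₂ (inj₂ (inj₂ (inj₁ k)))) = (farkas (A₁ ∷ A₂ ∷ A₃ ∷ A₄ ∷ A₅ ∷ z ∷ []) (# 1 ≼ X5 ∷ X5 ≼ X3 ∷ # 0 ≼ X1 ∷ # 0 ≼ X2 ∷ # 0 ≼ X0 ∷ # 0 ≼ X4 ∷ []) (# 1) (X0 ⊕ X1 ⊕ X2 ⊕ X3 ⊕ X4) 0 (1 ∙ 0 ∷ 1 ∙ 1 ∷ 1 ∙ 2 ∷ 1 ∙ 3 ∷ 1 ∙ 4 ∷ 1 ∙ 5 ∷ []) refl (le ∷ k ∷ p₂ ∷ p₃ ∷ p₁ ∷ p₅ ∷ []))
            by (inj₂ (inj₂ (inj₂ (inj₂ k)))) = (farkas (A₁ ∷ A₂ ∷ A₃ ∷ A₄ ∷ A₅ ∷ z ∷ []) (# 1 ≼ X5 ∷ X5 ≼ X4 ∷ # 0 ≼ X1 ∷ # 0 ≼ X2 ∷ # 0 ≼ X3 ∷ # 0 ≼ X0 ∷ []) (# 1) (X0 ⊕ X1 ⊕ X2 ⊕ X3 ⊕ X4) 0 (1 ∙ 0 ∷ 1 ∙ 1 ∷ 1 ∙ 2 ∷ 1 ∙ 3 ∷ 1 ∙ 4 ∷ 1 ∙ 5 ∷ []) refl (le ∷ k ∷ p₂ ∷ p₃ ∷ p₄ ∷ p₁ ∷ []))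
          avoid : ∀ {z} → z ≤ v₁ x y + v₂ x y + v₃ x y ⊎ z ≤ v₄ x y + v₅ x y + v₆ x y ⊎ z ≤ v₇ x y + v₈ x y + v₉ x y ⊎ z ≤ w₁ x y + w₂ x y + w₃ x y ⊎ z ≤ w₄ x y + w₅ x y + w₆ x y → ¬ 𝟙 ≤ z
          avoid = in-bad refl g₁ g₂ g₃ g₄ g₅
          fst-≤ : ∀ {u v w} → 𝟘 ≤ v → 𝟘 ≤ w → u ≤ u + v + w
          fst-≤ {u} {v} {w} p r = (farkas (u ∷ v ∷ w ∷ []) (# 0 ≼ X1 ∷ # 0 ≼ X2 ∷ []) X0 (X0 ⊕ X1 ⊕ X2) 0 (1 ∙ 0 ∷ 1 ∙ 1 ∷ []) refl (p ∷ r ∷ []))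
          snd-≤ : ∀ {u v w} → 𝟘 ≤ u → 𝟘 ≤ w → v ≤ u + v + w
          snd-≤ {u} {v} {w} p r = (farkas (v ∷ u ∷ w ∷ []) (# 0 ≼ X1 ∷ # 0 ≼ X2 ∷ []) X0 (X1 ⊕ X0 ⊕ X2) 0 (1 ∙ 0 ∷ 1 ∙ 1 ∷ []) refl (p ∷ r ∷ []))
          thd-≤ : ∀ {u v w} → 𝟘 ≤ u → 𝟘 ≤ v → w ≤ u + v + w
          thd-≤ {u} {v} {w} p r = (farkas (w ∷ u ∷ v ∷ []) (# 0 ≼ X1 ∷ # 0 ≼ X2 ∷ []) X0 (X1 ⊕ X2 ⊕ X0) 0 (1 ∙ 0 ∷ 1 ∙ 1 ∷ []) refl (p ∷ r ∷ []))
          refute : ∀ {P : Set} (d : Dec P) → ¬ 𝟙 ≤ 𝟏 d → ¬ P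
          refute d h p = h (≥-reflexive (𝟏-yes d p))
          stable : ∀ {u v} → ¬ 𝟙 ≤ 𝟏 (¬? (u ≤? v)) → u ≤ v
          stable {u} {v} h = ≤-by-contradiction (refute (¬? (u ≤? v)) h)
          i₁≢i₂ : i₁ ≢ i₂
          i₁≢i₂ e = refute (i₂ FP.≟ i₁) (avoid (inj₂ (inj₂ (inj₂ (inj₁ (fst-≤ m₂ m₃)))))) (sym e)
          switchable : Switchable M s a b i₁ j₁ i₂ j₂
          switchable = record
            { row-free = row-free ; col-free = col-free ; reserved₁ = q₁ ; reserved₂ = q₂ ; reserved₃ = q₃
            ; sym₁ = Syms.mult-0 M (c a j₁) s (avoid (inj₂ (inj₁ (fst-≤ n₅ n₆))))
            ; sym₂ = Syms.mult-0 M (c i₁ j₂) s (avoid (inj₂ (inj₁ (snd-≤ n₄ n₆))))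
            ; sym₃ = Syms.mult-0 M (c i₂ b) s (avoid (inj₂ (inj₁ (thd-≤ n₄ n₅))))
            ; sym₁₂ = λ e → refute (c i₁ j₂ FP.≟ c a j₁) (avoid (inj₂ (inj₂ (inj₁ (fst-≤ n₈ n₉))))) (sym e)
            ; sym₁₃ = λ e → refute (c i₂ b FP.≟ c a j₁) (avoid (inj₂ (inj₂ (inj₁ (snd-≤ n₇ n₉))))) (sym e)
            ; sym₂₃ = refute (c i₁ j₂ FP.≟ c i₂ b) (avoid (inj₂ (inj₂ (inj₁ (thd-≤ n₇ n₈)))))
            ; cell₁ = Cells.mult-0 M a j₁ (avoid (inj₁ (fst-≤ n₂ n₃)))
            ; cell₂ = Cells.mult-0 M i₁ j₂ (avoid (inj₁ (snd-≤ n₁ n₃)))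
            ; cell₃ = Cells.mult-0 M i₂ b (avoid (inj₁ (thd-≤ n₁ n₂)))
            ; i₁≢i₂ = i₁≢i₂
            ; j₁≢j₂ = λ e → refute (j₂ FP.≟ j₁) (avoid (inj₂ (inj₂ (inj₂ (inj₁ (snd-≤ m₁ m₃)))))) (sym e)
            ; load-i₁ = stable (avoid (inj₂ (inj₂ (inj₂ (inj₁ (thd-≤ m₁ m₂))))))
            ; load-i₂ = stable (avoid (inj₂ (inj₂ (inj₂ (inj₂ (fst-≤ m₅ m₆))))))
            ; load-j₁ = stable (avoid (inj₂ (inj₂ (inj₂ (inj₂ (snd-≤ m₄ m₆))))))
            ; load-j₂ = stable (avoid (inj₂ (inj₂ (inj₂ (inj₂ (thd-≤ m₄ m₅)))))) }
          assemble : (∃ λ M₀ → M ↭ (x ∷ y ∷ M₀)) → Found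
          assemble (M₀ , perm) = i₁ , j₁ , i₂ , j₂ , M₀ , subst₂ (λ u v → M ↭ ((i₁ , j₁ , u) ∷ (i₂ , j₂ , v) ∷ M₀)) s₁≡s s₂≡s perm , switchable

      search : Found
      search = step₁ (∑-positive M _ good-pair)
        where
        step₁ : (∃ λ x → x ∈ M × ¬ ∑ M (λ y → W x y * (𝟙 - bad x y)) ≤ 𝟘) → Found
        step₁ (x , x∈ , p) = step₂ (∑-positive M _ p)
          where
          step₂ : (∃ λ y → y ∈ M × ¬ W x y * (𝟙 - bad x y) ≤ 𝟘) → Found
          step₂ (y , y∈ , r) = examine x y x∈ y∈ r

  -- Filling all gaps and reading off the matchings

  module Filling {n t K : ℕ} (c : Fin n → Fin n → Fin K)
    (row-proper : ∀ i {j j′} → c i j ≡ c i j′ → j ≡ j′) (col-proper : ∀ j {i i′} → c i j ≡ c i′ j → i ≡ i′)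
    {Q : Fin K → Set} (Q? : ∀ k → Dec (Q k)) (ℓ B : 𝔽)
    (t≤n : ι t ≤ ι n) (ℓ≥0 : 𝟘 ≤ ℓ) (B≥2 : ι 2 ≤ B) (ν q lam h o : 𝔽) (νn : ν * ι n ≡ 𝟙) (ν≥0 : 𝟘 ≤ ν) (q≥0 : 𝟘 ≤ q) (q≤1 : q ≤ 𝟙) (lam≥0 : 𝟘 ≤ lam)
    (row-degree : ∀ i → q - lam ≤ ν * ∑ (allFin n) (λ j → 𝟏 (Q? (c i j)))) (col-degree : ∀ j → q - lam ≤ ν * ∑ (allFin n) (λ i → 𝟏 (Q? (c i j))))
    (codegree : ∀ i i′ → i ≢ i′ → ν * ∑ (allFin n) (λ j → 𝟏 (Q? (c i j)) * 𝟏 (Q? (c i′ j))) ≤ q * q + lam)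
    (h>0 : ¬ h ≤ 𝟘) (h-large : ι 3 * lam + ν ≤ ι 4 * (h * h)) (o-large : ℓ ≤ o * (B - 𝟙))
    (X≥0 : 𝟘 ≤ q - lam - ν * ℓ)
    (many : ¬ q * (q - lam - ν * ℓ) * (q - lam - ν * ℓ) ≤ ι 2 * h + ι 2 * (ν * B) + ι 4 * (ν * ℓ) + ι 5 * ν + ι 4 * o) where
    open Switching {t = t} c row-proper col-proper Q? ℓ B
    open Searching {t = t} c row-proper col-proper Q? ℓ B

    private
      Fn = allFin n
      Ft = allFin t

      deficient : ∀ {m} (f : Fin m → 𝔽) → (∀ i → f i ≤ 𝟙) → ∀ a → f a ≡ 𝟘 → ∑ (allFin m) f ≤ ι m - 𝟙
      deficient {m} f f≤1 a fa = ≤-trans (∑-mono (allFin m) {g = λ i → 𝟙 - 𝟏 (i FP.≟ a)} each)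
        (≤-reflexive (trans (∑-sub (allFin m) _ _) (cong₂ _-_ (trans (∑-Fin-const m 𝟙) (*-identityʳ (ι m))) (Enum.pick-1 (enumFin m) a))))
        where
        each : ∀ i → f i ≤ 𝟙 - 𝟏 (i FP.≟ a)
        each i = by (i FP.≟ a)
          where
          by : (d : Dec (i ≡ a)) → f i ≤ 𝟙 - 𝟏 d
          by (yes e) = (farkas (f i ∷ []) (X0 ≼ # 0 ∷ []) X0 (# 1 ⊖ # 1) 0 (1 ∙ 0 ∷ []) refl ((≤-reflexive (trans (cong f e) fa)) ∷ []))
          by (no _) = (farkas (f i ∷ []) (X0 ≼ # 1 ∷ []) X0 (# 1 ⊖ # 0) 0 (1 ∙ 0 ∷ []) refl ((f≤1 i) ∷ []))

      find : ∀ {m} {P : Fin m → Set} → (∀ i → Dec (P i)) → (∃ λ i → P i) ⊎ (∀ i → ¬ P i)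
      find P? = by (FP.any? P?)
        where
        by : Dec _ → _
        by (yes w) = inj₁ w
        by (no h) = inj₂ (λ i p → h (i , p))

      -- The matching s occupies as many columns as rows, because both numbers count its edges.
      free-column : ∀ {M} → Good M → ∀ s a → rows M a s ≡ 𝟘 → ∃ λ b → cols M b s ≡ 𝟘
      free-column {M} good s a row-free = by (find (λ b → cols M b s ≤? 𝟘))
        where
        open Good good
        open Loads good t≤n ℓ≥0
        by : (∃ λ b → cols M b s ≤ 𝟘) ⊎ (∀ b → ¬ cols M b s ≤ 𝟘) → ∃ λ b → cols M b s ≡ 𝟘
        by (inj₁ (b , le)) = b , ≤-antisym le (Cols.mult-≥0 M b s)
        by (inj₂ none) = ⊥-elim (1≰0 (farkas (∑ Fn (λ i → rows M i s) ∷ ι n ∷ present s ∷ ∑ Fn (λ j → cols M j s) ∷ []) (X0 ≼ X1 ⊖ # 1 ∷ X2 ≼ X0 ∷ X3 ≼ X2 ∷ X1 ⊗ # 1 ≼ X3 ∷ []) (# 1) (# 0) 0 (1 ∙ 0 ∷ 1 ∙ 1 ∷ 1 ∙ 2 ∷ 1 ∙ 3 ∷ []) refl ((deficient (λ i → rows M i s) (λ i → rows-once i s) a row-free) ∷ (≥-reflexive (present-by rowOf s)) ∷ (≤-reflexive (present-by colOf s)) ∷ full ∷ [])))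
          where
          full : ι n * 𝟙 ≤ ∑ Fn (λ j → cols M j s)
          full = ≤-trans (≥-reflexive (∑-Fin-const n 𝟙)) (∑-mono Fn (λ j → ≤-by-contradiction (λ h → none j (≤-reflexive (Cols.mult-0 M j s h)))))

      size-bound : ∀ {M} → Good M → ∀ a s → rows M a s ≡ 𝟘 → length M ℕ.< n ℕ.* t
      size-bound {M} good a s row-free = ι-cancel (subst₂ _≤_ (sym (ι-suc (length M))) (sym (ι-* n t)) (farkas (ι (length M) ∷ ι n ∷ ι t ∷ []) (X0 ≼ (X2 ⊖ # 1) ⊗ X1 ⊕ (X1 ⊖ # 1) ∷ []) (# 1 ⊕ X0) (X1 ⊗ X2) 0 (1 ∙ 0 ∷ []) refl (count ∷ [])))
        where
        open Good good
        column : Fin t → 𝔽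
        column s = ∑ Fn (λ i → rows M i s)
        column≤n : ∀ s → column s ≤ ι n
        column≤n s = ≤-trans (∑-mono Fn (λ i → rows-once i s)) (≤-reflexive (trans (∑-Fin-const n 𝟙) (*-identityʳ (ι n))))
        total : ι (length M) ≡ ∑ Ft column
        total = trans (trans (sym (*-identityʳ (ι (length M)))) (sym (∑-const M 𝟙))) (trans (sym (Enum.fibres (enumFin t) M matchOf (λ _ → 𝟙)))
          (∑-cong Ft (λ s → trans (∑-cong M (λ e → (*-identityʳ (𝟏 (matchOf e FP.≟ s))))) (sym (Enum.fibres (enumFin n) M rowOf (λ e → 𝟏 (matchOf e FP.≟ s)))))))
        count : ι (length M) ≤ (ι t - 𝟙) * ι n + (ι n - 𝟙)
        count = ≤-trans (≤-reflexive total) (≤-trans (∑-mono Ft {g = λ s′ → ι n - 𝟏 (s′ FP.≟ s)} each)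
          (≤-reflexive (trans (∑-sub Ft _ _) (trans (cong₂ _-_ (∑-Fin-const t (ι n)) (Enum.pick-1 (enumFin t) s)) (ring (ι t ∷ ι n ∷ []) (X0 ⊗ X1 ⊖ # 1) ((X0 ⊖ # 1) ⊗ X1 ⊕ (X1 ⊖ # 1)) refl)))))
          where
          each : ∀ s′ → column s′ ≤ ι n - 𝟏 (s′ FP.≟ s)
          each s′ = by (s′ FP.≟ s)
            where
            by : (d : Dec (s′ ≡ s)) → column s′ ≤ ι n - 𝟏 d
            by (yes refl) = deficient (λ i → rows M i s) (λ i → rows-once i s) a row-free
            by (no _) = (farkas (column s′ ∷ ι n ∷ []) (X0 ≼ X1 ∷ []) X0 (X1 ⊖ # 0) 0 (1 ∙ 0 ∷ []) refl ((column≤n s′) ∷ []))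

    Full : List Edge → Set
    Full M = ∀ i s → ¬ rows M i s ≤ 𝟘

    -- Each switch replaces two edges by three, so the packing grows by one, while a packing with a
    -- gap has fewer than n t edges. The fuel f therefore cannot run out while a gap remains.
    fill : ∀ f M → Good M → n ℕ.* t ℕ.≤ f ℕ.+ length M → ∃ λ M′ → Good M′ × Full M′
    fill f M good enough = by (find (λ i → dec-some i))
      where
      Gap : Fin n → Set
      Gap i = ∃ λ s → rows M i s ≤ 𝟘
      dec-some : ∀ i → Dec (Gap i)
      dec-some i = FP.any? (λ s → rows M i s ≤? 𝟘)
      by : (∃ λ i → Gap i) ⊎ (∀ i → ¬ Gap i) → ∃ λ M′ → Good M′ × Full M′
      by (inj₂ none) = M , good , λ i s le → none i (s , le)
      by (inj₁ (a , s , le)) = with-column (free-column good s a row-free)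
        where
        row-free : rows M a s ≡ 𝟘
        row-free = ≤-antisym le (Rows.mult-≥0 M a s)
        room : length M ℕ.< n ℕ.* t
        room = size-bound good a s row-free
        with-column : (∃ λ b → cols M b s ≡ 𝟘) → ∃ λ M′ → Good M′ × Full M′
        with-column (b , col-free) = continue f enough (Search.search good s a b row-free col-free t≤n ℓ≥0 B≥2 ν q lam h o νn ν≥0 q≥0 q≤1 lam≥0 row-degree col-degree codegree h>0 h-large o-large X≥0 many)
          where
          continue : ∀ f → n ℕ.* t ℕ.≤ f ℕ.+ length M → Search.Found good s a b row-free col-free t≤n ℓ≥0 B≥2 ν q lam h o νn ν≥0 q≥0 q≤1 lam≥0 row-degree col-degree codegree h>0 h-large o-large X≥0 many → ∃ λ M′ → Good M′ × Full M′
          continue zero en _ = ⊥-elim (ℕP.<⇒≱ room en)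
          continue (suc f) en (i₁ , j₁ , i₂ , j₂ , M₀ , perm , sw) = fill f _ (switch good perm sw) (ℕP.≤-trans en (ℕP.≤-reflexive (trans (cong (λ z → suc (f ℕ.+ z)) (PermP.↭-length perm)) (sym (ℕP.+-suc f (suc (suc (length M₀))))))))

    module _ {M : List Edge} (good : Good M) (full : Full M) where
      open Good good

      private
        once-unique : ∀ {W₁ W₂ : Set} (E₁ : Enum W₁) (E₂ : Enum W₂) (π₁ : Edge → W₁) (π₂ : Edge → W₂) → (∀ w₁ w₂ → mult E₁ E₂ π₁ π₂ M w₁ w₂ ≤ 𝟙) →
                      ∀ {e e′} → e ∈ M → e′ ∈ M → π₁ e ≡ π₁ e′ → π₂ e ≡ π₂ e′ → e ≡ e′
        once-unique E₁ E₂ π₁ π₂ once {e} {e′} m m′ p r = by (Enum._≟_ (enum× (enumFin n) (enum× (enumFin n) (enumFin t))) e e′)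
          where
          by : Dec (e ≡ e′) → e ≡ e′
          by (yes eq) = eq
          by (no ne) = ⊥-elim (clash (extract₂ m m′ ne))
            where
            clash : (∃ λ M₀ → M ↭ (e ∷ e′ ∷ M₀)) → ⊥
            clash (M₀ , perm) = Multiplicity.mult-≤1-unique E₁ E₂ π₁ π₂ {M} (once (π₁ e) (π₂ e)) M₀ perm refl refl (sym p) (sym r)

        edge : ∀ s i → ∃ λ e → e ∈ M × rowOf e ≡ i × matchOf e ≡ s
        edge s i = Rows.member M i s (full i s)

      matching : Fin t → Fin n → Fin n
      matching s i = colOf (proj₁ (edge s i))

      matching-injective : ∀ s {i i′} → matching s i ≡ matching s i′ → i ≡ i′
      matching-injective s {i} {i′} eq = by (edge s i) (edge s i′) eq
        where
        by : (x : ∃ λ e → e ∈ M × rowOf e ≡ i × matchOf e ≡ s) (y : ∃ λ e → e ∈ M × rowOf e ≡ i′ × matchOf e ≡ s) → colOf (proj₁ x) ≡ colOf (proj₁ y) → i ≡ i′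
        by (e , m , r , z) (e′ , m′ , r′ , z′) p = trans (sym r) (trans (cong rowOf (once-unique (enumFin n) (enumFin t) colOf matchOf cols-once m m′ p (trans z (sym z′)))) r′)

      matching-rainbow : ∀ s {i i′} → c i (matching s i) ≡ c i′ (matching s i′) → i ≡ i′
      matching-rainbow s {i} {i′} eq = by (edge s i) (edge s i′) eq
        where
        by : (x : ∃ λ e → e ∈ M × rowOf e ≡ i × matchOf e ≡ s) (y : ∃ λ e → e ∈ M × rowOf e ≡ i′ × matchOf e ≡ s) → c i (colOf (proj₁ x)) ≡ c i′ (colOf (proj₁ y)) → i ≡ i′
        by (e , m , refl , z) (e′ , m′ , refl , z′) p = cong rowOf (once-unique (enumFin K) (enumFin t) colourOf matchOf syms-once m m′ p (trans z (sym z′)))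

      matching-disjoint : ∀ s s′ → s ≢ s′ → ∀ i → matching s i ≢ matching s′ i
      matching-disjoint s s′ ne i eq = by (edge s i) (edge s′ i) eq
        where
        by : (x : ∃ λ e → e ∈ M × rowOf e ≡ i × matchOf e ≡ s) (y : ∃ λ e → e ∈ M × rowOf e ≡ i × matchOf e ≡ s′) → colOf (proj₁ x) ≡ colOf (proj₁ y) → ⊥
        by (e , m , r , z) (e′ , m′ , r′ , z′) p = ne (trans (sym z) (trans (cong matchOf (once-unique (enumFin n) (enumFin n) rowOf colOf cells-once m m′ (trans r (sym r′)) p)) z′))

  -- The hypergraph of cells and matchings

  ∑-⊎ : ∀ {A B : Set} (EA : Enum A) (EB : Enum B) f → ∑ (elems (enum⊎ EA EB)) f ≡ ∑ (elems EA) (f ∘ inj₁) + ∑ (elems EB) (f ∘ inj₂)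
  ∑-⊎ EA EB f = trans (∑-++ (map inj₁ (elems EA)) _ f) (cong₂ _+_ (∑-map inj₁ (elems EA) f) (∑-map inj₂ (elems EB) f))

  ∑-× : ∀ {A B : Set} (EA : Enum A) (EB : Enum B) f → ∑ (elems (enum× EA EB)) f ≡ ∑ (elems EA) (λ x → ∑ (elems EB) (λ y → f (x , y)))
  ∑-× EA EB f = ∑-pairs (elems EA) (elems EB) f

  module Triples {n t K : ℕ} (c : Fin n → Fin n → Fin K)
    (row-proper : ∀ i {j j′} → c i j ≡ c i j′ → j ≡ j′) (col-proper : ∀ j {i i′} → c i j ≡ c i′ j → i ≡ i′)
    (ξ : Fin K → 𝔽) (ξ-01 : ∀ k → ξ k ≡ 𝟘 ⊎ ξ k ≡ 𝟙) where

    Fn = allFin n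
    Ft = allFin t
    En = enumFin n
    Et = enumFin t
    EK = enumFin K

    Cell Line Sym V E Test : Set
    Cell = Fin n × Fin n
    Line = Fin n × Fin t
    Sym = Fin K × Fin t
    V = Cell ⊎ (Line ⊎ (Line ⊎ Sym))
    E = Fin n × Fin n × Fin t
    Test = Fin t ⊎ (Fin t ⊎ (Fin n ⊎ Fin n))

    EV : Enum V
    EV = enum⊎ (enum× En En) (enum⊎ (enum× En Et) (enum⊎ (enum× En Et) (enum× EK Et)))

    EE : Enum E
    EE = enum× En (enum× En Et)

    ETest : Enum Test
    ETest = enum⊎ Et (enum⊎ Et (enum⊎ En En))

    pattern cell p = inj₁ p
    pattern row p = inj₂ (inj₁ p)
    pattern col p = inj₂ (inj₂ (inj₁ p))
    pattern sym′ p = inj₂ (inj₂ (inj₂ p))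

    verts : E → List V
    verts (i , j , s) = cell (i , j) ∷ row (i , s) ∷ col (j , s) ∷ sym′ (c i j , s) ∷ []

    Q : Fin K → Set
    Q k = ¬ ξ k ≤ 𝟘

    Q? : ∀ k → Dec (Q k)
    Q? k = ¬? (ξ k ≤? 𝟘)

    in-Q : ∀ k → 𝟏 (Q? k) ≡ ξ k
    in-Q k = by (ξ-01 k)
      where
      by : ξ k ≡ 𝟘 ⊎ ξ k ≡ 𝟙 → 𝟏 (Q? k) ≡ ξ k
      by (inj₁ e) = trans (𝟏-no (Q? k) (λ q → q (≤-reflexive e))) (sym e)
      by (inj₂ e) = trans (𝟏-yes (Q? k) (λ le → 1≰0 (subst (_≤ 𝟘) e le))) (sym e)

    open Switching {t = t} c row-proper col-proper Q? 𝟘 𝟘 using (rowOf; colOf; matchOf; colourOf; reserved)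

    available : E → List E
    available e = by (Q? (colourOf e))
      where
      by : Dec (Q (colourOf e)) → List E
      by (yes _) = []
      by (no _) = e ∷ []

    es : List E
    es = concatMap available (elems EE)

    free : Fin n → Fin n → 𝔽
    free i j = 𝟙 - ξ (c i j)

    free≥0 : ∀ i j → 𝟘 ≤ free i j
    free≥0 i j = by (ξ-01 (c i j))
      where
      by : ξ (c i j) ≡ 𝟘 ⊎ ξ (c i j) ≡ 𝟙 → 𝟘 ≤ free i j
      by (inj₁ e) = (farkas (ξ (c i j) ∷ []) (X0 ≼ # 0 ∷ []) (# 0) (# 1 ⊖ X0) 0 (1 ∙1 ∷ 1 ∙ 0 ∷ []) refl ((≤-reflexive (e)) ∷ []))
      by (inj₂ e) = (complement-nonNeg (ξ (c i j)) (≤-reflexive (e)))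

    free≤1 : ∀ i j → free i j ≤ 𝟙
    free≤1 i j = by (ξ-01 (c i j))
      where
      by : ξ (c i j) ≡ 𝟘 ⊎ ξ (c i j) ≡ 𝟙 → free i j ≤ 𝟙
      by (inj₁ e) = (complement-≤1 (ξ (c i j)) (≥-reflexive (e)))
      by (inj₂ e) = (farkas (ξ (c i j) ∷ []) (# 1 ≼ X0 ∷ []) (# 1 ⊖ X0) (# 1) 0 (1 ∙1 ∷ 1 ∙ 0 ∷ []) refl ((≥-reflexive (e)) ∷ []))

    ∑-available : ∀ f e → ∑ (available e) f ≡ (𝟙 - ξ (colourOf e)) * f e
    ∑-available f e = trans (by (Q? (colourOf e))) (cong (λ z → (𝟙 - z) * f e) (in-Q (colourOf e)))
      where
      by : (d : Dec (Q (colourOf e))) → ∑ (available e) f ≡ (𝟙 - 𝟏 (Q? (colourOf e))) * f e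
      by _ with Q? (colourOf e)
      ... | yes _ = (ring (f e ∷ []) (# 0) ((# 1 ⊖ # 1) ⊗ X0) refl)
      ... | no _ = (ring (f e ∷ []) (X0 ⊕ # 0) ((# 1 ⊖ # 0) ⊗ X0) refl)

    ∑-E : ∀ f → ∑ (elems EE) f ≡ ∑ Fn (λ i → ∑ Fn (λ j → ∑ Ft (λ s → f (i , j , s))))
    ∑-E f = trans (∑-× En (enum× En Et) f) (∑-cong Fn (λ i → ∑-× En Et (λ p → f (i , p))))

    ∑-es : ∀ f → ∑ es f ≡ ∑ Fn (λ i → ∑ Fn (λ j → ∑ Ft (λ s → free i j * f (i , j , s))))
    ∑-es f = trans (∑-concatMap available (elems EE) f) (trans (∑-cong (elems EE) (∑-available f)) (∑-E _))

    es-free : ∀ {e} → e ∈ es → reserved e ≡ 𝟘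
    es-free {e} m = find (MemP.∈-concatMap⁻ available {xs = elems EE} m)
      where
      here-free : ∀ {d} → e ∈ available d → reserved e ≡ 𝟘
      here-free {d} m with Q? (colourOf d) in eq
      here-free {d} (here refl) | no q = 𝟏-no (Q? (colourOf d)) q
      find : ∀ {xs} → Any (λ d → e ∈ available d) xs → reserved e ≡ 𝟘
      find (here p) = here-free p
      find (there p) = find p

    open Counting EV

    ind : ∀ {A B : Set} (EA : Enum A) (EB : Enum B) a b a′ b′ → 𝟏 (Enum._≟_ (enum× EA EB) (a , b) (a′ , b′)) ≡ 𝟏 (Enum._≟_ EA a a′) * 𝟏 (Enum._≟_ EB b b′)
    ind EA EB a b a′ b′ = 𝟏-× (Enum._≟_ EA a a′) (Enum._≟_ EB b b′) (Enum._≟_ (enum× EA EB) (a , b) (a′ , b′)) (λ e → cong proj₁ e , cong proj₂ e) (cong₂ _,_)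

    private
      _≟V_ = Enum._≟_ EV

      sum-four : ∀ {a b d f a′ b′ d′ f′ z} → a ≡ a′ → b ≡ b′ → d ≡ d′ → f ≡ f′ → a′ + (b′ + (d′ + (f′ + 𝟘))) ≡ z → a + (b + (d + (f + 𝟘))) ≡ z
      sum-four refl refl refl refl e = e

      vc vr vcol vs : E → V
      vc e = cell (rowOf e , colOf e)
      vr e = row (rowOf e , matchOf e)
      vcol e = col (colOf e , matchOf e)
      vs e = sym′ (colourOf e , matchOf e)

      no-1 : ∀ u v → u ≢ v → 𝟏 (u ≟V v) ≡ 𝟘
      no-1 u v = 𝟏-no (u ≟V v)

      injective₁ : ∀ {A B : Set} {x y : A} → _≡_ {A = A ⊎ B} (inj₁ x) (inj₁ y) → x ≡ y
      injective₁ refl = refl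
      injective₂ : ∀ {A B : Set} {x y : B} → _≡_ {A = A ⊎ B} (inj₂ x) (inj₂ y) → x ≡ y
      injective₂ refl = refl

    count-cell : ∀ i j e → count (cell (i , j)) (verts e) ≡ 𝟏 (rowOf e FP.≟ i) * 𝟏 (colOf e FP.≟ j)
    count-cell i j e = sum-four (trans (𝟏-cong (vc e ≟V cell (i , j)) (Enum._≟_ (enum× En En) (rowOf e , colOf e) (i , j)) (injective₁) (cong (λ p → cell p))) (ind En En (rowOf e) (colOf e) i j)) (no-1 (vr e) (cell (i , j)) λ ()) (no-1 (vcol e) (cell (i , j)) λ ()) (no-1 (vs e) (cell (i , j)) λ ()) (ring (z ∷ []) (X0 ⊕ (# 0 ⊕ (# 0 ⊕ (# 0 ⊕ # 0)))) X0 refl)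
      where z = 𝟏 (rowOf e FP.≟ i) * 𝟏 (colOf e FP.≟ j)

    count-row : ∀ i s e → count (row (i , s)) (verts e) ≡ 𝟏 (rowOf e FP.≟ i) * 𝟏 (matchOf e FP.≟ s)
    count-row i s e = sum-four (no-1 (vc e) (row (i , s)) λ ()) (trans (𝟏-cong (vr e ≟V row (i , s)) (Enum._≟_ (enum× En Et) (rowOf e , matchOf e) (i , s)) (injective₁ ∘ injective₂) (cong (λ p → row p))) (ind En Et (rowOf e) (matchOf e) i s)) (no-1 (vcol e) (row (i , s)) λ ()) (no-1 (vs e) (row (i , s)) λ ()) (ring (z ∷ []) (# 0 ⊕ (X0 ⊕ (# 0 ⊕ (# 0 ⊕ # 0)))) X0 refl)
      where z = 𝟏 (rowOf e FP.≟ i) * 𝟏 (matchOf e FP.≟ s)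

    count-col : ∀ j s e → count (col (j , s)) (verts e) ≡ 𝟏 (colOf e FP.≟ j) * 𝟏 (matchOf e FP.≟ s)
    count-col j s e = sum-four (no-1 (vc e) (col (j , s)) λ ()) (no-1 (vr e) (col (j , s)) λ ()) (trans (𝟏-cong (vcol e ≟V col (j , s)) (Enum._≟_ (enum× En Et) (colOf e , matchOf e) (j , s)) (injective₁ ∘ injective₂ ∘ injective₂) (cong (λ p → col p))) (ind En Et (colOf e) (matchOf e) j s)) (no-1 (vs e) (col (j , s)) λ ()) (ring (z ∷ []) (# 0 ⊕ (# 0 ⊕ (X0 ⊕ (# 0 ⊕ # 0)))) X0 refl)
      where z = 𝟏 (colOf e FP.≟ j) * 𝟏 (matchOf e FP.≟ s)

    count-sym : ∀ k s e → count (sym′ (k , s)) (verts e) ≡ 𝟏 (colourOf e FP.≟ k) * 𝟏 (matchOf e FP.≟ s)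
    count-sym k s e = sum-four (no-1 (vc e) (sym′ (k , s)) λ ()) (no-1 (vr e) (sym′ (k , s)) λ ()) (no-1 (vcol e) (sym′ (k , s)) λ ()) (trans (𝟏-cong (vs e ≟V sym′ (k , s)) (Enum._≟_ (enum× EK Et) (colourOf e , matchOf e) (k , s)) (injective₂ ∘ injective₂ ∘ injective₂) (cong (λ p → sym′ p))) (ind EK Et (colourOf e) (matchOf e) k s)) (ring (z ∷ []) (# 0 ⊕ (# 0 ⊕ (# 0 ⊕ (X0 ⊕ # 0)))) X0 refl)
      where z = 𝟏 (colourOf e FP.≟ k) * 𝟏 (matchOf e FP.≟ s)

    verts-unique : ∀ e → Unique (verts e)
    verts-unique e = ((λ ()) ∷ (λ ()) ∷ (λ ()) ∷ []) ∷ ((λ ()) ∷ (λ ()) ∷ []) ∷ ((λ ()) ∷ []) ∷ [] ∷ []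

    Shares : V → E → E → Set
    Shares u e e′ = (u ≡ cell (rowOf e , colOf e) × rowOf e ≡ rowOf e′ × colOf e ≡ colOf e′)
      ⊎ (u ≡ row (rowOf e , matchOf e) × rowOf e ≡ rowOf e′ × matchOf e ≡ matchOf e′)
      ⊎ (u ≡ col (colOf e , matchOf e) × colOf e ≡ colOf e′ × matchOf e ≡ matchOf e′)
      ⊎ (u ≡ sym′ (colourOf e , matchOf e) × colourOf e ≡ colourOf e′ × matchOf e ≡ matchOf e′)

    shares : ∀ {u e e′} → u ∈ verts e → u ∈ verts e′ → Shares u e e′
    shares (here refl) (here p) = inj₁ (refl , cong proj₁ (injective₁ p) , cong proj₂ (injective₁ p))
    shares (there (here refl)) (there (here p)) = inj₂ (inj₁ (refl , cong proj₁ (injective₁ (injective₂ p)) , cong proj₂ (injective₁ (injective₂ p))))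
    shares (there (there (here refl))) (there (there (here p))) = inj₂ (inj₂ (inj₁ (refl , cong proj₁ (injective₁ (injective₂ (injective₂ p))) , cong proj₂ (injective₁ (injective₂ (injective₂ p))))))
    shares (there (there (there (here refl)))) (there (there (there (here p)))) = inj₂ (inj₂ (inj₂ (refl , cong proj₁ (injective₂ (injective₂ (injective₂ p))) , cong proj₂ (injective₂ (injective₂ (injective₂ p))))))
    shares (here refl) (there (here ()))
    shares (here refl) (there (there (here ())))
    shares (here refl) (there (there (there (here ()))))
    shares (there (here refl)) (here ())
    shares (there (here refl)) (there (there (here ())))
    shares (there (here refl)) (there (there (there (here ()))))
    shares (there (there (here refl))) (here ())
    shares (there (there (here refl))) (there (here ()))
    shares (there (there (here refl))) (there (there (there (here ()))))
    shares (there (there (there (here refl)))) (here ())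
    shares (there (there (there (here refl)))) (there (here ()))
    shares (there (there (there (here refl)))) (there (there (here ())))

    -- Linearity of the hypergraph. A row and a colour determine the column, and a column and a
    -- colour determine the row, because the colouring is proper; any other two vertices of
    -- different kinds already name the row, the column and the matching.
    two-determine : ∀ {u v} → u ≢ v → ∀ {e e′} → u ∈ verts e × v ∈ verts e → u ∈ verts e′ × v ∈ verts e′ → e ≡ e′
    two-determine {u} {v} ne {i , j , s} {i′ , j′ , s′} (ue , ve) (ue′ , ve′) = by (shares {e = i , j , s} {i′ , j′ , s′} ue ue′) (shares {e = i , j , s} {i′ , j′ , s′} ve ve′)
      where
      all-eq : i ≡ i′ → j ≡ j′ → s ≡ s′ → (i , j , s) ≡ (i′ , j′ , s′)
      all-eq refl refl refl = refl
      from-row : i ≡ i′ → c i j ≡ c i′ j′ → j ≡ j′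
      from-row refl = row-proper i
      from-col : j ≡ j′ → c i j ≡ c i′ j′ → i ≡ i′
      from-col refl = col-proper j
      by : Shares u (i , j , s) (i′ , j′ , s′) → Shares v (i , j , s) (i′ , j′ , s′) → (i , j , s) ≡ (i′ , j′ , s′)
      by (inj₁ (p , _)) (inj₁ (r , _)) = ⊥-elim (ne (trans p (sym r)))
      by (inj₁ (_ , a , b)) (inj₂ (inj₁ (_ , _ , d))) = all-eq a b d
      by (inj₁ (_ , a , b)) (inj₂ (inj₂ (inj₁ (_ , _ , d)))) = all-eq a b d
      by (inj₁ (_ , a , b)) (inj₂ (inj₂ (inj₂ (_ , _ , d)))) = all-eq a b d
      by (inj₂ (inj₁ (_ , _ , d))) (inj₁ (_ , a , b)) = all-eq a b d
      by (inj₂ (inj₁ (p , _))) (inj₂ (inj₁ (r , _))) = ⊥-elim (ne (trans p (sym r)))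
      by (inj₂ (inj₁ (_ , a , d))) (inj₂ (inj₂ (inj₁ (_ , b , _)))) = all-eq a b d
      by (inj₂ (inj₁ (_ , a , d))) (inj₂ (inj₂ (inj₂ (_ , k , _)))) = all-eq a (from-row a k) d
      by (inj₂ (inj₂ (inj₁ (_ , _ , d)))) (inj₁ (_ , a , b)) = all-eq a b d
      by (inj₂ (inj₂ (inj₁ (_ , b , d)))) (inj₂ (inj₁ (_ , a , _))) = all-eq a b d
      by (inj₂ (inj₂ (inj₁ (p , _)))) (inj₂ (inj₂ (inj₁ (r , _)))) = ⊥-elim (ne (trans p (sym r)))
      by (inj₂ (inj₂ (inj₁ (_ , b , d)))) (inj₂ (inj₂ (inj₂ (_ , k , _)))) = all-eq (from-col b k) b d
      by (inj₂ (inj₂ (inj₂ (_ , _ , d)))) (inj₁ (_ , a , b)) = all-eq a b d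
      by (inj₂ (inj₂ (inj₂ (_ , k , _)))) (inj₂ (inj₁ (_ , a , d))) = all-eq a (from-row a k) d
      by (inj₂ (inj₂ (inj₂ (_ , k , _)))) (inj₂ (inj₂ (inj₁ (_ , b , d)))) = all-eq (from-col b k) b d
      by (inj₂ (inj₂ (inj₂ (p , _)))) (inj₂ (inj₂ (inj₂ (r , _)))) = ⊥-elim (ne (trans p (sym r)))

  -- Degrees of the hypergraph and the first, incomplete packing

  module Decomposing {n t K : ℕ} (c : Fin n → Fin n → Fin K)
    (row-proper : ∀ i {j j′} → c i j ≡ c i j′ → j ≡ j′) (col-proper : ∀ j {i i′} → c i j ≡ c i′ j → i ≡ i′)
    (ξ : Fin K → 𝔽) (ξ-01 : ∀ k → ξ k ≡ 𝟘 ⊎ ξ k ≡ 𝟙)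
    (W : Fin n → Fin n → 𝔽) (ν lam : 𝔽) (νn : ν * ι n ≡ 𝟙) (ν≥0 : 𝟘 ≤ ν) (lam≥0 : 𝟘 ≤ lam) (t≤n : ι t ≤ ι n)
    (W≥0 : ∀ i j → 𝟘 ≤ W i j) (W≤ : ∀ i j → W i j ≤ ι 4 * ν)
    (row-lower : ∀ i → 𝟙 - lam ≤ ∑ (allFin n) (λ j → W i j * (𝟙 - ξ (c i j)))) (row-upper : ∀ i → ∑ (allFin n) (λ j → W i j * (𝟙 - ξ (c i j))) ≤ 𝟙 + lam)
    (col-lower : ∀ j → 𝟙 - lam ≤ ∑ (allFin n) (λ i → W i j * (𝟙 - ξ (c i j)))) (col-upper : ∀ j → ∑ (allFin n) (λ i → W i j * (𝟙 - ξ (c i j))) ≤ 𝟙 + lam)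
    (cell-upper : ∀ i j → ι t * W i j ≤ 𝟙) (colour-upper : ∀ k → ∑ (allFin n) (λ i → ∑ (allFin n) (λ j → 𝟏 (c i j FP.≟ k) * W i j)) ≤ 𝟙) where
    open Triples {t = t} c row-proper col-proper ξ ξ-01

    weight : E → 𝔽
    weight e = W (proj₁ e) (proj₁ (proj₂ e))

    on-rows on-cols : Fin t → V → 𝔽
    on-rows s (row (i , s′)) = ν * 𝟏 (s′ FP.≟ s)
    on-rows s _ = 𝟘
    on-cols s (col (j , s′)) = ν * 𝟏 (s′ FP.≟ s)
    on-cols s _ = 𝟘

    on-row on-col : Fin n → V → 𝔽
    on-row i (row (i′ , s)) = ν * 𝟏 (i′ FP.≟ i)
    on-row i _ = 𝟘
    on-col j (col (j′ , s)) = ν * 𝟏 (j′ FP.≟ j)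
    on-col j _ = 𝟘

    -- Weight 1/n on the row or column vertices of one matching, or on the vertices of one row or
    -- column over all matchings. The uncovered masses of such tests, times n, are the numbers of
    -- missing lines from which debts and loads are computed.
    test : Test → V → 𝔽
    test (inj₁ s) = on-rows s
    test (inj₂ (inj₁ s)) = on-cols s
    test (inj₂ (inj₂ (inj₁ i))) = on-row i
    test (inj₂ (inj₂ (inj₂ j))) = on-col j

    ∑-V : ∀ f → ∑ (elems EV) f ≡ ∑ Fn (λ i → ∑ Fn (λ j → f (cell (i , j)))) + (∑ Fn (λ i → ∑ Ft (λ s → f (row (i , s)))) + (∑ Fn (λ j → ∑ Ft (λ s → f (col (j , s)))) + ∑ (allFin K) (λ k → ∑ Ft (λ s → f (sym′ (k , s))))))
    ∑-V f = trans (∑-⊎ (enum× En En) (enum⊎ (enum× En Et) (enum⊎ (enum× En Et) (enum× EK Et))) f) (cong₂ _+_ (∑-× En En (λ p → f (cell p))) (trans (∑-⊎ (enum× En Et) (enum⊎ (enum× En Et) (enum× EK Et)) (f ∘ inj₂)) (cong₂ _+_ (∑-× En Et (λ p → f (row p)))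
      (trans (∑-⊎ (enum× En Et) (enum× EK Et) (f ∘ inj₂ ∘ inj₂)) (cong₂ _+_ (∑-× En Et (λ p → f (col p))) (∑-× EK Et (λ p → f (sym′ p))))))))

    private
      zeros : ∀ {A B : Set} (xs : List A) (ys : List B) (g : A → B → 𝔽) → ∑ xs (λ x → ∑ ys (λ y → 𝟘 * g x y)) ≡ 𝟘
      zeros xs ys g = trans (∑-cong xs (λ x → trans (∑-cong ys (λ y → (*-zeroˡ (g x y)))) (∑-0 ys))) (∑-0 xs)

      pick-second : ∀ (g : Fin n → Fin t → 𝔽) s → ∑ Fn (λ i → ∑ Ft (λ s′ → ν * 𝟏 (s′ FP.≟ s) * g i s′)) ≡ ν * ∑ Fn (λ i → g i s)
      pick-second g s = trans (∑-cong Fn (λ i → trans (∑-cong Ft (λ s′ → *-assoc _ _ _)) (trans (∑-*ˡ Ft ν _) (cong (ν *_) (Enum.pick Et (g i) s))))) (∑-*ˡ Fn ν _)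

      pick-first : ∀ (g : Fin n → Fin t → 𝔽) i → ∑ Fn (λ i′ → ∑ Ft (λ s → ν * 𝟏 (i′ FP.≟ i) * g i′ s)) ≡ ν * ∑ Ft (g i)
      pick-first g i = trans (∑-cong Fn (λ i′ → trans (∑-cong Ft (λ s → *-assoc _ _ _)) (trans (∑-*ˡ Ft ν _) (cong (ν *_) (∑-*ˡ Ft _ _))))) (trans (∑-*ˡ Fn ν _) (cong (ν *_) (Enum.pick En (λ i′ → ∑ Ft (g i′)) i)))

      four-terms : ∀ {a b d f z} → a ≡ 𝟘 → b ≡ z → d ≡ 𝟘 → f ≡ 𝟘 → a + (b + (d + f)) ≡ z
      four-terms {z = z} refl refl refl refl = (ring (z ∷ []) (# 0 ⊕ (X0 ⊕ (# 0 ⊕ # 0))) X0 refl)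

      four-terms′ : ∀ {a b d f z} → a ≡ 𝟘 → b ≡ 𝟘 → d ≡ z → f ≡ 𝟘 → a + (b + (d + f)) ≡ z
      four-terms′ {z = z} refl refl refl refl = (ring (z ∷ []) (# 0 ⊕ (# 0 ⊕ (X0 ⊕ # 0))) X0 refl)

    test-rows : ∀ s (g : V → 𝔽) → ∑ (elems EV) (λ v → test (inj₁ s) v * g v) ≡ ν * ∑ Fn (λ i → g (row (i , s)))
    test-rows s g = trans (∑-V _) (four-terms (zeros Fn Fn _) (pick-second (λ i s′ → g (row (i , s′))) s) (zeros Fn Ft _) (zeros (allFin K) Ft _))

    test-cols : ∀ s (g : V → 𝔽) → ∑ (elems EV) (λ v → test (inj₂ (inj₁ s)) v * g v) ≡ ν * ∑ Fn (λ j → g (col (j , s)))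
    test-cols s g = trans (∑-V _) (four-terms′ (zeros Fn Fn _) (zeros Fn Ft _) (pick-second (λ j s′ → g (col (j , s′))) s) (zeros (allFin K) Ft _))

    test-row : ∀ i (g : V → 𝔽) → ∑ (elems EV) (λ v → test (inj₂ (inj₂ (inj₁ i))) v * g v) ≡ ν * ∑ Ft (λ s → g (row (i , s)))
    test-row i g = trans (∑-V _) (four-terms (zeros Fn Fn _) (pick-first (λ i s → g (row (i , s))) i) (zeros Fn Ft _) (zeros (allFin K) Ft _))

    test-col : ∀ j (g : V → 𝔽) → ∑ (elems EV) (λ v → test (inj₂ (inj₂ (inj₂ j))) v * g v) ≡ ν * ∑ Ft (λ s → g (col (j , s)))
    test-col j g = trans (∑-V _) (four-terms′ (zeros Fn Fn _) (zeros Fn Ft _) (pick-first (λ j s → g (col (j , s))) j) (zeros (allFin K) Ft _))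

    test-≥0 : ∀ τ v → 𝟘 ≤ test τ v
    test-≥0 (inj₁ s) (row (i , s′)) = *-nonNeg ν≥0 (𝟏-nonNeg (s′ FP.≟ s))
    test-≥0 (inj₁ s) (cell _) = ≤-refl
    test-≥0 (inj₁ s) (col _) = ≤-refl
    test-≥0 (inj₁ s) (sym′ _) = ≤-refl
    test-≥0 (inj₂ (inj₁ s)) (col (j , s′)) = *-nonNeg ν≥0 (𝟏-nonNeg (s′ FP.≟ s))
    test-≥0 (inj₂ (inj₁ s)) (cell _) = ≤-refl
    test-≥0 (inj₂ (inj₁ s)) (row _) = ≤-refl
    test-≥0 (inj₂ (inj₁ s)) (sym′ _) = ≤-refl
    test-≥0 (inj₂ (inj₂ (inj₁ i))) (row (i′ , s)) = *-nonNeg ν≥0 (𝟏-nonNeg (i′ FP.≟ i))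
    test-≥0 (inj₂ (inj₂ (inj₁ i))) (cell _) = ≤-refl
    test-≥0 (inj₂ (inj₂ (inj₁ i))) (col _) = ≤-refl
    test-≥0 (inj₂ (inj₂ (inj₁ i))) (sym′ _) = ≤-refl
    test-≥0 (inj₂ (inj₂ (inj₂ j))) (col (j′ , s)) = *-nonNeg ν≥0 (𝟏-nonNeg (j′ FP.≟ j))
    test-≥0 (inj₂ (inj₂ (inj₂ j))) (cell _) = ≤-refl
    test-≥0 (inj₂ (inj₂ (inj₂ j))) (row _) = ≤-refl
    test-≥0 (inj₂ (inj₂ (inj₂ j))) (sym′ _) = ≤-refl

    private
      ν𝟏≤ν : ∀ {P : Set} (d : Dec P) → ν * 𝟏 d ≤ ν
      ν𝟏≤ν d = (*-shrinkʳ ν (𝟏 d) ν≥0 (𝟏-≤1 d))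

    test-≤ν : ∀ τ v → test τ v ≤ ν
    test-≤ν (inj₁ s) (row (i , s′)) = ν𝟏≤ν (s′ FP.≟ s)
    test-≤ν (inj₁ s) (cell _) = ν≥0
    test-≤ν (inj₁ s) (col _) = ν≥0
    test-≤ν (inj₁ s) (sym′ _) = ν≥0
    test-≤ν (inj₂ (inj₁ s)) (col (j , s′)) = ν𝟏≤ν (s′ FP.≟ s)
    test-≤ν (inj₂ (inj₁ s)) (cell _) = ν≥0
    test-≤ν (inj₂ (inj₁ s)) (row _) = ν≥0
    test-≤ν (inj₂ (inj₁ s)) (sym′ _) = ν≥0
    test-≤ν (inj₂ (inj₂ (inj₁ i))) (row (i′ , s)) = ν𝟏≤ν (i′ FP.≟ i)
    test-≤ν (inj₂ (inj₂ (inj₁ i))) (cell _) = ν≥0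
    test-≤ν (inj₂ (inj₂ (inj₁ i))) (col _) = ν≥0
    test-≤ν (inj₂ (inj₂ (inj₁ i))) (sym′ _) = ν≥0
    test-≤ν (inj₂ (inj₂ (inj₂ j))) (col (j′ , s)) = ν𝟏≤ν (j′ FP.≟ j)
    test-≤ν (inj₂ (inj₂ (inj₂ j))) (cell _) = ν≥0
    test-≤ν (inj₂ (inj₂ (inj₂ j))) (row _) = ν≥0
    test-≤ν (inj₂ (inj₂ (inj₂ j))) (sym′ _) = ν≥0

    private
      sum-1 : ∀ m → ι m ≤ ι n → ν * ∑ (allFin m) (λ _ → 𝟙) ≤ 𝟙
      sum-1 m m≤n = (farkas (ν ∷ S ∷ ι m ∷ ι n ∷ []) (X1 ≼ X2 ⊗ # 1 ∷ X2 ≼ X3 ∷ # 0 ≼ X0 ∷ X0 ⊗ X3 ≼ # 1 ∷ []) (X0 ⊗ X1) (# 1) 0 (1 ∙ 3 ∷ 1 ∙ 0 · 2 ∷ 1 ∙ 1 · 2 ∷ []) refl ((≤-reflexive (∑-Fin-const m 𝟙)) ∷ m≤n ∷ ν≥0 ∷ (≤-reflexive (νn)) ∷ []))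
        where S = ∑ (allFin m) (λ _ → 𝟙)

      times-1 : ∀ τ → ∑ (elems EV) (test τ) ≡ ∑ (elems EV) (λ v → test τ v * 𝟙)
      times-1 τ = ∑-cong (elems EV) (λ v → (sym (*-identityʳ (test τ v))))

    test-sum≤1 : ∀ τ → ∑ (elems EV) (test τ) ≤ 𝟙
    test-sum≤1 (inj₁ s) = ≤-trans (≤-reflexive (trans (times-1 (inj₁ s)) (test-rows s (λ _ → 𝟙)))) (sum-1 n ≤-refl)
    test-sum≤1 (inj₂ (inj₁ s)) = ≤-trans (≤-reflexive (trans (times-1 (inj₂ (inj₁ s))) (test-cols s (λ _ → 𝟙)))) (sum-1 n ≤-refl)
    test-sum≤1 (inj₂ (inj₂ (inj₁ i))) = ≤-trans (≤-reflexive (trans (times-1 (inj₂ (inj₂ (inj₁ i)))) (test-row i (λ _ → 𝟙)))) (sum-1 t t≤n)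
    test-sum≤1 (inj₂ (inj₂ (inj₂ j))) = ≤-trans (≤-reflexive (trans (times-1 (inj₂ (inj₂ (inj₂ j)))) (test-col j (λ _ → 𝟙)))) (sum-1 t t≤n)

    open Counting EV

    deg : V → 𝔽
    deg v = ∑ es (λ e → weight e * count v (verts e))

    deg-row : ∀ i s → deg (row (i , s)) ≡ ∑ Fn (λ j → W i j * (𝟙 - ξ (c i j)))
    deg-row i s = trans (∑-es _) (trans (∑-cong Fn (λ i′ → trans (∑-cong Fn (λ j → trans (∑-cong Ft (λ s′ → trans (cong (λ z → free i′ j * (W i′ j * z)) (count-row i s (i′ , j , s′)))
        (ring (free i′ j ∷ W i′ j ∷ 𝟏 (i′ FP.≟ i) ∷ 𝟏 (s′ FP.≟ s) ∷ []) (X0 ⊗ (X1 ⊗ (X2 ⊗ X3))) (X3 ⊗ (X2 ⊗ (X1 ⊗ X0))) refl))) (Enum.pick Et _ s))) (∑-*ˡ Fn _ _)))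
      (Enum.pick En (λ i′ → ∑ Fn (λ j → W i′ j * free i′ j)) i))

    deg-col : ∀ j s → deg (col (j , s)) ≡ ∑ Fn (λ i → W i j * (𝟙 - ξ (c i j)))
    deg-col j s = trans (∑-es _) (∑-cong Fn (λ i → trans (∑-cong Fn (λ j′ → trans (∑-cong Ft (λ s′ → trans (cong (λ z → free i j′ * (W i j′ * z)) (count-col j s (i , j′ , s′)))
        (ring (free i j′ ∷ W i j′ ∷ 𝟏 (j′ FP.≟ j) ∷ 𝟏 (s′ FP.≟ s) ∷ []) (X0 ⊗ (X1 ⊗ (X2 ⊗ X3))) (X3 ⊗ (X2 ⊗ (X1 ⊗ X0))) refl))) (Enum.pick Et _ s))) (Enum.pick En (λ j′ → W i j′ * free i j′) j)))

    deg-cell : ∀ i j → deg (cell (i , j)) ≤ 𝟙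
    deg-cell i j = ≤-trans (≤-reflexive (trans (∑-es _) (trans (∑-cong Fn (λ i′ → trans (∑-cong Fn (λ j′ → trans (trans (∑-cong Ft (λ s′ → trans (cong (λ z → free i′ j′ * (W i′ j′ * z)) (count-cell i j (i′ , j′ , s′)))
        (ring (free i′ j′ ∷ W i′ j′ ∷ 𝟏 (i′ FP.≟ i) ∷ 𝟏 (j′ FP.≟ j) ∷ []) (X0 ⊗ (X1 ⊗ (X2 ⊗ X3))) (X3 ⊗ (X2 ⊗ (X1 ⊗ X0))) refl))) (∑-Fin-const t _)) (ring (ι t ∷ 𝟏 (j′ FP.≟ j) ∷ 𝟏 (i′ FP.≟ i) ∷ W i′ j′ ∷ free i′ j′ ∷ []) (X0 ⊗ (X1 ⊗ (X2 ⊗ (X3 ⊗ X4)))) (X1 ⊗ (X2 ⊗ (X0 ⊗ X3 ⊗ X4))) refl))) (Enum.pick En _ j)))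
      (Enum.pick En (λ i′ → ι t * W i′ j * free i′ j) i))))
      (farkas (ι t ∷ W i j ∷ free i j ∷ []) (X0 ⊗ X1 ≼ # 1 ∷ # 0 ≼ X2 ∷ X2 ≼ # 1 ∷ []) (X0 ⊗ X1 ⊗ X2) (# 1) 0 (1 ∙ 2 ∷ 1 ∙ 0 · 1 ∷ []) refl ((cell-upper i j) ∷ (free≥0 i j) ∷ (free≤1 i j) ∷ []))

    deg-sym : ∀ k s → deg (sym′ (k , s)) ≤ 𝟙
    deg-sym k s = ≤-trans (≤-reflexive (trans (∑-es _) (∑-cong Fn (λ i → ∑-cong Fn (λ j → trans (∑-cong Ft (λ s′ → trans (cong (λ z → free i j * (W i j * z)) (count-sym k s (i , j , s′)))
        (ring (free i j ∷ W i j ∷ 𝟏 (c i j FP.≟ k) ∷ 𝟏 (s′ FP.≟ s) ∷ []) (X0 ⊗ (X1 ⊗ (X2 ⊗ X3))) (X3 ⊗ (X0 ⊗ (X2 ⊗ X1))) refl))) (Enum.pick Et _ s))))))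
      (≤-trans (∑-mono Fn (λ i → ∑-mono Fn (λ j → (farkas (free i j ∷ 𝟏 (c i j FP.≟ k) ∷ W i j ∷ []) (# 0 ≼ X1 ⊗ X2 ∷ X0 ≼ # 1 ∷ []) (X0 ⊗ (X1 ⊗ X2)) (X1 ⊗ X2) 0 (1 ∙ 0 · 1 ∷ []) refl ((*-nonNeg (𝟏-nonNeg (c i j FP.≟ k)) (W≥0 i j)) ∷ (free≤1 i j) ∷ []))))) (colour-upper k))

    private
      1≤1+lam : 𝟙 ≤ 𝟙 + lam
      1≤1+lam = (farkas (lam ∷ []) (# 0 ≼ X0 ∷ []) (# 1) (# 1 ⊕ X0) 0 (1 ∙ 0 ∷ []) refl (lam≥0 ∷ []))

    deg≤ : ∀ v → deg v ≤ 𝟙 + lam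
    deg≤ (cell (i , j)) = ≤-trans (deg-cell i j) 1≤1+lam
    deg≤ (row (i , s)) = ≤-trans (≤-reflexive (deg-row i s)) (row-upper i)
    deg≤ (col (j , s)) = ≤-trans (≤-reflexive (deg-col j s)) (col-upper j)
    deg≤ (sym′ (k , s)) = ≤-trans (deg-sym k s) 1≤1+lam

    deg≥ : ∀ τ v → test τ v * (𝟙 - lam) ≤ test τ v * deg v
    deg≥ τ v = by v (test-≥0 τ v)
      where
      zero-case : ∀ v → test τ v ≡ 𝟘 → test τ v * (𝟙 - lam) ≤ test τ v * deg v
      zero-case v e = subst (λ z → z * (𝟙 - lam) ≤ z * deg v) (sym e) (farkas (lam ∷ deg v ∷ []) ([]) (# 0 ⊗ (# 1 ⊖ X0)) (# 0 ⊗ X1) 0 ([]) refl ([]))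
      cell-0 : ∀ τ p → test τ (cell p) ≡ 𝟘
      cell-0 (inj₁ s) p = refl
      cell-0 (inj₂ (inj₁ s)) p = refl
      cell-0 (inj₂ (inj₂ (inj₁ i))) p = refl
      cell-0 (inj₂ (inj₂ (inj₂ j))) p = refl
      sym-0 : ∀ τ p → test τ (sym′ p) ≡ 𝟘
      sym-0 (inj₁ s) p = refl
      sym-0 (inj₂ (inj₁ s)) p = refl
      sym-0 (inj₂ (inj₂ (inj₁ i))) p = refl
      sym-0 (inj₂ (inj₂ (inj₂ j))) p = refl
      by : ∀ v → 𝟘 ≤ test τ v → test τ v * (𝟙 - lam) ≤ test τ v * deg v
      by (cell p) _ = zero-case (cell p) (cell-0 τ p)
      by (row (i , s)) h = *-monoʳ h (≤-trans (row-lower i) (≥-reflexive (deg-row i s)))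
        where
        *-monoʳ : ∀ {a x y} → 𝟘 ≤ a → x ≤ y → a * x ≤ a * y
        *-monoʳ {a} {x} {y} p r = (*-monoʳ-≤ a x y p r)
      by (col (j , s)) h = *-monoʳ h (≤-trans (col-lower j) (≥-reflexive (deg-col j s)))
        where
        *-monoʳ : ∀ {a x y} → 𝟘 ≤ a → x ≤ y → a * x ≤ a * y
        *-monoʳ {a} {x} {y} p r = (*-monoʳ-≤ a x y p r)
      by (sym′ p) _ = zero-case (sym′ p) (sym-0 τ p)

    -- By linearity at most one triple contains both vertices, and no weight exceeds 4ν.
    pair-degree : ∀ {u v} → u ≢ v → ∑ es (λ e → weight e * (count u (verts e) * count v (verts e))) ≤ ι 4 * ν
    pair-degree {u} {v} u≢v = ≤-trans (≤-reflexive (trans (∑-concatMap available (elems EE) _) (∑-cong (elems EE) (∑-available _))))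
      (≤-trans (∑-mono (elems EE) {g = λ e → 𝟏 (both? e) * (ι 4 * ν)} each) (≤-trans (≤-reflexive (∑-*ʳ (elems EE) (ι 4 * ν) _))
        (farkas (S ∷ ν ∷ []) (X0 ≼ # 1 ∷ # 0 ≼ X1 ∷ []) (X0 ⊗ (# 4 ⊗ X1)) (# 4 ⊗ X1) 0 (4 ∙ 0 · 1 ∷ []) refl ((at-most-one EE both? (two-determine u≢v)) ∷ ν≥0 ∷ []))))
      where
      _∈?_ : ∀ x xs → Dec (x ∈ xs)
      x ∈? xs = any? (Enum._≟_ EV x) xs
      both? : ∀ e → Dec (u ∈ verts e × v ∈ verts e)
      both? e = (u ∈? verts e) ×-dec (v ∈? verts e)
      S = ∑ (elems EE) (λ e → 𝟏 (both? e))
      count-≤ : ∀ x e → count x (verts e) ≤ 𝟏 (x ∈? verts e)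
      count-≤ x e = by (x ∈? verts e)
        where
        by : (d : Dec (x ∈ verts e)) → count x (verts e) ≤ 𝟏 d
        by (yes _) = count-≤1 x (verts-unique e)
        by (no h) = ≤-by-contradiction (λ p → h (∈-count x (verts e) p))
      each : ∀ e → (𝟙 - ξ (c (proj₁ e) (proj₁ (proj₂ e)))) * (weight e * (count u (verts e) * count v (verts e))) ≤ 𝟏 (both? e) * (ι 4 * ν)
      each e@(i , j , s) = subst (λ z → free i j * (W i j * (count u (verts e) * count v (verts e))) ≤ z * (ι 4 * ν)) (sym (𝟏-× (u ∈? verts e) (v ∈? verts e) (both? e) (λ p → p) _,_))
        (≤-trans (farkas (free i j ∷ W i j ∷ cu ∷ cv ∷ []) (X0 ≼ # 1 ∷ # 0 ≼ X1 ⊗ (X2 ⊗ X3) ∷ []) (X0 ⊗ (X1 ⊗ (X2 ⊗ X3))) (X1 ⊗ (X2 ⊗ X3)) 0 (1 ∙ 0 · 1 ∷ []) refl ((free≤1 i j) ∷ (*-nonNeg (W≥0 i j) (*-nonNeg (count-nonNeg u (verts e)) (count-nonNeg v (verts e)))) ∷ []))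
          (≤-trans (*-mono-≤ (W≥0 i j) (*-nonNeg (count-nonNeg u (verts e)) (count-nonNeg v (verts e))) (W≤ i j) (*-mono-≤ (count-nonNeg u (verts e)) (count-nonNeg v (verts e)) (count-≤ u e) (count-≤ v e))) (≤-reflexive (*-comm _ _))))
        where
        cu = count u (verts e)
        cv = count v (verts e)

    record Constants (N J : ℕ) (β θ κ R s₁ s₂ : 𝔽) : Set where
      field
        lam≤¼ : ι 4 * lam ≤ 𝟙
        4ν≤θ : ι 4 * ν ≤ θ
        β≥0 : 𝟘 ≤ β
        β≤⅓ : ι 3 * β ≤ 𝟙
        β≤κ : β ≤ κ
        growth : (𝟙 + ι 3 * β) ^ J * θ ≤ κ
        room : β * ((𝟙 + ι 3 * β) ^ J * ∑ es weight + ι (length (elems EV))) ≤ 𝟙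
        R≥0 : 𝟘 ≤ R
        R≡ : R ≡ s₁ * lam
        s₁≥1 : 𝟙 ≤ s₁
        s₂≥1 : 𝟙 ≤ s₂
        N≥1 : 𝟙 ≤ ι N
        small₁ : ι N * (ι 2 * (s₁ * (ι 8 * κ))) ≤ 𝟙
        small₂ : ι N * (ι 2 * (s₂ * θ)) ≤ 𝟙
        budget₁ : ι 2 * (ι J * (ι 1600 * (ι N * ι N) * (s₁ * s₁) * β * κ)) ≤ 𝟙
        budget₂ : ι 2 * (ι J * (ι 4 * β * lam * (ι N * s₂ + ι 5 * (ι N * ι N) * (s₂ * s₂ * θ)))) ≤ 𝟙
        R-large : ¬ (𝟙 + R * R) ^ N ≤ ι 2 * ι (length (elems (enum⊎ (enum⊎ EV ETest) ETest)))

    module _ {N J : ℕ} {β θ κ R s₁ s₂ : 𝔽} (constants : Constants N J β θ κ R s₁ s₂) where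
      open Constants constants
      private
        open module P = Nibbling EV ETest es verts weight test N J β θ κ lam R s₁ s₂ using (Assumptions; near-perfect)

        ν≤θ : ν ≤ θ
        ν≤θ = (farkas (ν ∷ θ ∷ []) (# 4 ⊗ X0 ≼ X1 ∷ # 0 ≼ X0 ∷ []) X0 X1 0 (1 ∙ 0 ∷ 3 ∙ 1 ∷ []) refl (4ν≤θ ∷ ν≥0 ∷ []))

        assumptions : Assumptions
        assumptions = record
          { w≥0 = λ e → W≥0 (proj₁ e) (proj₁ (proj₂ e)) ; verts-unique = verts-unique ; verts-4 = λ _ → refl
          ; deg-upper = deg≤ ; deg-lower = deg≥ ; codegree = λ ne → ≤-trans (pair-degree ne) 4ν≤θ
          ; test≥0 = test-≥0 ; test-sum = test-sum≤1 ; test≤θ = λ τ v → ≤-trans (test-≤ν τ v) ν≤θ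
          ; β≥0 = β≥0 ; β≤⅓ = β≤⅓ ; β≤ν = β≤κ ; lam≥0 = lam≥0 ; lam≤¼ = lam≤¼ ; θ≥0 = ≤-trans ν≥0 ν≤θ ; growth = growth ; room = room
          ; R≥0 = R≥0 ; R≡ = R≡ ; s₁≥1 = s₁≥1 ; s₂≥1 = s₂≥1 ; N≥1 = N≥1 ; small₁ = small₁ ; small₂ = small₂ ; budget₁ = budget₁ ; budget₂ = budget₂ ; R-large = R-large }

      -- The process only takes triples of unreserved colours. Initially a debt is therefore three
      -- times a number of missing rows, and a load is the number of matchings that miss the line;
      -- each such number is n times an uncovered test mass.
      near-good : ∀ {g ε ℓ B} → R ≤ s₂ * ε → ι 2 ≤ g * (𝟙 + ι 1 * β) ^ J → ι 3 * (ι n * (g + ε)) ≤ ℓ → ι n * (g + ε) ≤ B →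
                  ∃ λ M → Switching.Good {t = t} c row-proper col-proper Q? ℓ B M
      near-good {g} {ε} {ℓ} {B} R≤ g-large ℓ-large B-large = by (near-perfect assumptions R≤ g-large)
        where
        μ = g + ε
        open Switching {t = t} c row-proper col-proper Q? ℓ B
        cov : List E → V → 𝔽
        cov M v = ∑ M (λ e → count v (verts e))
        by : (∃ λ M → All (_∈ es) M × (∀ v → cov M v ≤ 𝟙) × (∀ τ → ∑ (elems EV) (λ v → test τ v * (𝟙 - cov M v)) ≤ μ)) → ∃ λ M → Good M
        by (M , M⊆ , once , unc) = M , record
          { rows-once = λ i s → subst (_≤ 𝟙) (∑-cong M (count-row i s)) (once (row (i , s)))
          ; cols-once = λ j s → subst (_≤ 𝟙) (∑-cong M (count-col j s)) (once (col (j , s)))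
          ; syms-once = λ k s → subst (_≤ 𝟙) (∑-cong M (count-sym k s)) (once (sym′ (k , s)))
          ; cells-once = λ i j → subst (_≤ 𝟙) (∑-cong M (count-cell i j)) (once (cell (i , j)))
          ; debt≤ = λ s → ≤-trans (≤-reflexive (debt-eq s)) (≤-trans (farkas (∑ Fn (λ i → 𝟙 - cov M (row (i , s))) ∷ ι n ∷ μ ∷ []) (X0 ≼ X1 ⊗ X2 ∷ []) (# 3 ⊗ X0) (# 3 ⊗ (X1 ⊗ X2)) 0 (3 ∙ 0 ∷ []) refl ((unscale (λ s → ∑ Fn (λ i → 𝟙 - cov M (row (i , s)))) (inj₁ s) s (test-rows s _)) ∷ [])) ℓ-large)
          ; row-load≤ = λ i → ≤-trans (≤-reflexive (load-eq rowOf (λ i s → row (i , s)) count-row i)) (≤-trans (unscale (λ i → ∑ Ft (λ s → 𝟙 - cov M (row (i , s)))) (inj₂ (inj₂ (inj₁ i))) i (test-row i _)) B-large)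
          ; col-load≤ = λ j → ≤-trans (≤-reflexive (load-eq colOf (λ j s → col (j , s)) count-col j)) (≤-trans (unscale (λ j → ∑ Ft (λ s → 𝟙 - cov M (col (j , s)))) (inj₂ (inj₂ (inj₂ j))) j (test-col j _)) B-large) }
          where
          unscale : ∀ {X : Set} (f : X → 𝔽) τ x → ∑ (elems EV) (λ v → test τ v * (𝟙 - cov M v)) ≡ ν * f x → f x ≤ ι n * μ
          unscale f τ x e = (farkas (f x ∷ ι n ∷ μ ∷ ν ∷ []) (X3 ⊗ X0 ≼ X2 ∷ # 0 ≼ X1 ∷ # 1 ⊗ X0 ≼ X3 ⊗ X1 ⊗ X0 ∷ []) X0 (X1 ⊗ X2) 0 (1 ∙ 2 ∷ 1 ∙ 0 · 1 ∷ []) refl ((subst (_≤ μ) e (unc τ)) ∷ (0≤ι n) ∷ (≥-reflexive (cong (_* f x) νn)) ∷ []))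
          unreserved : ∀ {e} → e ∈ M → reserved e ≡ 𝟘
          unreserved m = es-free (All.lookup M⊆ m)
          debt-eq : ∀ s → debt M s ≡ ι 3 * ∑ Fn (λ i → 𝟙 - cov M (row (i , s)))
          debt-eq s = trans (cong (λ z → ι 3 * ι n - z) (trans (∑-cong∈ M (λ e m → trans (cong (λ z → 𝟏 (matchOf e FP.≟ s) * (ι 3 - z)) (unreserved m)) (ring (𝟏 (matchOf e FP.≟ s) ∷ []) (X0 ⊗ (# 3 ⊖ # 0)) (# 3 ⊗ X0) refl))) (∑-*ˡ M (ι 3) _)))
            (trans (ring (ι n ∷ S ∷ []) (# 3 ⊗ X0 ⊖ # 3 ⊗ X1) (# 3 ⊗ (X0 ⊗ # 1 ⊖ X1)) refl) (cong (ι 3 *_) (trans (cong₂ _-_ (sym (∑-Fin-const n 𝟙)) (trans (sym (Enum.fibres En M rowOf (λ e → 𝟏 (matchOf e FP.≟ s)))) (∑-cong Fn (λ i → ∑-cong M (λ e → sym (count-row i s e)))))) (sym (∑-sub Fn _ _)))))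
            where S = ∑ M (λ e → 𝟏 (matchOf e FP.≟ s))
          load-eq : ∀ (π : E → Fin n) (vertex : Fin n → Fin t → V) → (∀ i s e → count (vertex i s) (verts e) ≡ 𝟏 (π e FP.≟ i) * 𝟏 (matchOf e FP.≟ s)) → ∀ i → load π M i ≡ ∑ Ft (λ s → 𝟙 - cov M (vertex i s))
          load-eq π vertex cnt i = trans (cong (λ z → ι t - z) (∑-cong∈ M (λ e m → trans (cong (λ z → 𝟏 (π e FP.≟ i) * (𝟙 - z)) (unreserved m)) (ring (𝟏 (π e FP.≟ i) ∷ []) (X0 ⊗ (# 1 ⊖ # 0)) X0 refl))))
            (trans (cong₂ _-_ (trans (sym (*-identityʳ (ι t))) (sym (∑-Fin-const t 𝟙))) (trans (sym (Enum.fibres Et M matchOf (λ e → 𝟏 (π e FP.≟ i)))) (∑-cong Ft (λ s → ∑-cong M (λ e → trans (*-comm _ _) (sym (cnt i s e))))))) (sym (∑-sub Ft _ _)))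

  -- Choice of the parameters

  bernoulli : ∀ {β} → 𝟘 ≤ β → ∀ k → 𝟙 + ι k * β ≤ (𝟙 + ι 1 * β) ^ k
  bernoulli {β} β≥0 zero = (farkas (β ∷ []) ([]) (# 1 ⊕ # 0 ⊗ X0) (# 1) 0 ([]) refl ([]))
  bernoulli {β} β≥0 (suc k) = subst (λ z → 𝟙 + z * β ≤ (𝟙 + ι 1 * β) * (𝟙 + ι 1 * β) ^ k) (sym (ι-suc k))
    (farkas (ι k ∷ β ∷ p ∷ []) (# 1 ⊕ X0 ⊗ X1 ≼ X2 ∷ # 0 ≼ X1 ∷ # 0 ≼ X0 ∷ []) (# 1 ⊕ (# 1 ⊕ X0) ⊗ X1) ((# 1 ⊕ # 1 ⊗ X1) ⊗ X2) 0 (1 ∙ 0 ∷ 1 ∙ 0 · 1 ∷ 1 ∙ 1 · 1 · 2 ∷ []) refl ((bernoulli β≥0 k) ∷ β≥0 ∷ (0≤ι k) ∷ []))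
    where p = (𝟙 + ι 1 * β) ^ k

  -- It finds the number of steps without a logarithm: since β ≤ 1, one step at most doubles the
  -- power, so the first power to reach Z overshoots by a factor of at most 2.
  first-crossing : ∀ {β Z} → 𝟘 ≤ β → β ≤ 𝟙 → 𝟙 ≤ Z → ∀ k → Z ≤ (𝟙 + ι 1 * β) ^ k → ∃ λ J → Z ≤ (𝟙 + ι 1 * β) ^ J × (𝟙 + ι 1 * β) ^ J ≤ ι 2 * Z
  first-crossing {β} {Z} β≥0 β≤1 Z≥1 zero h = 0 , h , (farkas (Z ∷ []) (# 1 ≼ X0 ∷ []) (# 1) (# 2 ⊗ X0) 0 (1 ∙1 ∷ 2 ∙ 0 ∷ []) refl (Z≥1 ∷ []))
  first-crossing {β} {Z} β≥0 β≤1 Z≥1 (suc k) h = by (Z ≤? ((𝟙 + ι 1 * β) ^ k))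
    where
    p = (𝟙 + ι 1 * β) ^ k
    by : Dec (Z ≤ p) → _
    by (yes r) = first-crossing β≥0 β≤1 Z≥1 k r
    by (no r) = suc k , h , (farkas (β ∷ p ∷ Z ∷ []) (X1 ≼ X2 ∷ # 0 ≼ X1 ∷ X0 ≼ # 1 ∷ []) ((# 1 ⊕ # 1 ⊗ X0) ⊗ X1) (# 2 ⊗ X2) 0 (2 ∙ 0 ∷ 1 ∙ 1 · 2 ∷ []) refl ((≰⇒≥ r) ∷ (^-nonNeg (farkas (β ∷ []) (# 0 ≼ X0 ∷ []) (# 0) (# 1 ⊕ # 1 ⊗ X0) 0 (1 ∙1 ∷ 1 ∙ 0 ∷ []) refl (β≥0 ∷ [])) k) ∷ β≤1 ∷ []))

  cube-growth : ∀ {β} → 𝟘 ≤ β → ∀ J → (𝟙 + ι 3 * β) ^ J ≤ (𝟙 + ι 1 * β) ^ J * (𝟙 + ι 1 * β) ^ J * (𝟙 + ι 1 * β) ^ J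
  cube-growth {β} β≥0 J = ≤-trans (^-mono (farkas (β ∷ []) (# 0 ≼ X0 ∷ []) (# 0) (# 1 ⊕ # 3 ⊗ X0) 0 (1 ∙1 ∷ 3 ∙ 0 ∷ []) refl (β≥0 ∷ [])) (farkas (β ∷ []) (# 0 ≼ X0 ∷ []) (# 1 ⊕ # 3 ⊗ X0) ((# 1 ⊕ # 1 ⊗ X0) ⊗ (# 1 ⊕ # 1 ⊗ X0) ⊗ (# 1 ⊕ # 1 ⊗ X0)) 0 (3 ∙ 0 · 0 ∷ 1 ∙ 0 · 0 · 0 ∷ []) refl (β≥0 ∷ [])) J)
    (≤-reflexive (trans (^-*-distrib (y * y) y J) (cong (_* y ^ J) (^-*-distrib y y J))))
    where y = 𝟙 + ι 1 * β

  -- Orders of magnitude in powers of m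

  module Scale {m : ℕ} (m≥200 : 200 ℕ.≤ m) where
    M x : 𝔽
    M = ι m
    x = inv M

    M≥200 : ι 200 ≤ M
    M≥200 = ι-mono m≥200

    M≥1 : 𝟙 ≤ M
    M≥1 = (farkas (M ∷ []) (# 200 ≼ X0 ∷ []) (# 1) X0 0 (199 ∙1 ∷ 1 ∙ 0 ∷ []) refl (M≥200 ∷ []))

    Mx : M * x ≡ 𝟙
    Mx = inv-inverse (≥1⇒≰0 M≥1)

    x≥0 : 𝟘 ≤ x
    x≥0 = inv-nonNeg (≥1⇒≰0 M≥1)

    x-small : ι 200 * x ≤ 𝟙
    x-small = (farkas (x ∷ M ∷ []) (# 200 ≼ X1 ∷ # 0 ≼ X0 ∷ X1 ⊗ X0 ≼ # 1 ∷ []) (# 200 ⊗ X0) (# 1) 0 (1 ∙ 2 ∷ 1 ∙ 0 · 1 ∷ []) refl (M≥200 ∷ x≥0 ∷ (≤-reflexive (Mx)) ∷ []))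

    x≤1 : x ≤ 𝟙
    x≤1 = (farkas (x ∷ []) (# 200 ⊗ X0 ≼ # 1 ∷ []) X0 (# 1) 199 (199 ∙1 ∷ 1 ∙ 0 ∷ []) refl (x-small ∷ []))

    M^≥1 : ∀ k → 𝟙 ≤ M ^ k
    M^≥1 k = ^-≥1 M≥1 k

    M^≥0 : ∀ k → 𝟘 ≤ M ^ k
    M^≥0 k = ≤-trans 0≤1 (M^≥1 k)

    x^≥0 : ∀ k → 𝟘 ≤ x ^ k
    x^≥0 k = ^-nonNeg x≥0 k

    M^x^ : ∀ k → M ^ k * x ^ k ≡ 𝟙
    M^x^ k = trans (sym (^-*-distrib M x k)) (trans (cong (_^ k) Mx) (one k))
      where
      one : ∀ k → 𝟙 ^ k ≡ 𝟙
      one zero = refl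
      one (suc k) = trans (*-identityˡ _) (one k)

    M^-mono : ∀ {j k} → j ℕ.≤ k → M ^ j ≤ M ^ k
    M^-mono {j} {k} j≤k = subst (M ^ j ≤_) (trans (sym (^-+ M j (k ℕ.∸ j))) (cong (M ^_) (ℕP.m+[n∸m]≡n j≤k)))
      (farkas (M ^ j ∷ M ^ (k ℕ.∸ j) ∷ []) (# 0 ≼ X0 ∷ # 1 ≼ X1 ∷ []) X0 (X0 ⊗ X1) 0 (1 ∙ 0 · 1 ∷ []) refl ((M^≥0 j) ∷ (M^≥1 (k ℕ.∸ j)) ∷ []))

    x^-anti : ∀ {j k} → j ℕ.≤ k → x ^ k ≤ x ^ j
    x^-anti {j} {k} j≤k = subst (_≤ x ^ j) (trans (sym (^-+ x j (k ℕ.∸ j))) (cong (x ^_) (ℕP.m+[n∸m]≡n j≤k)))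
      (*-shrinkʳ (x ^ j) (x ^ (k ℕ.∸ j)) (x^≥0 j) (^-≤1 x≥0 x≤1 (k ℕ.∸ j)))

    -- Bookkeeping of exponents. A numerical constant counts as a power of m since m ≥ 200,
    -- exponents add up under multiplication, and what remains to be checked is a comparison of
    -- numerals.
    record Below (k : ℕ) (X : 𝔽) : Set where
      constructor below
      field
        nonNeg : 𝟘 ≤ X
        bound : X ≤ M ^ k

    infixl 7 _⊠_
    _⊠_ : ∀ {j k X Y} → Below j X → Below k Y → Below (j ℕ.+ k) (X * Y)
    _⊠_ {j} {k} (below p q) (below r s) = below (*-nonNeg p r) (subst (_ ≤_) (sym (^-+ M j k)) (*-mono-≤ p r q s))

    const-below : ∀ a k → IsTrue (a ℕ.≤ᵇ 200 ℕ.^ k) → Below k (ι a)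
    const-below a k h = below (0≤ι a) (≤-trans (ι-mono (ℕP.≤ᵇ⇒≤ a (200 ℕ.^ k) h)) (≤-trans (≤-reflexive (ι-^ 200 k)) (^-mono (0≤ι 200) M≥200 k)))

    power-below : ∀ k → Below k (M ^ k)
    power-below k = below (M^≥0 k) ≤-refl

    shrink : ∀ {k X Y} → Below k Y → 𝟘 ≤ X → X ≤ Y → Below k X
    shrink (below _ q) p h = below p (≤-trans h q)

    against-x : ∀ {j k X} → Below k X → k ℕ.≤ j → X * x ^ j ≤ 𝟙
    against-x {j} {k} {X} (below p q) k≤j = (farkas (X ∷ x ^ j ∷ M ^ j ∷ []) (X0 ≼ X2 ∷ # 0 ≼ X1 ∷ X2 ⊗ X1 ≼ # 1 ∷ []) (X0 ⊗ X1) (# 1) 0 (1 ∙ 2 ∷ 1 ∙ 0 · 1 ∷ []) refl ((≤-trans q (M^-mono k≤j)) ∷ (x^≥0 j) ∷ (≤-reflexive (M^x^ j)) ∷ []))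

  -- The parameters as powers of m, and the assembly

  module Main {n t m A : ℕ} (c : Fin n → Fin n → Fin (n ℕ.* n))
    (row-proper : ∀ i {j j′} → c i j ≡ c i j′ → j ≡ j′) (col-proper : ∀ j {i i′} → c i j ≡ c i′ j → i ≡ i′)
    (A≥200 : 200 ℕ.≤ A) (m≥A : A ℕ.≤ m) (n-lower : m ℕ.^ A ℕ.≤ n) (n-upper : n ℕ.≤ m ℕ.^ (2 ℕ.* A))
    (t≤n : t ℕ.≤ n) (gap : 4 ℕ.* n ℕ.+ m ℕ.* t ℕ.≤ m ℕ.* n)
    (few-huge : ∑ (allFin (n ℕ.* n)) (λ k → 𝟏 (¬? (∑ (allFin n) (λ i → ∑ (allFin n) (λ j → 𝟏 (c i j FP.≟ k))) ≤? ι t))) ≤ ι t) where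

    open Scale (ℕP.≤-trans A≥200 m≥A)

    private
      K = n ℕ.* n
      Fn = allFin n
      En = enumFin n

      nn ν γ : 𝔽
      nn = ι n
      ν = inv nn
      γ = 𝟙 - ν * ι t

      M^A≤n : M ^ A ≤ nn
      M^A≤n = ≤-trans (≥-reflexive (ι-^ m A)) (ι-mono n-lower)

      n≥1 : 𝟙 ≤ nn
      n≥1 = ≤-trans (M^≥1 A) M^A≤n

      νn : ν * nn ≡ 𝟙
      νn = trans (*-comm ν nn) (inv-inverse (≥1⇒≰0 n≥1))

      ν≥0 : 𝟘 ≤ ν
      ν≥0 = inv-nonNeg (≥1⇒≰0 n≥1)

      t≤n′ : ι t ≤ nn
      t≤n′ = ι-mono t≤n

      -- As n is at least M^200, a single factor ν absorbs every quantity of exponent at most 200.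
      against-ν : ∀ {k X} → Below k X → k ℕ.≤ 200 → X * ν ≤ 𝟙
      against-ν {k} {X} (below _ q) k≤ = (farkas (X ∷ ν ∷ nn ∷ []) (X0 ≼ X2 ∷ # 0 ≼ X1 ∷ X1 ⊗ X2 ≼ # 1 ∷ []) (X0 ⊗ X1) (# 1) 0 (1 ∙ 2 ∷ 1 ∙ 0 · 1 ∷ []) refl ((≤-trans q (≤-trans (M^-mono (ℕP.≤-trans k≤ A≥200)) M^A≤n)) ∷ ν≥0 ∷ (≤-reflexive (νn)) ∷ []))

      ν≤x^ : ∀ k → k ℕ.≤ 200 → ν ≤ x ^ k
      ν≤x^ k k≤ = (farkas (ν ∷ x ^ k ∷ M ^ k ∷ []) (X2 ⊗ X0 ≼ # 1 ∷ # 0 ≼ X1 ∷ # 1 ⊗ X0 ≼ X2 ⊗ X1 ⊗ X0 ∷ []) X0 X1 0 (1 ∙ 2 ∷ 1 ∙ 0 · 1 ∷ []) refl ((against-ν (power-below k) k≤) ∷ (x^≥0 k) ∷ (≥-reflexive (cong (_* ν) (M^x^ k))) ∷ []))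

      4x≤γ : ι 4 * x ≤ γ
      4x≤γ = (farkas (x ∷ ν ∷ ι t ∷ nn ∷ M ∷ []) (# 4 ⊗ X3 ⊕ X4 ⊗ X2 ≼ X4 ⊗ X3 ∷ # 0 ≼ X0 ⊗ X1 ∷ # 1 ⊗ (X0 ⊗ # 4) ≼ X1 ⊗ X3 ⊗ (X0 ⊗ # 4) ∷ # 1 ⊗ (X1 ⊗ X2) ≼ X4 ⊗ X0 ⊗ (X1 ⊗ X2) ∷ X4 ⊗ X0 ⊗ (X1 ⊗ X3) ≼ # 1 ⊗ # 1 ∷ []) (# 4 ⊗ X0) (# 1 ⊖ X1 ⊗ X2) 0 (1 ∙ 2 ∷ 1 ∙ 3 ∷ 1 ∙ 4 ∷ 1 ∙ 0 · 1 ∷ []) refl (gap′ ∷ (*-nonNeg x≥0 ν≥0) ∷ (≥-reflexive (cong (_* (x * ι 4)) νn)) ∷ (≥-reflexive (cong (_* (ν * ι t)) Mx)) ∷ (≤-reflexive (cong₂ _*_ Mx νn)) ∷ []))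
        where
        gap′ : ι 4 * nn + M * ι t ≤ M * nn
        gap′ = subst₂ _≤_ (trans (ι-+ (4 ℕ.* n) (m ℕ.* t)) (cong₂ _+_ (ι-* 4 n) (ι-* m t))) (ι-* m n) (ι-mono gap)

      2x≤1 : ι 2 * x ≤ 𝟙
      2x≤1 = (farkas (x ∷ []) (# 200 ⊗ X0 ≼ # 1 ∷ []) (# 2 ⊗ X0) (# 1) 99 (99 ∙1 ∷ 1 ∙ 0 ∷ []) refl (x-small ∷ []))

      open module Wt = Weighting c row-proper col-proper t ν x γ νn (ring (ν ∷ ι t ∷ []) (X0 ⊗ X1) (# 1 ⊖ (# 1 ⊖ X0 ⊗ X1)) refl) ν≥0 x≥0 2x≤1 4x≤γ using (weight)

      w≥0 = Wt.weight-≥0 few-huge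
      w≤2ν = Wt.weight-≤2ν few-huge
      w-row = Wt.row-sum few-huge
      w-col = Wt.col-sum few-huge
      w-cell = Wt.cell-sum few-huge
      w-colour = Wt.colour-sum few-huge

      -- The exponent is chosen so that M^(2N) = M² · M · M · M^(6A) dominates 2 · 12 n³: the
      -- tracked quantities number at most 12 n³, n³ is at most M^(6A), and M² exceeds 24.
      -- Potentials beyond a threshold R ≥ M are thus too large.
      N : ℕ
      N = 3 ℕ.* A ℕ.+ 2

      N≥1 : 𝟙 ≤ ι N
      N≥1 = ι-mono (ℕP.≤-trans (ℕ.s≤s ℕ.z≤n) (ℕP.m≤n+m 2 (3 ℕ.* A)))

      N≤4M : ι N ≤ ι 4 * M
      N≤4M = (farkas (ι N ∷ M ∷ ι A ∷ []) (X0 ≼ # 3 ⊗ X2 ⊕ # 2 ∷ X2 ≼ X1 ∷ # 200 ≼ X1 ∷ []) X0 (# 4 ⊗ X1) 0 (198 ∙1 ∷ 1 ∙ 0 ∷ 3 ∙ 1 ∷ 1 ∙ 2 ∷ []) refl ((≤-reflexive (trans (ι-+ (3 ℕ.* A) 2) (cong (_+ ι 2) (ι-* 3 A)))) ∷ (ι-mono m≥A) ∷ M≥200 ∷ []))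

      N-below : Below 2 (ι N)
      N-below = shrink (const-below 4 1 tt ⊠ power-below 1) (0≤ι N) (subst (λ z → ι N ≤ ι 4 * z) (ring (M ∷ []) X0 (X0 ↑ 1) refl) N≤4M)

      R-large : ∀ {R X} → M ≤ R → X ≤ ι 12 * (nn * (nn * nn)) → ¬ (𝟙 + R * R) ^ N ≤ ι 2 * X
      R-large {R} {X} M≤R X≤ h = 1≰0 (*-cancel-≤0′ (farkas (p ∷ M ∷ X ∷ nn ∷ []) (X1 ⊗ X1 ⊗ X0 ≼ # 2 ⊗ X2 ∷ X2 ≼ # 12 ⊗ (X3 ⊗ (X3 ⊗ X3)) ∷ X3 ⊗ (X3 ⊗ X3) ≼ X0 ∷ # 25 ≼ X1 ⊗ X1 ∷ # 0 ≼ X0 ∷ []) (X0 ⊗ # 1) (X0 ⊗ # 0) 0 (1 ∙ 0 ∷ 2 ∙ 1 ∷ 24 ∙ 2 ∷ 1 ∙ 3 · 4 ∷ []) refl (lower ∷ X≤ ∷ cube ∷ MM ∷ p≥0 ∷ [])))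
        where
        p = M ^ (6 ℕ.* A ℕ.+ 2)
        p≥0 = M^≥0 (6 ℕ.* A ℕ.+ 2)
        MM : ι 25 ≤ M * M
        MM = (farkas (M ∷ []) (# 200 ≼ X0 ∷ []) (# 25) (X0 ⊗ X0) 0 (39975 ∙1 ∷ 400 ∙ 0 ∷ 1 ∙ 0 · 0 ∷ []) refl (M≥200 ∷ []))
        *-cancel-≤0′ : p * 𝟙 ≤ p * 𝟘 → 𝟙 ≤ 𝟘
        *-cancel-≤0′ = *-cancelˡ-≤ (M^≥1 (6 ℕ.* A ℕ.+ 2))
        double : ∀ k → M ^ k * M ^ k ≡ M ^ (k ℕ.+ k)
        double k = sym (^-+ M k k)
        n≤ : nn ≤ M ^ (2 ℕ.* A)
        n≤ = ≤-trans (ι-mono n-upper) (≤-reflexive (ι-^ m (2 ℕ.* A)))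
        cube : nn * (nn * nn) ≤ p
        cube = ≤-trans (*-mono-≤ (0≤ι n) (square-nonNeg nn) n≤ (*-mono-≤ (0≤ι n) (0≤ι n) n≤ n≤))
          (≤-trans (≤-reflexive (trans (cong (M ^ (2 ℕ.* A) *_) (double (2 ℕ.* A))) (sym (^-+ M (2 ℕ.* A) (2 ℕ.* A ℕ.+ 2 ℕ.* A)))))
            (M^-mono (ℕP.≤-trans (ℕP.≤-reflexive (six A)) (ℕP.m≤m+n (6 ℕ.* A) 2))))
          where
          six : ∀ A → 2 ℕ.* A ℕ.+ (2 ℕ.* A ℕ.+ 2 ℕ.* A) ≡ 6 ℕ.* A
          six A = trans (cong (2 ℕ.* A ℕ.+_) (sym (ℕP.*-distribʳ-+ A 2 2))) (sym (ℕP.*-distribʳ-+ A 2 4))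
        lower : M * M * p ≤ ι 2 * X
        lower = ≤-trans (≤-reflexive eq) (≤-trans (^-mono (*-nonNeg (0≤ι m) (0≤ι m)) (farkas (M ∷ R ∷ []) (X0 ⊗ X0 ≼ X1 ⊗ X1 ∷ []) (X0 ⊗ X0) (# 1 ⊕ X1 ⊗ X1) 0 (1 ∙1 ∷ 1 ∙ 0 ∷ []) refl ((*-mono-≤ (0≤ι m) (0≤ι m) M≤R M≤R) ∷ [])) N) h)
          where
          eq : M * M * p ≡ (M * M) ^ N
          eq = trans (trans (ring (M ∷ p ∷ []) (X0 ⊗ X0 ⊗ X1) (X0 ⊗ (X0 ⊗ X1)) refl) (cong (M ^_) (exponent A))) (trans (^-+ M N N) (sym (^-*-distrib M M N)))
            where
            exponent : ∀ A → suc (suc (6 ℕ.* A ℕ.+ 2)) ≡ (3 ℕ.* A ℕ.+ 2) ℕ.+ (3 ℕ.* A ℕ.+ 2)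
            exponent A = trans (trans (cong suc (sym (ℕP.+-suc (6 ℕ.* A) 2))) (sym (ℕP.+-suc (6 ℕ.* A) 3))) (trans (cong (ℕ._+ 4) (ℕP.*-distribʳ-+ A 3 3)) (interchange (3 ℕ.* A)))
              where
              interchange : ∀ a → a ℕ.+ a ℕ.+ 4 ≡ (a ℕ.+ 2) ℕ.+ (a ℕ.+ 2)
              interchange a = trans (ℕP.+-assoc a a 4) (trans (cong (a ℕ.+_) (trans (sym (ℕP.+-assoc a 2 2)) (ℕP.+-comm (a ℕ.+ 2) 2))) (sym (ℕP.+-assoc a 2 (a ℕ.+ 2))))

    -- The reserve: a random set of colours of density q = m⁻².

      q : 𝔽
      q = x * x

      q≥0 : 𝟘 ≤ q
      q≥0 = square-nonNeg x

      q-small : ι 40000 * q ≤ 𝟙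
      q-small = (farkas (x ∷ []) (# 200 ⊗ X0 ≼ # 1 ∷ # 0 ≼ X0 ∷ []) (# 40000 ⊗ (X0 ⊗ X0)) (# 1) 0 (1 ∙ 0 ∷ 200 ∙ 0 · 1 ∷ []) refl (x-small ∷ x≥0 ∷ []))

      q≤1 : q ≤ 𝟙
      q≤1 = (farkas (q ∷ []) (# 40000 ⊗ X0 ≼ # 1 ∷ []) X0 (# 1) 39999 (39999 ∙1 ∷ 1 ∙ 0 ∷ []) refl (q-small ∷ []))

      Ix : Set
      Ix = Fin n ⊎ (Fin n ⊎ (Fin n ⊎ (Fin n ⊎ (Fin n × Fin n))))

      EIx : Enum Ix
      EIx = enum⊎ En (enum⊎ En (enum⊎ En (enum⊎ En (enum× En En))))

      open Assignment K using (Stat; linear; bilinear; assignment)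

      θ = ι 2 * ν

      θ≥0 : 𝟘 ≤ θ
      θ≥0 = *-nonNeg (0≤ι 2) ν≥0

      ν≤θ : ν ≤ θ
      ν≤θ = (farkas (ν ∷ []) (# 0 ≼ X0 ∷ []) X0 (# 2 ⊗ X0) 0 (1 ∙ 0 ∷ []) refl (ν≥0 ∷ []))

      ν-total : ∑ Fn (λ _ → ν) ≤ 𝟙
      ν-total = ≤-reflexive (trans (∑-Fin-const n ν) (trans (*-comm nn ν) νn))

      -- Weight 0 on the diagonal allows all pairs of rows as indices. For i = i′ the products would
      -- be squares, and the statistic would not be affine.
      off : Fin n → Fin n → 𝔽
      off i i′ = 𝟙 - 𝟏 (i FP.≟ i′)

      off≥0 : ∀ i i′ → 𝟘 ≤ off i i′
      off≥0 i i′ = (complement-nonNeg (𝟏 (i FP.≟ i′)) (𝟏-≤1 (i FP.≟ i′)))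

      ν-off≤ν : ∀ i i′ → ν * off i i′ ≤ ν
      ν-off≤ν i i′ = (farkas (ν ∷ 𝟏 (i FP.≟ i′) ∷ []) (# 0 ≼ X0 ∷ # 0 ≼ X1 ∷ []) (X0 ⊗ (# 1 ⊖ X1)) X0 0 (1 ∙ 0 · 1 ∷ []) refl (ν≥0 ∷ (𝟏-nonNeg (i FP.≟ i′)) ∷ []))

      stat : Ix → Stat θ
      stat (inj₁ i) = linear En (c i) (row-proper i) (weight i) (w≥0 i) (w≤2ν i) θ≥0 (≤-reflexive (w-row i))
      stat (inj₂ (inj₁ j)) = linear En (λ i → c i j) (col-proper j) (λ i → weight i j) (λ i → w≥0 i j) (λ i → w≤2ν i j) θ≥0 (≤-reflexive (w-col j))
      stat (inj₂ (inj₂ (inj₁ i))) = linear En (c i) (row-proper i) (λ _ → ν) (λ _ → ν≥0) (λ _ → ν≤θ) θ≥0 ν-total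
      stat (inj₂ (inj₂ (inj₂ (inj₁ j)))) = linear En (λ i → c i j) (col-proper j) (λ _ → ν) (λ _ → ν≥0) (λ _ → ν≤θ) θ≥0 ν-total
      stat (inj₂ (inj₂ (inj₂ (inj₂ (i , i′))))) = bilinear En (c i) (row-proper i) (c i′) (row-proper i′) (ν * off i i′) (*-nonNeg ν≥0 (off≥0 i i′))
          (farkas (ν ∷ off i i′ ∷ []) (X0 ⊗ X1 ≼ X0 ∷ []) (# 2 ⊗ (X0 ⊗ X1)) (# 2 ⊗ X0) 0 (2 ∙ 0 ∷ []) refl ((ν-off≤ν i i′) ∷ []))
          (≤-trans (≤-reflexive (trans (sym (∑-const Fn (ν * off i i′))) refl)) (≤-trans (∑-mono Fn (λ _ → ν-off≤ν i i′)) ν-total)) (λ j k → disjoint i i′ j k)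
        where
        disjoint : ∀ i i′ j k → ν * off i i′ * (𝟏 (c i j FP.≟ k) * 𝟏 (c i′ j FP.≟ k)) ≡ 𝟘
        disjoint i i′ j k = by (i FP.≟ i′)
          where
          by : (d : Dec (i ≡ i′)) → ν * (𝟙 - 𝟏 d) * (𝟏 (c i j FP.≟ k) * 𝟏 (c i′ j FP.≟ k)) ≡ 𝟘
          by (yes _) = (ring (ν ∷ 𝟏 (c i j FP.≟ k) ∷ 𝟏 (c i′ j FP.≟ k) ∷ []) (X0 ⊗ (# 1 ⊖ # 1) ⊗ (X1 ⊗ X2)) (# 0) refl)
          by (no ne) = trans (cong (ν * (𝟙 - 𝟘) *_) (trans (𝟏-*-cong (c i j FP.≟ k) {y = 𝟘} (λ p → 𝟏-no (c i′ j FP.≟ k) (λ r → ne (col-proper j (trans p (sym r)))))) (*-zeroʳ (𝟏 (c i j FP.≟ k))))) (ring (ν ∷ []) (X0 ⊗ (# 1 ⊖ # 0) ⊗ # 0) (# 0) refl)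

      -- With the threshold M and the magnification M^41 the reserve deviates by at most x^40. The
      -- exponent 40 comes from the waste of the nibble: `budget₂` has to absorb a factor bounded by
      -- M^39. The 2 in `lam` is the bound for the rescaling factor `ρ`.
      lam₀ lam s₁ : 𝔽
      lam₀ = x ^ 40
      lam = ι 2 * x ^ 40
      s₁ = M ^ 41

      s₁-lam₀ : M ≡ s₁ * lam₀
      s₁-lam₀ = trans (sym (*-identityʳ M)) (trans (cong (M *_) (sym (M^x^ 40))) (sym (*-assoc M (M ^ 40) (x ^ 40))))

      lam₀≥0 : 𝟘 ≤ lam₀
      lam₀≥0 = x^≥0 40

      lam≥0 : 𝟘 ≤ lam
      lam≥0 = *-nonNeg (0≤ι 2) lam₀≥0

      Ix-size : ι (length (elems EIx)) ≤ ι 12 * (nn * (nn * nn))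
      Ix-size = ≤-trans (≤-reflexive size) (farkas (nn ∷ []) (# 1 ≼ X0 ∷ []) (X0 ⊕ (X0 ⊕ (X0 ⊕ (X0 ⊕ X0 ⊗ X0)))) (# 12 ⊗ (X0 ⊗ (X0 ⊗ X0))) 0 (7 ∙1 ∷ 30 ∙ 0 ∷ 35 ∙ 0 · 0 ∷ 12 ∙ 0 · 0 · 0 ∷ []) refl (n≥1 ∷ []))
        where
        len : ∀ {A : Set} (xs : List A) → ι (length xs) ≡ ∑ xs (λ _ → 𝟙)
        len xs = trans (sym (*-identityʳ (ι (length xs)))) (sym (∑-const xs 𝟙))
        ones : ∑ Fn (λ _ → 𝟙) ≡ nn
        ones = trans (∑-Fin-const n 𝟙) (*-identityʳ nn)
        size : ι (length (elems EIx)) ≡ nn + (nn + (nn + (nn + nn * nn)))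
        size = trans (len (elems EIx)) (trans (∑-⊎ En (enum⊎ En (enum⊎ En (enum⊎ En (enum× En En)))) (λ _ → 𝟙)) (cong₂ _+_ ones (trans (∑-⊎ En (enum⊎ En (enum⊎ En (enum× En En))) (λ _ → 𝟙)) (cong₂ _+_ ones (trans (∑-⊎ En (enum⊎ En (enum× En En)) (λ _ → 𝟙)) (cong₂ _+_ ones
          (trans (∑-⊎ En (enum× En En) (λ _ → 𝟙)) (cong₂ _+_ ones (trans (∑-× En En (λ _ → 𝟙)) (trans (∑-cong Fn (λ _ → ones)) (∑-Fin-const n nn)))))))))))

      small-reserve : ι N * (ι 2 * (s₁ * θ)) ≤ 𝟙
      small-reserve = ≤-trans (≤-reflexive (ring (ι N ∷ s₁ ∷ ν ∷ []) (X0 ⊗ (# 2 ⊗ (X1 ⊗ (# 2 ⊗ X2)))) (X0 ⊗ (# 4 ⊗ X1) ⊗ X2) refl)) (against-ν (N-below ⊠ (const-below 4 1 tt ⊠ power-below 41)) (ℕP.≤ᵇ⇒≤ 44 200 tt))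

      budget-reserve : ι 2 * (ι 5 * (ι N * ι N) * (s₁ * s₁ * θ) * ι 2) ≤ 𝟙
      budget-reserve = ≤-trans (≤-reflexive (ring (ι N ∷ s₁ ∷ ν ∷ []) (# 2 ⊗ (# 5 ⊗ (X0 ⊗ X0) ⊗ (X1 ⊗ X1 ⊗ (# 2 ⊗ X2)) ⊗ # 2)) (# 40 ⊗ (X0 ⊗ X0) ⊗ (X1 ⊗ X1) ⊗ X2) refl))
        (against-ν (const-below 40 1 tt ⊠ (N-below ⊠ N-below) ⊠ (power-below 41 ⊠ power-below 41)) (ℕP.≤ᵇ⇒≤ 87 200 tt))

      Reserve : Set
      Reserve = ∃ λ ξ → (∀ k → ξ k ≡ 𝟘 ⊎ ξ k ≡ 𝟙) ×
        (∀ τ → Stat.T (stat τ) (λ _ → q) - lam₀ ≤ Stat.T (stat τ) ξ × Stat.T (stat τ) ξ ≤ Stat.T (stat τ) (λ _ → q) + lam₀)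

      reserve : Reserve
      reserve = assignment EIx N {θ} {q} {M} {s₁} {lam₀} stat θ≥0 q≥0 q≤1 (0≤ι m) s₁-lam₀ (M^≥1 41) N≥1 small-reserve budget-reserve (R-large ≤-refl Ix-size)

    private
      module WithReserve (ξ : Fin K → 𝔽) (ξ-01 : ∀ k → ξ k ≡ 𝟘 ⊎ ξ k ≡ 𝟙)
        (tracked : ∀ τ → Stat.T (stat τ) (λ _ → q) - lam₀ ≤ Stat.T (stat τ) ξ × Stat.T (stat τ) ξ ≤ Stat.T (stat τ) (λ _ → q) + lam₀) where

        ρ : 𝔽
        ρ = inv (𝟙 - q)

        1-q≰0 : ¬ 𝟙 - q ≤ 𝟘
        1-q≰0 h = 1≰0 (farkas (q ∷ []) (# 1 ⊖ X0 ≼ # 0 ∷ # 40000 ⊗ X0 ≼ # 1 ∷ []) (# 1) (# 0) 39998 (40000 ∙ 0 ∷ 1 ∙ 1 ∷ []) refl (h ∷ q-small ∷ []))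

        ρ-inverse : (𝟙 - q) * ρ ≡ 𝟙
        ρ-inverse = inv-inverse 1-q≰0

        ρ≥0 : 𝟘 ≤ ρ
        ρ≥0 = inv-nonNeg 1-q≰0

        ρ≤2 : ρ ≤ ι 2
        ρ≤2 = (farkas (ρ ∷ q ∷ []) ((# 1 ⊖ X1) ⊗ X0 ≼ # 1 ∷ # 0 ≼ X0 ∷ # 40000 ⊗ X1 ≼ # 1 ∷ []) X0 (# 2) 19999 (40000 ∙ 0 ∷ 19999 ∙ 1 ∷ 1 ∙ 1 · 2 ∷ []) refl ((≤-reflexive (ρ-inverse)) ∷ ρ≥0 ∷ q-small ∷ []))

        W : Fin n → Fin n → 𝔽
        W i j = ρ * weight i j

        W≥0 : ∀ i j → 𝟘 ≤ W i j
        W≥0 i j = *-nonNeg ρ≥0 (w≥0 i j)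

        W≤4ν : ∀ i j → W i j ≤ ι 4 * ν
        W≤4ν i j = ≤-trans (*-mono-≤ ρ≥0 (w≥0 i j) ρ≤2 (w≤2ν i j)) (farkas (ν ∷ []) ([]) (# 2 ⊗ (# 2 ⊗ X0)) (# 4 ⊗ X0) 0 ([]) refl ([]))

        scaled-total : ∀ (w : Fin n → 𝔽) (a : Fin n → Fin K) → ∑ Fn w ≡ 𝟙 → ∑ Fn (λ j → ρ * w j * (𝟙 - ξ (a j))) ≡ ρ * (𝟙 - ∑ Fn (λ j → w j * ξ (a j)))
        scaled-total w a e = trans (∑-cong Fn (λ j → (ring (ρ ∷ w j ∷ ξ (a j) ∷ []) (X0 ⊗ X1 ⊗ (# 1 ⊖ X2)) (X0 ⊗ (X1 ⊖ X1 ⊗ X2)) refl))) (trans (∑-*ˡ Fn ρ _) (cong (ρ *_) (trans (∑-sub Fn _ _) (cong (λ z → z - ∑ Fn (λ j → w j * ξ (a j))) e))))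

        at-q : ∀ (w : Fin n → 𝔽) → ∑ Fn w ≡ 𝟙 → ∑ Fn (λ j → w j * q) ≡ q
        at-q w e = trans (∑-*ʳ Fn q w) (trans (cong (_* q) e) (*-identityˡ q))

        near-one-lower : ∀ {T} → T ≤ q + lam₀ → 𝟙 - lam ≤ ρ * (𝟙 - T)
        near-one-lower {T} h = (farkas (l ∷ ρ ∷ T ∷ q ∷ []) (X2 ≼ X3 ⊕ X0 ∷ # 0 ≼ X1 ∷ X1 ≼ # 2 ∷ # 1 ≼ (# 1 ⊖ X3) ⊗ X1 ∷ # 0 ≼ X0 ∷ []) (# 1 ⊖ # 2 ⊗ X0) (X1 ⊗ (# 1 ⊖ X2)) 0 (1 ∙ 3 ∷ 1 ∙ 0 · 1 ∷ 1 ∙ 2 · 4 ∷ []) refl (h ∷ ρ≥0 ∷ ρ≤2 ∷ (≥-reflexive (ρ-inverse)) ∷ lam₀≥0 ∷ []))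
          where l = x ^ 40

        near-one-upper : ∀ {T} → q - lam₀ ≤ T → ρ * (𝟙 - T) ≤ 𝟙 + lam
        near-one-upper {T} h = (farkas (ρ ∷ T ∷ l ∷ q ∷ []) (X3 ⊖ X2 ≼ X1 ∷ # 0 ≼ X0 ∷ X0 ≼ # 2 ∷ (# 1 ⊖ X3) ⊗ X0 ≼ # 1 ∷ # 0 ≼ X2 ∷ []) (X0 ⊗ (# 1 ⊖ X1)) (# 1 ⊕ # 2 ⊗ X2) 0 (1 ∙ 3 ∷ 1 ∙ 0 · 1 ∷ 1 ∙ 2 · 4 ∷ []) refl (h ∷ ρ≥0 ∷ ρ≤2 ∷ (≤-reflexive (ρ-inverse)) ∷ lam₀≥0 ∷ []))
          where l = x ^ 40

        T-upper : ∀ τ {a} → Stat.T (stat τ) (λ _ → q) ≡ a → Stat.T (stat τ) ξ ≤ a + lam₀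
        T-upper τ e = subst (λ z → Stat.T (stat τ) ξ ≤ z + lam₀) e (proj₂ (tracked τ))

        T-lower : ∀ τ {a} → Stat.T (stat τ) (λ _ → q) ≡ a → a - lam₀ ≤ Stat.T (stat τ) ξ
        T-lower τ e = subst (λ z → z - lam₀ ≤ Stat.T (stat τ) ξ) e (proj₁ (tracked τ))

        row-lower : ∀ i → 𝟙 - lam ≤ ∑ Fn (λ j → W i j * (𝟙 - ξ (c i j)))
        row-lower i = subst (𝟙 - lam ≤_) (sym (scaled-total (weight i) (c i) (w-row i))) (near-one-lower (T-upper (inj₁ i) (at-q (weight i) (w-row i))))
        row-upper : ∀ i → ∑ Fn (λ j → W i j * (𝟙 - ξ (c i j))) ≤ 𝟙 + lam
        row-upper i = subst (_≤ 𝟙 + lam) (sym (scaled-total (weight i) (c i) (w-row i))) (near-one-upper (T-lower (inj₁ i) (at-q (weight i) (w-row i))))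
        col-lower : ∀ j → 𝟙 - lam ≤ ∑ Fn (λ i → W i j * (𝟙 - ξ (c i j)))
        col-lower j = subst (𝟙 - lam ≤_) (sym (scaled-total (λ i → weight i j) (λ i → c i j) (w-col j))) (near-one-lower (T-upper (inj₂ (inj₁ j)) (at-q (λ i → weight i j) (w-col j))))
        col-upper : ∀ j → ∑ Fn (λ i → W i j * (𝟙 - ξ (c i j))) ≤ 𝟙 + lam
        col-upper j = subst (_≤ 𝟙 + lam) (sym (scaled-total (λ i → weight i j) (λ i → c i j) (w-col j))) (near-one-upper (T-lower (inj₂ (inj₁ j)) (at-q (λ i → weight i j) (w-col j))))

        -- Here the slack of the weighting is spent. Dividing by 1 - q = 1 - x² restores row and
        -- column sums of about 1 after the reserve is removed, and 1 - 4x² is small enough for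
        -- colour and cell sums to survive this.
        slack : ∀ {S} → S ≤ 𝟙 - ι 4 * (x * x) → ρ * S ≤ 𝟙
        slack {S} h = (farkas (ρ ∷ S ∷ x ∷ []) (X1 ≼ # 1 ⊖ # 4 ⊗ (X2 ⊗ X2) ∷ # 0 ≼ X0 ∷ (# 1 ⊖ X2 ⊗ X2) ⊗ X0 ≼ # 1 ∷ # 0 ≼ X2 ⊗ X2 ∷ []) (X0 ⊗ X1) (# 1) 0 (1 ∙ 2 ∷ 1 ∙ 0 · 1 ∷ 3 ∙ 1 · 3 ∷ []) refl (h ∷ ρ≥0 ∷ (≤-reflexive (ρ-inverse)) ∷ q≥0 ∷ []))

        cell-upper : ∀ i j → ι t * W i j ≤ 𝟙
        cell-upper i j = ≤-trans (≤-reflexive (*-exchange (ι t) ρ (weight i j))) (slack (w-cell i j))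

        colour-upper : ∀ k → ∑ Fn (λ i → ∑ Fn (λ j → 𝟏 (c i j FP.≟ k) * W i j)) ≤ 𝟙
        colour-upper k = ≤-trans (≤-reflexive (trans (∑-cong Fn (λ i → trans (∑-cong Fn (λ j → (*-exchange (𝟏 (c i j FP.≟ k)) ρ (weight i j)))) (∑-*ˡ Fn ρ _))) (∑-*ˡ Fn ρ _))) (slack (w-colour k))

        open module D = Decomposing {t = t} c row-proper col-proper ξ ξ-01 W ν lam νn ν≥0 lam≥0 t≤n′ W≥0 W≤4ν row-lower row-upper col-lower col-upper cell-upper colour-upper using (Constants; near-good)
        open Triples {t = t} c row-proper col-proper ξ ξ-01 using (EV; ETest; es; Q?; in-Q; V; E; Test)

        edge-weight : E → 𝔽
        edge-weight = D.weight

        -- The nibble: the alive part shrinks until it has density m⁻¹⁷.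

        Pn y : ℕ
        Pn = 64 ℕ.* m ℕ.^ 51
        y = 4 ℕ.+ (Pn ℕ.* (4 ℕ.* length es) ℕ.+ length (elems EV) ℕ.+ n)

        y-eq : ι y ≡ ι 4 + (ι Pn * (ι 4 * ι (length es)) + ι (length (elems EV)) + nn)
        y-eq = trans (ι-+ 4 (Pn ℕ.* (4 ℕ.* length es) ℕ.+ length (elems EV) ℕ.+ n)) (cong (ι 4 +_) (trans (ι-+ (Pn ℕ.* (4 ℕ.* length es) ℕ.+ length (elems EV)) n) (cong (_+ nn) (trans (ι-+ (Pn ℕ.* (4 ℕ.* length es)) (length (elems EV))) (cong (_+ ι (length (elems EV))) (trans (ι-* Pn (4 ℕ.* length es)) (cong (ι Pn *_) (ι-* 4 (length es)))))))))

        Pn-eq : ι Pn ≡ ι 64 * M ^ 51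
        Pn-eq = trans (ι-* 64 (m ℕ.^ 51)) (cong (ι 64 *_) (ι-^ m 51))

        es-part : 𝟘 ≤ ι Pn * (ι 4 * ι (length es))
        es-part = *-nonNeg (0≤ι Pn) (*-nonNeg (0≤ι 4) (0≤ι (length es)))

        y≥4 : ι 4 ≤ ι y
        y≥4 = (farkas (ι y ∷ ι Pn ∷ ι (length es) ∷ ι (length (elems EV)) ∷ nn ∷ []) (# 4 ⊕ (X1 ⊗ (# 4 ⊗ X2) ⊕ X3 ⊕ X4) ≼ X0 ∷ # 0 ≼ X1 ⊗ (# 4 ⊗ X2) ∷ # 0 ≼ X3 ∷ # 0 ≼ X4 ∷ []) (# 4) X0 0 (1 ∙ 0 ∷ 1 ∙ 1 ∷ 1 ∙ 2 ∷ 1 ∙ 3 ∷ []) refl ((≥-reflexive (y-eq)) ∷ es-part ∷ (0≤ι (length (elems EV))) ∷ (0≤ι n) ∷ []))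

        y≥n : nn ≤ ι y
        y≥n = (farkas (nn ∷ ι y ∷ ι Pn ∷ ι (length es) ∷ ι (length (elems EV)) ∷ []) (# 4 ⊕ (X2 ⊗ (# 4 ⊗ X3) ⊕ X4 ⊕ X0) ≼ X1 ∷ # 0 ≼ X2 ⊗ (# 4 ⊗ X3) ∷ # 0 ≼ X4 ∷ []) X0 X1 0 (4 ∙1 ∷ 1 ∙ 0 ∷ 1 ∙ 1 ∷ 1 ∙ 2 ∷ []) refl ((≥-reflexive (y-eq)) ∷ es-part ∷ (0≤ι (length (elems EV))) ∷ []))

        y≥1 : 𝟙 ≤ ι y
        y≥1 = (farkas (ι y ∷ []) (# 4 ≼ X0 ∷ []) (# 1) X0 0 (3 ∙1 ∷ 1 ∙ 0 ∷ []) refl (y≥4 ∷ []))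

        -- The summands of `y` are the demands on β = 1/y: 4 for β ≤ 1/4, n for β ≤ ν, and the rest
        -- for `room`. There `Pn` stands in for (1 + 3β)^J, so that β can be fixed before J is
        -- known.
        β : 𝔽
        β = inv (ι y)

        yβ : ι y * β ≡ 𝟙
        yβ = inv-inverse (≥1⇒≰0 y≥1)

        β≥0 : 𝟘 ≤ β
        β≥0 = inv-nonNeg (≥1⇒≰0 y≥1)

        β≤¼ : ι 4 * β ≤ 𝟙
        β≤¼ = (farkas (β ∷ ι y ∷ []) (# 4 ≼ X1 ∷ # 0 ≼ X0 ∷ X1 ⊗ X0 ≼ # 1 ∷ []) (# 4 ⊗ X0) (# 1) 0 (1 ∙ 2 ∷ 1 ∙ 0 · 1 ∷ []) refl (y≥4 ∷ β≥0 ∷ (≤-reflexive (yβ)) ∷ []))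

        β≤ν : β ≤ ν
        β≤ν = (farkas (β ∷ ν ∷ nn ∷ ι y ∷ []) (X2 ≼ X3 ∷ # 0 ≼ X0 ⊗ X1 ∷ X3 ⊗ X0 ⊗ X1 ≼ # 1 ⊗ X1 ∷ # 1 ⊗ X0 ≼ X1 ⊗ X2 ⊗ X0 ∷ []) X0 X1 0 (1 ∙ 2 ∷ 1 ∙ 3 ∷ 1 ∙ 0 · 1 ∷ []) refl (y≥n ∷ (*-nonNeg β≥0 ν≥0) ∷ (≤-reflexive (cong (_* ν) yβ)) ∷ (≥-reflexive (cong (_* β) νn)) ∷ []))

        Z : 𝔽
        Z = ι 2 * M ^ 17

        Z≥1 : 𝟙 ≤ Z
        Z≥1 = (farkas (p ∷ []) (# 1 ≼ X0 ∷ []) (# 1) (# 2 ⊗ X0) 0 (1 ∙1 ∷ 2 ∙ 0 ∷ []) refl ((M^≥1 17) ∷ []))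
          where p = M ^ 17

        Zn : ℕ
        Zn = 2 ℕ.* m ℕ.^ 17

        -- By Bernoulli's inequality Z y steps certainly bring the power beyond Z. The 2 in `Z` is
        -- the one that `near-perfect` asks for.
        crossing : ∃ λ J → Z ≤ (𝟙 + ι 1 * β) ^ J × (𝟙 + ι 1 * β) ^ J ≤ ι 2 * Z
        crossing = first-crossing β≥0 (farkas (β ∷ []) (# 4 ⊗ X0 ≼ # 1 ∷ []) X0 (# 1) 3 (3 ∙1 ∷ 1 ∙ 0 ∷ []) refl (β≤¼ ∷ [])) Z≥1 (Zn ℕ.* y)
          (≤-trans (farkas (Z ∷ ι (Zn ℕ.* y) ∷ β ∷ ι y ∷ []) (X0 ⊗ # 1 ≼ X0 ⊗ (X3 ⊗ X2) ∷ X0 ⊗ X3 ⊗ X2 ≼ X1 ⊗ X2 ∷ []) X0 (# 1 ⊕ X1 ⊗ X2) 0 (1 ∙1 ∷ 1 ∙ 0 ∷ 1 ∙ 1 ∷ []) refl ((≥-reflexive (cong (Z *_) yβ)) ∷ (≥-reflexive (cong (_* β) zy)) ∷ [])) (bernoulli β≥0 (Zn ℕ.* y)))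
          where
          zy : ι (Zn ℕ.* y) ≡ Z * ι y
          zy = trans (ι-* Zn y) (cong (_* ι y) (trans (ι-* 2 (m ℕ.^ 17)) (cong (ι 2 *_) (ι-^ m 17))))

        module Run (J : ℕ) (Z≤ : Z ≤ (𝟙 + ι 1 * β) ^ J) (≤2Z : (𝟙 + ι 1 * β) ^ J ≤ ι 2 * Z) where
          b a : 𝔽
          b = (𝟙 + ι 1 * β) ^ J
          a = M ^ 17

          b≥0 : 𝟘 ≤ b
          b≥0 = ^-nonNeg (farkas (β ∷ []) (# 0 ≼ X0 ∷ []) (# 0) (# 1 ⊕ # 1 ⊗ X0) 0 (1 ∙1 ∷ 1 ∙ 0 ∷ []) refl (β≥0 ∷ [])) J

          b≤ : b ≤ ι 4 * a
          b≤ = (farkas (b ∷ a ∷ []) (X0 ≼ # 2 ⊗ (# 2 ⊗ X1) ∷ []) X0 (# 4 ⊗ X1) 0 (1 ∙ 0 ∷ []) refl (≤2Z ∷ []))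

          -- Bernoulli's inequality bounds J β by (1 + β)^J, which is at most 4 M^17. The truth is
          -- logarithmic, but a power of M is good enough for the budgets.
          Jβ-below : Below 18 (ι J * β)
          Jβ-below = shrink (const-below 4 1 tt ⊠ power-below 17) (*-nonNeg (0≤ι J) β≥0) (farkas (ι J ∷ β ∷ a ∷ b ∷ []) (# 1 ⊕ X0 ⊗ X1 ≼ X3 ∷ X3 ≼ # 4 ⊗ X2 ∷ []) (X0 ⊗ X1) (# 4 ⊗ X2) 0 (1 ∙1 ∷ 1 ∙ 0 ∷ 1 ∙ 1 ∷ []) refl ((bernoulli β≥0 J) ∷ b≤ ∷ []))

          ρJ : (𝟙 + ι 3 * β) ^ J ≤ ι Pn
          ρJ = ≤-trans (cube-growth β≥0 J) (≤-trans (*-mono-≤ (*-nonNeg b≥0 b≥0) b≥0 (*-mono-≤ b≥0 b≥0 b≤ b≤) b≤) (≤-reflexive (trans (ring (a ∷ []) (# 4 ⊗ X0 ⊗ (# 4 ⊗ X0) ⊗ (# 4 ⊗ X0)) (# 64 ⊗ (X0 ⊗ (X0 ⊗ X0))) refl) (sym (trans Pn-eq (cong (ι 64 *_) (trans (^-+ M 17 34) (cong (a *_) (^-+ M 17 17)))))))))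

          κ : 𝔽
          κ = ι Pn * (ι 4 * ν)

          s₂ R : 𝔽
          s₂ = ι 2 * M ^ 18
          R = ι 2 * M

          Pn-below : Below 52 (ι Pn)
          Pn-below = shrink (const-below 64 1 tt ⊠ power-below 51) (0≤ι Pn) (≤-reflexive Pn-eq)

          s₂-below : Below 19 s₂
          s₂-below = const-below 2 1 tt ⊠ power-below 18

          edge-total : ∑ es edge-weight ≤ ι 4 * ι (length es)
          edge-total = ≤-trans (∑-mono es (λ e → ≤-trans (W≤4ν (proj₁ e) (proj₁ (proj₂ e))) (farkas (ν ∷ []) (X0 ≼ # 1 ∷ []) (# 4 ⊗ X0) (# 4) 0 (4 ∙ 0 ∷ []) refl ((ν≤x^ 0 ℕ.z≤n) ∷ [])))) (≤-reflexive (trans (∑-const es (ι 4)) (*-comm _ _)))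

          V-size : ι (length (elems (enum⊎ (enum⊎ EV ETest) ETest))) ≤ ι 12 * (nn * (nn * nn))
          V-size = ≤-trans (≤-reflexive size) (farkas (nn ∷ T ∷ []) (# 1 ≼ X0 ∷ X1 ≼ X0 ∷ []) (X0 ⊗ X0 ⊕ (X0 ⊗ X1 ⊕ (X0 ⊗ X1 ⊕ X0 ⊗ X0 ⊗ X1)) ⊕ (X1 ⊕ (X1 ⊕ (X0 ⊕ X0))) ⊕ (X1 ⊕ (X1 ⊕ (X0 ⊕ X0)))) (# 12 ⊗ (X0 ⊗ (X0 ⊗ X0))) 0 (19 ∙ 0 ∷ 7 ∙ 1 ∷ 30 ∙ 0 · 0 ∷ 4 ∙ 0 · 1 ∷ 11 ∙ 0 · 0 · 0 ∷ 1 ∙ 0 · 0 · 1 ∷ []) refl (n≥1 ∷ t≤n′ ∷ []))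
            where
            T = ι t
            Ft = allFin t
            len : ∀ {A : Set} (xs : List A) → ι (length xs) ≡ ∑ xs (λ _ → 𝟙)
            len xs = trans (sym (*-identityʳ (ι (length xs)))) (sym (∑-const xs 𝟙))
            ones : ∀ k → ∑ (allFin k) (λ _ → 𝟙) ≡ ι k
            ones k = trans (∑-Fin-const k 𝟙) (*-identityʳ (ι k))
            box : ∀ k l → ∑ (elems (enum× (enumFin k) (enumFin l))) (λ _ → 𝟙) ≡ ι k * ι l
            box k l = trans (∑-× (enumFin k) (enumFin l) (λ _ → 𝟙)) (trans (∑-cong (allFin k) (λ _ → ones l)) (∑-Fin-const k (ι l)))
            Et = enumFin t
            tests : ∑ (elems ETest) (λ _ → 𝟙) ≡ T + (T + (nn + nn))
            tests = trans (∑-⊎ Et (enum⊎ Et (enum⊎ En En)) (λ _ → 𝟙)) (cong₂ _+_ (ones t) (trans (∑-⊎ Et (enum⊎ En En) (λ _ → 𝟙)) (cong₂ _+_ (ones t) (trans (∑-⊎ En En (λ _ → 𝟙)) (cong₂ _+_ (ones n) (ones n))))))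
            vertices : ∑ (elems EV) (λ _ → 𝟙) ≡ nn * nn + (nn * T + (nn * T + nn * nn * T))
            vertices = trans (∑-⊎ (enum× En En) (enum⊎ (enum× En Et) (enum⊎ (enum× En Et) (enum× (enumFin K) Et))) (λ _ → 𝟙)) (cong₂ _+_ (box n n) (trans (∑-⊎ (enum× En Et) (enum⊎ (enum× En Et) (enum× (enumFin K) Et)) (λ _ → 𝟙)) (cong₂ _+_ (box n t)
              (trans (∑-⊎ (enum× En Et) (enum× (enumFin K) Et) (λ _ → 𝟙)) (cong₂ _+_ (box n t) (trans (box K t) (cong (_* T) (ι-* n n))))))))
            size : ι (length (elems (enum⊎ (enum⊎ EV ETest) ETest))) ≡ nn * nn + (nn * T + (nn * T + nn * nn * T)) + (T + (T + (nn + nn))) + (T + (T + (nn + nn)))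
            size = trans (len (elems (enum⊎ (enum⊎ EV ETest) ETest))) (trans (∑-⊎ (enum⊎ EV ETest) ETest (λ _ → 𝟙)) (cong₂ _+_ (trans (∑-⊎ EV ETest (λ _ → 𝟙)) (cong₂ _+_ vertices tests)) tests))

          constants : Constants N J β (ι 4 * ν) κ R s₁ s₂
          constants = record
            { lam≤¼ = ≤-trans (≤-reflexive (ring (l ∷ []) (# 4 ⊗ (# 2 ⊗ X0)) (# 8 ⊗ X0) refl)) (against-x (const-below 8 1 tt) (ℕP.≤ᵇ⇒≤ 1 40 tt))
            ; 4ν≤θ = ≤-refl
            ; β≥0 = β≥0
            ; β≤⅓ = (farkas (β ∷ []) (# 4 ⊗ X0 ≼ # 1 ∷ []) (# 3 ⊗ X0) (# 1) 3 (1 ∙1 ∷ 3 ∙ 0 ∷ []) refl (β≤¼ ∷ []))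
            ; β≤κ = ≤-trans β≤ν (farkas (ν ∷ ι Pn ∷ []) (# 1 ≼ X1 ∷ # 0 ≼ X0 ∷ []) X0 (X1 ⊗ (# 4 ⊗ X0)) 0 (3 ∙ 1 ∷ 4 ∙ 0 · 1 ∷ []) refl (Pn≥1 ∷ ν≥0 ∷ []))
            ; growth = *-mono-≤ (^-nonNeg (farkas (β ∷ []) (# 0 ≼ X0 ∷ []) (# 0) (# 1 ⊕ # 3 ⊗ X0) 0 (1 ∙1 ∷ 3 ∙ 0 ∷ []) refl (β≥0 ∷ [])) J) (*-nonNeg (0≤ι 4) ν≥0) ρJ ≤-refl
            ; room = (farkas (β ∷ r ∷ S ∷ L ∷ ι Pn ∷ ι (length es) ∷ ι y ∷ nn ∷ []) (X1 ⊗ X2 ≼ X4 ⊗ (# 4 ⊗ X5) ∷ # 0 ≼ X0 ∷ X0 ⊗ (# 4 ⊕ (X4 ⊗ (# 4 ⊗ X5) ⊕ X3 ⊕ X7)) ≼ X0 ⊗ X6 ∷ X6 ⊗ X0 ≼ # 1 ∷ # 0 ≼ X7 ∷ []) (X0 ⊗ (X1 ⊗ X2 ⊕ X3)) (# 1) 0 (4 ∙ 1 ∷ 1 ∙ 2 ∷ 1 ∙ 3 ∷ 1 ∙ 0 · 1 ∷ 1 ∙ 1 · 4 ∷ []) refl ((*-mono-≤ (^-nonNeg (farkas (β ∷ []) (# 0 ≼ X0 ∷ []) (# 0) (# 1 ⊕ # 3 ⊗ X0) 0 (1 ∙1 ∷ 3 ∙ 0 ∷ []) refl (β≥0 ∷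 [])) J) (∑-nonNeg es (λ e → W≥0 (proj₁ e) (proj₁ (proj₂ e)))) ρJ edge-total) ∷ β≥0 ∷ (≥-reflexive (cong (β *_) y-eq)) ∷ (≤-reflexive (yβ)) ∷ (0≤ι n) ∷ []))
            ; R≥0 = *-nonNeg (0≤ι 2) (0≤ι m)
            ; R≡ = trans (cong (ι 2 *_) s₁-lam₀) (ring (s₁ ∷ l ∷ []) (# 2 ⊗ (X0 ⊗ X1)) (X0 ⊗ (# 2 ⊗ X1)) refl)
            ; s₁≥1 = M^≥1 41
            ; s₂≥1 = (farkas (p₁₈ ∷ []) (# 1 ≼ X0 ∷ []) (# 1) (# 2 ⊗ X0) 0 (1 ∙1 ∷ 2 ∙ 0 ∷ []) refl ((M^≥1 18) ∷ []))
            ; N≥1 = N≥1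
            ; small₁ = ≤-trans (≤-reflexive (ring (ι N ∷ s₁ ∷ ι Pn ∷ ν ∷ []) (X0 ⊗ (# 2 ⊗ (X1 ⊗ (# 8 ⊗ (X2 ⊗ (# 4 ⊗ X3)))))) (# 64 ⊗ X0 ⊗ X1 ⊗ X2 ⊗ X3) refl)) (against-ν (const-below 64 1 tt ⊠ N-below ⊠ power-below 41 ⊠ Pn-below) (ℕP.≤ᵇ⇒≤ 96 200 tt))
            ; small₂ = ≤-trans (≤-reflexive (ring (ι N ∷ s₂ ∷ ν ∷ []) (X0 ⊗ (# 2 ⊗ (X1 ⊗ (# 4 ⊗ X2)))) (# 8 ⊗ X0 ⊗ X1 ⊗ X2) refl)) (against-ν (const-below 8 1 tt ⊠ N-below ⊠ s₂-below) (ℕP.≤ᵇ⇒≤ 22 200 tt))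
            -- The costliest demand on n: the factors have exponents 2, 18, 4, 82 and 52, together
            -- 158, and the factor ν provides 200.
            ; budget₁ = ≤-trans (≤-reflexive (ring (ι J ∷ ι N ∷ s₁ ∷ β ∷ ι Pn ∷ ν ∷ []) (# 2 ⊗ (X0 ⊗ (# 1600 ⊗ (X1 ⊗ X1) ⊗ (X2 ⊗ X2) ⊗ X3 ⊗ (X4 ⊗ (# 4 ⊗ X5))))) (# 12800 ⊗ (X0 ⊗ X3) ⊗ (X1 ⊗ X1) ⊗ (X2 ⊗ X2) ⊗ X4 ⊗ X5) refl))
                (against-ν (const-below 12800 2 tt ⊠ Jβ-below ⊠ (N-below ⊠ N-below) ⊠ (power-below 41 ⊠ power-below 41) ⊠ Pn-below) (ℕP.≤ᵇ⇒≤ 158 200 tt))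
            ; budget₂ = budget
            ; R-large = R-large (farkas (M ∷ []) (# 0 ≼ X0 ∷ []) X0 (# 2 ⊗ X0) 0 (1 ∙ 0 ∷ []) refl ((0≤ι m) ∷ [])) V-size }
            where
            l = x ^ 40
            r = (𝟙 + ι 3 * β) ^ J
            S = ∑ es edge-weight
            L = ι (length (elems EV))
            p₁₈ = M ^ 18
            Pn≥1 : 𝟙 ≤ ι Pn
            Pn≥1 = subst (𝟙 ≤_) (sym Pn-eq) (farkas (p₅₁ ∷ []) (# 1 ≼ X0 ∷ []) (# 1) (# 64 ⊗ X0) 0 (63 ∙1 ∷ 64 ∙ 0 ∷ []) refl ((M^≥1 51) ∷ []))
              where p₅₁ = M ^ 51
            Js : 𝔽
            Js = ι N * s₂
            second : ι 5 * (ι N * ι N) * (s₂ * s₂ * (ι 4 * ν)) ≤ Js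
            second = ≤-trans (≤-trans (≤-reflexive (ring (ι N ∷ s₂ ∷ ν ∷ []) (# 5 ⊗ (X0 ⊗ X0) ⊗ (X1 ⊗ X1 ⊗ (# 4 ⊗ X2))) (# 20 ⊗ (X0 ⊗ X0) ⊗ (X1 ⊗ X1) ⊗ X2) refl)) (against-ν (const-below 20 1 tt ⊠ (N-below ⊠ N-below) ⊠ (s₂-below ⊠ s₂-below)) (ℕP.≤ᵇ⇒≤ 43 200 tt)))
              (≤-trans (≥-reflexive (*-identityˡ 𝟙)) (*-mono-≤ 0≤1 0≤1 N≥1 (farkas (p₁₈ ∷ []) (# 1 ≼ X0 ∷ []) (# 1) (# 2 ⊗ X0) 0 (1 ∙1 ∷ 2 ∙ 0 ∷ []) refl ((M^≥1 18) ∷ []))))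
            budget : ι 2 * (ι J * (ι 4 * β * lam * (ι N * s₂ + ι 5 * (ι N * ι N) * (s₂ * s₂ * (ι 4 * ν))))) ≤ 𝟙
            budget = ≤-trans (farkas (ι J ∷ β ∷ l ∷ ι N ∷ s₂ ∷ Y ∷ p₁₈ ∷ []) (X5 ≼ X3 ⊗ X4 ∷ # 0 ≼ X0 ⊗ X1 ⊗ X2 ∷ X0 ⊗ X1 ⊗ X2 ⊗ (X3 ⊗ X4) ≼ X0 ⊗ X1 ⊗ X2 ⊗ (X3 ⊗ (# 2 ⊗ X6)) ∷ []) (# 2 ⊗ (X0 ⊗ (# 4 ⊗ X1 ⊗ (# 2 ⊗ X2) ⊗ (X3 ⊗ X4 ⊕ X5)))) (# 64 ⊗ (X0 ⊗ X1) ⊗ X3 ⊗ X6 ⊗ X2) 0 (32 ∙ 2 ∷ 16 ∙ 0 · 1 ∷ []) refl (second ∷ (*-nonNeg (*-nonNeg (0≤ι J) β≥0) lam₀≥0) ∷ (≤-reflexive (cong (λ z → ι J * β * l * (ι N * z)) (refl {x = s₂}))) ∷ []))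
              (against-x (const-below 64 1 tt ⊠ Jβ-below ⊠ N-below ⊠ power-below 18) (ℕP.≤ᵇ⇒≤ 39 40 tt))
              where Y = ι 5 * (ι N * ι N) * (s₂ * s₂ * (ι 4 * ν))

          -- Both the living part and the waste have density at most ε, so the initial debts are at
          -- most ℓ. The value z = x^8 serves at once as load bound over n, as share of overloaded
          -- lines and as discrepancy h: it has to be small against q³ = x^6, the order of the share
          -- of candidate pairs. Markov's inequality then needs 12 ε ≤ z², whence 17 = 2 · 8 + 1.
          ε ℓ Bd z : 𝔽
          ε = x ^ 17
          z = x ^ 8
          ℓ = ι 3 * (nn * (ε + ε))
          Bd = nn * z

          ε≥0 : 𝟘 ≤ ε
          ε≥0 = x^≥0 17

          z≥0 : 𝟘 ≤ z
          z≥0 = x^≥0 8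

          ε-eq : ε ≡ z * z * x
          ε-eq = trans (trans (^-+ x 8 9) (cong (z *_) (^-+ x 8 1))) (ring (z ∷ x ∷ []) (X0 ⊗ (X0 ⊗ (X1 ⊗ # 1))) (X0 ⊗ X0 ⊗ X1) refl)

          12ε≤ : ι 12 * ε ≤ z * z
          12ε≤ = (farkas (ε ∷ z ∷ x ∷ []) (X0 ≼ X1 ⊗ X1 ⊗ X2 ∷ # 200 ⊗ X2 ≼ # 1 ∷ # 0 ≼ X1 ⊗ X1 ∷ []) (# 12 ⊗ X0) (X1 ⊗ X1) 49 (600 ∙ 0 ∷ 47 ∙ 2 ∷ 3 ∙ 1 · 2 ∷ []) refl ((≤-reflexive (ε-eq)) ∷ x-small ∷ (square-nonNeg z) ∷ []))

          z≤1 : z ≤ 𝟙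
          z≤1 = ^-≤1 x≥0 x≤1 8

          2ν≤z : ι 2 * ν ≤ z
          2ν≤z = (farkas (ν ∷ z ∷ x ∷ []) (X0 ≼ X1 ⊗ X2 ∷ # 2 ⊗ X2 ≼ # 1 ∷ # 0 ≼ X1 ∷ []) (# 2 ⊗ X0) X1 0 (2 ∙ 0 ∷ 1 ∙ 1 · 2 ∷ []) refl ((≤-trans (ν≤x^ 9 (ℕP.≤ᵇ⇒≤ 9 200 tt)) (≤-reflexive (trans (^-+ x 8 1) (ring (z ∷ x ∷ []) (X0 ⊗ (X1 ⊗ # 1)) (X0 ⊗ X1) refl)))) ∷ 2x≤1 ∷ z≥0 ∷ []))

          Bd≥2 : ι 2 ≤ Bd
          Bd≥2 = (farkas (nn ∷ z ∷ ν ∷ []) (# 2 ⊗ X2 ≼ X1 ∷ # 0 ≼ X0 ∷ # 1 ≼ X2 ⊗ X0 ∷ []) (# 2) (X0 ⊗ X1) 0 (2 ∙ 2 ∷ 1 ∙ 0 · 1 ∷ []) refl (2ν≤z ∷ (0≤ι n) ∷ (≥-reflexive (νn)) ∷ []))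

          o-large : ℓ ≤ z * (Bd - 𝟙)
          o-large = (farkas (nn ∷ ε ∷ z ∷ []) (# 12 ⊗ X1 ≼ X2 ⊗ X2 ∷ # 0 ≼ X0 ∷ # 2 ≼ X0 ⊗ X2 ∷ # 0 ≼ X2 ∷ []) (# 3 ⊗ (X0 ⊗ (X1 ⊕ X1))) (X2 ⊗ (X0 ⊗ X2 ⊖ # 1)) 1 (1 ∙ 0 · 1 ∷ 1 ∙ 2 · 3 ∷ []) refl (12ε≤ ∷ (0≤ι n) ∷ Bd≥2 ∷ z≥0 ∷ []))

          M₀-good : ∃ λ M₀ → Switching.Good {t = t} c row-proper col-proper Q? ℓ Bd M₀
          M₀-good = near-good {N} {J} {β} {ι 4 * ν} {κ} {R} {s₁} {s₂} constants {ε} {ε} {ℓ} {Bd}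
            (farkas (M ∷ s₂ ∷ ε ∷ []) (# 2 ⊗ X0 ≼ X1 ⊗ X2 ∷ []) (# 2 ⊗ X0) (X1 ⊗ X2) 0 (1 ∙ 0 ∷ []) refl ((≥-reflexive (s₂ε)) ∷ []))
            (≤-trans (farkas (ε ∷ Z ∷ a ∷ []) (# 1 ≼ X2 ⊗ X0 ∷ X0 ⊗ (# 2 ⊗ X2) ≼ X0 ⊗ X1 ∷ []) (# 2) (X0 ⊗ X1) 0 (2 ∙ 0 ∷ 1 ∙ 1 ∷ []) refl ((≥-reflexive (M^x^ 17)) ∷ (≥-reflexive (cong (ε *_) (refl {x = Z}))) ∷ [])) (*-mono-≤ ε≥0 (≤-trans 0≤1 Z≥1) ≤-refl Z≤))
            ≤-refl
            (farkas (nn ∷ ε ∷ z ∷ []) (# 0 ≼ X0 ∷ # 12 ⊗ X1 ≼ X2 ⊗ X2 ∷ X2 ⊗ X2 ≼ # 1 ⊗ X2 ∷ # 0 ≼ X1 ∷ []) (X0 ⊗ (X1 ⊕ X1)) (X0 ⊗ X2) 0 (1 ∙ 0 · 1 ∷ 1 ∙ 0 · 2 ∷ 10 ∙ 0 · 3 ∷ []) refl ((0≤ι n) ∷ 12ε≤ ∷ (*-mono-≤ z≥0 z≥0 z≤1 ≤-refl) ∷ ε≥0 ∷ []))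
            where
            s₂ε : s₂ * ε ≡ ι 2 * M
            s₂ε = trans (cong (λ w → ι 2 * w * ε) (^-+ M 1 17)) (trans (ring (M ∷ a ∷ ε ∷ []) (# 2 ⊗ (X0 ⊗ # 1 ⊗ X1) ⊗ X2) (# 2 ⊗ X0 ⊗ (X1 ⊗ X2)) refl) (trans (cong (ι 2 * M *_) (M^x^ 17)) (ring (M ∷ []) (# 2 ⊗ X0 ⊗ # 1) (# 2 ⊗ X0) refl)))

          νℓ : ν * ℓ ≡ ι 6 * ε
          νℓ = trans (ring (ν ∷ nn ∷ ε ∷ []) (X0 ⊗ (# 3 ⊗ (X1 ⊗ (X2 ⊕ X2)))) (X0 ⊗ X1 ⊗ (# 6 ⊗ X2)) refl) (trans (cong (_* (ι 6 * ε)) νn) (*-identityˡ _))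

          νBd : ν * Bd ≡ z
          νBd = trans (ring (ν ∷ nn ∷ z ∷ []) (X0 ⊗ (X1 ⊗ X2)) (X0 ⊗ X1 ⊗ X2) refl) (trans (cong (_* z) νn) (*-identityˡ _))

          F-deg : ∀ (a : Fin n → Fin K) → ∑ Fn (λ j → ν * ξ (a j)) ≡ ν * ∑ Fn (λ j → 𝟏 (Q? (a j)))
          F-deg a = trans (∑-*ˡ Fn ν _) (cong (ν *_) (∑-cong Fn (λ j → sym (in-Q (a j)))))

          νq : ∑ Fn (λ _ → ν * q) ≡ q
          νq = trans (∑-Fin-const n (ν * q)) (trans (ring (nn ∷ ν ∷ q ∷ []) (X0 ⊗ (X1 ⊗ X2)) (X1 ⊗ X0 ⊗ X2) refl) (trans (cong (_* q) νn) (*-identityˡ q)))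

          lam₀≤z : lam₀ ≤ z
          lam₀≤z = x^-anti (ℕP.≤ᵇ⇒≤ 8 40 tt)

          row-degree : ∀ i → q - lam₀ ≤ ν * ∑ Fn (λ j → 𝟏 (Q? (c i j)))
          row-degree i = ≤-trans (T-lower (inj₂ (inj₂ (inj₁ i))) νq) (≤-reflexive (F-deg (c i)))

          col-degree : ∀ j → q - lam₀ ≤ ν * ∑ Fn (λ i → 𝟏 (Q? (c i j)))
          col-degree j = ≤-trans (T-lower (inj₂ (inj₂ (inj₂ (inj₁ j)))) νq) (≤-reflexive (F-deg (λ i → c i j)))

          codegree : ∀ i i′ → i ≢ i′ → ν * ∑ Fn (λ j → 𝟏 (Q? (c i j)) * 𝟏 (Q? (c i′ j))) ≤ q * q + lam₀
          codegree i i′ ne = ≤-trans (≤-reflexive eq) (T-upper (inj₂ (inj₂ (inj₂ (inj₂ (i , i′))))) start)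
            where
            off≡1 : off i i′ ≡ 𝟙
            off≡1 = trans (cong (λ w → 𝟙 - w) (𝟏-no (i FP.≟ i′) ne)) (ring [] (# 1 ⊖ # 0) (# 1) refl)
            eq : ν * ∑ Fn (λ j → 𝟏 (Q? (c i j)) * 𝟏 (Q? (c i′ j))) ≡ ∑ Fn (λ j → ν * off i i′ * (ξ (c i j) * ξ (c i′ j)))
            eq = trans (sym (∑-*ˡ Fn ν _)) (∑-cong Fn (λ j → trans (cong (ν *_) (cong₂ _*_ (in-Q (c i j)) (in-Q (c i′ j)))) (cong (_* (ξ (c i j) * ξ (c i′ j))) (trans (sym (*-identityʳ ν)) (cong (ν *_) (sym off≡1))))))
            start : ∑ Fn (λ j → ν * off i i′ * (q * q)) ≡ q * q
            start = trans (∑-Fin-const n _) (trans (cong (λ w → nn * (ν * w * (q * q))) off≡1) (trans (ring (nn ∷ ν ∷ q ∷ []) (X0 ⊗ (X1 ⊗ # 1 ⊗ (X2 ⊗ X2))) (X1 ⊗ X0 ⊗ (X2 ⊗ X2)) refl) (trans (cong (_* (q * q)) νn) (*-identityˡ _))))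

          z-eq : z ≡ q * q * (q * q)
          z-eq = (ring (x ∷ []) (X0 ⊗ (X0 ⊗ (X0 ⊗ (X0 ⊗ (X0 ⊗ (X0 ⊗ (X0 ⊗ (X0 ⊗ # 1)))))))) (X0 ⊗ X0 ⊗ (X0 ⊗ X0) ⊗ (X0 ⊗ X0 ⊗ (X0 ⊗ X0))) refl)

          z-small : ι 40000 * z ≤ q * q * q
          z-small = (farkas (z ∷ q ∷ []) (X0 ≼ X1 ⊗ X1 ⊗ (X1 ⊗ X1) ∷ # 40000 ⊗ X1 ≼ # 1 ∷ # 0 ≼ X1 ⊗ X1 ⊗ X1 ∷ []) (# 40000 ⊗ X0) (X1 ⊗ X1 ⊗ X1) 0 (40000 ∙ 0 ∷ 1 ∙ 1 · 2 ∷ []) refl ((≤-reflexive (z-eq)) ∷ q-small ∷ (*-nonNeg (square-nonNeg q) q≥0) ∷ []))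

          z≤q : ι 40000 * z ≤ q
          z≤q = (farkas (z ∷ q ∷ []) (# 40000 ⊗ X0 ≼ X1 ⊗ X1 ⊗ X1 ∷ X1 ≼ # 1 ∷ # 0 ≼ X1 ∷ []) (# 40000 ⊗ X0) X1 0 (1 ∙ 0 ∷ 1 ∙ 1 · 2 ∷ 1 ∙ 1 · 2 · 2 ∷ []) refl (z-small ∷ q≤1 ∷ q≥0 ∷ []))

          6ε≤z : ι 6 * ε ≤ z
          6ε≤z = (farkas (ε ∷ z ∷ []) (# 12 ⊗ X0 ≼ X1 ⊗ X1 ∷ # 0 ≼ X1 ∷ X1 ≼ # 1 ∷ []) (# 6 ⊗ X0) X1 1 (1 ∙ 0 ∷ 1 ∙ 1 ∷ 1 ∙ 1 · 2 ∷ []) refl (12ε≤ ∷ z≥0 ∷ z≤1 ∷ []))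

          X-large : q ≤ ι 2 * (q - lam₀ - ν * ℓ)
          X-large = (farkas (q ∷ lam₀ ∷ ν ∷ ℓ ∷ ε ∷ z ∷ []) (X2 ⊗ X3 ≼ # 6 ⊗ X4 ∷ # 6 ⊗ X4 ≼ X5 ∷ X1 ≼ X5 ∷ # 40000 ⊗ X5 ≼ X0 ∷ # 0 ≼ X5 ∷ []) X0 (# 2 ⊗ (X0 ⊖ X1 ⊖ X2 ⊗ X3)) 0 (2 ∙ 0 ∷ 2 ∙ 1 ∷ 2 ∙ 2 ∷ 1 ∙ 3 ∷ 39996 ∙ 4 ∷ []) refl ((≤-reflexive (νℓ)) ∷ 6ε≤z ∷ lam₀≤z ∷ z≤q ∷ z≥0 ∷ []))

          X≥0 : 𝟘 ≤ q - lam₀ - ν * ℓ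
          X≥0 = (farkas (q ∷ lam₀ ∷ ν ∷ ℓ ∷ []) (X0 ≼ # 2 ⊗ (X0 ⊖ X1 ⊖ X2 ⊗ X3) ∷ # 0 ≼ X0 ∷ []) (# 0) (X0 ⊖ X1 ⊖ X2 ⊗ X3) 1 (1 ∙ 0 ∷ 1 ∙ 1 ∷ []) refl (X-large ∷ q≥0 ∷ []))

          z≰0 : ¬ z ≤ 𝟘
          z≰0 h = 1≰0 (farkas (z ∷ p ∷ []) (X0 ≼ # 0 ∷ # 1 ≼ X1 ⊗ X0 ∷ # 0 ≼ X1 ∷ []) (# 1) (# 0) 0 (1 ∙ 1 ∷ 1 ∙ 0 · 2 ∷ []) refl (h ∷ (≥-reflexive (M^x^ 8)) ∷ (M^≥0 8) ∷ []))
            where p = M ^ 8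

          h-large : ι 3 * lam₀ + ν ≤ ι 4 * (z * z)
          h-large = (farkas (lam₀ ∷ ν ∷ z ∷ x ∷ []) (X0 ≼ X3 ↑ 16 ∷ X1 ≼ X3 ↑ 16 ∷ X3 ↑ 16 ≼ X2 ⊗ X2 ∷ []) (# 3 ⊗ X0 ⊕ X1) (# 4 ⊗ (X2 ⊗ X2)) 0 (3 ∙ 0 ∷ 1 ∙ 1 ∷ 4 ∙ 2 ∷ []) refl ((x^-anti (ℕP.≤ᵇ⇒≤ 16 40 tt)) ∷ (ν≤x^ 16 (ℕP.≤ᵇ⇒≤ 16 200 tt)) ∷ (≤-reflexive (^-+ x 8 8)) ∷ []))

          -- The left side is at least q³ / 4, hence at least 10000 z, while the right side is at
          -- most 15 z. Since z is positive, there is a candidate pair without defect.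
          many : ¬ q * (q - lam₀ - ν * ℓ) * (q - lam₀ - ν * ℓ) ≤ ι 2 * z + ι 2 * (ν * Bd) + ι 4 * (ν * ℓ) + ι 5 * ν + ι 4 * z
          many h = z≰0 (farkas (z ∷ q ∷ X ∷ ν ∷ Bd ∷ ℓ ∷ ε ∷ []) (X1 ⊗ X2 ⊗ X2 ≼ # 2 ⊗ X0 ⊕ # 2 ⊗ (X3 ⊗ X4) ⊕ # 4 ⊗ (X3 ⊗ X5) ⊕ # 5 ⊗ X3 ⊕ # 4 ⊗ X0 ∷ X3 ⊗ X4 ≼ X0 ∷ X3 ⊗ X5 ≼ # 6 ⊗ X6 ∷ # 6 ⊗ X6 ≼ X0 ∷ # 2 ⊗ X3 ≼ X0 ∷ # 40000 ⊗ X0 ≼ X1 ⊗ X1 ⊗ X1 ∷ # 0 ≼ X1 ∷ X1 ≼ # 2 ⊗ X2 ∷ []) X0 (# 0) 39941 (4 ∙ 0 ∷ 8 ∙ 1 ∷ 16 ∙ 2 ∷ 16 ∙ 3 ∷ 10 ∙ 4 ∷ 1 ∙ 5 ∷ 1 ∙ 6 · 7 · 7 ∷ 2 ∙ 6 · 6 · 7 ∷ []) refl (h ∷ (≤-reflexive (νBd)) ∷ (≤-reflexive (νℓ)) ∷ 6ε≤z ∷ 2ν≤z ∷ z-small ∷ q≥0 ∷ X-large ∷ []))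
            where X = q - lam₀ - ν * ℓ

          open module Fl = Filling {t = t} c row-proper col-proper Q? ℓ Bd t≤n′ (≤-trans (*-nonNeg (0≤ι 3) (*-nonNeg (0≤ι n) (farkas (ε ∷ []) (# 0 ≼ X0 ∷ []) (# 0) (X0 ⊕ X0) 0 (2 ∙ 0 ∷ []) refl (ε≥0 ∷ [])))) ≤-refl) Bd≥2 ν q lam₀ z z νn ν≥0 q≥0 q≤1 lam₀≥0
            row-degree col-degree codegree z≰0 h-large o-large X≥0 many using (fill; Full)

          Matchings : Set
          Matchings = ∃ λ (f : Fin t → Fin n → Fin n) → (∀ s {i i′} → f s i ≡ f s i′ → i ≡ i′) × (∀ s {i i′} → c i (f s i) ≡ c i′ (f s i′) → i ≡ i′) × (∀ s s′ → s ≢ s′ → ∀ i → f s i ≢ f s′ i)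

          matchings : Matchings
          matchings = from-good M₀-good
            where
            finish : (∃ λ M′ → Switching.Good {t = t} c row-proper col-proper Q? ℓ Bd M′ × Full M′) → Matchings
            finish (M′ , good , full) = Fl.matching good full , (λ s → Fl.matching-injective good full s) , (λ s → Fl.matching-rainbow good full s) , Fl.matching-disjoint good full
            from-good : (∃ λ M₀ → Switching.Good {t = t} c row-proper col-proper Q? ℓ Bd M₀) → Matchings
            from-good (M₀ , good) = finish (fill (n ℕ.* t) M₀ good (ℕP.m≤m+n (n ℕ.* t) (length M₀)))

    decomposition : ∃ λ (f : Fin t → Fin n → Fin n) → (∀ s {i i′} → f s i ≡ f s i′ → i ≡ i′) × (∀ s {i i′} → c i (f s i) ≡ c i′ (f s i′) → i ≡ i′) × (∀ s s′ → s ≢ s′ → ∀ i → f s i ≢ f s′ i)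
    decomposition = with-reserve reserve
      where
      with-reserve : Reserve → _
      with-reserve (ξ , ξ-01 , tracked) = run crossing
        where
        open WithReserve ξ ξ-01 tracked
        run : (∃ λ J → Z ≤ (𝟙 + ι 1 * β) ^ J × (𝟙 + ι 1 * β) ^ J ≤ ι 2 * Z) → _
        run (J , lo , hi) = Run.matchings J lo hi

  -- From natural numbers to finitely many colours

  ι-length-filter : ∀ {A : Set} {P : A → Set} (P? : ∀ x → Dec (P x)) xs → ι (length (filter P? xs)) ≡ ∑ xs (λ x → 𝟏 (P? x))
  ι-length-filter P? [] = refl
  ι-length-filter P? (x ∷ xs) with P? x
  ... | yes _ = trans (ι-suc (length (filter P? xs))) (cong (𝟙 +_) (ι-length-filter P? xs))
  ... | no _ = trans (ι-length-filter P? xs) (sym (+-identityˡ _))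

  ∑-cartesianProduct : ∀ {A B : Set} (xs : List A) (ys : List B) f → ∑ (cartesianProduct xs ys) f ≡ ∑ xs (λ x → ∑ ys (λ y → f (x , y)))
  ∑-cartesianProduct [] ys f = refl
  ∑-cartesianProduct (x ∷ xs) ys f = trans (∑-++ (map (x ,_) ys) (cartesianProduct xs ys) f) (cong₂ _+_ (∑-map (x ,_) ys f) (∑-cartesianProduct xs ys f))

  map-unique : ∀ {A B : Set} (f : A → B) (g : B → A) {xs} → Unique xs → All (λ x → g (f x) ≡ x) xs → Unique (map f xs)
  map-unique f g [] [] = []
  map-unique f g {x ∷ xs} (p ∷ un) (e ∷ es) = separate p es ∷ map-unique f g un es
    where
    separate : ∀ {ys} → All (x ≢_) ys → All (λ y → g (f y) ≡ y) ys → All (f x ≢_) (map f ys)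
    separate [] [] = []
    separate (q ∷ qs) (r ∷ rs) = (λ h → q (trans (sym e) (trans (cong g h) r))) ∷ separate qs rs

  edgeCount-∑ : ∀ {n} (c : Colouring n) k → ι (edgeCount c k) ≡ ∑ (allFin n) (λ i → ∑ (allFin n) (λ j → 𝟏 (c i j ℕP.≟ k)))
  edgeCount-∑ {n} c k = trans (ι-length-filter (λ e → c (proj₁ e) (proj₂ e) ℕP.≟ k) (cartesianProduct (allFin n) (allFin n))) (∑-cartesianProduct (allFin n) (allFin n) _)

  module Recolour {n′ : ℕ} (c : Colouring (suc n′)) where
    n = suc n′
    K = n ℕ.* n

    colour : Fin K → ℕ
    colour k = c (proj₁ (Data.Fin.remQuot {n} n k)) (proj₂ (Data.Fin.remQuot {n} n k))

    represent : ∀ v → Dec (∃ λ k → colour k ≡ v) → Fin K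
    represent v (yes (k , _)) = k
    -- A default for numbers that colour no cell; the colours of cells never get here.
    represent v (no _) = Fin.zero

    -- The n² cells themselves serve as the new colours: a colour is represented by a cell that
    -- carries it, so no bound on the original colours is needed.
    rep : ℕ → Fin K
    rep v = represent v (FP.any? (λ k → colour k ℕP.≟ v))

    colour-rep : ∀ i j → colour (rep (c i j)) ≡ c i j
    colour-rep i j = by (FP.any? (λ k → colour k ℕP.≟ c i j))
      where
      by : (d : Dec (∃ λ k → colour k ≡ c i j)) → colour (represent (c i j) d) ≡ c i j
      by (yes (_ , e)) = e
      by (no h) = ⊥-elim (h (Data.Fin.combine i j , cong (λ p → c (proj₁ p) (proj₂ p)) (FP.remQuot-combine i j)))

    recoloured : Fin n → Fin n → Fin K
    recoloured i j = rep (c i j)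

    same-colour : ∀ {i j i′ j′} → recoloured i j ≡ recoloured i′ j′ → c i j ≡ c i′ j′
    same-colour {i} {j} {i′} {j′} e = trans (sym (colour-rep i j)) (trans (cong colour e) (colour-rep i′ j′))

    size : Fin K → 𝔽
    size k = ∑ (allFin n) (λ i → ∑ (allFin n) (λ j → 𝟏 (recoloured i j FP.≟ k)))

    module _ (X b t : ℕ) (t-large : X ℕ.< t ℕ.* b) (above : AtMostColoursAbove c X b) where
      private
        huge? : ∀ k → Dec (¬ size k ≤ ι t)
        huge? k = ¬? (size k ≤? ι t)

        -- A huge index is the colour of at least one cell, hence a value of `rep`, and there `rep`
        -- undoes `colour`. Distinct huge indices thus come from distinct original colours.
        used : ∀ k → ¬ size k ≤ ι t → rep (colour k) ≡ k
        used k h = find₁ (∑-positive (allFin n) _ (λ le → h (≤-trans le (0≤ι t))))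
          where
          find₂ : ∀ {i} → (∃ λ j → j ∈ allFin n × ¬ 𝟏 (recoloured i j FP.≟ k) ≤ 𝟘) → rep (colour k) ≡ k
          find₂ {i} (j , _ , p) = trans (cong rep (trans (cong colour (sym e)) (colour-rep i j))) e
            where
            e : recoloured i j ≡ k
            e = 𝟏-positive (recoloured i j FP.≟ k) p
          find₁ : (∃ λ i → i ∈ allFin n × ¬ ∑ (allFin n) (λ j → 𝟏 (recoloured i j FP.≟ k)) ≤ 𝟘) → rep (colour k) ≡ k
          find₁ (i , _ , p) = find₂ {i} (∑-positive (allFin n) _ p)

        size-edges : ∀ k → rep (colour k) ≡ k → size k ≡ ι (edgeCount c (colour k))
        size-edges k e = trans (∑-cong (allFin n) (λ i → ∑-cong (allFin n) (λ j → 𝟏-cong (recoloured i j FP.≟ k) (c i j ℕP.≟ colour k)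
          (λ p → trans (sym (colour-rep i j)) (cong colour p)) (λ p → trans (cong rep p) e)))) (sym (edgeCount-∑ c (colour k)))

        hs : List (Fin K)
        hs = filter huge? (allFin K)

        hs-huge : All (λ k → ¬ size k ≤ ι t) hs
        hs-huge = AllP.all-filter huge? (allFin K)

        many-edges : ∀ {k} → ¬ size k ≤ ι t → X ℕ.< edgeCount c (colour k) ℕ.* b
        many-edges {k} h = ℕP.<-≤-trans t-large (ℕP.*-mono-≤ {t} {edgeCount c (colour k)} {b} {b} (ℕP.<⇒≤ (ℕP.≰⇒> λ le → h (≤-trans (≤-reflexive (size-edges k (used k h))) (ι-mono {edgeCount c (colour k)} {t} le)))) ℕP.≤-refl)

        above-all : ∀ {ks} → All (λ k → ¬ size k ≤ ι t) ks → All (λ v → X ℕ.< edgeCount c v ℕ.* b) (map colour ks)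
        above-all [] = []
        above-all (p ∷ ps) = many-edges p ∷ above-all ps

        few : length hs ℕ.* b ℕ.≤ X
        few = subst (λ l → l ℕ.* b ℕ.≤ X) (LP.length-map colour hs)
          (above (map colour hs) (map-unique colour rep (UniqueP.filter⁺ huge? (UniqueP.allFin⁺ K)) (All.map (λ {k} → used k) hs-huge)) (above-all hs-huge))

      few-huge : ∑ (allFin K) (λ k → 𝟏 (huge? k)) ≤ ι t
      few-huge = ≤-trans (≥-reflexive (ι-length-filter huge? (allFin K))) (ι-mono (ℕP.<⇒≤ (ℕP.*-cancelʳ-< b (length hs) t (ℕP.≤-<-trans few t-large))))

  integer-root : ∀ A n → ∃ λ m → m ℕ.^ suc A ℕ.≤ n × n ℕ.< suc m ℕ.^ suc A
  integer-root A n = descend n (ℕP.<-≤-trans (ℕP.n<1+n n) (ℕP.≤-trans (ℕP.≤-reflexive (sym (ℕP.*-identityʳ (suc n)))) (ℕP.*-monoʳ-≤ (suc n) (ℕP.m^n>0 (suc n) A))))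
    where
    descend : ∀ k → n ℕ.< suc k ℕ.^ suc A → ∃ λ m → m ℕ.^ suc A ℕ.≤ n × n ℕ.< suc m ℕ.^ suc A
    descend zero h = 0 , ℕ.z≤n , h
    descend (suc k) h = by (n ℕP.<? suc k ℕ.^ suc A)
      where
      by : Dec (n ℕ.< suc k ℕ.^ suc A) → _
      by (yes p) = descend k p
      by (no p) = suc k , ℕP.≮⇒≥ p , h

  -- The hypothesis on ε in terms of m, and the number of matchings

  module Arithmetic (q : ℕ) (q≥199 : 199 ℕ.≤ q) (n a b m : ℕ) (b>0 : 0 ℕ.< b) (a<b : a ℕ.< b)
    (hyp : b ℕ.^ suc q ℕ.* suc q ℕ.^ suc q ℕ.≤ a ℕ.^ suc q ℕ.* 1 ℕ.^ suc q ℕ.* n ℕ.^ 1)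
    (m-lower : m ℕ.^ suc q ℕ.≤ n) (m-upper : n ℕ.< suc m ℕ.^ suc q) where
    α = suc q

    power-* : ∀ x y k → (x ℕ.* y) ℕ.^ k ≡ x ℕ.^ k ℕ.* y ℕ.^ k
    power-* x y zero = refl
    power-* x y (suc k) = trans (cong (x ℕ.* y ℕ.*_) (power-* x y k)) (ℕP.[m*n]*[o*p]≡[m*o]*[n*p] x y (x ℕ.^ k) (y ℕ.^ k))

    hyp′ : b ℕ.^ α ℕ.* α ℕ.^ α ℕ.≤ a ℕ.^ α ℕ.* n
    hyp′ = ℕP.≤-trans hyp (ℕP.≤-reflexive (cong₂ ℕ._*_ (trans (cong (a ℕ.^ α ℕ.*_) (ℕP.^-zeroˡ α)) (ℕP.*-identityʳ (a ℕ.^ α))) (ℕP.*-identityʳ n)))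

    -- The α-th powers compare: (b α)^α ≤ a^α n < a^α (m + 1)^α. With ε = a / b this says that ε (m
    -- + 1) exceeds α. Here `α` is the reciprocal of the exponent α in the theorem.
    bα<a[m+1] : b ℕ.* α ℕ.< a ℕ.* suc m
    bα<a[m+1] = ℕP.≰⇒> λ le → contradiction₁ (ℕP.≤-trans (ℕP.≤-trans (ℕP.≤-reflexive (sym (power-* a (suc m) α))) (ℕP.^-monoˡ-≤ α le)) (ℕP.≤-trans (ℕP.≤-reflexive (power-* b α α)) hyp′))
      where
      contradiction₁ : a ℕ.^ α ℕ.* suc m ℕ.^ α ℕ.≤ a ℕ.^ α ℕ.* n → ⊥
      contradiction₁ le = by (a ℕ.^ α) refl
        where
        by : ∀ p → a ℕ.^ α ≡ p → ⊥
        by zero e = ℕP.<⇒≱ (ℕP.*-mono-< {0} {b ℕ.^ α} {0} {α ℕ.^ α} (ℕP.m^n>0 b {{ℕ.>-nonZero b>0}} α) (ℕP.m^n>0 α α)) (ℕP.≤-trans hyp′ (ℕP.≤-reflexive (cong (ℕ._* n) e)))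
        by (suc p) e = ℕP.<⇒≱ m-upper (ℕP.*-cancelˡ-≤ (suc p) (subst (λ z → z ℕ.* suc m ℕ.^ α ℕ.≤ z ℕ.* n) e le))

    α≤m : α ℕ.≤ m
    α≤m = ℕP.≤-pred (ℕP.≰⇒> λ le → ℕP.<⇒≱ bα<a[m+1] (ℕP.*-mono-≤ (ℕP.<⇒≤ a<b) le))

    m≥200 : 200 ℕ.≤ m
    m≥200 = ℕP.≤-trans (ℕ.s≤s q≥199) α≤m

    qb≤am : q ℕ.* b ℕ.≤ a ℕ.* m
    qb≤am = ℕP.+-cancelˡ-≤ b (q ℕ.* b) (a ℕ.* m) (ℕP.≤-trans (ℕP.≤-trans (ℕP.≤-reflexive (ℕP.*-comm (suc q) b)) (ℕP.<⇒≤ bα<a[m+1]))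
      (ℕP.≤-trans (ℕP.≤-reflexive (ℕP.*-suc a m)) (ℕP.+-monoˡ-≤ (a ℕ.* m) (ℕP.<⇒≤ a<b))))

    m≤n : m ℕ.≤ n
    m≤n = ℕP.≤-trans (ℕP.≤-trans (ℕP.≤-reflexive (sym (ℕP.*-identityʳ m))) (ℕP.*-monoʳ-≤ m (ℕP.m^n>0 m {{ℕ.>-nonZero (ℕP.≤-trans (ℕ.s≤s ℕ.z≤n) m≥200)}} q))) m-lower

    n-upper : n ℕ.≤ m ℕ.^ (2 ℕ.* α)
    n-upper = ℕP.≤-trans (ℕP.<⇒≤ m-upper) (ℕP.≤-trans (ℕP.^-monoˡ-≤ α suc≤square) (ℕP.≤-reflexive (ℕP.^-*-assoc m 2 α)))
      where
      m≥1 : 1 ℕ.≤ m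
      m≥1 = ℕP.≤-trans (ℕ.s≤s ℕ.z≤n) m≥200
      suc≤square : suc m ℕ.≤ m ℕ.^ 2
      suc≤square = ℕP.≤-trans (ℕP.+-monoˡ-≤ m m≥1) (ℕP.≤-trans (ℕP.≤-reflexive (trans (cong (m ℕ.+_) (sym (ℕP.+-identityʳ m))) refl)) (ℕP.≤-trans (ℕP.*-monoˡ-≤ m (ℕP.≤-trans (ℕ.s≤s (ℕ.s≤s ℕ.z≤n)) m≥200)) (ℕP.≤-reflexive (cong (m ℕ.*_) (sym (ℕP.*-identityʳ m))))))

    X : ℕ
    X = (b ℕ.∸ a) ℕ.* n

    private instance
      b-nonZero : ℕ.NonZero b
      b-nonZero = ℕ.>-nonZero b>0

    -- One more than the integer part of (1 - ε) n, hence strictly more than (1 - ε) n. A colour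
    -- with more than t cells is then among those that the hypothesis counts, and fewer than t
    -- colours are.
    t : ℕ
    t = suc (X DM./ b)

    X-split : X ≡ X DM.% b ℕ.+ X DM./ b ℕ.* b
    X-split = DM.m≡m%n+[m/n]*n X b

    X<tb : X ℕ.< t ℕ.* b
    X<tb = ℕP.≤-<-trans (ℕP.≤-reflexive X-split) (ℕP.+-monoˡ-< (X DM./ b ℕ.* b) (DM.m%n<n X b))

    tb≤ : t ℕ.* b ℕ.≤ b ℕ.+ X
    tb≤ = ℕP.+-monoʳ-≤ b (ℕP.≤-trans (ℕP.m≤n+m _ (X DM.% b)) (ℕP.≤-reflexive (sym X-split)))

    -- It says 1 - t / n ≥ 4 / m, the slack that the weighting asks for. It holds since ε is at
    -- least 199 / m and the rounding of t costs at most 1 / n ≤ 1 / m.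
    gap : 4 ℕ.* n ℕ.+ m ℕ.* t ℕ.≤ m ℕ.* n
    gap = ι-cancel (subst₂ _≤_ (sym (trans (ι-+ (4 ℕ.* n) (m ℕ.* t)) (cong₂ _+_ (ι-* 4 n) (ι-* m t)))) (sym (ι-* m n))
      (*-cancelˡ-≤ {ι b} (ι-mono b>0) (farkas (ι b ∷ ι n ∷ ι m ∷ ι t ∷ ι a ∷ []) (X3 ⊗ X0 ≼ X0 ⊕ (X0 ⊖ X4) ⊗ X1 ∷ # 199 ⊗ X0 ≼ X4 ⊗ X2 ∷ X2 ≼ X1 ∷ # 0 ≼ X2 ∷ # 0 ≼ X1 ∷ # 0 ≼ X0 ∷ []) (X0 ⊗ (# 4 ⊗ X1 ⊕ X2 ⊗ X3)) (X0 ⊗ (X2 ⊗ X1)) 0 (1 ∙ 0 · 3 ∷ 1 ∙ 1 · 4 ∷ 1 ∙ 2 · 5 ∷ 194 ∙ 4 · 5 ∷ []) refl (hyp₁ ∷ hyp₂ ∷ (ι-mono m≤n) ∷ (0≤ι m) ∷ (0≤ι n) ∷ (0≤ι b) ∷ []))))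
      where
      hyp₁ : ι t * ι b ≤ ι b + (ι b - ι a) * ι n
      hyp₁ = ≤-trans (≥-reflexive (ι-* t b)) (≤-trans (ι-mono tb≤) (≤-reflexive (trans (ι-+ b X) (cong (ι b +_) (trans (ι-* (b ℕ.∸ a) n) (cong (_* ι n) minus))))))
        where
        minus : ι (b ℕ.∸ a) ≡ ι b - ι a
        minus = trans (ring (ι (b ℕ.∸ a) ∷ ι a ∷ []) X0 (X1 ⊕ X0 ⊖ X1) refl) (cong (_- ι a) (trans (sym (ι-+ a (b ℕ.∸ a))) (cong ι (ℕP.m+[n∸m]≡n (ℕP.<⇒≤ a<b)))))
      hyp₂ : ι 199 * ι b ≤ ι a * ι m
      hyp₂ = ≤-trans (≥-reflexive (ι-* 199 b)) (≤-trans (ι-mono (ℕP.≤-trans (ℕP.*-monoˡ-≤ b q≥199) qb≤am)) (≤-reflexive (ι-* a m)))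

    t≤n : t ℕ.≤ n
    t≤n = ℕP.*-cancelˡ-≤ m {{ℕ.>-nonZero (ℕP.≤-trans (ℕ.s≤s ℕ.z≤n) m≥200)}} (ℕP.≤-trans (ℕP.m≤n+m (m ℕ.* t) (4 ℕ.* n)) gap)

  -- With ε = a / b and α = 1 / (q + 1) the inequality between powers is ε ≥ n^(-α) / α, raised to
  -- the power q + 1 and cleared of denominators.
  rainbow-decomposition : ∀ q → 199 ℕ.≤ q → ∀ (n : ℕ) → 1 ℕ.≤ n → ∀ (a b : ℕ) → 0 ℕ.< b → a ℕ.< b →
    b ℕ.^ suc q ℕ.* suc q ℕ.^ suc q ℕ.≤ a ℕ.^ suc q ℕ.* 1 ℕ.^ suc q ℕ.* n ℕ.^ 1 →
    ∀ (c : Colouring n) → Proper c → AtMostColoursAbove c ((b ℕ.∸ a) ℕ.* n) b →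
    ∃ λ t → (b ℕ.∸ a) ℕ.* n ℕ.≤ t ℕ.* b × EdgeDisjointRainbowMatchings c t
  rainbow-decomposition q q≥199 n@(suc n′) _ a b b>0 a<b hyp c (row-proper , col-proper) above = with-root (integer-root q n)
    where
    with-root : (∃ λ m → m ℕ.^ suc q ℕ.≤ n × n ℕ.< suc m ℕ.^ suc q) → _
    with-root (m , m-lower , m-upper) = t , ℕP.<⇒≤ X<tb , assemble (Main.decomposition {n} {t} {m} {suc q} recoloured
        (λ i e → row-proper i _ _ (same-colour e)) (λ j e → col-proper _ _ j (same-colour e)) (ℕ.s≤s q≥199) α≤m m-lower n-upper t≤n gap (few-huge X b t X<tb above))
      where
      open Arithmetic q q≥199 n a b m b>0 a<b hyp m-lower m-upper
      open Recolour c using (recoloured; same-colour; few-huge; rep)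
      assemble : (∃ λ (f : Fin t → Fin n → Fin n) → (∀ s {i i′} → f s i ≡ f s i′ → i ≡ i′) × (∀ s {i i′} → recoloured i (f s i) ≡ recoloured i′ (f s i′) → i ≡ i′) × (∀ s s′ → s ≢ s′ → ∀ i → f s i ≢ f s′ i)) → EdgeDisjointRainbowMatchings c t
      assemble (f , injective , rainbow , disjoint) = (λ s → f s , injective s) , (λ s e → rainbow s (cong rep e)) , disjoint

open import Data.Nat using (ℕ; suc; _+_; _*_; _∸_; _^_; _≤_; _<_)

theorem1p9 : Σ ℕ λ p → Σ ℕ λ q →
  ∀ (n : ℕ) → 1 ≤ n →
  ∀ (a b : ℕ) → 0 < b → a < b →
  b ^ suc q * suc q ^ suc q ≤ a ^ suc q * suc p ^ suc q * n ^ suc p →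
  ∀ (c : Colouring n) → Proper c →
  AtMostColoursAbove c ((b ∸ a) * n) b →
  ∃ λ t → (b ∸ a) * n ≤ t * b × EdgeDisjointRainbowMatchings c t
theorem1p9 = 0 , 199 , Development.rainbow-decomposition 199 (ℕP.≤ᵇ⇒≤ 199 199 tt)
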